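{- Let $j_0\in\mathbb{Q}$. There is an effectively computable constant $c(j_0)>0$, depending only on $j_0$, such that for every elliptic curve $E$ over $\mathbb{Q}$ with $j$-invariant equal to $j_0$ we have $$1+\mathrm{rank}\, E(\mathbb{Q})\ge c(j_0)\cdot \log \max\{\beta_x(E),\beta_y(E)\}.$$
   Context: For an elliptic curve $E$ over $\mathbb{Q}$, an $x$-arithmetic progression is a sequence $P_1,\dots,P_N$ of $\mathbb{Q}$-rational points on $E$ whose $x$-coordinates form an arithmetic progression for some choice of Weierstrass equation $y^2=x^3+ax^2+bx+c$ for $E$; a $y$-arithmetic progression is defined similarly with $y$-coordinates. Such a sequence is non-trivial if the resulting progression of coordinates is non-constant (these notions do not depend on the choice of Weierstrass equation). $\beta_x(E)$ (resp. $\beta_y(E)$) denotes the maximal length of a non-trivial $x$-arithmetic (resp. $y$-arithmetic) progression of rational points on $E$. "Effectively computable" means an explicit closed formula can be obtained. -}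

module Defs where

open import Data.Nat as ℕ using (ℕ; zero; suc)
open import Data.Integer as ℤ using (ℤ; +_; -[1+_])
open import Data.Rational as ℚ using (ℚ; 0ℚ; 1ℚ; _+_; _*_; _-_; -_; _÷_; ≢-nonZero)
open import Data.Rational.Properties using (_≟_)
open import Data.Fin using (Fin; toℕ)
open import Data.Product using (Σ; ∃; _×_; _,_)
open import Relation.Nullary using (¬_; yes; no)
open import Relation.Binary.PropositionalEquality using (_≡_; _≢_)

q : ℤ → ℚ
q z = z ℚ./ 1

-- Weierstrass equation  y² = x³ + a x² + b x + c  over ℚ
-- discriminant Δ = -16 a² (4ac - b²) - 64 b³ - 432 c² + 288 a b c  (standard Δ for a₁=a₃=0)
disc : ℚ → ℚ → ℚ → ℚ
disc a b c = (- (q (+ 16) * a * a * (q (+ 4) * a * c - b * b)))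
           - q (+ 64) * b * b * b - q (+ 432) * c * c + q (+ 288) * a * b * c

record Weierstrass : Set where
  constructor weier
  field
    a b c : ℚ
    nonsing : disc a b c ≢ 0ℚ
open Weierstrass public

c4 : Weierstrass → ℚ
c4 E = q (+ 16) * a E * a E - q (+ 48) * b E

jInv : Weierstrass → ℚ
jInv E = _÷_ (c4 E * c4 E * c4 E) (disc (a E) (b E) (c E)) {{≢-nonZero (nonsing E)}}

data Pt : Set where
  O  : Pt
  pt : ℚ → ℚ → Pt

OnCurve : Weierstrass → Pt → Set
OnCurve E O = Data.Unit.⊤ where import Data.Unit
OnCurve E (pt x y) = y * y ≡ x * x * x + a E * x * x + b E * x + c E

RatPt : Weierstrass → Set
RatPt E = Σ Pt (OnCurve E)

neg : Pt → Pt
neg O = O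
neg (pt x y) = pt x (- y)

private
  third : Weierstrass → ℚ → ℚ → ℚ → ℚ → Pt
  third E lam x1 y1 x2 = pt x3 (lam * (x1 - x3) - y1)
    where x3 = lam * lam - a E - x1 - x2

add : Weierstrass → Pt → Pt → Pt
add E O P = P
add E P O = P
add E (pt x1 y1) (pt x2 y2) with x2 - x1 ≟ 0ℚ
... | no h = third E (_÷_ (y2 - y1) (x2 - x1) {{≢-nonZero h}}) x1 y1 x2
... | yes _ with y1 + y2 ≟ 0ℚ
...   | yes _ = O
...   | no _ with q (+ 2) * y1 ≟ 0ℚ
...     | yes _ = O
...     | no h = third E (_÷_ (q (+ 3) * x1 * x1 + q (+ 2) * a E * x1 + b E) (q (+ 2) * y1)
                              {{≢-nonZero h}}) x1 y1 x2

nmul : Weierstrass → ℕ → Pt → Pt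
nmul E zero P = O
nmul E (suc n) P = add E P (nmul E n P)

zmul : Weierstrass → ℤ → Pt → Pt
zmul E (+ n) P = nmul E n P
zmul E -[1+ n ] P = neg (nmul E (suc n) P)

lincomb : (E : Weierstrass) (r : ℕ) → (Fin r → ℤ) → (Fin r → RatPt E) → Pt
lincomb E zero n P = O
lincomb E (suc r) n P =
  add E (zmul E (n Fin.zero) (Data.Product.proj₁ (P Fin.zero)))
        (lincomb E r (λ i → n (Fin.suc i)) (λ i → P (Fin.suc i)))
  where import Data.Fin as Fin; import Data.Product

Independent : (E : Weierstrass) (r : ℕ) → (Fin r → RatPt E) → Set
Independent E r P = (n : Fin r → ℤ) → lincomb E r n P ≡ O → (i : Fin r) → n i ≡ + 0

IsRank : Weierstrass → ℕ → Set
IsRank E r = (Σ (Fin r → RatPt E) (Independent E r))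
           × ((P : Fin (suc r) → RatPt E) → ¬ Independent E (suc r) P)

AffPt : Weierstrass → Set
AffPt E = Σ (ℚ × ℚ) λ { (x , y) → OnCurve E (pt x y) }

xc yc : {E : Weierstrass} → AffPt E → ℚ
xc ((x , _) , _) = x
yc ((_ , y) , _) = y

NonTrivAP : (N : ℕ) → (Fin N → ℚ) → Set
NonTrivAP N u = ∃ λ u0 → ∃ λ d → d ≢ 0ℚ × ((i : Fin N) → u i ≡ u0 + q (+ toℕ i) * d)

XAP YAP : (E : Weierstrass) → ℕ → Set
XAP E N = Σ (Fin N → AffPt E) λ P → NonTrivAP N (λ i → xc {E} (P i))
YAP E N = Σ (Fin N → AffPt E) λ P → NonTrivAP N (λ i → yc {E} (P i))

{-# OPTIONS --safe #-}

-- With X = 3x + a and Y = 3y the curve becomes 3Y² = X³ + AX + B, and H(X¹² / D²) with D = 4A³ + 27B² is a height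
-- on E(ℚ) unchanged by twisting. Hence it is controlled by constants depending on j only: doubling a point raises
-- it to the fourth power, up to a constant factor, and the height of a sum is at most a power of the heights of the
-- summands. There are at most 16 (h + 1)² points of height at most h.
--
-- Let h be the largest height in a window of n consecutive terms Pᵢ of the progression. If n > 3 · 2^(rk), a packing
-- argument in E(ℚ) modulo 2^k E(ℚ) and 2-power torsion gives four terms whose differences have height at most
-- h^(c / 4^k). Suppose Pᵢ − Pⱼ and Pᵢ − Pₗ have small height. Collinearity of Pᵢ, −Pⱼ and Pⱼ − Pᵢ makes the
-- denominators of Xᵢ and Xⱼ nearly coprime and keeps one of Xᵢ, Xⱼ small, likewise for Xᵢ and Xₗ, so that the linear
-- relation between Xᵢ, Xⱼ, Xₗ (or between Yᵢ, Yⱼ, Yₗ) bounds the height of Pᵢ. Interpolating between two such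
-- terms, h ≤ (C n)^c · h^(c / 4^k), and for a large k depending on j only this bounds h by a power of n, which is
-- itself exponential in r. So the whole progression consists of points of height at most C^(r+1).

module Submission where

-- The heights are naive and multiplicative. In place of a canonical height with a parallelogram law
-- there are two inequalities: `H(P + Q) ≤ (C H(P) H(Q))^K` with an uncontrolled exponent `K`, and
-- `H(P)⁴ ≤ C H(2P)` with the exact exponent 4. A bounded chain of additions costs a fixed power of
-- the height, while division by `2^k` gains a `4^k`-th root, which outweighs every fixed power once
-- `k` is large. Hence the packing modulo `2^k E(ℚ)`, rather than an angle argument in `E(ℚ) ⊗ ℝ`.
-- The obstacle is uniformity over twists. Quantities must be compared in units of their weight, and
-- `D` is in general not a perfect power, so there is no rational unit of weight 2 attached to the
-- curve. Twelfth powers make every weight an integral power of `D` and suffice for size estimates.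
-- The arguments with denominators need an actual unit; it is the abscissa of one of the small
-- differences, and for this reason a difference with `X = 0` has to be avoided.

module RationalAlgebra where

  open import Defs using (q)
  open import Data.Nat using (ℕ)
  open import Data.Integer using (+_)
  open import Data.Product using (_×_; _,_)
  open import Data.Rational using (ℚ; 0ℚ; _+_; _*_; _-_; -_; 1/_; _÷_; ≢-nonZero; NonZero)
  open import Data.Rational.Properties
  open import Data.Sum using (_⊎_; inj₁; inj₂)
  open import Data.Maybe using (Maybe; just; nothing)
  open import Relation.Nullary using (Dec; yes; no)
  open import Relation.Binary.PropositionalEquality
  open import Level using (0ℓ)
  import Tactic.RingSolver.Core.AlmostCommutativeRing as ACR
  import Data.Integer.Tactic.RingSolver as ℤ-RingSolver
  import Data.Nat.Tactic.RingSolver as ℕ-RingSolver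
  open import Tactic.RingSolver.Core.Expression public using (Expr; Κ; _⊕_; _⊗_; ⊝_)

  private
    decToMaybe : ∀ {x} → Dec (0ℚ ≡ x) → Maybe (0ℚ ≡ x)
    decToMaybe (yes p) = just p
    decToMaybe (no _)  = nothing

  ℚ-ring : ACR.AlmostCommutativeRing 0ℓ 0ℓ
  ℚ-ring = ACR.fromCommutativeRing +-*-commutativeRing (λ x → decToMaybe (0ℚ ≟ x))

  open import Tactic.RingSolver.NonReflective ℚ-ring public using () renaming (solve to ℚ-identity)
  open import Tactic.RingSolver.NonReflective ℤ-RingSolver.ring public using () renaming (solve to ℤ-identity)
  open import Tactic.RingSolver.NonReflective ℕ-RingSolver.ring public using () renaming (solve to ℕ-identity)

  infixl 6 _⊖_
  infix 4 _⊜_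
  infix 9 #_

  _⊖_ : ∀ {A : Set} {n} → Expr A n → Expr A n → Expr A n
  x ⊖ y = x ⊕ ⊝ y

  _⊜_ : ∀ {A : Set} {n} → Expr A n → Expr A n → Expr A n × Expr A n
  _⊜_ = _,_

  #_ : ∀ {n} → ℕ → Expr ℚ n
  # k = Κ (q (+ k))

  x≡y⇒x-y≡0 : ∀ {x y} → x ≡ y → x - y ≡ 0ℚ
  x≡y⇒x-y≡0 {x} refl = +-inverseʳ x

  x-y≡0⇒x≡y : ∀ {x y} → x - y ≡ 0ℚ → x ≡ y
  x-y≡0⇒x≡y {x} {y} h = trans (lemma x y) (trans (cong (_+ y) h) (+-identityˡ y))
    where
    lemma : ∀ x y → x ≡ x - y + y
    lemma = ℚ-identity 2 (λ x y → x ⊜ x ⊖ y ⊕ y) refl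

  infixr 5 _·_
  infixl 4 _⊹_

  _·_ : ∀ {x y} c → x ≡ y → c * (x - y) ≡ 0ℚ
  c · h = trans (cong (c *_) (x≡y⇒x-y≡0 h)) (*-zeroʳ c)

  _⊹_ : ∀ {x y} → x ≡ 0ℚ → y ≡ 0ℚ → x + y ≡ 0ℚ
  refl ⊹ refl = refl

  -- A linear combination of hypotheses: the remaining equation is a polynomial identity.
  byLinComb : ∀ {l r s} → s ≡ 0ℚ → l - r ≡ s → l ≡ r
  byLinComb h e = x-y≡0⇒x≡y (trans e h)

  *-cancelˡ-≢0 : ∀ {z x y} → z ≢ 0ℚ → z * x ≡ z * y → x ≡ y
  *-cancelˡ-≢0 {z} {x} {y} z≢0 h = trans (sym (step x)) (trans (cong (z⁻¹ *_) h) (step y))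
    where
    instance nz : NonZero z
             nz = ≢-nonZero z≢0
    z⁻¹ = 1/ z
    step : ∀ w → z⁻¹ * (z * w) ≡ w
    step w = trans (sym (*-assoc z⁻¹ z w)) (trans (cong (_* w) (*-inverseˡ z)) (*-identityˡ w))

  *-zero-cancelˡ : ∀ {z x} → z ≢ 0ℚ → z * x ≡ 0ℚ → x ≡ 0ℚ
  *-zero-cancelˡ {z} z≢0 h = *-cancelˡ-≢0 z≢0 (trans h (sym (*-zeroʳ z)))

  x*y≡0⇒x≡0∨y≡0 : ∀ x {y} → x * y ≡ 0ℚ → x ≡ 0ℚ ⊎ y ≡ 0ℚ
  x*y≡0⇒x≡0∨y≡0 x h with x ≟ 0ℚ
  ... | yes x≡0 = inj₁ x≡0
  ... | no x≢0 = inj₂ (*-zero-cancelˡ x≢0 h)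

  *-≢0 : ∀ {x y} → x ≢ 0ℚ → y ≢ 0ℚ → x * y ≢ 0ℚ
  *-≢0 x≢0 y≢0 h = y≢0 (*-zero-cancelˡ x≢0 h)

  x*x≡0⇒x≡0 : ∀ x → x * x ≡ 0ℚ → x ≡ 0ℚ
  x*x≡0⇒x≡0 x h with x*y≡0⇒x≡0∨y≡0 x h
  ... | inj₁ e = e
  ... | inj₂ e = e

  *-÷-cancel : ∀ x y (y≢0 : y ≢ 0ℚ) → y * _÷_ x y {{≢-nonZero y≢0}} ≡ x
  *-÷-cancel x y y≢0 = trans (lemma y x (1/ y)) (trans (cong (x *_) (*-inverseʳ y)) (*-identityʳ x))
    where
    instance nz : NonZero y
             nz = ≢-nonZero y≢0
    lemma : ∀ y x i → y * (x * i) ≡ x * (y * i)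
    lemma = ℚ-identity 3 (λ y x i → y ⊗ (x ⊗ i) ⊜ x ⊗ (y ⊗ i)) refl

-- Collinear triples on a Weierstrass cubic: chords and tangents

module ChordTangent where

  open import Defs
  open RationalAlgebra
  open import Data.Integer using (+_)
  open import Data.Rational using (ℚ; 0ℚ; 1ℚ; _+_; _*_; _-_; -_)
  open import Data.Rational.Properties
  open import Data.Product using (_×_; _,_)
  open import Data.Empty using (⊥-elim)
  open import Relation.Nullary using (Dec; yes; no)
  open import Relation.Binary.PropositionalEquality
  open import Tactic.RingSolver using (solve-∀)

  -- The line y = l x + n meets the curve in the three listed points, counted with multiplicity
  -- (Vieta's formulas, the product of the roots being redundant).
  record Line (a b l n x₁ y₁ x₂ y₂ x₃ y₃ : ℚ) : Set where
    constructor line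
    field
      on₁ : y₁ ≡ l * x₁ + n
      on₂ : y₂ ≡ l * x₂ + n
      on₃ : y₃ ≡ l * x₃ + n
      s₁  : x₁ + x₂ + x₃ ≡ l * l - a
      s₂  : x₁ * x₂ + x₁ * x₃ + x₂ * x₃ ≡ b - q (+ 2) * l * n
  open Line public

  line-swap : ∀ {a b l n x₁ y₁ x₂ y₂ x₃ y₃} → Line a b l n x₁ y₁ x₂ y₂ x₃ y₃ → Line a b l n x₂ y₂ x₁ y₁ x₃ y₃
  line-swap {x₁ = x₁} {x₂ = x₂} {x₃ = x₃} L =
    line (on₂ L) (on₁ L) (on₃ L) (trans (e₁ x₁ x₂ x₃) (s₁ L)) (trans (e₂ x₁ x₂ x₃) (s₂ L))
    where
    e₁ : ∀ x₁ x₂ x₃ → x₂ + x₁ + x₃ ≡ x₁ + x₂ + x₃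
    e₁ = ℚ-identity 3 (λ x₁ x₂ x₃ → x₂ ⊕ x₁ ⊕ x₃ ⊜ x₁ ⊕ x₂ ⊕ x₃) refl
    e₂ : ∀ x₁ x₂ x₃ → x₂ * x₁ + x₂ * x₃ + x₁ * x₃ ≡ x₁ * x₂ + x₁ * x₃ + x₂ * x₃
    e₂ = ℚ-identity 3 (λ x₁ x₂ x₃ → x₂ ⊗ x₁ ⊕ x₂ ⊗ x₃ ⊕ x₁ ⊗ x₃ ⊜ x₁ ⊗ x₂ ⊕ x₁ ⊗ x₃ ⊕ x₂ ⊗ x₃) refl

  line-rotate : ∀ {a b l n x₁ y₁ x₂ y₂ x₃ y₃} → Line a b l n x₁ y₁ x₂ y₂ x₃ y₃ → Line a b l n x₂ y₂ x₃ y₃ x₁ y₁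
  line-rotate {x₁ = x₁} {x₂ = x₂} {x₃ = x₃} L =
    line (on₂ L) (on₃ L) (on₁ L) (trans (e₁ x₁ x₂ x₃) (s₁ L)) (trans (e₂ x₁ x₂ x₃) (s₂ L))
    where
    e₁ : ∀ x₁ x₂ x₃ → x₂ + x₃ + x₁ ≡ x₁ + x₂ + x₃
    e₁ = ℚ-identity 3 (λ x₁ x₂ x₃ → x₂ ⊕ x₃ ⊕ x₁ ⊜ x₁ ⊕ x₂ ⊕ x₃) refl
    e₂ : ∀ x₁ x₂ x₃ → x₂ * x₃ + x₂ * x₁ + x₃ * x₁ ≡ x₁ * x₂ + x₁ * x₃ + x₂ * x₃
    e₂ = ℚ-identity 3 (λ x₁ x₂ x₃ → x₂ ⊗ x₃ ⊕ x₂ ⊗ x₁ ⊕ x₃ ⊗ x₁ ⊜ x₁ ⊗ x₂ ⊕ x₁ ⊗ x₃ ⊕ x₂ ⊗ x₃) refl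

  line-neg : ∀ {a b l n x₁ y₁ x₂ y₂ x₃ y₃} → Line a b l n x₁ y₁ x₂ y₂ x₃ y₃ →
    Line a b (- l) (- n) x₁ (- y₁) x₂ (- y₂) x₃ (- y₃)
  line-neg {a} {b} {l} {n} L = line (on (on₁ L)) (on (on₂ L)) (on (on₃ L))
    (trans (s₁ L) (e₁ l a)) (trans (s₂ L) (e₂ l b n))
    where
    neg-line : ∀ l x n → - (l * x + n) ≡ - l * x + - n
    neg-line = ℚ-identity 3 (λ l x n → ⊝ (l ⊗ x ⊕ n) ⊜ ⊝ l ⊗ x ⊕ ⊝ n) refl
    on : ∀ {x y} → y ≡ l * x + n → - y ≡ - l * x + - n
    on {x} refl = neg-line l x n
    e₁ : ∀ l a → l * l - a ≡ - l * - l - a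
    e₁ = ℚ-identity 2 (λ l a → l ⊗ l ⊖ a ⊜ ⊝ l ⊗ ⊝ l ⊖ a) refl
    e₂ : ∀ l b n → b - q (+ 2) * l * n ≡ b - q (+ 2) * - l * - n
    e₂ = ℚ-identity 3 (λ l b n → b ⊖ # 2 ⊗ l ⊗ n ⊜ b ⊖ # 2 ⊗ ⊝ l ⊗ ⊝ n) refl

  Cubic : ℚ → ℚ → ℚ → ℚ → ℚ → Set
  Cubic a b c x y = y * y ≡ x * x * x + a * x * x + b * x + c

  -- By `s₁` and `s₂` the cubic minus the squared line is `(x - x₁)(x - x₂)(x - x₃)` up to an
  -- additive constant, and the first point shows that this constant is zero.
  third-onCurve : ∀ {a b c l n x₁ y₁ x₂ y₂ x₃ y₃} → Line a b l n x₁ y₁ x₂ y₂ x₃ y₃ →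
    Cubic a b c x₁ y₁ → Cubic a b c x₃ y₃
  third-onCurve {a} {b} {c} {l} {n} {x₁} {_} {x₂} {_} {x₃} (line refl _ refl s₁ s₂) h =
    byLinComb (1ℚ · h ⊹ (x₁ * x₁ - x₃ * x₃) · s₁ ⊹ (x₃ - x₁) · s₂)
      (ℚ-identity 8 (λ a b c l n x₁ x₂ x₃ → (l ⊗ x₃ ⊕ n) ⊗ (l ⊗ x₃ ⊕ n) ⊖ (x₃ ⊗ x₃ ⊗ x₃ ⊕ a ⊗ x₃ ⊗ x₃ ⊕ b ⊗ x₃ ⊕ c) ⊜ Κ 1ℚ ⊗ ((l ⊗
          x₁ ⊕ n) ⊗ (l ⊗ x₁ ⊕ n) ⊖ (x₁ ⊗ x₁ ⊗ x₁ ⊕ a ⊗ x₁ ⊗ x₁ ⊕ b ⊗ x₁ ⊕ c)) ⊕ (x₁ ⊗ x₁ ⊖ x₃ ⊗ x₃) ⊗ (x₁ ⊕ x₂ ⊕ x₃ ⊖ (l ⊗ l ⊖ a))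
          ⊕ (x₃ ⊖ x₁) ⊗ (x₁ ⊗ x₂ ⊕ x₁ ⊗ x₃ ⊕ x₂ ⊗ x₃ ⊖ (b ⊖ # 2 ⊗ l ⊗ n))) refl a b c l n x₁ x₂ x₃)

  slope-chord : ∀ {a b l n x₁ y₁ x₂ y₂ x₃ y₃} → Line a b l n x₁ y₁ x₂ y₂ x₃ y₃ → (x₂ - x₁) * l ≡ y₂ - y₁
  slope-chord {l = l} {n} {x₁} {_} {x₂} (line refl refl _ _ _) = ℚ-identity 4 (λ l n x₁ x₂ → (x₂ ⊖ x₁) ⊗ l ⊜ l ⊗ x₂ ⊕ n ⊖ (l ⊗ x₁
      ⊕ n)) refl l n x₁ x₂

  -- Eliminating `x₃` from the two Vieta relations at a double root leaves the derivative of the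
  -- curve equation.
  slope-tangent : ∀ {a b l n x₁ y₁ x₂ y₂ x₃ y₃} → Line a b l n x₁ y₁ x₂ y₂ x₃ y₃ → x₂ ≡ x₁ →
    q (+ 2) * y₁ * l ≡ q (+ 3) * x₁ * x₁ + q (+ 2) * a * x₁ + b
  slope-tangent {a} {b} {l} {n} {x} {_} {_} {_} {x₃} (line refl _ _ s₁ s₂) refl =
    byLinComb (- (q (+ 2) * x) · s₁ ⊹ 1ℚ · s₂)
      (ℚ-identity 6 (λ a b l n x x₃ → # 2 ⊗ (l ⊗ x ⊕ n) ⊗ l ⊖ (# 3 ⊗ x ⊗ x ⊕ # 2 ⊗ a ⊗ x ⊕ b) ⊜ ⊝ (# 2 ⊗ x) ⊗ (x ⊕ x ⊕ x₃ ⊖ (l ⊗ l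
          ⊖ a)) ⊕ Κ 1ℚ ⊗ (x ⊗ x ⊕ x ⊗ x₃ ⊕ x ⊗ x₃ ⊖ (b ⊖ # 2 ⊗ l ⊗ n))) refl a b l n x x₃)

  -- Serves `nonsingular`: once a root is moved to the origin, a singular point there shows up as
  -- two vanishing coefficients, the situation of `disc-00`.
  disc-translate : ∀ a b c s → disc a b c ≡
    disc (q (+ 3) * s + a) (q (+ 3) * s * s + q (+ 2) * a * s + b) (s * s * s + a * s * s + b * s + c)
  disc-translate = lemma
    where
    lemma : ∀ a b c s → (- (q (+ 16) * a * a * (q (+ 4) * a * c - b * b)))
             - q (+ 64) * b * b * b - q (+ 432) * c * c + q (+ 288) * a * b * c ≡
             (let a' = q (+ 3) * s + a ; b' = q (+ 3) * s * s + q (+ 2) * a * s + b ; c' = s * s * s + a * s * s + b * s + c in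
              (- (q (+ 16) * a' * a' * (q (+ 4) * a' * c' - b' * b')))
             - q (+ 64) * b' * b' * b' - q (+ 432) * c' * c' + q (+ 288) * a' * b' * c')
    lemma = solve-∀ ℚ-ring

  disc-00 : ∀ a → disc a 0ℚ 0ℚ ≡ 0ℚ
  disc-00 = lemma
    where
    lemma : ∀ a → (- (q (+ 16) * a * a * (q (+ 4) * a * 0ℚ - 0ℚ * 0ℚ)))
             - q (+ 64) * 0ℚ * 0ℚ * 0ℚ - q (+ 432) * 0ℚ * 0ℚ + q (+ 288) * a * 0ℚ * 0ℚ ≡ 0ℚ
    lemma = ℚ-identity 1 (λ a → (⊝ (# 16 ⊗ a ⊗ a ⊗ (# 4 ⊗ a ⊗ Κ 0ℚ ⊖ Κ 0ℚ ⊗ Κ 0ℚ))) ⊖ # 64 ⊗ Κ 0ℚ ⊗ Κ 0ℚ ⊗ Κ 0ℚ ⊖ # 432 ⊗ Κ 0ℚ ⊗ Κ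
        0ℚ ⊕ # 288 ⊗ a ⊗ Κ 0ℚ ⊗ Κ 0ℚ ⊜ Κ 0ℚ) refl

  nonsingular : ∀ {a b c x y} → disc a b c ≢ 0ℚ → Cubic a b c x y → y ≡ 0ℚ →
    q (+ 3) * x * x + q (+ 2) * a * x + b ≢ 0ℚ
  nonsingular {a} {b} {c} {x} Δ≢0 h refl h' = Δ≢0 (trans (disc-translate a b c x)
    (trans (cong₂ (disc (q (+ 3) * x + a)) h' (trans (sym h) (*-zeroˡ 0ℚ))) (disc-00 (q (+ 3) * x + a))))

  2≢0 : q (+ 2) ≢ 0ℚ
  2≢0 ()

  2x≡0⇒x≡0 : ∀ x → q (+ 2) * x ≡ 0ℚ → x ≡ 0ℚ
  2x≡0⇒x≡0 x = *-zero-cancelˡ 2≢0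

  x+x≡2x : ∀ x → x + x ≡ q (+ 2) * x
  x+x≡2x = ℚ-identity 1 (λ x → x ⊕ x ⊜ # 2 ⊗ x) refl

  -- For distinct abscissas this is the chord, otherwise the tangent. If `2 y₁` vanishes too, the
  -- tangent relation kills the derivative at a root, against nonsingularity.
  line-unique-slope : ∀ {a b c l n x₁ y₁ x₂ y₂ x₃ y₃ l′ n′ x₃′ y₃′} → disc a b c ≢ 0ℚ → Cubic a b c x₁ y₁ →
    Line a b l n x₁ y₁ x₂ y₂ x₃ y₃ → Line a b l′ n′ x₁ y₁ x₂ y₂ x₃′ y₃′ → l ≡ l′
  line-unique-slope {a} {b} {c} {l} {_} {x₁} {y₁} {x₂} {y₂} {l′ = l′} Δ≢0 h L L′ = chord (x₂ - x₁ ≟ 0ℚ)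
    where
    tangent : x₂ ≡ x₁ → Dec (q (+ 2) * y₁ ≡ 0ℚ) → l ≡ l′
    tangent x≡ (no y≢) = *-cancelˡ-≢0 y≢ (trans (slope-tangent L x≡) (sym (slope-tangent L′ x≡)))
    tangent x≡ (yes y≡) = ⊥-elim (nonsingular {a} {b} {c} {x₁} {y₁} Δ≢0 h (2x≡0⇒x≡0 y₁ y≡)
      (trans (sym (slope-tangent L x≡)) (trans (cong (_* l) y≡) (*-zeroˡ l))))
    chord : Dec (x₂ - x₁ ≡ 0ℚ) → l ≡ l′
    chord (no x≢) = *-cancelˡ-≢0 x≢ (trans (slope-chord L) (sym (slope-chord L′)))
    chord (yes x≡) = tangent (x-y≡0⇒x≡y x≡) (q (+ 2) * y₁ ≟ 0ℚ)

  -- Because of this uniqueness any line exhibited through two points computes their sum, and the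
  -- divisions in `add` are met only once, in `add-sum`.
  line-unique : ∀ {a b c l n x₁ y₁ x₂ y₂ x₃ y₃ l′ n′ x₃′ y₃′} → disc a b c ≢ 0ℚ → Cubic a b c x₁ y₁ →
    Line a b l n x₁ y₁ x₂ y₂ x₃ y₃ → Line a b l′ n′ x₁ y₁ x₂ y₂ x₃′ y₃′ → x₃ ≡ x₃′ × y₃ ≡ y₃′
  line-unique {a} {b} {c} Δ≢0 h L L′ = third L L′ (line-unique-slope {a} {b} {c} Δ≢0 h L L′)
    where
    third : ∀ {a b l n x₁ y₁ x₂ y₂ x₃ y₃ l′ n′ x₃′ y₃′} → Line a b l n x₁ y₁ x₂ y₂ x₃ y₃ →
      Line a b l′ n′ x₁ y₁ x₂ y₂ x₃′ y₃′ → l ≡ l′ → x₃ ≡ x₃′ × y₃ ≡ y₃′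
    third {a} {b} {l} {n} {x₁} {y₁} {x₂} {y₂} {x₃} {y₃} {_} {n′} {x₃′} L L′ refl =
      x≡ , trans (on₃ L) (trans (cong₂ (λ x n → l * x + n) x≡ n≡) (sym (on₃ L′)))
      where
      x≡ : x₃ ≡ x₃′
      x≡ = byLinComb (1ℚ · s₁ L ⊹ - 1ℚ · s₁ L′) (ℚ-identity 6 (λ a l x₁ x₂ x₃ x₃′ → x₃ ⊖ x₃′ ⊜ Κ 1ℚ ⊗ (x₁ ⊕ x₂ ⊕ x₃ ⊖ (l ⊗ l ⊖ a))
          ⊕ ⊝ Κ 1ℚ ⊗ (x₁ ⊕ x₂ ⊕ x₃′ ⊖ (l ⊗ l ⊖ a))) refl a l x₁ x₂ x₃ x₃′)
      n≡ : n ≡ n′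
      n≡ = byLinComb (- 1ℚ · on₁ L ⊹ 1ℚ · on₁ L′) (ℚ-identity 5 (λ l n n′ x₁ y₁ → n ⊖ n′ ⊜ ⊝ Κ 1ℚ ⊗ (y₁ ⊖ (l ⊗ x₁ ⊕ n)) ⊕ Κ 1ℚ ⊗
          (y₁ ⊖ (l ⊗ x₁ ⊕ n′))) refl l n n′ x₁ y₁)

  -- A line `y = l x + n` is never vertical: equal abscissas give equal ordinates, so inverse points
  -- would have `2 y₁ = 0` at a double contact and be singular.
  not-inverse : ∀ {a b c l n x₁ y₁ x₂ y₂ x₃ y₃} → disc a b c ≢ 0ℚ → Cubic a b c x₁ y₁ →
    Line a b l n x₁ y₁ x₂ y₂ x₃ y₃ → x₁ ≡ x₂ → y₁ + y₂ ≢ 0ℚ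
  not-inverse {a} {b} {c} {l} {n} {x₁} {y₁} {x₂} {y₂} Δ≢0 h L x≡ y≡ = nonsingular {a} {b} {c} {x₁} {y₁} Δ≢0 h (2x≡0⇒x≡0 y₁ 2y≡0)
    (trans (sym (slope-tangent L (sym x≡))) (trans (cong (_* l) 2y≡0) (*-zeroˡ l)))
    where
    y₁≡y₂ : y₁ ≡ y₂
    y₁≡y₂ = trans (on₁ L) (trans (cong (λ x → l * x + n) x≡) (sym (on₂ L)))
    2y≡0 : q (+ 2) * y₁ ≡ 0ℚ
    2y≡0 = trans (sym (x+x≡2x y₁)) (trans (cong (λ y → y₁ + y) y₁≡y₂) y≡)

  -- A division-free view of `add`. The line meets the curve in the negative of the sum, whence the
  -- ordinate `- y₃`.
  data Sum (E : Weierstrass) (x₁ y₁ x₂ y₂ : ℚ) : Pt → Set where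
    inverse : x₁ ≡ x₂ → y₁ + y₂ ≡ 0ℚ → Sum E x₁ y₁ x₂ y₂ O
    secant  : ∀ {l n x₃ y₃} → Line (a E) (b E) l n x₁ y₁ x₂ y₂ x₃ (- y₃) → Sum E x₁ y₁ x₂ y₂ (pt x₃ y₃)

  private
    chord-line : ∀ {a b c} l x₁ y₁ x₂ y₂ → x₂ - x₁ ≢ 0ℚ → Cubic a b c x₁ y₁ → Cubic a b c x₂ y₂ → (x₂ - x₁) * l ≡ y₂ - y₁ →
      Line a b l (y₁ - l * x₁) x₁ y₁ x₂ y₂ (l * l - a - x₁ - x₂) (- (l * (x₁ - (l * l - a - x₁ - x₂)) - y₁))
    chord-line {a} {b} {c} l x₁ y₁ x₂ y₂ d≢0 h₁ h₂ hl = line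
      (ℚ-identity 3 (λ l x₁ y₁ → y₁ ⊜ l ⊗ x₁ ⊕ (y₁ ⊖ l ⊗ x₁)) refl l x₁ y₁)
      (byLinComb (- 1ℚ · hl) (ℚ-identity 5 (λ l x₁ y₁ x₂ y₂ → y₂ ⊖ (l ⊗ x₂ ⊕ (y₁ ⊖ l ⊗ x₁)) ⊜ ⊝ Κ 1ℚ ⊗ ((x₂ ⊖ x₁) ⊗ l ⊖ (y₂ ⊖
          y₁))) refl l x₁ y₁ x₂ y₂))
      (ℚ-identity 5 (λ a l x₁ y₁ x₂ → ⊝ (l ⊗ (x₁ ⊖ (l ⊗ l ⊖ a ⊖ x₁ ⊖ x₂)) ⊖ y₁) ⊜ l ⊗ (l ⊗ l ⊖ a ⊖ x₁ ⊖ x₂) ⊕ (y₁ ⊖ l ⊗ x₁)) refl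
          a l x₁ y₁ x₂)
      (ℚ-identity 4 (λ a l x₁ x₂ → x₁ ⊕ x₂ ⊕ (l ⊗ l ⊖ a ⊖ x₁ ⊖ x₂) ⊜ l ⊗ l ⊖ a) refl a l x₁ x₂)
      (*-cancelˡ-≢0 d≢0
        (byLinComb (1ℚ · h₂ ⊹ - 1ℚ · h₁ ⊹ ((x₂ - x₁) * l + y₁ + y₂) · hl)
          (ℚ-identity 8 (λ a b c l x₁ y₁ x₂ y₂ → (x₂ ⊖ x₁) ⊗ (x₁ ⊗ x₂ ⊕ x₁ ⊗ (l ⊗ l ⊖ a ⊖ x₁ ⊖ x₂) ⊕ x₂ ⊗ (l ⊗ l ⊖ a ⊖ x₁ ⊖ x₂)) ⊖
              (x₂ ⊖ x₁) ⊗ (b ⊖ # 2 ⊗ l ⊗ (y₁ ⊖ l ⊗ x₁)) ⊜ Κ 1ℚ ⊗ (y₂ ⊗ y₂ ⊖ (x₂ ⊗ x₂ ⊗ x₂ ⊕ a ⊗ x₂ ⊗ x₂ ⊕ b ⊗ x₂ ⊕ c)) ⊕ ⊝ Κ 1ℚ ⊗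
              (y₁ ⊗ y₁ ⊖ (x₁ ⊗ x₁ ⊗ x₁ ⊕ a ⊗ x₁ ⊗ x₁ ⊕ b ⊗ x₁ ⊕ c)) ⊕ ((x₂ ⊖ x₁) ⊗ l ⊕ y₁ ⊕ y₂) ⊗ ((x₂ ⊖ x₁) ⊗ l ⊖ (y₂ ⊖ y₁)))
              refl a b c l x₁ y₁ x₂ y₂)))

    tangent-line : ∀ {a b} l x₁ y₁ x₂ y₂ → x₂ ≡ x₁ → y₂ ≡ y₁ →
      q (+ 2) * y₁ * l ≡ q (+ 3) * x₁ * x₁ + q (+ 2) * a * x₁ + b →
      Line a b l (y₁ - l * x₁) x₁ y₁ x₂ y₂ (l * l - a - x₁ - x₂) (- (l * (x₁ - (l * l - a - x₁ - x₂)) - y₁))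
    tangent-line {a} {b} l x y _ _ refl refl hl = line
      (ℚ-identity 3 (λ l x y → y ⊜ l ⊗ x ⊕ (y ⊖ l ⊗ x)) refl l x y)
      (ℚ-identity 3 (λ l x y → y ⊜ l ⊗ x ⊕ (y ⊖ l ⊗ x)) refl l x y)
      (ℚ-identity 4 (λ a l x y → ⊝ (l ⊗ (x ⊖ (l ⊗ l ⊖ a ⊖ x ⊖ x)) ⊖ y) ⊜ l ⊗ (l ⊗ l ⊖ a ⊖ x ⊖ x) ⊕ (y ⊖ l ⊗ x)) refl a l x y)
      (ℚ-identity 3 (λ a l x → x ⊕ x ⊕ (l ⊗ l ⊖ a ⊖ x ⊖ x) ⊜ l ⊗ l ⊖ a) refl a l x)
      (byLinComb (1ℚ · hl) (ℚ-identity 5 (λ a b l x y → x ⊗ x ⊕ x ⊗ (l ⊗ l ⊖ a ⊖ x ⊖ x) ⊕ x ⊗ (l ⊗ l ⊖ a ⊖ x ⊖ x) ⊖ (b ⊖ # 2 ⊗ l ⊗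
          (y ⊖ l ⊗ x)) ⊜ Κ 1ℚ ⊗ (# 2 ⊗ y ⊗ l ⊖ (# 3 ⊗ x ⊗ x ⊕ # 2 ⊗ a ⊗ x ⊕ b))) refl a b l x y))

    squares : ∀ x y → x * x ≡ y * y → y + x ≢ 0ℚ → x ≡ y
    squares x y h s≢0 = *-cancelˡ-≢0 s≢0 (byLinComb (1ℚ · h) (ℚ-identity 2 (λ x y → (y ⊕ x) ⊗ x ⊖ (y ⊕ x) ⊗ y ⊜ Κ 1ℚ ⊗ (x ⊗ x ⊖ y
        ⊗ y)) refl x y))

  same-point : ∀ E {x₁ y₁ x₂ y₂} → OnCurve E (pt x₁ y₁) → OnCurve E (pt x₂ y₂) →
    x₂ ≡ x₁ → y₁ + y₂ ≢ 0ℚ → y₂ ≡ y₁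
  same-point E {y₁ = y₁} {y₂ = y₂} h₁ h₂ refl y≢ = squares y₂ y₁ (trans h₂ (sym h₁)) y≢

  same-point-2y : ∀ E {x₁ y₁ x₂ y₂} → OnCurve E (pt x₁ y₁) → OnCurve E (pt x₂ y₂) →
    x₂ ≡ x₁ → y₁ + y₂ ≢ 0ℚ → q (+ 2) * y₁ ≢ 0ℚ
  same-point-2y E {y₁ = y₁} h₁ h₂ x≡ y≢ 2y≡0 =
    y≢ (trans (cong (λ y → y₁ + y) (same-point E h₁ h₂ x≡ y≢)) (trans (x+x≡2x y₁) 2y≡0))

  add-sum : ∀ E {x₁ y₁ x₂ y₂} → OnCurve E (pt x₁ y₁) → OnCurve E (pt x₂ y₂) →
    Sum E x₁ y₁ x₂ y₂ (add E (pt x₁ y₁) (pt x₂ y₂))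
  add-sum E {x₁} {y₁} {x₂} {y₂} h₁ h₂ with x₂ - x₁ ≟ 0ℚ
  ... | no x≢ = secant (chord-line _ x₁ y₁ x₂ y₂ x≢ h₁ h₂ (*-÷-cancel (y₂ - y₁) (x₂ - x₁) x≢))
  ... | yes x≡ with y₁ + y₂ ≟ 0ℚ
  ...   | yes y≡ = inverse (sym (x-y≡0⇒x≡y {x₂} {x₁} x≡)) y≡
  ...   | no y≢ with q (+ 2) * y₁ ≟ 0ℚ
  -- Points of the curve with equal abscissas and `y₁ + y₂ ≢ 0` coincide, so `y₁ + y₂ = 2 y₁`, which
  -- contradicts this branch.
  ...     | yes 2y≡0 = ⊥-elim (same-point-2y E {x₁} {y₁} {x₂} {y₂} h₁ h₂ (x-y≡0⇒x≡y {x₂} {x₁} x≡) y≢ 2y≡0)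
  ...     | no 2y≢0 = secant (tangent-line _ x₁ y₁ x₂ y₂ (x-y≡0⇒x≡y {x₂} {x₁} x≡) (same-point E {x₁} {y₁} {x₂} {y₂} h₁ h₂ (x-y≡0⇒x≡y {x₂} {x₁} x≡) y≢)
              (*-÷-cancel (q (+ 3) * x₁ * x₁ + q (+ 2) * a E * x₁ + b E) (q (+ 2) * y₁) 2y≢0))

-- The polynomial identities behind associativity

module CollinearSums where

  open import Defs
  open RationalAlgebra
  open ChordTangent
  open import Data.Integer using (+_)
  open import Data.Rational using (ℚ; 0ℚ; 1ℚ; _+_; _*_; _-_; -_)
  open import Data.Rational.Properties
  open import Relation.Binary.PropositionalEquality

  -- A line in coordinates centred at its second point (s , t).
  line-centred-s₁ : ∀ {a b l n x₁ y₁ s t x₃ y₃} → Line a b l n x₁ y₁ s t x₃ y₃ →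
    (x₁ - s) + (x₃ - s) ≡ l * l - (q (+ 3) * s + a)
  line-centred-s₁ {a} {b} {l} {n} {x₁} {y₁} {s} {t} {x₃} L =
    byLinComb (1ℚ · s₁ L) (ℚ-identity 5 (λ a l x₁ s x₃ → x₁ ⊖ s ⊕ (x₃ ⊖ s) ⊖ (l ⊗ l ⊖ (# 3 ⊗ s ⊕ a)) ⊜ Κ 1ℚ ⊗ (x₁ ⊕ s ⊕ x₃ ⊖ (l ⊗
        l ⊖ a))) refl a l x₁ s x₃)

  line-centred-s₂ : ∀ {a b l n x₁ y₁ s t x₃ y₃} → Line a b l n x₁ y₁ s t x₃ y₃ →
    (x₁ - s) * (x₃ - s) ≡ (q (+ 3) * s * s + q (+ 2) * a * s + b) - q (+ 2) * l * t
  line-centred-s₂ {a} {b} {l} {n} {x₁} {y₁} {s} {t} {x₃} (line _ refl _ s₁ s₂) =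
    byLinComb (- (q (+ 2) * s) · s₁ ⊹ 1ℚ · s₂) (ℚ-identity 7 (λ a b l n x₁ s x₃ → (x₁ ⊖ s) ⊗ (x₃ ⊖ s) ⊖ (# 3 ⊗ s ⊗ s ⊕ # 2 ⊗ a ⊗ s
        ⊕ b ⊖ # 2 ⊗ l ⊗ (l ⊗ s ⊕ n)) ⊜ ⊝ (# 2 ⊗ s) ⊗ (x₁ ⊕ s ⊕ x₃ ⊖ (l ⊗ l ⊖ a)) ⊕ Κ 1ℚ ⊗ (x₁ ⊗ s ⊕ x₁ ⊗ x₃ ⊕ s ⊗ x₃ ⊖ (b ⊖ # 2 ⊗
        l ⊗ n))) refl a b l n x₁ s x₃)

  line-centred-on : ∀ {a b l n x₁ y₁ s t x₃ y₃} → Line a b l n x₁ y₁ s t x₃ y₃ → y₁ ≡ t + l * (x₁ - s)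
  line-centred-on {l = l} {n} {x₁} {y₁} {s} {t} (line refl refl _ _ _) = ℚ-identity 4 (λ l n x₁ s → l ⊗ x₁ ⊕ n ⊜ l ⊗ s ⊕ n ⊕ l ⊗
      (x₁ ⊖ s)) refl l n x₁ s

  -- In coordinates centred at P₂ = (0 , t): X₁, X₃ are the abscissas of P₁, P₃, and U, V those of P₁ + P₂, P₂ + P₃;
  -- the lines P₁P₂ and P₂P₃ have slopes l and m, the line through P₁ + P₂ and P₃ has slope k.
  -- It meets the curve again where the line of slope k + l − m through P₁ and P₂ + P₃ does.
  module Centred (A B t l m k X₁ X₃ U V : ℚ)
    (h₁ : X₁ + U ≡ l * l - A) (h₂ : X₁ * U ≡ B - q (+ 2) * l * t)
    (h₃ : X₃ + V ≡ m * m - A) (h₄ : X₃ * V ≡ B - q (+ 2) * m * t) where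

    module _ (h₅ : (k + l) * (X₃ - U) ≡ (l + m) * X₃ + q (+ 2) * t) (δ≢0 : X₃ - U ≢ 0ℚ) where

      -- `h₅` is the chord from P₁ + P₂ to P₃, written in terms of `k + l`. The mirror image, the
      -- chord of slope `k′ = k + l - m` from P₁ to P₂ + P₃, has the same shape because
      -- `k′ + m = k + l`.
      slope-left : (k + l) * (X₁ - V) ≡ (l + m) * X₁ + q (+ 2) * t
      slope-left = *-cancelˡ-≢0 δ≢0 (byLinComb
        ((X₁ - V) · h₅ ⊹ (l + m) · h₂ ⊹ - (l + m) · h₄ ⊹ q (+ 2) * t · h₁ ⊹ - (q (+ 2) * t) · h₃)
        (ℚ-identity 10 (λ A B t l m k X₁ X₃ U V → (X₃ ⊖ U) ⊗ ((k ⊕ l) ⊗ (X₁ ⊖ V)) ⊖ (X₃ ⊖ U) ⊗ ((l ⊕ m) ⊗ X₁ ⊕ # 2 ⊗ t) ⊜ (X₁ ⊖ V)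
            ⊗ ((k ⊕ l) ⊗ (X₃ ⊖ U) ⊖ ((l ⊕ m) ⊗ X₃ ⊕ # 2 ⊗ t)) ⊕ (l ⊕ m) ⊗ (X₁ ⊗ U ⊖ (B ⊖ # 2 ⊗ l ⊗ t)) ⊕ ⊝ (l ⊕ m) ⊗ (X₃ ⊗ V ⊖ (B
            ⊖ # 2 ⊗ m ⊗ t)) ⊕ # 2 ⊗ t ⊗ (X₁ ⊕ U ⊖ (l ⊗ l ⊖ A)) ⊕ ⊝ (# 2 ⊗ t) ⊗ (X₃ ⊕ V ⊖ (m ⊗ m ⊖ A))) refl A B t l m k X₁ X₃ U
            V))

      difference : X₁ - X₃ ≡ (l - m) * (k + l)
      difference = *-cancelˡ-≢0 δ≢0 (byLinComb
        (- (l - m) · h₅ ⊹ X₃ · h₁ ⊹ - 1ℚ · h₂ ⊹ - X₃ · h₃ ⊹ 1ℚ · h₄)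
        (ℚ-identity 10 (λ A B t l m k X₁ X₃ U V → (X₃ ⊖ U) ⊗ (X₁ ⊖ X₃) ⊖ (X₃ ⊖ U) ⊗ ((l ⊖ m) ⊗ (k ⊕ l)) ⊜ ⊝ (l ⊖ m) ⊗ ((k ⊕ l) ⊗
            (X₃ ⊖ U) ⊖ ((l ⊕ m) ⊗ X₃ ⊕ # 2 ⊗ t)) ⊕ X₃ ⊗ (X₁ ⊕ U ⊖ (l ⊗ l ⊖ A)) ⊕ ⊝ Κ 1ℚ ⊗ (X₁ ⊗ U ⊖ (B ⊖ # 2 ⊗ l ⊗ t)) ⊕ ⊝ X₃ ⊗
            (X₃ ⊕ V ⊖ (m ⊗ m ⊖ A)) ⊕ Κ 1ℚ ⊗ (X₃ ⊗ V ⊖ (B ⊖ # 2 ⊗ m ⊗ t))) refl A B t l m k X₁ X₃ U V))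

    module _ (X : ℚ) (h₆ : X ≡ k * k - A - U - X₃)
      (slope-left : (k + l) * (X₁ - V) ≡ (l + m) * X₁ + q (+ 2) * t)
      (difference : X₁ - X₃ ≡ (l - m) * (k + l)) where

      -- Since `k + l` is unchanged when P₁ and P₃ are exchanged, so is this expression for the
      -- abscissa. That symmetry is the reason why the two lines have the same third point.
      third≡ : X ≡ (k + l) * ((k + l) - l - m)
      third≡ = byLinComb (1ℚ · h₆ ⊹ - 1ℚ · h₁ ⊹ 1ℚ · difference)
        (ℚ-identity 8 (λ A l m k X₁ X₃ U X → X ⊖ (k ⊕ l) ⊗ (k ⊕ l ⊖ l ⊖ m) ⊜ Κ 1ℚ ⊗ (X ⊖ (k ⊗ k ⊖ A ⊖ U ⊖ X₃)) ⊕ ⊝ Κ 1ℚ ⊗ (X₁ ⊕ U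
            ⊖ (l ⊗ l ⊖ A)) ⊕ Κ 1ℚ ⊗ (X₁ ⊖ X₃ ⊖ (l ⊖ m) ⊗ (k ⊕ l))) refl A l m k X₁ X₃ U X)

      sum≡ : X₁ + V + X ≡ (k + l - m) * (k + l - m) - A
      sum≡ = byLinComb (1ℚ · third≡ ⊹ 1ℚ · difference ⊹ 1ℚ · h₃)
        (ℚ-identity 8 (λ A l m k X₁ X₃ V X → X₁ ⊕ V ⊕ X ⊖ ((k ⊕ l ⊖ m) ⊗ (k ⊕ l ⊖ m) ⊖ A) ⊜ Κ 1ℚ ⊗ (X ⊖ (k ⊕ l) ⊗ (k ⊕ l ⊖ l ⊖ m))
            ⊕ Κ 1ℚ ⊗ (X₁ ⊖ X₃ ⊖ (l ⊖ m) ⊗ (k ⊕ l)) ⊕ Κ 1ℚ ⊗ (X₃ ⊕ V ⊖ (m ⊗ m ⊖ A))) refl A l m k X₁ X₃ V X)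

      pairs≡ : X₁ * V + X₁ * X + V * X ≡ B - q (+ 2) * (k + l - m) * (- t - (k + l) * V)
      pairs≡ = byLinComb ((X₁ + V) · third≡ ⊹ V · difference ⊹ 1ℚ · h₄ ⊹ (k + l) · slope-left)
        (ℚ-identity 10 (λ A B t l m k X₁ X₃ V X → X₁ ⊗ V ⊕ X₁ ⊗ X ⊕ V ⊗ X ⊖ (B ⊖ # 2 ⊗ (k ⊕ l ⊖ m) ⊗ (⊝ t ⊖ (k ⊕ l) ⊗ V)) ⊜ (X₁ ⊕
            V) ⊗ (X ⊖ (k ⊕ l) ⊗ (k ⊕ l ⊖ l ⊖ m)) ⊕ V ⊗ (X₁ ⊖ X₃ ⊖ (l ⊖ m) ⊗ (k ⊕ l)) ⊕ Κ 1ℚ ⊗ (X₃ ⊗ V ⊖ (B ⊖ # 2 ⊗ m ⊗ t)) ⊕ (k ⊕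
            l) ⊗ ((k ⊕ l) ⊗ (X₁ ⊖ V) ⊖ ((l ⊕ m) ⊗ X₁ ⊕ # 2 ⊗ t))) refl A B t l m k X₁ X₃ V X)

      on-left : t + l * X₁ ≡ (k + l - m) * X₁ + (- t - (k + l) * V)
      on-left = byLinComb (- 1ℚ · slope-left) (ℚ-identity 6 (λ t l m k X₁ V → t ⊕ l ⊗ X₁ ⊖ ((k ⊕ l ⊖ m) ⊗ X₁ ⊕ (⊝ t ⊖ (k ⊕ l) ⊗
          V)) ⊜ ⊝ Κ 1ℚ ⊗ ((k ⊕ l) ⊗ (X₁ ⊖ V) ⊖ ((l ⊕ m) ⊗ X₁ ⊕ # 2 ⊗ t))) refl t l m k X₁ V)

      on-middle : - (t + m * V) ≡ (k + l - m) * V + (- t - (k + l) * V)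
      on-middle = ℚ-identity 5 (λ t l m k V → ⊝ (t ⊕ m ⊗ V) ⊜ (k ⊕ l ⊖ m) ⊗ V ⊕ (⊝ t ⊖ (k ⊕ l) ⊗ V)) refl t l m k V

      on-third : k * X + (- t - (k + l) * U) ≡ (k + l - m) * X + (- t - (k + l) * V)
      on-third = byLinComb (- (l - m) · third≡ ⊹ (k + l) · difference ⊹ - (k + l) · h₁ ⊹ (k + l) · h₃)
        (ℚ-identity 10 (λ A t l m k X₁ X₃ U V X → k ⊗ X ⊕ (⊝ t ⊖ (k ⊕ l) ⊗ U) ⊖ ((k ⊕ l ⊖ m) ⊗ X ⊕ (⊝ t ⊖ (k ⊕ l) ⊗ V)) ⊜ ⊝ (l ⊖
            m) ⊗ (X ⊖ (k ⊕ l) ⊗ (k ⊕ l ⊖ l ⊖ m)) ⊕ (k ⊕ l) ⊗ (X₁ ⊖ X₃ ⊖ (l ⊖ m) ⊗ (k ⊕ l)) ⊕ ⊝ (k ⊕ l) ⊗ (X₁ ⊕ U ⊖ (l ⊗ l ⊖ A)) ⊕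
            (k ⊕ l) ⊗ (X₃ ⊕ V ⊖ (m ⊗ m ⊖ A))) refl A t l m k X₁ X₃ U V X)

-- Commutativity, inverses, and the common third point of two lines

module AddLaws where

  open import Defs
  open RationalAlgebra
  open ChordTangent
  open CollinearSums
  open import Data.Integer using (+_)
  open import Data.Rational using (0ℚ; 1ℚ; _+_; _*_; _-_; -_)
  open import Data.Rational.Properties
  open import Data.Product using (∃; _,_; proj₂)
  open import Data.Empty using (⊥-elim)
  open import Data.Unit using (tt)
  open import Relation.Binary.PropositionalEquality

  neg-involutive : ∀ x → - (- x) ≡ x
  neg-involutive = ℚ-identity 1 (λ x → ⊝ (⊝ x) ⊜ x) refl

  neg-square : ∀ x → - x * - x ≡ x * x
  neg-square = ℚ-identity 1 (λ x → ⊝ x ⊗ ⊝ x ⊜ x ⊗ x) refl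

  -- Undoes the centring at P₂. The last two hypotheses are isolated because they are obtained by
  -- division in the generic case and by a separate argument when P₂ has order two.
  line-assemble : ∀ {a b l nl m nm k nk x₁ y₁ s t x₃ y₃ u yu v yv x y} →
    Line a b l nl x₁ y₁ s t u (- yu) → Line a b m nm x₃ y₃ s t v (- yv) → Line a b k nk u yu x₃ y₃ x y →
    (k + l) * ((x₁ - s) - (v - s)) ≡ (l + m) * (x₁ - s) + q (+ 2) * t →
    (x₁ - s) - (x₃ - s) ≡ (l - m) * (k + l) →
    ∃ λ n → Line a b (k + l - m) n x₁ y₁ v yv x y
  line-assemble {a} {b} {l} {nl} {m} {nm} {k} {nk} {x₁} {y₁} {s} {t} {x₃} {y₃} {u} {yu} {v} {yv} {x} {y} L M K e₁ e₂ =
    (- t - (k + l) * (v - s)) - (k + l - m) * s , line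
    (trans (line-centred-on L) (trans on-left (shift x₁)))
    (trans (sym (neg-involutive yv)) (trans (cong -_ (line-centred-on (line-rotate (line-rotate (line-swap M)))))
      (trans on-middle (shift v))))
    (trans third-on (trans on-third (shift x)))
    (byLinComb (1ℚ · sum≡) (ℚ-identity 8 (λ a l m k x₁ s v x → x₁ ⊕ v ⊕ x ⊖ ((k ⊕ l ⊖ m) ⊗ (k ⊕ l ⊖ m) ⊖ a) ⊜ Κ 1ℚ ⊗ (x₁ ⊖ s ⊕ (v
        ⊖ s) ⊕ (x ⊖ s) ⊖ ((k ⊕ l ⊖ m) ⊗ (k ⊕ l ⊖ m) ⊖ (# 3 ⊗ s ⊕ a)))) refl a l m k x₁ s v x))
    (byLinComb (1ℚ · pairs≡ ⊹ q (+ 2) * s · sum≡)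
       (ℚ-identity 10 (λ a b l m k x₁ s t v x → x₁ ⊗ v ⊕ x₁ ⊗ x ⊕ v ⊗ x ⊖ (b ⊖ # 2 ⊗ (k ⊕ l ⊖ m) ⊗ (⊝ t ⊖ (k ⊕ l) ⊗ (v ⊖ s) ⊖ (k ⊕
           l ⊖ m) ⊗ s)) ⊜ Κ 1ℚ ⊗ ((x₁ ⊖ s) ⊗ (v ⊖ s) ⊕ (x₁ ⊖ s) ⊗ (x ⊖ s) ⊕ (v ⊖ s) ⊗ (x ⊖ s) ⊖ (# 3 ⊗ s ⊗ s ⊕ # 2 ⊗ a ⊗ s ⊕ b ⊖ #
           2 ⊗ (k ⊕ l ⊖ m) ⊗ (⊝ t ⊖ (k ⊕ l) ⊗ (v ⊖ s)))) ⊕ # 2 ⊗ s ⊗ (x₁ ⊖ s ⊕ (v ⊖ s) ⊕ (x ⊖ s) ⊖ ((k ⊕ l ⊖ m) ⊗ (k ⊕ l ⊖ m) ⊖ (#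
           3 ⊗ s ⊕ a)))) refl a b l m k x₁ s t v x))
    where
    h₆ : x - s ≡ k * k - (q (+ 3) * s + a) - (u - s) - (x₃ - s)
    h₆ = byLinComb (1ℚ · s₁ K) (ℚ-identity 6 (λ a k s x₃ u x → x ⊖ s ⊖ (k ⊗ k ⊖ (# 3 ⊗ s ⊕ a) ⊖ (u ⊖ s) ⊖ (x₃ ⊖ s)) ⊜ Κ 1ℚ ⊗ (u ⊕
        x₃ ⊕ x ⊖ (k ⊗ k ⊖ a))) refl a k s x₃ u x)
    module C = Centred (q (+ 3) * s + a) (q (+ 3) * s * s + q (+ 2) * a * s + b) t l m k (x₁ - s) (x₃ - s) (u - s) (v - s)
      (line-centred-s₁ L) (line-centred-s₂ L) (line-centred-s₁ M) (line-centred-s₂ M)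
    sum≡ = C.sum≡ (x - s) h₆ e₁ e₂
    pairs≡ = C.pairs≡ (x - s) h₆ e₁ e₂
    on-left = C.on-left (x - s) h₆ e₁ e₂
    on-middle = C.on-middle (x - s) h₆ e₁ e₂
    on-third = C.on-third (x - s) h₆ e₁ e₂
    shift : ∀ z → (k + l - m) * (z - s) + (- t - (k + l) * (v - s)) ≡
      (k + l - m) * z + ((- t - (k + l) * (v - s)) - (k + l - m) * s)
    shift z = ℚ-identity 7 (λ t l m k s v z → (k ⊕ l ⊖ m) ⊗ (z ⊖ s) ⊕ (⊝ t ⊖ (k ⊕ l) ⊗ (v ⊖ s)) ⊜ (k ⊕ l ⊖ m) ⊗ z ⊕ (⊝ t ⊖ (k ⊕ l)
        ⊗ (v ⊖ s) ⊖ (k ⊕ l ⊖ m) ⊗ s)) refl t l m k s v z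
    third-on : y ≡ k * (x - s) + (- t - (k + l) * (u - s))
    third-on = byLinComb (1ℚ · on₃ K ⊹ - 1ℚ · on₁ K ⊹ - 1ℚ · line-centred-on (line-rotate (line-rotate (line-swap L))))
      (ℚ-identity 9 (λ k nk l s t u yu x y → y ⊖ (k ⊗ (x ⊖ s) ⊕ (⊝ t ⊖ (k ⊕ l) ⊗ (u ⊖ s))) ⊜ Κ 1ℚ ⊗ (y ⊖ (k ⊗ x ⊕ nk)) ⊕ ⊝ Κ 1ℚ ⊗
          (yu ⊖ (k ⊗ u ⊕ nk)) ⊕ ⊝ Κ 1ℚ ⊗ (⊝ yu ⊖ (t ⊕ l ⊗ (u ⊖ s)))) refl k nk l s t u yu x y)

  assoc-line : ∀ {a b l nl m nm k nk x₁ y₁ s t x₃ y₃ u yu v yv x y} →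
    Line a b l nl x₁ y₁ s t u (- yu) → Line a b m nm x₃ y₃ s t v (- yv) → Line a b k nk u yu x₃ y₃ x y →
    x₃ - u ≢ 0ℚ → ∃ λ k′ → ∃ λ n → Line a b k′ n x₁ y₁ v yv x y
  assoc-line {a} {b} {l} {nl} {m} {nm} {k} {nk} {x₁} {y₁} {s} {t} {x₃} {y₃} {u} {yu} {v} {yv} L M K δ≢0 =
    _ , line-assemble L M K (C.slope-left h₅ δ≢0′) (C.difference h₅ δ≢0′)
    where
    module C = Centred (q (+ 3) * s + a) (q (+ 3) * s * s + q (+ 2) * a * s + b) t l m k (x₁ - s) (x₃ - s) (u - s) (v - s)
      (line-centred-s₁ L) (line-centred-s₂ L) (line-centred-s₁ M) (line-centred-s₂ M)
    δ≡ : (x₃ - s) - (u - s) ≡ x₃ - u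
    δ≡ = ℚ-identity 3 (λ x₃ s u → x₃ ⊖ s ⊖ (u ⊖ s) ⊜ x₃ ⊖ u) refl x₃ s u
    δ≢0′ : (x₃ - s) - (u - s) ≢ 0ℚ
    δ≢0′ h = δ≢0 (trans (sym δ≡) h)
    h₅ : (k + l) * ((x₃ - s) - (u - s)) ≡ (l + m) * (x₃ - s) + q (+ 2) * t
    h₅ = byLinComb (1ℚ · slope-chord K ⊹ 1ℚ · line-centred-on M
        ⊹ 1ℚ · line-centred-on (line-rotate (line-rotate (line-swap L))))
      (ℚ-identity 9 (λ k l m s t u yu x₃ y₃ → (k ⊕ l) ⊗ (x₃ ⊖ s ⊖ (u ⊖ s)) ⊖ ((l ⊕ m) ⊗ (x₃ ⊖ s) ⊕ # 2 ⊗ t) ⊜ Κ 1ℚ ⊗ ((x₃ ⊖ u) ⊗ k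
          ⊖ (y₃ ⊖ yu)) ⊕ Κ 1ℚ ⊗ (y₃ ⊖ (t ⊕ m ⊗ (x₃ ⊖ s))) ⊕ Κ 1ℚ ⊗ (⊝ yu ⊖ (t ⊕ l ⊗ (u ⊖ s)))) refl k l m s t u yu x₃ y₃)

  -- The case P₁ + P₂ = P₃ and P₂ + P₃ = P₁ not covered above: P₂ has order two.
  assoc-line-two-torsion : ∀ {a b c l nl m nm k nk x₁ y₁ s t x₃ y₃ x y} → disc a b c ≢ 0ℚ →
    Cubic a b c x₁ y₁ → Cubic a b c s t →
    Line a b l nl x₁ y₁ s t x₃ (- y₃) → Line a b m nm x₃ y₃ s t x₁ (- y₁) → Line a b k nk x₃ y₃ x₃ y₃ x y →
    ∃ λ k′ → ∃ λ n → Line a b k′ n x₁ y₁ x₁ y₁ x y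
  assoc-line-two-torsion {a} {b} {c} {l} {nl} {m} {nm} {k} {nk} {x₁} {y₁} {s} {t} {x₃} {y₃} Δ≢0 C₁ C₂ L M K =
    _ , line-assemble L M K slope-left difference
    where
    -- `L` and the negative of `M` share the points P₁ and -P₃, so their third points `(s , t)` and
    -- `(s , - t)` agree.
    2t≡0 : q (+ 2) * t ≡ 0ℚ
    2t≡0 = trans (byLinComb (1ℚ · proj₂ (line-unique {a} {b} {c} Δ≢0 C₁ L′ M′)) (ℚ-identity 1 (λ t → # 2 ⊗ t ⊖ Κ 0ℚ ⊜ Κ 1ℚ ⊗ (t ⊖
        ⊝ t)) refl t)) refl
      where
      L′ : Line a b l nl x₁ y₁ x₃ (- y₃) s t
      L′ = line-swap (line-rotate (line-rotate L))
      M′ : Line a b (- m) (- nm) x₁ y₁ x₃ (- y₃) s (- t)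
      M′ = subst (λ z → Line a b (- m) (- nm) x₁ z x₃ (- y₃) s (- t)) (neg-involutive y₁)
        (line-rotate (line-rotate (line-neg M)))
    t≡0 : t ≡ 0ℚ
    t≡0 = 2x≡0⇒x≡0 t 2t≡0
    B≢0 : q (+ 3) * s * s + q (+ 2) * a * s + b ≢ 0ℚ
    B≢0 = nonsingular {a} {b} {c} {s} {t} Δ≢0 C₂ t≡0
    X₃≢0 : x₃ - s ≢ 0ℚ
    X₃≢0 X₃≡0 = B≢0 (byLinComb (- 1ℚ · line-centred-s₂ L ⊹ (x₁ - s) · X₃≡0 ⊹ l · 2t≡0)
      (ℚ-identity 7 (λ a b l x₁ s t x₃ → # 3 ⊗ s ⊗ s ⊕ # 2 ⊗ a ⊗ s ⊕ b ⊖ Κ 0ℚ ⊜ ⊝ Κ 1ℚ ⊗ ((x₁ ⊖ s) ⊗ (x₃ ⊖ s) ⊖ (# 3 ⊗ s ⊗ s ⊕ # 2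
          ⊗ a ⊗ s ⊕ b ⊖ # 2 ⊗ l ⊗ t)) ⊕ (x₁ ⊖ s) ⊗ (x₃ ⊖ s ⊖ Κ 0ℚ) ⊕ l ⊗ (# 2 ⊗ t ⊖ Κ 0ℚ)) refl a b l x₁ s t x₃))
    l+m≡0 : l + m ≡ 0ℚ
    l+m≡0 = *-zero-cancelˡ X₃≢0 (byLinComb (- 1ℚ · line-centred-on M
        ⊹ - 1ℚ · line-centred-on (line-rotate (line-rotate (line-swap L))) ⊹ - 1ℚ · 2t≡0)
      (ℚ-identity 6 (λ l m s t x₃ y₃ → (x₃ ⊖ s) ⊗ (l ⊕ m) ⊖ Κ 0ℚ ⊜ ⊝ Κ 1ℚ ⊗ (y₃ ⊖ (t ⊕ m ⊗ (x₃ ⊖ s))) ⊕ ⊝ Κ 1ℚ ⊗ (⊝ y₃ ⊖ (t ⊕ l ⊗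
          (x₃ ⊖ s))) ⊕ ⊝ Κ 1ℚ ⊗ (# 2 ⊗ t ⊖ Κ 0ℚ)) refl l m s t x₃ y₃))
    slope-left : (k + l) * ((x₁ - s) - (x₁ - s)) ≡ (l + m) * (x₁ - s) + q (+ 2) * t
    slope-left = byLinComb (- (x₁ - s) · l+m≡0 ⊹ - 1ℚ · 2t≡0) (ℚ-identity 6 (λ k l m x₁ s t → (k ⊕ l) ⊗ (x₁ ⊖ s ⊖ (x₁ ⊖ s)) ⊖ ((l
        ⊕ m) ⊗ (x₁ ⊖ s) ⊕ # 2 ⊗ t) ⊜ ⊝ (x₁ ⊖ s) ⊗ (l ⊕ m ⊖ Κ 0ℚ) ⊕ ⊝ Κ 1ℚ ⊗ (# 2 ⊗ t ⊖ Κ 0ℚ)) refl k l m x₁ s t)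
    difference : (x₁ - s) - (x₃ - s) ≡ (l - m) * (k + l)
    difference = *-cancelˡ-≢0 X₃≢0 (byLinComb
      (1ℚ · slope-tangent K refl ⊹ q (+ 2) * k · line-centred-on (line-rotate (line-rotate (line-swap L)))
        ⊹ q (+ 2) * (x₃ - s) · line-centred-s₁ L ⊹ - 1ℚ · line-centred-s₂ L
        ⊹ q (+ 2) * (k + l) · t≡0 ⊹ (x₃ - s) * (k + l) · l+m≡0)
      (ℚ-identity 10 (λ a b k l m x₁ s t x₃ y₃ → (x₃ ⊖ s) ⊗ (x₁ ⊖ s ⊖ (x₃ ⊖ s)) ⊖ (x₃ ⊖ s) ⊗ ((l ⊖ m) ⊗ (k ⊕ l)) ⊜ Κ 1ℚ ⊗ (# 2 ⊗
          y₃ ⊗ k ⊖ (# 3 ⊗ x₃ ⊗ x₃ ⊕ # 2 ⊗ a ⊗ x₃ ⊕ b)) ⊕ # 2 ⊗ k ⊗ (⊝ y₃ ⊖ (t ⊕ l ⊗ (x₃ ⊖ s))) ⊕ # 2 ⊗ (x₃ ⊖ s) ⊗ (x₁ ⊖ s ⊕ (x₃ ⊖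
          s) ⊖ (l ⊗ l ⊖ (# 3 ⊗ s ⊕ a))) ⊕ ⊝ Κ 1ℚ ⊗ ((x₁ ⊖ s) ⊗ (x₃ ⊖ s) ⊖ (# 3 ⊗ s ⊗ s ⊕ # 2 ⊗ a ⊗ s ⊕ b ⊖ # 2 ⊗ l ⊗ t)) ⊕ # 2 ⊗
          (k ⊕ l) ⊗ (t ⊖ Κ 0ℚ) ⊕ (x₃ ⊖ s) ⊗ (k ⊕ l) ⊗ (l ⊕ m ⊖ Κ 0ℚ)) refl a b k l m x₁ s t x₃ y₃))

  add-O : ∀ E P → add E P O ≡ P
  add-O E O = refl
  add-O E (pt x y) = refl

  neg-onCurve : ∀ E P → OnCurve E P → OnCurve E (neg P)
  neg-onCurve E O h = tt
  neg-onCurve E (pt x y) h = trans (neg-square y) h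

  add-inverse : ∀ E {x₁ y₁ x₂ y₂} → OnCurve E (pt x₁ y₁) → OnCurve E (pt x₂ y₂) → x₁ ≡ x₂ → y₁ + y₂ ≡ 0ℚ →
    add E (pt x₁ y₁) (pt x₂ y₂) ≡ O
  add-inverse E {x₁} {y₁} {x₂} {y₂} h₁ h₂ x≡ y≡ = go (add-sum E h₁ h₂)
    where
    go : ∀ {P} → Sum E x₁ y₁ x₂ y₂ P → P ≡ O
    go (inverse _ _) = refl
    go (secant L) = ⊥-elim (not-inverse {a E} {b E} {c E} (nonsing E) h₁ L x≡ y≡)

  add-line : ∀ E {x₁ y₁ x₂ y₂ l n x₃ y₃} → OnCurve E (pt x₁ y₁) → OnCurve E (pt x₂ y₂) →
    Line (a E) (b E) l n x₁ y₁ x₂ y₂ x₃ y₃ → add E (pt x₁ y₁) (pt x₂ y₂) ≡ pt x₃ (- y₃)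
  add-line E {x₁} {y₁} {x₂} {y₂} {x₃ = x₃} {y₃} h₁ h₂ L = go (add-sum E h₁ h₂)
    where
    go : ∀ {P} → Sum E x₁ y₁ x₂ y₂ P → P ≡ pt x₃ (- y₃)
    go (inverse x≡ y≡) = ⊥-elim (not-inverse {a E} {b E} {c E} (nonsing E) h₁ L x≡ y≡)
    go (secant {y₃ = y′} L′) with line-unique {a E} {b E} {c E} (nonsing E) h₁ L L′
    ... | refl , refl = cong (pt x₃) (sym (neg-involutive y′))

  add-comm : ∀ E P Q → OnCurve E P → OnCurve E Q → add E P Q ≡ add E Q P
  add-comm E O Q hP hQ = sym (add-O E Q)
  add-comm E (pt _ _) O hP hQ = refl
  add-comm E (pt x₁ y₁) (pt x₂ y₂) hP hQ = go (add-sum E hP hQ)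
    where
    go : ∀ {P} → Sum E x₁ y₁ x₂ y₂ P → P ≡ add E (pt x₂ y₂) (pt x₁ y₁)
    go (inverse x≡ y≡) = sym (add-inverse E hQ hP (sym x≡) (trans (+-comm y₂ y₁) y≡))
    go (secant {y₃ = y₃} L) = sym (trans (add-line E hQ hP (line-swap L)) (cong (pt _) (neg-involutive y₃)))

  add-neg : ∀ E P → OnCurve E P → add E P (neg P) ≡ O
  add-neg E O h = refl
  add-neg E (pt x y) h = add-inverse E {x} {y} {x} { - y} h (neg-onCurve E (pt x y) h) refl (+-inverseʳ y)

  add-onCurve : ∀ E P Q → OnCurve E P → OnCurve E Q → OnCurve E (add E P Q)
  add-onCurve E O Q hP hQ = hQ
  add-onCurve E (pt _ _) O hP hQ = hP
  add-onCurve E (pt x₁ y₁) (pt x₂ y₂) hP hQ = go (add-sum E hP hQ)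
    where
    go : ∀ {P} → Sum E x₁ y₁ x₂ y₂ P → OnCurve E P
    go (inverse _ _) = tt
    go (secant {x₃ = x₃} {y₃} L) = trans (sym (neg-square y₃))
      (third-onCurve {a E} {b E} {c E} L hP)

-- Associativity of addition

module AddAssociative where

  open import Defs
  open RationalAlgebra
  open ChordTangent
  open AddLaws
  open import Data.Rational using (0ℚ; 1ℚ; _+_; _*_; _-_; -_)
  open import Data.Rational.Properties
  open import Data.Product using (proj₁; proj₂)
  open import Relation.Nullary using (Dec; yes; no)
  open import Relation.Binary.PropositionalEquality

  private
    -‿flip : ∀ {x y} → x + y ≡ 0ℚ → x ≡ - y
    -‿flip {x} {y} h = byLinComb (1ℚ · h) (lemma x y)
      where
      lemma : ∀ x y → x - - y ≡ 1ℚ * (x + y - 0ℚ)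
      lemma = ℚ-identity 2 (λ x y → x ⊖ ⊝ y ⊜ Κ 1ℚ ⊗ (x ⊕ y ⊖ Κ 0ℚ)) refl

  module _ (E : Weierstrass) where

    private
      A = a E
      B = b E

    -- Here U = P₁ + P₂ and V = P₂ + P₃. `assoc-line` divides by `x₃ - u`; if this vanishes, its
    -- mirror image divides by `x₁ - v`. If both vanish and no sum is `O`, then U = P₃ and V = P₁,
    -- which is the two-torsion case.
    assoc-secants : ∀ {x₁ y₁ s t x₃ y₃ u yu v yv l nl m nm} →
      OnCurve E (pt x₁ y₁) → OnCurve E (pt s t) → OnCurve E (pt x₃ y₃) →
      OnCurve E (pt u yu) → OnCurve E (pt v yv) →
      Line A B l nl x₁ y₁ s t u (- yu) → Line A B m nm s t x₃ y₃ v (- yv) →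
      add E (pt u yu) (pt x₃ y₃) ≡ add E (pt x₁ y₁) (pt v yv)
    assoc-secants {x₁} {y₁} {s} {t} {x₃} {y₃} {u} {yu} {v} {yv} C₁ C₂ C₃ Cu Cv L M =
      go (add-sum E {u} {yu} {x₃} {y₃} Cu C₃) (add-sum E {x₁} {y₁} {v} {yv} C₁ Cv)
      where
      -- If U + P₃ = O then P₁, P₂, P₃ are collinear, so that V = − P₁.
      left-inverse : u ≡ x₃ → yu + y₃ ≡ 0ℚ → add E (pt x₁ y₁) (pt v yv) ≡ O
      left-inverse refl y≡ = add-inverse E {x₁} {y₁} {v} {yv} C₁ Cv (proj₁ e) (trans (cong (λ y → y + yv) (proj₂ e)) (+-inverseˡ yv))
        where
        L′ = subst (λ y → Line A B _ _ x₁ y₁ s t u y) (sym (-‿flip (trans (+-comm y₃ yu) y≡))) L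
        e = line-unique {A} {B} {c E} (nonsing E) C₂ (line-rotate L′) M
      right-inverse : x₁ ≡ v → y₁ + yv ≡ 0ℚ → add E (pt u yu) (pt x₃ y₃) ≡ O
      right-inverse refl y≡ = add-inverse E {u} {yu} {x₃} {y₃} Cu C₃ (sym (proj₁ e))
        (trans (cong (λ y → yu + y) (proj₂ e)) (+-inverseʳ yu))
        where
        M′ = subst (λ y → Line A B _ _ s t x₃ y₃ x₁ y) (sym (-‿flip y≡)) M
        e = line-unique {A} {B} {c E} (nonsing E) C₁ (line-rotate (line-rotate M′)) L
      both : ∀ {k nk x y k′ nk′ x′ y′} → Line A B k nk u yu x₃ y₃ x (- y) → Line A B k′ nk′ x₁ y₁ v yv x′ (- y′) →
        Dec (x₃ - u ≡ 0ℚ) → Dec (x₁ - v ≡ 0ℚ) → pt x y ≡ add E (pt x₁ y₁) (pt v yv)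
      both {y = y} K K′ (no δ≢0) _ = sym (trans
        (add-line E {x₁} {y₁} {v} {yv} C₁ Cv (proj₂ (proj₂ (assoc-line L (line-swap M) K δ≢0))))
        (cong (pt _) (neg-involutive y)))
      both {y = y} {x′ = x′} {y′} K K′ (yes _) (no δ≢0) = trans
        (sym (trans (add-line E {u} {yu} {x₃} {y₃} Cu C₃ K) (cong (pt _) (neg-involutive y))))
        (trans (add-comm E (pt u yu) (pt x₃ y₃) Cu C₃)
        (trans (trans
          (add-line E {x₃} {y₃} {u} {yu} C₃ Cu (proj₂ (proj₂ (assoc-line (line-swap M) L (line-swap K′) δ≢0))))
          (cong (pt _) (neg-involutive y′)))
        (sym (trans (add-line E {x₁} {y₁} {v} {yv} C₁ Cv K′) (cong (pt _) (neg-involutive y′))))))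
      both {y = y} K K′ (yes δ≡0) (yes δ′≡0) =
        special {x₁} {y₁} {s} {t} {x₃} {y₃} {u} {yu} {v} {yv} C₁ C₂ (x-y≡0⇒x≡y {x₃} {u} δ≡0) (x-y≡0⇒x≡y {x₁} {v} δ′≡0)
          (same-point E {u} {yu} {x₃} {y₃} Cu C₃ (x-y≡0⇒x≡y {x₃} {u} δ≡0)
            (not-inverse {A} {B} {c E} (nonsing E) Cu K (sym (x-y≡0⇒x≡y {x₃} {u} δ≡0))))
          (same-point E {v} {yv} {x₁} {y₁} Cv C₁ (x-y≡0⇒x≡y {x₁} {v} δ′≡0)
            (not-inverse {A} {B} {c E} (nonsing E) Cv (line-swap K′) (sym (x-y≡0⇒x≡y {x₁} {v} δ′≡0)))) L M K
        where
        special : ∀ {x₁ y₁ s t x₃ y₃ u yu v yv l nl m nm k nk x y} →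
          OnCurve E (pt x₁ y₁) → OnCurve E (pt s t) → x₃ ≡ u → x₁ ≡ v → y₃ ≡ yu → y₁ ≡ yv →
          Line A B l nl x₁ y₁ s t u (- yu) → Line A B m nm s t x₃ y₃ v (- yv) →
          Line A B k nk u yu x₃ y₃ x (- y) → pt x y ≡ add E (pt x₁ y₁) (pt v yv)
        special {x₁} {y₁} {y = y} C₁ C₂ refl refl refl refl L M K = sym (trans
          (add-line E {x₁} {y₁} {x₁} {y₁} C₁ C₁
            (proj₂ (proj₂ (assoc-line-two-torsion {A} {B} {c E} (nonsing E) C₁ C₂ L (line-swap M) K))))
          (cong (pt _) (neg-involutive y)))
      go : ∀ {P Q} → Sum E u yu x₃ y₃ P → Sum E x₁ y₁ v yv Q → P ≡ add E (pt x₁ y₁) (pt v yv)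
      go (inverse x≡ y≡) _ = sym (left-inverse x≡ y≡)
      go (secant K) (inverse x≡ y≡) = trans (sym (trans (add-line E {u} {yu} {x₃} {y₃} Cu C₃ K) (cong (pt _) (neg-involutive _))))
        (trans (right-inverse x≡ y≡) (sym (add-inverse E C₁ Cv x≡ y≡)))
      go (secant K) (secant K′) = both K K′ (x₃ - u ≟ 0ℚ) (x₁ - v ≟ 0ℚ)

    -- The instances of associativity in which two neighbouring summands cancel, where there is no
    -- secant line to work with. The line of P, Q, -(P + Q), negated, passes through -P and P + Q
    -- and meets the curve again in -Q.
    add-cancelˡ-neg : ∀ P Q → OnCurve E P → OnCurve E Q → add E (neg P) (add E P Q) ≡ Q
    add-cancelˡ-neg O Q hP hQ = refl
    add-cancelˡ-neg (pt x y) O hP hQ = trans (add-comm E (neg (pt x y)) (pt x y) (neg-onCurve E (pt x y) hP) hP) (add-neg E (pt x y) hP)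
    add-cancelˡ-neg (pt x₁ y₁) (pt x₂ y₂) hP hQ =
      go (add-sum E {x₁} {y₁} {x₂} {y₂} hP hQ) (add-onCurve E (pt x₁ y₁) (pt x₂ y₂) hP hQ)
      where
      go : ∀ {R} → Sum E x₁ y₁ x₂ y₂ R → OnCurve E R → add E (pt x₁ (- y₁)) R ≡ pt x₂ y₂
      go (inverse refl y≡) _ = cong (pt x₁) (sym (-‿flip (trans (+-comm y₂ y₁) y≡)))
      go (secant {x₃ = x₃} {y₃} L) hR = trans
        (add-line E {x₁} { - y₁} {x₃} {y₃} (neg-onCurve E (pt x₁ y₁) hP) hR
          (subst (λ y → Line A B _ _ x₁ (- y₁) x₃ y x₂ (- y₂)) (neg-involutive y₃)
            (line-swap (line-rotate (line-rotate (line-neg L))))))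
        (cong (pt x₂) (neg-involutive y₂))

    add-assoc : ∀ P Q R → OnCurve E P → OnCurve E Q → OnCurve E R → add E (add E P Q) R ≡ add E P (add E Q R)
    add-assoc O Q R hP hQ hR = refl
    add-assoc (pt _ _) O R hP hQ hR = refl
    add-assoc (pt x₁ y₁) (pt x₂ y₂) O hP hQ hR = add-O E (add E (pt x₁ y₁) (pt x₂ y₂))
    add-assoc P@(pt x₁ y₁) Q@(pt x₂ y₂) R@(pt x₃ y₃) hP hQ hR =
      go (add-sum E {x₁} {y₁} {x₂} {y₂} hP hQ) (add-sum E {x₂} {y₂} {x₃} {y₃} hQ hR)
        (add-onCurve E P Q hP hQ) (add-onCurve E Q R hQ hR)
        (add-cancelˡ-neg Q R hQ hR) refl
      where
      go : ∀ {U V} → Sum E x₁ y₁ x₂ y₂ U → Sum E x₂ y₂ x₃ y₃ V → OnCurve E U → OnCurve E V →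
        add E (neg Q) V ≡ R → U ≡ add E P Q → add E U R ≡ add E P V
      go {V = V} (inverse refl y≡) _ _ _ e _ =
        trans (sym e) (cong (λ y → add E (pt x₁ y) V) (sym (-‿flip y≡)))
      go {U = U} (secant _) (inverse refl y≡) hU _ _ e =
        trans (cong (λ y → add E U (pt x₂ y)) (-‿flip (trans (+-comm y₃ y₂) y≡)))
        (trans (add-comm E U (neg Q) hU (neg-onCurve E Q hQ))
        (trans (cong (add E (neg Q)) (trans e (add-comm E P Q hP hQ))) (add-cancelˡ-neg Q P hQ hP)))
      go (secant L) (secant M) hU hV _ _ = assoc-secants hP hQ hR hU hV L M

-- A pigeonhole principle with multiplicities

module Pigeonhole where

  open import Data.Nat using (ℕ; zero; suc; _+_; _*_; _≤_; _<_; _≟_; _<?_; z≤n; s≤s)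
  open import Data.Nat.Properties
  open import Data.Bool using (true; false)
  open import Data.Fin using (Fin; zero; suc; toℕ; inject≤)
  open import Data.Fin.Properties using (toℕ<n; toℕ-injective; inject≤-injective)
  open import Data.List using (List; []; _∷_; length; filter; lookup; allFin)
  open import Data.List.Properties using (length-tabulate)
  open import Data.List.Relation.Unary.All as All using (All; []; _∷_)
  import Data.List.Relation.Unary.All.Properties as All
  open import Data.List.Relation.Unary.Unique.Propositional using (Unique)
  open import Data.List.Relation.Unary.AllPairs using ([]; _∷_)
  import Data.List.Relation.Unary.Unique.Propositional.Properties as Unique
  open import Data.List.Membership.Propositional.Properties using (∈-lookup)
  open import Data.Product using (Σ; ∃; _×_; _,_; proj₁; proj₂)
  open import Relation.Nullary using (yes; no; does; contradiction)
  open import Relation.Nullary.Decidable using (¬?)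
  open import Relation.Unary using (Decidable)
  open import Relation.Binary.PropositionalEquality

  private
    length-filter-¬ : ∀ {A : Set} {P : A → Set} (P? : Decidable P) xs →
      length xs ≡ length (filter P? xs) + length (filter (λ x → ¬? (P? x)) xs)
    length-filter-¬ P? [] = refl
    length-filter-¬ P? (x ∷ xs) with P? x
    ... | yes _ = cong suc (length-filter-¬ P? xs)
    ... | no _  = trans (cong suc (length-filter-¬ P? xs)) (sym (+-suc _ _))

    length-filter-filter : ∀ {A : Set} {P Q : A → Set} (P? : Decidable P) (Q? : Decidable Q) xs →
      length (filter P? (filter Q? xs)) ≤ length (filter P? xs)
    length-filter-filter P? Q? [] = z≤n
    length-filter-filter P? Q? (x ∷ xs) with does (Q? x)
    length-filter-filter P? Q? (x ∷ xs) | true with does (P? x)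
    ... | true  = s≤s (length-filter-filter P? Q? xs)
    ... | false = length-filter-filter P? Q? xs
    length-filter-filter P? Q? (x ∷ xs) | false with does (P? x)
    ... | true  = m≤n⇒m≤1+n (length-filter-filter P? Q? xs)
    ... | false = length-filter-filter P? Q? xs

    -- Either the top value `b` is taken more than `c` times, or dropping its fibre leaves more than
    -- `c * b` elements with values below `b`.
    pigeonhole-list : ∀ {A : Set} (φ : A → ℕ) c b xs → All (λ x → φ x < b) xs → c * b < length xs →
      ∃ λ z → c < length (filter (λ x → φ x ≟ z) xs)
    pigeonhole-list φ c zero [] [] h = contradiction h λ ()
    pigeonhole-list φ c zero (x ∷ xs) (() ∷ _) h
    pigeonhole-list φ c (suc b) xs φ< h with c <? length (filter (λ x → φ x ≟ b) xs)
    ... | yes c< = b , c<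
    ... | no c≮ = proj₁ ih , ≤-trans (proj₂ ih) (length-filter-filter (λ x → φ x ≟ proj₁ ih) (λ x → ¬? (φ x ≟ b)) xs)
      where
      rest = filter (λ x → ¬? (φ x ≟ b)) xs
      rest-bound : All (λ x → φ x < b) rest
      rest-bound = All.map (λ { (p , q) → ≤∧≢⇒< (≤-pred p) q })
        (All.zip (All.filter⁺ (λ x → ¬? (φ x ≟ b)) φ< , All.all-filter (λ x → ¬? (φ x ≟ b)) xs))
      c*b< : c * b < length rest
      c*b< = +-cancelˡ-< c (c * b) (length rest) (≤-trans (s≤s (≤-reflexive (sym (*-suc c b))))
        (≤-trans h (≤-trans (≤-reflexive (length-filter-¬ (λ x → φ x ≟ b) xs)) (+-monoˡ-≤ (length rest) (≮⇒≥ c≮)))))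
      ih = pigeonhole-list φ c b rest rest-bound c*b<
    lookup-injective : ∀ {A : Set} {xs : List A} → Unique xs → ∀ i j → lookup xs i ≡ lookup xs j → i ≡ j
    lookup-injective (_ ∷ _) zero zero e = refl
    lookup-injective (x∉ ∷ _) zero (suc j) e = contradiction e (All.lookup x∉ (∈-lookup j))
    lookup-injective (x∉ ∷ _) (suc i) zero e = contradiction (sym e) (All.lookup x∉ (∈-lookup i))
    lookup-injective (_ ∷ u) (suc i) (suc j) e = cong suc (lookup-injective u i j e)

  pigeonhole-multi : ∀ {a b} c (φ : Fin a → Fin b) → c * b < a →
    Σ (Fin (suc c) → Fin a) λ ι → (∀ {i j} → ι i ≡ ι j → i ≡ j) × (∀ i j → φ (ι i) ≡ φ (ι j))
  pigeonhole-multi {a} {b} c φ h = ι , ι-injective , λ i j → toℕ-injective (trans (ι-value i) (sym (ι-value j)))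
    where
    xs = allFin a
    found = pigeonhole-list (λ x → toℕ (φ x)) c b xs (All.tabulate⁺ (λ i → toℕ<n (φ i)))
      (subst (c * b <_) (sym (length-tabulate (λ (i : Fin a) → i))) h)
    z = proj₁ found
    ys = filter (λ x → toℕ (φ x) ≟ z) xs
    ys-unique : Unique ys
    ys-unique = Unique.filter⁺ (λ x → toℕ (φ x) ≟ z) (Unique.allFin⁺ a)
    ι : Fin (suc c) → Fin a
    ι i = lookup ys (inject≤ i (proj₂ found))
    ι-injective : ∀ {i j} → ι i ≡ ι j → i ≡ j
    ι-injective e = inject≤-injective (proj₂ found) (proj₂ found) _ _ (lookup-injective ys-unique _ _ e)
    ι-value : ∀ i → toℕ (φ (ι i)) ≡ z
    ι-value i = All.lookup (All.all-filter (λ x → toℕ (φ x) ≟ z) xs) (∈-lookup (inject≤ i (proj₂ found)))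

-- Abelian groups modulo 2-power torsion

module TwoPowerTorsion where

  open import Algebra.Structures using (IsAbelianGroup)
  open import Data.Bool using (Bool; true; false; not)
  open import Data.Nat as ℕ using (ℕ; zero; suc; ⌊_/2⌋)
  import Data.Nat.Properties as ℕ
  import Data.Integer.Properties as ℤ
  open import Data.Nat.Induction using (<-wellFounded; Acc; acc)
  open import Data.Integer as ℤ using (ℤ; +_; -[1+_])
  open import Data.Fin using (Fin; zero; suc)
  open import Data.Product using (∃; _,_; proj₂)
  open import Relation.Binary.PropositionalEquality

  module AbelianGroupFacts {G : Set} {_∙_ : G → G → G} {ε : G} {inv : G → G}
    (isAbelianGroup : IsAbelianGroup _≡_ _∙_ ε inv) where

    open IsAbelianGroup isAbelianGroup using (assoc; comm; identityˡ; identityʳ; inverseˡ; inverseʳ)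

    infixl 6 _⊝_
    _⊝_ : G → G → G
    x ⊝ y = x ∙ inv y

    interchange : ∀ u v x y → (u ∙ v) ∙ (x ∙ y) ≡ (u ∙ x) ∙ (v ∙ y)
    interchange u v x y = trans (assoc u v _) (trans (cong (u ∙_) (trans (sym (assoc v x y))
      (trans (cong (_∙ y) (comm v x)) (assoc x v y)))) (sym (assoc u x _)))

    ∙-cancelʳ : ∀ z x y → x ∙ z ≡ y ∙ z → x ≡ y
    ∙-cancelʳ z x y h = trans (sym (drop x)) (trans (cong (_⊝ z) h) (drop y))
      where
      drop : ∀ w → (w ∙ z) ⊝ z ≡ w
      drop w = trans (assoc w z _) (trans (cong (w ∙_) (inverseʳ z)) (identityʳ w))

    inv-unique : ∀ x y → x ∙ y ≡ ε → y ≡ inv x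
    inv-unique x y h = ∙-cancelʳ x y (inv x) (trans (comm y x) (trans h (sym (inverseˡ x))))

    inv-∙ : ∀ x y → inv (x ∙ y) ≡ inv x ∙ inv y
    inv-∙ x y = sym (inv-unique (x ∙ y) _ (trans (interchange x y _ _)
      (trans (cong₂ _∙_ (inverseʳ x) (inverseʳ y)) (identityˡ ε))))

    inv-ε : inv ε ≡ ε
    inv-ε = sym (inv-unique ε ε (identityˡ ε))

    dbl : G → G
    dbl x = x ∙ x

    dbl^ : ℕ → G → G
    dbl^ zero    x = x
    dbl^ (suc e) x = dbl (dbl^ e x)

    dbl-∙ : ∀ x y → dbl (x ∙ y) ≡ dbl x ∙ dbl y
    dbl-∙ x y = interchange x y x y

    dbl^-∙ : ∀ e x y → dbl^ e (x ∙ y) ≡ dbl^ e x ∙ dbl^ e y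
    dbl^-∙ zero    x y = refl
    dbl^-∙ (suc e) x y = trans (cong dbl (dbl^-∙ e x y)) (dbl-∙ _ _)

    dbl^-inv : ∀ e x → dbl^ e (inv x) ≡ inv (dbl^ e x)
    dbl^-inv zero    x = refl
    dbl^-inv (suc e) x = trans (cong dbl (dbl^-inv e x)) (sym (inv-∙ _ _))

    dbl^-+ : ∀ d e x → dbl^ (d ℕ.+ e) x ≡ dbl^ d (dbl^ e x)
    dbl^-+ zero    e x = refl
    dbl^-+ (suc d) e x = cong dbl (dbl^-+ d e x)

    dbl^-suc : ∀ e x → dbl^ (suc e) x ≡ dbl^ e (dbl x)
    dbl^-suc e x = trans (cong (λ k → dbl^ k x) (ℕ.+-comm 1 e)) (dbl^-+ e 1 x)

    infix 4 _≈_
    -- Congruence modulo 2-power torsion, phrased without a quotient. Its point is that doubling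
    -- becomes injective, see `≈-dbl⁻¹`.
    record _≈_ (x y : G) : Set where
      constructor _,_
      field
        exponent : ℕ
        equal    : dbl^ exponent x ≡ dbl^ exponent y
    open _≈_ public

    ≈-lift : ∀ d {e x y} → dbl^ e x ≡ dbl^ e y → dbl^ (d ℕ.+ e) x ≡ dbl^ (d ℕ.+ e) y
    ≈-lift d {e} {x} {y} h = trans (dbl^-+ d e x) (trans (cong (dbl^ d) h) (sym (dbl^-+ d e y)))

    ≈-refl : ∀ {x} → x ≈ x
    ≈-refl = 0 , refl

    ≈-reflexive : ∀ {x y} → x ≡ y → x ≈ y
    ≈-reflexive refl = ≈-refl

    ≈-sym : ∀ {x y} → x ≈ y → y ≈ x
    ≈-sym (e , h) = e , sym h

    ≈-liftʳ : ∀ d {e x y} → dbl^ e x ≡ dbl^ e y → dbl^ (e ℕ.+ d) x ≡ dbl^ (e ℕ.+ d) y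
    ≈-liftʳ d {e} {x} {y} h = subst (λ k → dbl^ k x ≡ dbl^ k y) (ℕ.+-comm d e) (≈-lift d h)

    ≈-trans : ∀ {x y z} → x ≈ y → y ≈ z → x ≈ z
    ≈-trans (d , h) (e , k) = (d ℕ.+ e) , trans (≈-liftʳ e {d} h) (≈-lift d k)

    ≈-∙ : ∀ {u v x y} → u ≈ v → x ≈ y → u ∙ x ≈ v ∙ y
    ≈-∙ {u} {v} {x} {y} (d , h) (e , k) = (d ℕ.+ e) ,
      trans (dbl^-∙ (d ℕ.+ e) u x) (trans (cong₂ _∙_ (≈-liftʳ e {d} h) (≈-lift d k)) (sym (dbl^-∙ (d ℕ.+ e) v y)))

    ≈-inv : ∀ {x y} → x ≈ y → inv x ≈ inv y
    ≈-inv {x} {y} (e , h) = e , trans (dbl^-inv e x) (trans (cong inv h) (sym (dbl^-inv e y)))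

    ≈-dbl : ∀ {x y} → x ≈ y → dbl x ≈ dbl y
    ≈-dbl h = ≈-∙ h h

    ≈-dbl⁻¹ : ∀ {x y} → dbl x ≈ dbl y → x ≈ y
    ≈-dbl⁻¹ {x} {y} (e , h) = suc e , trans (dbl^-suc e x) (trans h (sym (dbl^-suc e y)))

    ≈-⊝ : ∀ {x y z} → x ∙ y ≈ z → x ≈ z ⊝ y
    ≈-⊝ {x} {y} {z} h = ≈-trans (≈-reflexive (sym (trans (assoc x y _) (trans (cong (x ∙_) (inverseʳ y)) (identityʳ x)))))
      (≈-∙ h (≈-refl {inv y}))

    ⊝-swap : ∀ {u v x y} → u ∙ v ≈ x ∙ y → u ⊝ x ≈ y ⊝ v
    ⊝-swap {u} {v} {x} {y} h = ≈-trans (≈-∙ (≈-⊝ h) (≈-refl {inv x})) (≈-reflexive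
      (trans (cong (λ w → (w ⊝ v) ⊝ x) (comm x y)) (trans (cong (_⊝ x) (trans (assoc y x _) (trans (cong (y ∙_) (comm x _)) (sym (assoc y _ x)))))
        (trans (assoc _ x _) (trans (cong ((y ⊝ v) ∙_) (inverseʳ x)) (identityʳ _))))))

    ≈ε⇒dbl : ∀ {x} → x ≈ ε → ∃ λ e → dbl^ e x ≡ ε
    ≈ε⇒dbl (e , h) = e , trans h (go e)
      where
      go : ∀ e → dbl^ e ε ≡ ε
      go zero = refl
      go (suc e) = trans (cong dbl (go e)) (identityˡ ε)

    nmult : ℕ → G → G
    nmult zero    x = ε
    nmult (suc n) x = x ∙ nmult n x

    zmult : ℤ → G → G
    zmult (+ n)    x = nmult n x
    zmult -[1+ n ] x = inv (nmult (suc n) x)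

    lincombination : (n : ℕ) → (Fin n → ℤ) → (Fin n → G) → G
    lincombination zero    z g = ε
    lincombination (suc n) z g = zmult (z zero) (g zero) ∙ lincombination n (λ i → z (suc i)) (λ i → g (suc i))

    pick : Bool → G → G
    pick true  x = x
    pick false x = ε

    subsetSum : (n : ℕ) → (Fin n → Bool) → (Fin n → G) → G
    subsetSum zero    s g = ε
    subsetSum (suc n) s g = pick (s zero) (g zero) ∙ subsetSum n (λ i → s (suc i)) (λ i → g (suc i))

    odd : ℕ → Bool
    odd zero    = false
    odd (suc n) = not (odd n)

    -- Rounds towards zero, so that the absolute value is halved for both signs and the descent in
    -- `independent₂⇒independent` terminates.
    halfℤ : ℤ → ℤ
    halfℤ (+ n)    = + ⌊ n /2⌋
    halfℤ -[1+ n ] = ℤ.- (+ ⌊ suc n /2⌋)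

    oddℤ : ℤ → Bool
    oddℤ z = odd ℤ.∣ z ∣

    nmult-parity : ∀ n x → nmult n x ≡ pick (odd n) x ∙ dbl (nmult ⌊ n /2⌋ x)
    nmult-parity zero x = sym (trans (identityˡ _) (identityˡ ε))
    nmult-parity (suc zero) x = cong (x ∙_) (sym (identityˡ ε))
    nmult-parity (suc (suc n)) x = trans (sym (assoc x x _)) (trans (cong (dbl x ∙_) (nmult-parity n x))
      (trans (sym (assoc _ _ _)) (trans (cong (_∙ dbl (nmult ⌊ n /2⌋ x)) (comm (dbl x) (pick (odd n) x)))
      (trans (assoc _ _ _) (cong₂ _∙_ (cong (λ b → pick b x) (sym (not-not (odd n)))) (sym (dbl-∙ x _)))))))
      where
      not-not : ∀ b → not (not b) ≡ b
      not-not true = refl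
      not-not false = refl

    zmult-- : ∀ n x → zmult (ℤ.- (+ n)) x ≡ inv (nmult n x)
    zmult-- zero x = sym inv-ε
    zmult-- (suc n) x = refl

    zmult-parity : ∀ z x → ∃ λ u → zmult z x ≡ pick (oddℤ z) x ∙ dbl u
    zmult-parity (+ n) x = _ , nmult-parity n x
    zmult-parity -[1+ n ] x = _ , trans (cong inv (nmult-parity (suc n) x)) (trans (inv-∙ _ _)
      (trans (cong₂ _∙_ (flip (pick (odd (suc n)) x)) (inv-∙ _ _))
      (trans (assoc _ _ _) (cong (pick (odd (suc n)) x ∙_) (sym (dbl-∙ _ _))))))
      where
      flip : ∀ y → inv y ≡ y ∙ dbl (inv y)
      flip y = trans (sym (identityˡ _)) (trans (cong (_∙ inv y) (sym (inverseʳ y))) (assoc y _ _))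

    zmult-half : ∀ z x → oddℤ z ≡ false → zmult z x ≡ dbl (zmult (halfℤ z) x)
    zmult-half (+ n) x h = trans (nmult-parity n x) (trans (cong (λ b → pick b x ∙ dbl (nmult ⌊ n /2⌋ x)) h) (identityˡ _))
    zmult-half -[1+ n ] x h = trans (cong inv (trans (nmult-parity (suc n) x) (trans (cong (λ b → pick b x ∙ dbl (nmult ⌊ suc n /2⌋ x)) h) (identityˡ _))))
      (trans (inv-∙ _ _) (cong dbl (sym (zmult-- ⌊ suc n /2⌋ x))))

    lincombination-parity : ∀ n z g → ∃ λ u → lincombination n z g ≡ subsetSum n (λ i → oddℤ (z i)) g ∙ dbl u
    lincombination-parity zero z g = ε , sym (trans (identityˡ _) (identityˡ ε))
    lincombination-parity (suc n) z g = _ , trans (cong₂ _∙_ (proj₂ (zmult-parity (z zero) (g zero)))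
        (proj₂ (lincombination-parity n (λ i → z (suc i)) (λ i → g (suc i)))))
      (trans (interchange _ _ _ _) (cong (subsetSum (suc n) (λ i → oddℤ (z i)) g ∙_) (sym (dbl-∙ _ _))))

    lincombination-half : ∀ n z g → (∀ i → oddℤ (z i) ≡ false) →
      lincombination n z g ≡ dbl (lincombination n (λ i → halfℤ (z i)) g)
    lincombination-half zero z g h = sym (identityˡ ε)
    lincombination-half (suc n) z g h = trans (cong₂ _∙_ (zmult-half (z zero) (g zero) (h zero))
      (lincombination-half n (λ i → z (suc i)) (λ i → g (suc i)) (λ i → h (suc i)))) (sym (dbl-∙ _ _))

    -- Linear independence in G / (2G + 2-power torsion), a vector space over the field with two elements.
    Independent₂ : (n : ℕ) → (Fin n → G) → Set
    Independent₂ n g = ∀ s u → subsetSum n s g ≈ dbl u → ∀ i → s i ≡ false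

    private
      ∣halfℤ∣ : ∀ z → ℤ.∣ halfℤ z ∣ ≡ ⌊ ℤ.∣ z ∣ /2⌋
      ∣halfℤ∣ (+ n) = refl
      ∣halfℤ∣ -[1+ n ] = abs- ⌊ suc n /2⌋
        where
        abs- : ∀ m → ℤ.∣ ℤ.- (+ m) ∣ ≡ m
        abs- zero = refl
        abs- (suc m) = refl

      even-half≡0 : ∀ n → odd n ≡ false → ⌊ n /2⌋ ≡ 0 → n ≡ 0
      even-half≡0 zero h e = refl
      even-half≡0 (suc zero) () e

    -- Infinite descent: independence modulo doubles makes all coefficients of a relation even, and
    -- the halved relation holds again because `≈` cancels a doubling. The absolute value of the
    -- chosen coefficient drops until it is zero.
    independent₂⇒independent : ∀ n g → Independent₂ n g → ∀ z → lincombination n z g ≈ ε → ∀ i → z i ≡ + 0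
    independent₂⇒independent n g ind z h i = go z h (<-wellFounded ℤ.∣ z i ∣)
      where
      go : ∀ z → lincombination n z g ≈ ε → Acc ℕ._<_ ℤ.∣ z i ∣ → z i ≡ + 0
      go z h (acc rs) = conclude ℤ.∣ z i ∣ refl
        where
        even : ∀ j → oddℤ (z j) ≡ false
        even = ind (λ j → oddℤ (z j)) _ (≈-trans (≈-⊝ (≈-trans (≈-reflexive (sym (proj₂ (lincombination-parity n z g)))) h))
          (≈-reflexive (trans (identityˡ _) (inv-∙ _ _))))
        half≈ε : lincombination n (λ j → halfℤ (z j)) g ≈ ε
        half≈ε = ≈-dbl⁻¹ (≈-trans (≈-reflexive (sym (lincombination-half n z g even))) (≈-trans h (≈-reflexive (sym (identityˡ ε)))))
        conclude : ∀ n → ℤ.∣ z i ∣ ≡ n → z i ≡ + 0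
        conclude zero e = ℤ.∣i∣≡0⇒i≡0 e
        conclude (suc n) e = ℤ.∣i∣≡0⇒i≡0 (even-half≡0 _ (even i) (trans (sym (∣halfℤ∣ (z i)))
          (cong ℤ.∣_∣ (go (λ j → halfℤ (z j)) half≈ε (rs smaller)))))
          where
          smaller : ℤ.∣ halfℤ (z i) ∣ ℕ.< ℤ.∣ z i ∣
          smaller = subst₂ ℕ._<_ (sym (trans (∣halfℤ∣ (z i)) (cong ⌊_/2⌋ e))) (sym e) (ℕ.⌊n/2⌋<n n)

-- Packing in an abelian group with a height

module SpherePacking where

  open TwoPowerTorsion
  open Pigeonhole
  open import Algebra.Structures using (IsAbelianGroup)
  open import Data.Bool using (Bool; true; false)
  open import Data.Empty using (⊥-elim)
  open import Data.Nat using (ℕ; zero; suc; _+_; _*_; _^_; _≤_; _<_; z≤n; s≤s; NonZero; >-nonZero; _≤?_)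
  open import Data.Nat.Properties
  import Data.Integer as ℤ
  open import Data.Fin using (Fin; zero; suc; combine; remQuot; finToFun; funToFin)
  open import Data.Fin.Properties using (remQuot-combine; combine-remQuot; finToFun-funToFin)
  open import Data.Product using (Σ; ∃; _×_; _,_; proj₁; proj₂)
  open import Relation.Nullary using (¬_; yes; no; contradiction)
  open import Relation.Binary.PropositionalEquality

  infixl 1 _>>=¬¬_
  -- Coset representatives, maximal independent families and nets cannot be computed from a bound on
  -- the rank, so their existence is asserted under double negation. What is finally drawn from them
  -- is an inequality of natural numbers, which is stable.
  _>>=¬¬_ : ∀ {A B : Set} → ¬ ¬ A → (A → ¬ ¬ B) → ¬ ¬ B
  (m >>=¬¬ f) k = m (λ a → f a k)

  return¬¬ : ∀ {A : Set} → A → ¬ ¬ A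
  return¬¬ a k = k a

  ¬¬-Fin : ∀ n {P : Fin n → Set} → (∀ i → ¬ ¬ P i) → ¬ ¬ (∀ i → P i)
  ¬¬-Fin zero h k = k λ ()
  ¬¬-Fin (suc n) h = h zero >>=¬¬ λ p → ¬¬-Fin n (λ i → h (suc i)) >>=¬¬ λ ps →
    return¬¬ λ { zero → p ; (suc i) → ps i }

  cons : ∀ {A : Set} {n} → A → (Fin n → A) → Fin (suc n) → A
  cons x xs zero    = x
  cons x xs (suc i) = xs i

  ^-cancelʳ-≤ : ∀ {a b} n → 1 ≤ n → a ^ n ≤ b ^ n → a ≤ b
  ^-cancelʳ-≤ {a} {b} n n≥1 h with a ≤? b
  ... | yes a≤b = a≤b
  ... | no a≰b = contradiction h (<⇒≱ (^-monoˡ-< n {{>-nonZero n≥1}} (≰⇒> a≰b)))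

  ^-distrib-* : ∀ a b n → (a * b) ^ n ≡ a ^ n * b ^ n
  ^-distrib-* a b zero = refl
  ^-distrib-* a b (suc n) = trans (cong (a * b *_) (^-distrib-* a b n)) ([m*n]*[o*p]≡[m*o]*[n*p] a b (a ^ n) (b ^ n))

  ^-swap : ∀ a m n → (a ^ m) ^ n ≡ (a ^ n) ^ m
  ^-swap a m n = trans (^-*-assoc a m n) (trans (cong (a ^_) (*-comm m n)) (sym (^-*-assoc a n m)))

  1≤^ : ∀ {a} n → 1 ≤ a → 1 ≤ a ^ n
  1≤^ {a} n a≥1 = subst (_≤ a ^ n) (^-zeroˡ n) (^-monoˡ-≤ n a≥1)

  ^-sum-bound : ∀ {X C h₁ h₂} a b K → C ≤ X → h₁ ≤ X ^ a → h₂ ≤ X ^ b → (C * (h₁ * h₂)) ^ K ≤ X ^ ((1 + (a + b)) * K)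
  ^-sum-bound {X} a b K C≤ h₁≤ h₂≤ = subst (_ ≤_) (^-*-assoc X (1 + (a + b)) K)
    (^-monoˡ-≤ K (*-mono-≤ C≤ (subst (_ ≤_) (sym (^-distribˡ-+-* X a b)) (*-mono-≤ h₁≤ h₂≤))))

  -- Exponents of `X` along the packing: `combined a b` belongs to a sum of elements of heights at
  -- most `X^a` and `X^b`. In the last two exponents the outer `combined` with `1` pays for a
  -- torsion summand, and the leading `1 +` for the factor `C^(4^k)` of `H-dbl^`.
  module PackingExponents (K : ℕ) where

    combined : ℕ → ℕ → ℕ
    combined a b = (1 + (a + b)) * K

    translateExponent ballExponent differenceExponent : ℕ
    translateExponent = combined 1 1
    ballExponent = 1 + combined (combined translateExponent translateExponent) 1
    differenceExponent = combined (combined ballExponent ballExponent) 1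

  -- Only `H-dbl` has to be sharp. The exponent `K` may be as large as it likes, since it is fixed
  -- before the number of doublings is chosen.
  record HeightedGroup : Set₁ where
    field
      G   : Set
      _∙_ : G → G → G
      ε   : G
      inv : G → G
      isAbelianGroup : IsAbelianGroup _≡_ _∙_ ε inv
      H   : G → ℕ
      C K : ℕ
      1≤C : 1 ≤ C
      1≤H : ∀ x → 1 ≤ H x
      H-ε : H ε ≤ C
      H-inv : ∀ x → H (inv x) ≡ H x
      H-∙ : ∀ x y → H (x ∙ y) ≤ (C * (H x * H y)) ^ K
      H-dbl : ∀ x → H x ^ 4 ≤ C * H (x ∙ x)
      count : ℕ → ℕ
      finite : ∀ X f (T : Fin f → G) → (∀ {i j} → T i ≡ T j → i ≡ j) → (∀ i → H (T i) ≤ X) → f ≤ count X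

  module _ (𝓗 : HeightedGroup) where
    open HeightedGroup 𝓗
    open AbelianGroupFacts isAbelianGroup
    open IsAbelianGroup isAbelianGroup using (assoc; comm; identityˡ; identityʳ; inverseˡ; inverseʳ)

    H-⊝ : ∀ x y → H (x ⊝ y) ≤ (C * (H x * H y)) ^ K
    H-⊝ x y = subst (λ h → H (x ⊝ y) ≤ (C * (H x * h)) ^ K) (H-inv y) (H-∙ x (inv y))

    -- If the double of `t` has height at most `C`, then `H t ^ 4 ≤ C² ≤ C⁴`. So the bound passes
    -- from `2t` to `t` without loss, whatever the order of `t`.
    H-torsion : ∀ e {t} → dbl^ e t ≡ ε → H t ≤ C
    H-torsion zero refl = H-ε
    H-torsion (suc e) {t} h = ^-cancelʳ-≤ 4 (s≤s z≤n) (≤-trans (H-dbl t) (≤-trans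
      (*-monoʳ-≤ C (H-torsion e (trans (sym (dbl^-suc e t)) h)))
      (*-monoʳ-≤ C (≤-trans (≤-reflexive (sym (*-identityʳ C))) (*-monoʳ-≤ C (1≤^ 2 1≤C))))))

    H-≈ : ∀ {x y} → x ≈ y → H x ≤ (C * (H y * C)) ^ K
    H-≈ {x} {y} h = ≤-trans (≤-reflexive (cong H split)) (≤-trans (H-∙ y (x ⊝ y))
      (^-monoˡ-≤ K (*-monoʳ-≤ C (*-monoʳ-≤ (H y) (H-torsion (proj₁ tors) (proj₂ tors))))))
      where
      tors = ≈ε⇒dbl (≈-trans (≈-∙ h (≈-refl {inv y})) (≈-reflexive (inverseʳ y)))
      split : x ≡ y ∙ (x ⊝ y)
      split = sym (trans (cong (y ∙_) (comm x _)) (trans (sym (assoc y _ x)) (trans (cong (_∙ x) (inverseʳ y)) (identityˡ x))))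

    -- The constants accumulate like a geometric series; the generous power `C ^ (4 ^ k)` closes the
    -- induction because `4^k + 4^k ≤ 4^(k+1)`.
    H-dbl^ : ∀ k x → H x ^ (4 ^ k) ≤ C ^ (4 ^ k) * H (dbl^ k x)
    H-dbl^ zero x = subst₂ (λ u v → u ≤ v * H x) (sym (*-identityʳ (H x))) (sym (*-identityʳ C))
      (≤-trans (≤-reflexive (sym (*-identityˡ (H x)))) (*-monoˡ-≤ (H x) 1≤C))
    H-dbl^ (suc k) x = begin
      H x ^ (4 * 4 ^ k)                                ≡⟨ ^-*-assoc (H x) 4 (4 ^ k) ⟨
      (H x ^ 4) ^ (4 ^ k)                              ≤⟨ ^-monoˡ-≤ (4 ^ k) (H-dbl x) ⟩
      (C * H (dbl x)) ^ (4 ^ k)                        ≡⟨ ^-distrib-* C (H (dbl x)) (4 ^ k) ⟩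
      C ^ (4 ^ k) * H (dbl x) ^ (4 ^ k)                ≤⟨ *-monoʳ-≤ (C ^ (4 ^ k)) (H-dbl^ k (dbl x)) ⟩
      C ^ (4 ^ k) * (C ^ (4 ^ k) * H (dbl^ k (dbl x))) ≡⟨ *-assoc (C ^ (4 ^ k)) _ _ ⟨
      C ^ (4 ^ k) * C ^ (4 ^ k) * H (dbl^ k (dbl x))   ≡⟨ cong₂ (λ u v → u * H v) (sym (^-distribˡ-+-* C (4 ^ k) (4 ^ k))) (sym (dbl^-suc k x)) ⟩
      C ^ (4 ^ k + 4 ^ k) * H (dbl^ (suc k) x)         ≤⟨ *-monoˡ-≤ (H (dbl^ (suc k) x)) (^-monoʳ-≤ C {{>-nonZero 1≤C}} (+-monoʳ-≤ (4 ^ k) (m≤m+n (4 ^ k) (2 * 4 ^ k)))) ⟩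
      C ^ (4 * 4 ^ k) * H (dbl^ (suc k) x)             ∎
      where open ≤-Reasoning

    module Rank (r : ℕ)
      (rank≤r : (g : Fin (suc r) → G) → ¬ (∀ z → lincombination (suc r) z g ≡ ε → ∀ i → z i ≡ ℤ.+ 0)) where

      Cover : ℕ → ℕ → Set
      Cover M k = Σ (Fin M → G) λ rep → ∀ x → ¬ ¬ (∃ λ c → ∃ λ u → x ≈ rep c ∙ dbl^ k u)

      private
        Maximal : ℕ → Set
        Maximal s = Σ (Fin s → G) λ g → Independent₂ s g × (∀ x → ¬ Independent₂ (suc s) (cons x g))

        large-dependent : ∀ g → ¬ Independent₂ (suc r) g
        large-dependent g ind = rank≤r g (λ z h → independent₂⇒independent (suc r) g ind z (≈-reflexive h))

        -- If no independent family of size at most `r` were maximal, families could be extended one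
        -- element at a time up to size `r + 1`, which the rank forbids.
        maximal : ¬ ¬ (∃ λ s → s ≤ r × Maximal s)
        maximal none = independent (suc r) ≤-refl (λ { (g , ind) → large-dependent g ind })
          where
          independent : ∀ s → s ≤ suc r → ¬ ¬ (Σ (Fin s → G) (Independent₂ s))
          independent zero _ k = k ((λ ()) , λ _ _ _ ())
          independent (suc s) s< k = independent s (≤-trans (n≤1+n s) s<) λ { (g , ind) →
            none (s , ≤-pred s< , g , ind , λ x ind′ → k (cons x g , ind′)) }

        -- Adjoining `x` to a maximal family creates a relation. It must involve `x`, since the
        -- family itself is independent, and over the field with two elements its coefficient there
        -- is 1, so that it can be solved for `x`.
        spans : ∀ s (g : Fin s → G) → Independent₂ s g → (∀ x → ¬ Independent₂ (suc s) (cons x g)) →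
          ∀ x → ¬ ¬ (∃ λ t → ∃ λ u → x ≈ subsetSum s t g ∙ dbl u)
        spans s g ind max x none = max x λ t u h → conclude t u h
          where
          conclude : ∀ t u → subsetSum (suc s) t (cons x g) ≈ dbl u → ∀ i → t i ≡ false
          conclude t u h with t zero in t₀
          ... | true = ⊥-elim (none ((λ i → t (suc i)) , (u ⊝ S) , ≈-trans (≈-⊝ h) (≈-reflexive flip)))
            where
            S = subsetSum s (λ i → t (suc i)) g
            -- Signs do not matter modulo doubles: -S = S - 2S.
            flip : dbl u ⊝ S ≡ S ∙ dbl (u ⊝ S)
            flip = sym (trans (cong (S ∙_) (trans (dbl-∙ u (inv S)) (comm _ _))) (trans (sym (assoc S _ _))
              (trans (cong (_∙ dbl u) (trans (sym (assoc S _ _)) (trans (cong (_∙ inv S) (inverseʳ S)) (identityˡ _)))) (comm _ _))))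
          ... | false = λ { zero → t₀ ; (suc i) → ind _ u (≈-trans (≈-reflexive (sym (identityˡ _))) h) i }

        toBool : Fin 2 → Bool
        toBool zero = false
        toBool (suc zero) = true

        fromBool : Bool → Fin 2
        fromBool false = zero
        fromBool true = suc zero

        toBool-fromBool : ∀ b → toBool (fromBool b) ≡ b
        toBool-fromBool false = refl
        toBool-fromBool true = refl

        subsetSum-cong : ∀ n {s t : Fin n → Bool} g → (∀ i → s i ≡ t i) → subsetSum n s g ≡ subsetSum n t g
        subsetSum-cong zero g h = refl
        subsetSum-cong (suc n) g h = cong₂ _∙_ (cong (λ b → pick b (g zero)) (h zero)) (subsetSum-cong n _ (λ i → h (suc i)))

      cover₁ : ¬ ¬ (∃ λ s → s ≤ r × Cover (2 ^ s) 1)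
      cover₁ = maximal >>=¬¬ λ { (s , s≤r , g , ind , max) → return¬¬ (s , s≤r ,
        (λ c → subsetSum s (λ i → toBool (finToFun {2} {s} c i)) g) , λ x → spans s g ind max x >>=¬¬ λ { (t , u , h) →
        return¬¬ (funToFin (λ i → fromBool (t i)) , u , ≈-trans h (≈-reflexive (cong (_∙ dbl u) (subsetSum-cong s g λ i →
          sym (trans (cong toBool (finToFun-funToFin (λ i → fromBool (t i)) i)) (toBool-fromBool (t i))))))) }) }

      -- A base `M` expansion with `k` digits: in `x ≈ rep c ∙ dbl u` the quotient `u` is expanded
      -- again.
      cover-^ : ∀ {M} → Cover M 1 → ∀ k → Cover (M ^ k) k
      cover-^ cov zero = (λ _ → ε) , λ x → return¬¬ (zero , x , ≈-reflexive (sym (identityˡ x)))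
      cover-^ {M} cov (suc k) = rep , covers
        where
        ih = cover-^ cov k
        rep : Fin (M * M ^ k) → G
        rep c = proj₁ cov (proj₁ (remQuot (M ^ k) c)) ∙ dbl (proj₁ ih (proj₂ (remQuot {M} (M ^ k) c)))
        covers : ∀ x → ¬ ¬ (∃ λ c → ∃ λ u → x ≈ rep c ∙ dbl^ (suc k) u)
        covers x = proj₂ cov x >>=¬¬ λ { (c , u , h) → proj₂ ih u >>=¬¬ λ { (d , v , h′) → return¬¬ (combine c d , v ,
          ≈-trans h (≈-trans (≈-∙ ≈-refl (≈-dbl h′)) (≈-reflexive (trans (cong (proj₁ cov c ∙_) (dbl-∙ _ _))
            (trans (sym (assoc _ _ _)) (cong (λ p → (proj₁ cov (proj₁ p) ∙ dbl (proj₁ ih (proj₂ p))) ∙ dbl^ (suc k) v)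
              (sym (remQuot-combine c d)))))))) } }

      open PackingExponents K

      module Ball (k X : ℕ) (C^≤X : C ^ (4 ^ k) ≤ X) (exp≤ : ballExponent ≤ 4 ^ k) where

        private
          q = 4 ^ k

          1≤q : 1 ≤ q
          1≤q = 1≤^ k (s≤s z≤n)

          C≤C^q : C ≤ C ^ q
          C≤C^q = subst (_≤ C ^ q) (*-identityʳ C) (^-monoʳ-≤ C {{>-nonZero 1≤C}} 1≤q)

          C≤X : C ≤ X
          C≤X = ≤-trans C≤C^q C^≤X

          1≤X : 1 ≤ X
          1≤X = ≤-trans 1≤C C≤X

          ≤X^1 : ∀ {h} → h ≤ X → h ≤ X ^ 1
          ≤X^1 = subst (_ ≤_) (sym (*-identityʳ X))

        -- The ball of radius `X^(ballExponent / 4^k)`, written without roots; `exp≤` keeps this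
        -- radius below `X`.
        InBall : G → Set
        InBall x = H x ^ q ≤ X ^ ballExponent

        Separated : ∀ {f} → (Fin f → G) → Set
        Separated T = (∀ i → InBall (T i)) × (∀ i j → T i ≈ T j → i ≡ j)

        -- Such a `T` is a system of representatives for the classes modulo 2-power torsion that
        -- meet the ball.
        Net : Set
        Net = ∃ λ f → Σ (Fin f → G) λ T → Separated T × (∀ u → InBall u → ¬ ¬ (∃ λ j → u ≈ T j))

        inBall⇒≤X : ∀ {x} → InBall x → H x ≤ X
        inBall⇒≤X h = ^-cancelʳ-≤ q 1≤q (≤-trans h (^-monoʳ-≤ X {{>-nonZero 1≤X}} exp≤))

        -- Greedy construction: unless some separated family is already dense, every separated
        -- family can be enlarged, until there are more than `count X` points of height at most `X`.
        net : ¬ ¬ Net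
        net none = separated (suc (count X)) λ { (T , ball , sep) → 1+n≰n
            (finite X (suc (count X)) T (λ e → sep _ _ (≈-reflexive e)) (λ i → inBall⇒≤X (ball i))) }
          where
          separated : ∀ f → ¬ ¬ (Σ (Fin f → G) Separated)
          separated zero nosep = nosep ((λ ()) , (λ ()) , λ ())
          separated (suc f) nosep = separated f λ { (T , ball , sep) → none (f , T , (ball , sep) , λ u ball-u ∄j → nosep (cons u T ,
            (λ { zero → ball-u ; (suc i) → ball i }) ,
            λ { zero zero _ → refl
              ; zero (suc j) h → ⊥-elim (∄j (j , h))
              ; (suc i) zero h → ⊥-elim (∄j (i , ≈-sym h))
              ; (suc i) (suc j) h → cong suc (sep i j h) })) }

        ε-inBall : InBall ε
        ε-inBall = ≤-trans (^-monoˡ-≤ q H-ε) (≤-trans C^≤X (subst (_≤ X ^ ballExponent) (*-identityʳ X)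
          (^-monoʳ-≤ X {{>-nonZero 1≤X}} {1} {ballExponent} (s≤s z≤n))))

        translate-bound : ∀ {p t} → H p ≤ X → InBall t → H (p ∙ t) ≤ X ^ translateExponent
        translate-bound {p} {t} hp ht = ≤-trans (H-∙ p t) (^-sum-bound 1 1 K C≤X (≤X^1 hp) (≤X^1 (inBall⇒≤X ht)))

        -- This inequality dictates the radius of the ball: dividing a difference of two translates
        -- by `2^k` takes a `4^k`-th root of a fixed power of `X`.
        quotient-inBall : ∀ {v w u} → H v ≤ X ^ translateExponent → H w ≤ X ^ translateExponent →
          v ⊝ w ≈ dbl^ k u → InBall u
        quotient-inBall {v} {w} {u} hv hw h = ≤-trans (H-dbl^ k u) (*-mono-≤ C^≤X (≤-trans (H-≈ (≈-sym h))
          (^-sum-bound (combined translateExponent translateExponent) 1 K C≤X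
            (≤-trans (H-⊝ v w) (^-sum-bound translateExponent translateExponent K C≤X hv hw)) (≤X^1 C≤X))))

        difference-bound : ∀ {d t t′} → d ≈ t ⊝ t′ → InBall t → InBall t′ → H d ^ q ≤ X ^ differenceExponent
        difference-bound {d} {t} {t′} h ht ht′ = begin
          H d ^ q                                 ≤⟨ ^-monoˡ-≤ q (H-≈ h) ⟩
          ((C * (H (t ⊝ t′) * C)) ^ K) ^ q        ≡⟨ power C (H (t ⊝ t′)) C ⟩
          (C ^ q * (H (t ⊝ t′) ^ q * C ^ q)) ^ K  ≤⟨ ^-sum-bound (combined ballExponent ballExponent) 1 K C^≤X inner (≤X^1 C^≤X) ⟩
          X ^ differenceExponent                  ∎
          where
          open ≤-Reasoning
          power : ∀ a b c → ((a * (b * c)) ^ K) ^ q ≡ (a ^ q * (b ^ q * c ^ q)) ^ K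
          power a b c = trans (^-swap (a * (b * c)) K q) (cong (_^ K)
            (trans (^-distrib-* a (b * c) q) (cong (a ^ q *_) (^-distrib-* b c q))))
          inner : H (t ⊝ t′) ^ q ≤ X ^ combined ballExponent ballExponent
          inner = ≤-trans (^-monoˡ-≤ q (H-⊝ t t′)) (≤-trans (≤-reflexive (power C (H t) (H t′)))
            (^-sum-bound ballExponent ballExponent K C^≤X ht ht′))

      -- The translates of a maximal net in a small ball by the points P i overlap at most threefold; they all lie in a
      -- ball which, up to multiplication by 2^k, is covered by 2^(rk) copies of the small one.
      packing : ∀ k X → C ^ (4 ^ k) ≤ X → ballExponent ≤ 4 ^ k →
        ∀ n (P : Fin n → G) → (∀ {i j} → P i ≡ P j → i ≡ j) → (∀ i → H (P i) ≤ X) → 3 * (2 ^ r) ^ k < n →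
        ¬ ¬ (Σ (Fin 4 → Fin n) λ ι → (∀ {a b} → ι a ≡ ι b → a ≡ b) ×
          (∀ a b → H (P (ι a) ⊝ P (ι b)) ^ (4 ^ k) ≤ X ^ differenceExponent))
      packing k X C^≤X exp≤ n P P-injective P≤X n> =
        cover₁ >>=¬¬ λ { (s , s≤r , cov) → net >>=¬¬ λ { (f , T , (ball , sep) , dense) →
        -- The neutral element lies in the ball, so the net is not empty and the strict inequality
        -- `n>` survives multiplication by `f`.
        dense ε ε-inBall >>=¬¬ λ { (j₀ , _) →
        Main.main s s≤r (cover-^ cov k) f T ball sep dense j₀ } } }
        where
        open Ball k X C^≤X exp≤
        module Main (s : ℕ) (s≤r : s ≤ r) (cov : Cover ((2 ^ s) ^ k) k) (f : ℕ) (T : Fin f → G)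
          (ball : ∀ i → InBall (T i)) (sep : ∀ i j → T i ≈ T j → i ≡ j)
          (dense : ∀ u → InBall u → ¬ ¬ (∃ λ j → u ≈ T j)) (j₀ : Fin f) where

          left : Fin (n * f) → Fin n
          left p = proj₁ (remQuot {n} f p)
          right : Fin (n * f) → Fin f
          right p = proj₂ (remQuot {n} f p)
          W : Fin (n * f) → G
          W p = P (left p) ∙ T (right p)

          pair-injective : ∀ {p p′} → left p ≡ left p′ → right p ≡ right p′ → p ≡ p′
          pair-injective {p} {p′} e e′ = trans (sym (combine-remQuot {n} f p)) (trans (cong₂ combine e e′) (combine-remQuot {n} f p′))

          many : (3 * f) * (2 ^ s) ^ k < n * f
          many = subst (_< n * f) (lemma (3) f ((2 ^ s) ^ k)) (*-monoˡ-< f {{nonZero-f j₀}}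
            (≤-<-trans (*-monoʳ-≤ 3 (^-monoˡ-≤ k (^-monoʳ-≤ 2 s≤r))) n>))
            where
            nonZero-f : ∀ {f} → Fin f → NonZero f
            nonZero-f {suc f} _ = _
            lemma : ∀ a b c → (a * c) * b ≡ (a * b) * c
            lemma a b c = trans (*-assoc a c b) (trans (cong (a *_) (*-comm c b)) (sym (*-assoc a b c)))

          W-bound : ∀ p → H (W p) ≤ X ^ translateExponent
          W-bound p = translate-bound (P≤X (left p)) (ball (right p))

          main : ¬ ¬ (Σ (Fin 4 → Fin n) λ ι → (∀ {a b} → ι a ≡ ι b → a ≡ b) ×
            (∀ a b → H (P (ι a) ⊝ P (ι b)) ^ (4 ^ k) ≤ X ^ differenceExponent))
          main = ¬¬-Fin (n * f) (λ p → proj₂ cov (W p)) >>=¬¬ λ code → second code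
            where
            second : (∀ p → ∃ λ c → ∃ λ u → W p ≈ proj₁ cov c ∙ dbl^ k u) → _
            second code = ¬¬-Fin (suc (3 * f)) (λ a → dense (U′ a) (U′-ball a)) >>=¬¬ λ near → third near
              where
              -- The `n * f` translates fall into `(2^s)^k` cosets, so more than `3 f` share one.
              -- Differences within it are multiples of `2^k` modulo torsion, with quotients `U′` in
              -- the small ball.
              hole₁ = pigeonhole-multi (3 * f) (λ p → proj₁ (code p)) many
              ι₁ = proj₁ hole₁
              U : Fin (suc (3 * f)) → G
              U a = proj₁ (proj₂ (code (ι₁ a)))
              U′ : Fin (suc (3 * f)) → G
              U′ a = U a ⊝ U zero
              W-difference : ∀ a → W (ι₁ a) ⊝ W (ι₁ zero) ≈ dbl^ k (U′ a)
              W-difference a = ≈-trans (≈-∙ (proj₂ (proj₂ (code (ι₁ a)))) (≈-inv (proj₂ (proj₂ (code (ι₁ zero))))))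
                (≈-reflexive (trans (cong (λ c → (rep (ι₁ a) ∙ dbl^ k (U a)) ⊝ (proj₁ cov c ∙ dbl^ k (U zero)))
                    (sym (proj₂ (proj₂ hole₁) a zero)))
                  (trans (cong ((rep (ι₁ a) ∙ dbl^ k (U a)) ∙_) (inv-∙ _ _)) (trans (interchange _ _ _ _)
                  (trans (cong (_∙ (dbl^ k (U a) ⊝ dbl^ k (U zero))) (inverseʳ _)) (trans (identityˡ _)
                  (trans (cong (dbl^ k (U a) ∙_) (sym (dbl^-inv k _))) (sym (dbl^-∙ k _ _)))))))))
                where
                rep : Fin (n * f) → G
                rep p = proj₁ cov (proj₁ (code p))
              U′-ball : ∀ a → InBall (U′ a)
              U′-ball a = quotient-inBall (W-bound (ι₁ a)) (W-bound (ι₁ zero)) (W-difference a)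
              third : (∀ a → ∃ λ j → U′ a ≈ T j) → _
              third near = return¬¬ ((λ a → left (p a)) , distinct , bound)
                where
                -- The `3 f + 1` quotients meet only `f` classes of the net, so four of them agree;
                -- then the four translates themselves agree modulo torsion.
                hole₂ = pigeonhole-multi 3 (λ a → proj₁ (near a)) (n<1+n (3 * f))
                ι₂ = proj₁ hole₂
                p : Fin 4 → Fin (n * f)
                p a = ι₁ (ι₂ a)
                same-remainder : ∀ a b → U′ (ι₂ a) ≈ U′ (ι₂ b)
                same-remainder a b = ≈-trans (proj₂ (near (ι₂ a))) (≈-trans
                  (≈-reflexive (cong T (proj₂ (proj₂ hole₂) a b))) (≈-sym (proj₂ (near (ι₂ b)))))
                dbl^-≈ : ∀ k {x y} → x ≈ y → dbl^ k x ≈ dbl^ k y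
                dbl^-≈ zero h = h
                dbl^-≈ (suc k) h = ≈-dbl (dbl^-≈ k h)
                W-≈ : ∀ a b → W (p a) ≈ W (p b)
                W-≈ a b = ≈-trans (≈-sym (restore a)) (≈-trans (≈-∙ (≈-trans (W-difference (ι₂ a))
                  (≈-trans (dbl^-≈ k (same-remainder a b)) (≈-sym (W-difference (ι₂ b))))) ≈-refl) (restore b))
                  where
                  restore : ∀ a → (W (p a) ⊝ W (ι₁ zero)) ∙ W (ι₁ zero) ≈ W (p a)
                  restore a = ≈-reflexive (trans (assoc _ _ _) (trans (cong (W (p a) ∙_) (inverseˡ _)) (identityʳ _)))
                difference : ∀ a b → P (left (p a)) ⊝ P (left (p b)) ≈ T (right (p b)) ⊝ T (right (p a))
                difference a b = ⊝-swap (W-≈ a b)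
                bound : ∀ a b → H (P (left (p a)) ⊝ P (left (p b))) ^ (4 ^ k) ≤ X ^ differenceExponent
                bound a b = difference-bound (difference a b) (ball _) (ball _)
                -- Equal terms of the progression would leave net elements that agree modulo
                -- torsion; by separation these are equal, and so are the two pairs.
                distinct : ∀ {a b} → left (p a) ≡ left (p b) → a ≡ b
                distinct {a} {b} e = proj₁ (proj₂ hole₂) (proj₁ (proj₂ hole₁) (pair-injective e
                  (sym (sep _ _ (≈-trans (≈-reflexive (sym (cancel _))) (≈-trans (≈-∙ (≈-sym T≈) ≈-refl) (≈-reflexive (identityˡ _))))))))
                  where
                  T≈ : ε ≈ T (right (p b)) ⊝ T (right (p a))
                  T≈ = ≈-trans (≈-reflexive (trans (sym (inverseʳ _)) (cong (λ i → P (left (p a)) ⊝ P i) e))) (difference a b)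
                  cancel : ∀ x → (T (right (p b)) ⊝ x) ∙ x ≡ T (right (p b))
                  cancel x = trans (assoc _ _ _) (trans (cong (T (right (p b)) ∙_) (inverseˡ x)) (identityʳ _))

-- Heights of rational numbers and clearing of denominators

module RationalHeight where

  open import Defs using (q)
  open RationalAlgebra
  open import Data.Nat as ℕ using (ℕ; zero; suc; _⊔_)
  import Data.Nat.Properties as ℕ
  import Data.Nat.Divisibility as ℕ
  open import Data.Nat.Coprimality as Coprimality using (Coprime; coprime-divisor)
  import Data.Nat.GCD as ℕ
  open import Data.Integer as ℤ using (ℤ; +_; ∣_∣)
  import Data.Integer.Properties as ℤ
  import Data.Integer.GCD as ℤ
  open import Data.Rational using (ℚ; mkℚ; 0ℚ; 1ℚ; _+_; _*_; _-_; -_; 1/_; ↥_; ↧_; ↧ₙ_; ≢-nonZero; NonZero)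
  open import Data.Rational.Properties
  open import Data.Product using (_,_)
  open import Data.Sum using (inj₁; inj₂)
  open import Relation.Binary.PropositionalEquality

  -- z = m / n, not necessarily in lowest terms.
  record Frac (z : ℚ) (m n : ℤ) : Set where
    constructor frac
    field
      factor      : ℤ
      numerator   : ↥ z ℤ.* factor ≡ m
      denominator : ↧ z ℤ.* factor ≡ n
      nonzero     : n ≢ + 0
  open Frac

  private
    ↧≢0 : ∀ z → ↧ z ≢ + 0
    ↧≢0 (mkℚ _ _ _) ()

    *-≢0ℤ : ∀ {m n} → m ≢ + 0 → n ≢ + 0 → m ℤ.* n ≢ + 0
    *-≢0ℤ {m} {n} m≢0 n≢0 h with ℤ.i*j≡0⇒i≡0∨j≡0 m h
    ... | inj₁ e = m≢0 e
    ... | inj₂ e = n≢0 e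

  frac-self : ∀ z → Frac z (↥ z) (↧ z)
  frac-self z = frac (+ 1) (ℤ.*-identityʳ _) (ℤ.*-identityʳ _) (↧≢0 z)

  frac-q : ∀ m → Frac (q m) m (+ 1)
  frac-q m = frac (ℤ.gcd m (+ 1)) (↥-/ m 1) (↧-/ m 1) λ ()

  frac-* : ∀ {z w m n m′ n′} → Frac z m n → Frac w m′ n′ → Frac (z * w) (m ℤ.* m′) (n ℤ.* n′)
  frac-* {z} {w} (frac g refl refl n≢0) (frac g′ refl refl n′≢0) = reduced _ (↥-* z w) (↧-* z w)
    where
    lemma : ∀ u v g g′ → u ℤ.* v ℤ.* (g ℤ.* g′) ≡ (u ℤ.* g) ℤ.* (v ℤ.* g′)
    lemma = ℤ-identity 4 (λ u v g g′ → u ⊗ v ⊗ (g ⊗ g′) ⊜ (u ⊗ g) ⊗ (v ⊗ g′)) refl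
    step : ∀ t f u v → t ℤ.* f ≡ u ℤ.* v → t ℤ.* (f ℤ.* (g ℤ.* g′)) ≡ (u ℤ.* g) ℤ.* (v ℤ.* g′)
    step t f u v h = trans (sym (ℤ.*-assoc t f _)) (trans (cong (ℤ._* (g ℤ.* g′)) h) (lemma u v g g′))
    reduced : ∀ f → ↥ (z * w) ℤ.* f ≡ ↥ z ℤ.* ↥ w → ↧ (z * w) ℤ.* f ≡ ↧ z ℤ.* ↧ w →
      Frac (z * w) ((↥ z ℤ.* g) ℤ.* (↥ w ℤ.* g′)) ((↧ z ℤ.* g) ℤ.* (↧ w ℤ.* g′))
    reduced f hn hd = frac (f ℤ.* (g ℤ.* g′)) (step (↥ (z * w)) f (↥ z) (↥ w) hn) (step (↧ (z * w)) f (↧ z) (↧ w) hd) (*-≢0ℤ n≢0 n′≢0)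

  frac-+ : ∀ {z w m n m′ n′} → Frac z m n → Frac w m′ n′ → Frac (z + w) (m ℤ.* n′ ℤ.+ m′ ℤ.* n) (n ℤ.* n′)
  frac-+ {z} {w} (frac g refl refl n≢0) (frac g′ refl refl n′≢0) = reduced _ (↥-+ z w) (↧-+ z w)
    where
    lemma : ∀ a b c d g h → (a ℤ.* b ℤ.+ c ℤ.* d) ℤ.* (g ℤ.* h) ≡ (a ℤ.* g) ℤ.* (b ℤ.* h) ℤ.+ (c ℤ.* h) ℤ.* (d ℤ.* g)
    lemma = ℤ-identity 6 (λ a b c d g h → (a ⊗ b ⊕ c ⊗ d) ⊗ (g ⊗ h) ⊜ (a ⊗ g) ⊗ (b ⊗ h) ⊕ (c ⊗ h) ⊗ (d ⊗ g)) refl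
    lemma′ : ∀ u v g g′ → u ℤ.* v ℤ.* (g ℤ.* g′) ≡ (u ℤ.* g) ℤ.* (v ℤ.* g′)
    lemma′ = ℤ-identity 4 (λ u v g g′ → u ⊗ v ⊗ (g ⊗ g′) ⊜ (u ⊗ g) ⊗ (v ⊗ g′)) refl
    reduced : ∀ f → ↥ (z + w) ℤ.* f ≡ ↥ z ℤ.* ↧ w ℤ.+ ↥ w ℤ.* ↧ z → ↧ (z + w) ℤ.* f ≡ ↧ z ℤ.* ↧ w →
      Frac (z + w) ((↥ z ℤ.* g) ℤ.* (↧ w ℤ.* g′) ℤ.+ (↥ w ℤ.* g′) ℤ.* (↧ z ℤ.* g)) ((↧ z ℤ.* g) ℤ.* (↧ w ℤ.* g′))
    reduced f hn hd = frac (f ℤ.* (g ℤ.* g′))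
      (trans (sym (ℤ.*-assoc (↥ (z + w)) f _)) (trans (cong (ℤ._* (g ℤ.* g′)) hn) (lemma (↥ z) (↧ w) (↥ w) (↧ z) g g′)))
      (trans (sym (ℤ.*-assoc (↧ (z + w)) f _)) (trans (cong (ℤ._* (g ℤ.* g′)) hd) (lemma′ (↧ z) (↧ w) g g′)))
      (*-≢0ℤ n≢0 n′≢0)

  private
    factor≢0 : ∀ {z m n} (f : Frac z m n) → factor f ≢ + 0
    factor≢0 {z} (frac _ _ d n≢0) refl = n≢0 (trans (sym d) (ℤ.*-zeroʳ (↧ z)))

    cancelℤ : ∀ {c a b} → c ≢ + 0 → a ℤ.* c ≡ b ℤ.* c → a ≡ b
    cancelℤ {c} {a} {b} c≢0 h = ℤ.*-cancelʳ-≡ a b c {{ℤ.≢-nonZero c≢0}} h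

  frac-unique : ∀ {z w m n m′ n′} → Frac z m n → Frac w m′ n′ → m ℤ.* n′ ≡ m′ ℤ.* n → z ≡ w
  frac-unique {z} {w} F@(frac g refl refl _) F′@(frac g′ refl refl _) h = ≃⇒≡ (Data.Rational.*≡*
    (cancelℤ (*-≢0ℤ (factor≢0 F) (factor≢0 F′)) (trans (lemma (↥ z) (↧ w) g g′) (trans h (lemma′ (↥ w) (↧ z) g g′)))))
    where
    import Data.Rational
    lemma : ∀ a b g h → a ℤ.* b ℤ.* (g ℤ.* h) ≡ (a ℤ.* g) ℤ.* (b ℤ.* h)
    lemma = ℤ-identity 4 (λ a b g h → a ⊗ b ⊗ (g ⊗ h) ⊜ (a ⊗ g) ⊗ (b ⊗ h)) refl
    lemma′ : ∀ a b g h → (a ℤ.* h) ℤ.* (b ℤ.* g) ≡ a ℤ.* b ℤ.* (g ℤ.* h)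
    lemma′ = ℤ-identity 4 (λ a b g h → (a ⊗ h) ⊗ (b ⊗ g) ⊜ a ⊗ b ⊗ (g ⊗ h)) refl

  frac-injective : ∀ {z m n m′ n′} → Frac z m n → Frac z m′ n′ → m ℤ.* n′ ≡ m′ ℤ.* n
  frac-injective {z} (frac g refl refl _) (frac g′ refl refl _) = lemma (↥ z) (↧ z) g g′
    where
    lemma : ∀ a b g h → (a ℤ.* g) ℤ.* (b ℤ.* h) ≡ (a ℤ.* h) ℤ.* (b ℤ.* g)
    lemma = ℤ-identity 4 (λ a b g h → (a ⊗ g) ⊗ (b ⊗ h) ⊜ (a ⊗ h) ⊗ (b ⊗ g)) refl

  q-+ : ∀ m n → q (m ℤ.+ n) ≡ q m + q n
  q-+ m n = frac-unique (frac-q (m ℤ.+ n)) (frac-+ (frac-q m) (frac-q n)) (lemma m n)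
    where
    lemma : ∀ m n → (m ℤ.+ n) ℤ.* (+ 1 ℤ.* + 1) ≡ (m ℤ.* + 1 ℤ.+ n ℤ.* + 1) ℤ.* + 1
    lemma = ℤ-identity 2 (λ m n → (m ⊕ n) ⊗ (Κ (+ 1) ⊗ Κ (+ 1)) ⊜ (m ⊗ Κ (+ 1) ⊕ n ⊗ Κ (+ 1)) ⊗ Κ (+ 1)) refl

  q-* : ∀ m n → q (m ℤ.* n) ≡ q m * q n
  q-* m n = frac-unique (frac-q (m ℤ.* n)) (frac-* (frac-q m) (frac-q n)) refl

  q-neg : ∀ m → q (ℤ.- m) ≡ - q m
  q-neg m = byLinComb (1ℚ · trans (sym (q-+ (ℤ.- m) m)) (cong q (ℤ.+-inverseˡ m))) (lemma (q (ℤ.- m)) (q m))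
    where
    lemma : ∀ x y → x - (- y) ≡ 1ℚ * (x + y - 0ℚ)
    lemma = ℚ-identity 2 (λ x y → x ⊖ (⊝ y) ⊜ Κ 1ℚ ⊗ (x ⊕ y ⊖ Κ 0ℚ)) refl

  q-injective : ∀ {m n} → q m ≡ q n → m ≡ n
  q-injective {m} {n} h = trans (sym (ℤ.*-identityʳ m)) (trans
    (frac-injective (subst (λ z → Frac z m (+ 1)) h (frac-q m)) (frac-q n)) (ℤ.*-identityʳ n))

  q-↥ : ∀ z → z * q (↧ z) ≡ q (↥ z)
  q-↥ z = frac-unique (frac-* (frac-self z) (frac-q (↧ z))) (frac-q (↥ z)) (lemma (↥ z) (↧ z))
    where
    lemma : ∀ a b → a ℤ.* b ℤ.* + 1 ≡ a ℤ.* (b ℤ.* + 1)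
    lemma = ℤ-identity 2 (λ a b → a ⊗ b ⊗ Κ (+ 1) ⊜ a ⊗ (b ⊗ Κ (+ 1))) refl

  H : ℚ → ℕ
  H z = ∣ ↥ z ∣ ⊔ ↧ₙ z

  1≤H : ∀ z → 1 ℕ.≤ H z
  1≤H (mkℚ _ _ _) = ℕ.≤-trans (ℕ.s≤s ℕ.z≤n) (ℕ.m≤n⊔m _ _)

  H-frac : ∀ {z m n} → Frac z m n → H z ℕ.≤ ∣ m ∣ ⊔ ∣ n ∣
  H-frac {z} F@(frac g refl refl _) = ℕ.⊔-mono-≤ (grow (↥ z)) (grow (↧ z))
    where
    1≤∣g∣ : 1 ℕ.≤ ∣ g ∣
    1≤∣g∣ = ℕ.n≢0⇒n>0 (λ e → factor≢0 F (ℤ.∣i∣≡0⇒i≡0 e))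
    grow : ∀ a → ∣ a ∣ ℕ.≤ ∣ a ℤ.* g ∣
    grow a = ℕ.≤-trans (ℕ.≤-reflexive (sym (ℕ.*-identityʳ ∣ a ∣))) (ℕ.≤-trans (ℕ.*-monoʳ-≤ ∣ a ∣ 1≤∣g∣)
      (ℕ.≤-reflexive (sym (ℤ.abs-* a g))))

  ∣↥∣≤H : ∀ z → ∣ ↥ z ∣ ℕ.≤ H z
  ∣↥∣≤H z = ℕ.m≤m⊔n _ _

  ↧≤H : ∀ z → ↧ₙ z ℕ.≤ H z
  ↧≤H z = ℕ.m≤n⊔m _ _

  H-q : ∀ m → H (q m) ℕ.≤ ∣ m ∣ ⊔ 1
  H-q m = H-frac (frac-q m)

  H-* : ∀ z w → H (z * w) ℕ.≤ H z ℕ.* H w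
  H-* z w = ℕ.≤-trans (H-frac (frac-* (frac-self z) (frac-self w))) (ℕ.⊔-lub
    (ℕ.≤-trans (ℕ.≤-reflexive (ℤ.abs-* (↥ z) (↥ w))) (ℕ.*-mono-≤ (∣↥∣≤H z) (∣↥∣≤H w)))
    (ℕ.≤-trans (ℕ.≤-reflexive (ℤ.abs-* (↧ z) (↧ w))) (ℕ.*-mono-≤ (↧≤H z) (↧≤H w))))

  H-+ : ∀ z w → H (z + w) ℕ.≤ 2 ℕ.* (H z ℕ.* H w)
  H-+ z w = ℕ.≤-trans (H-frac (frac-+ (frac-self z) (frac-self w))) (ℕ.⊔-lub
    (ℕ.≤-trans (ℤ.∣i+j∣≤∣i∣+∣j∣ (↥ z ℤ.* ↧ w) (↥ w ℤ.* ↧ z)) (ℕ.+-mono-≤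
      (ℕ.≤-trans (ℕ.≤-reflexive (ℤ.abs-* (↥ z) (↧ w))) (ℕ.*-mono-≤ (∣↥∣≤H z) (↧≤H w)))
      (ℕ.≤-trans (ℕ.≤-reflexive (ℤ.abs-* (↥ w) (↧ z))) (ℕ.≤-trans (ℕ.≤-reflexive (ℕ.*-comm ∣ ↥ w ∣ (↧ₙ z)))
        (ℕ.≤-trans (ℕ.*-mono-≤ (↧≤H z) (∣↥∣≤H w)) (ℕ.m≤m+n _ 0))))))
    (ℕ.≤-trans (ℕ.≤-reflexive (ℤ.abs-* (↧ z) (↧ w))) (ℕ.≤-trans (ℕ.*-mono-≤ (↧≤H z) (↧≤H w)) (ℕ.m≤m+n _ _))))

  H-neg : ∀ z → H (- z) ≡ H z
  H-neg (mkℚ (+ zero) _ _) = refl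
  H-neg (mkℚ (+ suc _) _ _) = refl
  H-neg (mkℚ (ℤ.-[1+ _ ]) _ _) = refl

  H-1/ : ∀ z .{{_ : NonZero z}} → H (1/ z) ≡ H z
  H-1/ (mkℚ (+ suc n) d _) = ℕ.⊔-comm (suc d) (suc n)
  H-1/ (mkℚ (ℤ.-[1+ n ]) d _) = ℕ.⊔-comm (suc d) (suc n)

  H-quotient : ∀ {x y z} → x ≢ 0ℚ → x * y ≡ z → H y ℕ.≤ H z ℕ.* H x
  H-quotient {x} {y} {z} x≢0 h = subst (λ n → H y ℕ.≤ H z ℕ.* n) (H-1/ x)
    (ℕ.≤-trans (ℕ.≤-reflexive (cong H y≡)) (H-* z (1/ x)))
    where
    instance nz : NonZero x
             nz = ≢-nonZero x≢0
    y≡ : y ≡ z * 1/ x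
    y≡ = *-cancelˡ-≢0 x≢0 (trans h (sym (trans (lemma x z (1/ x)) (trans (cong (z *_) (*-inverseʳ x)) (*-identityʳ z)))))
      where
      lemma : ∀ x z i → x * (z * i) ≡ z * (x * i)
      lemma = ℚ-identity 3 (λ x z i → x ⊗ (z ⊗ i) ⊜ z ⊗ (x ⊗ i)) refl

  coprime-↥-↧ : ∀ z → Coprime ∣ ↥ z ∣ (↧ₙ z)
  coprime-↥-↧ (mkℚ n d c) = Coprimality.recompute c

  coprime-* : ∀ {m n o} → Coprime m n → Coprime m o → Coprime m (n ℕ.* o)
  coprime-* {m} {n} {o} cn co {i} (i∣m , i∣no) = co (i∣m , coprime-divisor
    (λ {j} (j∣i , j∣n) → cn (ℕ.∣-trans j∣i i∣m , j∣n)) i∣no)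

  coprime-^ʳ : ∀ {m n} k → Coprime m n → Coprime m (n ℕ.^ k)
  coprime-^ʳ zero c (_ , i∣1) = ℕ.∣1⇒≡1 i∣1
  coprime-^ʳ (suc k) c = coprime-* c (coprime-^ʳ k c)

  coprime-^ : ∀ {m n} k → Coprime m n → Coprime (m ℕ.^ k) (n ℕ.^ k)
  coprime-^ k c = Coprimality.sym (coprime-^ʳ k (Coprimality.sym (coprime-^ʳ k c)))

  H-coprime : ∀ {z m n} → Frac z m n → Coprime ∣ m ∣ ∣ n ∣ → ∣ m ∣ ⊔ ∣ n ∣ ℕ.≤ H z
  H-coprime {z} (frac g refl refl _) c = ℕ.⊔-mono-≤ (shrink (↥ z)) (shrink (↧ z))
    where
    ∣g∣≡1 : ∣ g ∣ ≡ 1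
    ∣g∣≡1 = c (ℕ.divides ∣ ↥ z ∣ (ℤ.abs-* (↥ z) g) , ℕ.divides ∣ ↧ z ∣ (ℤ.abs-* (↧ z) g))
    shrink : ∀ a → ∣ a ℤ.* g ∣ ℕ.≤ ∣ a ∣
    shrink a = ℕ.≤-reflexive (trans (ℤ.abs-* a g) (trans (cong (∣ a ∣ ℕ.*_) ∣g∣≡1) (ℕ.*-identityʳ ∣ a ∣)))

  infixr 8 _^^_
  _^^_ : ℚ → ℕ → ℚ
  x ^^ zero  = 1ℚ
  x ^^ suc n = x * x ^^ n

  frac-^^ : ∀ {z m n} k → Frac z m n → Frac (z ^^ k) (m ℤ.^ k) (n ℤ.^ k)
  frac-^^ zero f = frac-q (+ 1)
  frac-^^ (suc k) f = frac-* f (frac-^^ k f)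

  abs-^ : ∀ m k → ∣ m ℤ.^ k ∣ ≡ ∣ m ∣ ℕ.^ k
  abs-^ m zero = refl
  abs-^ m (suc k) = trans (ℤ.abs-* m (m ℤ.^ k)) (cong (∣ m ∣ ℕ.*_) (abs-^ m k))

  -- A power of a reduced fraction is reduced, so nothing cancels and the height is exactly
  -- multiplicative on powers.
  H-^^ : ∀ z k → H z ℕ.^ k ≡ H (z ^^ k)
  H-^^ z k = ℕ.≤-antisym lower (ℕ.≤-trans (H-frac (frac-^^ k (frac-self z))) (ℕ.⊔-lub
    (ℕ.≤-trans (ℕ.≤-reflexive (abs-^ (↥ z) k)) (ℕ.^-monoˡ-≤ k (∣↥∣≤H z)))
    (ℕ.≤-trans (ℕ.≤-reflexive (abs-^ (↧ z) k)) (ℕ.^-monoˡ-≤ k (↧≤H z)))))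
    where
    terms : ∣ ↥ z ℤ.^ k ∣ ⊔ ∣ ↧ z ℤ.^ k ∣ ℕ.≤ H (z ^^ k)
    terms = H-coprime (frac-^^ k (frac-self z))
      (subst₂ Coprime (sym (abs-^ (↥ z) k)) (sym (abs-^ (↧ z) k)) (coprime-^ k (coprime-↥-↧ z)))
    lower : H z ℕ.^ k ℕ.≤ H (z ^^ k)
    lower with ℕ.≤-total ∣ ↥ z ∣ (↧ₙ z)
    ... | inj₁ h = ℕ.≤-trans (ℕ.≤-reflexive (trans (cong (ℕ._^ k) (ℕ.m≤n⇒m⊔n≡n h)) (sym (abs-^ (↧ z) k))))
        (ℕ.≤-trans (ℕ.m≤n⊔m _ _) terms)
    ... | inj₂ h = ℕ.≤-trans (ℕ.≤-reflexive (trans (cong (ℕ._^ k) (ℕ.m≥n⇒m⊔n≡m h)) (sym (abs-^ (↥ z) k))))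
        (ℕ.≤-trans (ℕ.m≤m⊔n _ _) terms)

  H≤H^^ : ∀ z k → H z ℕ.≤ H (z ^^ suc k)
  H≤H^^ z k = ℕ.≤-trans (ℕ.≤-reflexive (sym (ℕ.*-identityʳ (H z)))) (ℕ.≤-trans
    (ℕ.^-monoʳ-≤ (H z) {{ℕ.>-nonZero (1≤H z)}} (ℕ.s≤s (ℕ.z≤n {k}))) (ℕ.≤-reflexive (H-^^ z (suc k))))

  ^^-* : ∀ x y k → (x * y) ^^ k ≡ x ^^ k * y ^^ k
  ^^-* x y zero = refl
  ^^-* x y (suc k) = trans (cong ((x * y) *_) (^^-* x y k)) (lemma x y (x ^^ k) (y ^^ k))
    where
    lemma : ∀ x y u v → x * y * (u * v) ≡ x * u * (y * v)
    lemma = ℚ-identity 4 (λ x y u v → x ⊗ y ⊗ (u ⊗ v) ⊜ x ⊗ u ⊗ (y ⊗ v)) refl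

  ^^-+ : ∀ x j k → x ^^ (j ℕ.+ k) ≡ x ^^ j * x ^^ k
  ^^-+ x zero k = sym (*-identityˡ _)
  ^^-+ x (suc j) k = trans (cong (x *_) (^^-+ x j k)) (sym (*-assoc x _ _))

  ^^-^^ : ∀ x j k → (x ^^ j) ^^ k ≡ x ^^ (j ℕ.* k)
  ^^-^^ x j zero = cong (x ^^_) (sym (ℕ.*-zeroʳ j))
  ^^-^^ x j (suc k) = trans (cong (x ^^ j *_) (^^-^^ x j k)) (trans (sym (^^-+ x j (j ℕ.* k)))
    (cong (x ^^_) (sym (ℕ.*-suc j k))))

  ^^-≢0 : ∀ {x} k → x ≢ 0ℚ → x ^^ k ≢ 0ℚ
  ^^-≢0 zero x≢0 ()
  ^^-≢0 (suc k) x≢0 = *-≢0 x≢0 (^^-≢0 k x≢0)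

  -- Carries an integer expression along with a rational one. Identities are proved over ℚ, where
  -- division is available, and `int-equal` reads them over ℤ, where divisibility makes sense.
  record Int (z : ℚ) (m : ℤ) : Set where
    constructor int
    field
      int≡ : z ≡ q m
  open Int public

  int-* : ∀ {z w m n} → Int z m → Int w n → Int (z * w) (m ℤ.* n)
  int-* {m = m} {n} (int hz) (int hw) = int (trans (cong₂ _*_ hz hw) (sym (q-* m n)))

  int-+ : ∀ {z w m n} → Int z m → Int w n → Int (z + w) (m ℤ.+ n)
  int-+ {m = m} {n} (int hz) (int hw) = int (trans (cong₂ _+_ hz hw) (sym (q-+ m n)))

  int-neg : ∀ {z m} → Int z m → Int (- z) (ℤ.- m)
  int-neg {m = m} (int hz) = int (trans (cong -_ hz) (sym (q-neg m)))

  int-q : ∀ m → Int (q m) m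
  int-q m = int refl

  int-clear : ∀ z → Int (z * q (↧ z)) (↥ z)
  int-clear z = int (q-↥ z)

  int-equal : ∀ {z w m n} → Int z m → Int w n → z ≡ w → m ≡ n
  int-equal (int hz) (int hw) h = q-injective (trans (sym hz) (trans h hw))

  ∣-sum≡0 : ∀ {t n k} → t ℤ.+ n ℤ.* k ≡ + 0 → ∣ n ∣ ℕ.∣ ∣ t ∣
  ∣-sum≡0 {t} {n} {k} h = ℕ.divides ∣ k ∣ (trans (cong ∣_∣ t≡) (trans (ℤ.∣-i∣≡∣i∣ (n ℤ.* k))
    (trans (ℤ.abs-* n k) (ℕ.*-comm ∣ n ∣ ∣ k ∣))))
    where
    t≡ : t ≡ ℤ.- (n ℤ.* k)
    t≡ = trans (sym (ℤ.+-identityʳ t)) (trans (cong (λ s → t ℤ.+ s) (sym (ℤ.+-inverseʳ (n ℤ.* k))))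
      (trans (sym (ℤ.+-assoc t _ _)) (trans (cong (ℤ._+ ℤ.- (n ℤ.* k)) h) (ℤ.+-identityˡ _))))

  1≤↧ : ∀ z → 1 ℕ.≤ ↧ₙ z
  1≤↧ (mkℚ _ _ _) = ℕ.s≤s ℕ.z≤n

  1≤∣↥∣ : ∀ {z} → z ≢ 0ℚ → 1 ℕ.≤ ∣ ↥ z ∣
  1≤∣↥∣ {z} z≢0 = ℕ.n≢0⇒n>0 (λ e → z≢0 (↥p≡0⇒p≡0 z (ℤ.∣i∣≡0⇒i≡0 e)))

-- Twist-invariant heights of quantities with a weight

module WeightedHeight where

  open import Defs using (q)
  open RationalAlgebra
  open RationalHeight
  open import Data.Nat as ℕ using (ℕ; suc; _⊔_; _≤_; z≤n; s≤s)
  import Data.Nat.Properties as ℕ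
  open import Data.Integer as ℤ using (+_; ∣_∣)
  open import Data.Rational using (ℚ; 0ℚ; 1ℚ; _+_; _*_; _-_; -_; 1/_; ≢-nonZero; NonZero)
  open import Data.Rational.Properties hiding (≤-trans; ≤-reflexive)
  open import Relation.Nullary using (yes; no; contradiction)
  open import Relation.Binary.PropositionalEquality

  -- Opaque, so that exponents are never evaluated.
  opaque
    prodExp sumExp : ℕ → ℕ → ℕ
    prodExp K L = K ℕ.+ L
    sumExp K L = (1 ℕ.+ (0 ℕ.+ (K ℕ.+ L))) ℕ.* 12 ℕ.+ L

    powExp : ℕ → ℕ
    powExp K = K ℕ.* 12

    maxExp : ℕ → ℕ → ℕ
    maxExp = _⊔_

    plusExp : ℕ → ℕ → ℕ
    plusExp K L = 1 ℕ.+ (K ℕ.+ L)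

  -- For a quantity z of weight k (the coordinates x, y have weights 2, 3 and D weight 12), the rational
  -- number z¹² / Dᵏ is unchanged by twisting the curve; Weight k z K bounds its height by Qᴷ.
  module Weights (D : ℚ) (D≢0 : D ≢ 0ℚ) (Q : ℕ) (2≤Q : 2 ≤ Q) where

    private
      instance nz : NonZero D
               nz = ≢-nonZero D≢0

    D⁻¹ : ℚ
    D⁻¹ = 1/ D

    1≤Q : 1 ≤ Q
    1≤Q = ℕ.≤-trans (s≤s z≤n) 2≤Q

    D⁻¹≢0 : D⁻¹ ≢ 0ℚ
    D⁻¹≢0 e = contradiction (trans (sym (*-inverseʳ D)) (trans (cong (D *_) e) (*-zeroʳ D))) λ ()

    normal : ℕ → ℚ → ℚ
    normal k z = z ^^ 12 * D⁻¹ ^^ k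

    record Weight (k : ℕ) (z : ℚ) (K : ℕ) : Set where
      constructor weight
      field
        bound : H (normal k z) ≤ Q ℕ.^ K
    open Weight public

    Q^-mono : ∀ {K L} → K ≤ L → Q ℕ.^ K ≤ Q ℕ.^ L
    Q^-mono = ℕ.^-monoʳ-≤ Q {{ℕ.>-nonZero 1≤Q}}

    weaken : ∀ {k z K L} → K ≤ L → Weight k z K → Weight k z L
    weaken h w = weight (ℕ.≤-trans (bound w) (Q^-mono h))

    H-*-bound : ∀ {x y K L} → H x ≤ Q ℕ.^ K → H y ≤ Q ℕ.^ L → H (x * y) ≤ Q ℕ.^ (K ℕ.+ L)
    H-*-bound {x} {y} {K} {L} hx hy = ℕ.≤-trans (H-* x y)
      (ℕ.≤-trans (ℕ.*-mono-≤ hx hy) (ℕ.≤-reflexive (sym (ℕ.^-distribˡ-+-* Q K L))))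

    H-+-bound : ∀ {x y K L} → H x ≤ Q ℕ.^ K → H y ≤ Q ℕ.^ L → H (x + y) ≤ Q ℕ.^ (1 ℕ.+ (K ℕ.+ L))
    H-+-bound {x} {y} {K} {L} hx hy = ℕ.≤-trans (H-+ x y) (ℕ.*-mono-≤ 2≤Q
      (ℕ.≤-trans (ℕ.*-mono-≤ hx hy) (ℕ.≤-reflexive (sym (ℕ.^-distribˡ-+-* Q K L)))))

    H-quotient-bound : ∀ {x y z K L} → x ≢ 0ℚ → x * y ≡ z → H x ≤ Q ℕ.^ K → H z ≤ Q ℕ.^ L → H y ≤ Q ℕ.^ (L ℕ.+ K)
    H-quotient-bound {K = K} {L} x≢0 h hx hz = ℕ.≤-trans (H-quotient x≢0 h)
      (ℕ.≤-trans (ℕ.*-mono-≤ hz hx) (ℕ.≤-reflexive (sym (ℕ.^-distribˡ-+-* Q L K))))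

    H-^^-bound : ∀ {x K} n → H x ≤ Q ℕ.^ K → H (x ^^ n) ≤ Q ℕ.^ (K ℕ.* n)
    H-^^-bound {x} {K} n hx = ℕ.≤-trans (ℕ.≤-reflexive (sym (H-^^ x n)))
      (ℕ.≤-trans (ℕ.^-monoˡ-≤ n hx) (ℕ.≤-reflexive (ℕ.^-*-assoc Q K n)))

    normal-* : ∀ k l z y → normal (k ℕ.+ l) (z * y) ≡ normal k z * normal l y
    normal-* k l z y = trans (cong₂ _*_ (^^-* z y 12) (^^-+ D⁻¹ k l)) (lemma (z ^^ 12) (y ^^ 12) (D⁻¹ ^^ k) (D⁻¹ ^^ l))
      where
      lemma : ∀ a b c d → a * b * (c * d) ≡ a * c * (b * d)
      lemma = ℚ-identity 4 (λ a b c d → a ⊗ b ⊗ (c ⊗ d) ⊜ a ⊗ c ⊗ (b ⊗ d)) refl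

    normal-^^ : ∀ k z n → normal (k ℕ.* n) (z ^^ n) ≡ normal k z ^^ n
    normal-^^ k z n = trans (cong₂ _*_ (trans (^^-^^ z n 12) (trans (cong (z ^^_) (ℕ.*-comm n 12)) (sym (^^-^^ z 12 n))))
      (sym (^^-^^ D⁻¹ k n))) (sym (^^-* (z ^^ 12) (D⁻¹ ^^ k) n))

    normal≢0 : ∀ k {z} → z ≢ 0ℚ → normal k z ≢ 0ℚ
    normal≢0 k z≢0 = *-≢0 (^^-≢0 12 z≢0) (^^-≢0 k D⁻¹≢0)

    opaque
      unfolding prodExp sumExp powExp

      weight-* : ∀ {k l z y K L} → Weight k z K → Weight l y L → Weight (k ℕ.+ l) (z * y) (prodExp K L)
      weight-* {k} {l} {z} {y} {K} {L} u v = weight (subst (λ x → H x ≤ Q ℕ.^ (K ℕ.+ L)) (sym (normal-* k l z y))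
        (H-*-bound {normal k z} {normal l y} {K} {L} (bound u) (bound v)))

      weight-quotient : ∀ {k l y t z K L} → y ≢ 0ℚ → y * t ≡ z → Weight k y K → Weight (k ℕ.+ l) z L → Weight l t (prodExp L K)
      weight-quotient {k} {l} {y} {t} {z} {K} {L} y≢0 h u v = weight (H-quotient-bound {normal k y} {normal l t} {normal (k ℕ.+ l) z}
        {K} {L} (normal≢0 k y≢0) (trans (sym (normal-* k l y t)) (cong (normal (k ℕ.+ l)) h)) (bound u) (bound v))

    -- Normalisation commutes with powers, and the height of a power dominates that of its base. In
    -- this way `A³`, `B²` and `3Y²` control `A`, `B` and `Y`.
    weight-root : ∀ {k z K} n → Weight (k ℕ.* suc n) (z ^^ suc n) K → Weight k z K
    weight-root {k} {z} {K} n u = weight (ℕ.≤-trans (H≤H^^ (normal k z) n)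
      (subst (λ x → H x ≤ Q ℕ.^ K) (normal-^^ k z (suc n)) (bound u)))

    opaque
      unfolding prodExp sumExp powExp

      weight⁰ : ∀ {z K} → H z ≤ Q ℕ.^ K → Weight 0 z (powExp K)
      weight⁰ {z} {K} h = weight (subst (λ x → H x ≤ Q ℕ.^ (K ℕ.* 12)) (sym (*-identityʳ (z ^^ 12))) (H-^^-bound {z} {K} 12 h))

    height⁰ : ∀ {z K} → Weight 0 z K → H z ≤ Q ℕ.^ K
    height⁰ {z} {K} w = ℕ.≤-trans (H≤H^^ z 11) (subst (λ x → H x ≤ Q ℕ.^ K) (*-identityʳ (z ^^ 12)) (bound w))

    weight-q : ∀ m → ∣ m ∣ ≤ Q → Weight 0 (q m) (powExp 1)
    weight-q m h = weight⁰ {q m} {1} (ℕ.≤-trans (H-q m) (ℕ.≤-trans (ℕ.⊔-lub h 1≤Q) (ℕ.≤-reflexive (sym (ℕ.*-identityʳ Q)))))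

    weight-neg : ∀ {k z K} → Weight k z K → Weight k (- z) K
    weight-neg {k} {z} {K} w = weight (subst (λ x → H (x * D⁻¹ ^^ k) ≤ Q ℕ.^ K) (sym (trans (cong (_^^ 12) (lemma z))
        (trans (^^-* (- 1ℚ) z 12) (*-identityˡ (z ^^ 12))))) (bound w))
      where
      lemma : ∀ z → - z ≡ - 1ℚ * z
      lemma = ℚ-identity 1 (λ z → ⊝ z ⊜ ⊝ Κ 1ℚ ⊗ z) refl

    opaque
      unfolding prodExp sumExp powExp

      -- Twelfth powers are not additive. Factoring `z + y = (1 + z / y) y` moves the addition to
      -- the ratio, which has weight 0 and is an honest rational number independent of twists.
      weight-+ : ∀ {k z y K L} → Weight k z K → Weight k y L → Weight k (z + y) (sumExp K L)
      weight-+ {k} {z} {y} {K} {L} u v with y ≟ 0ℚ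
      ... | yes refl = subst (λ x → Weight k x ((1 ℕ.+ (0 ℕ.+ (K ℕ.+ L))) ℕ.* 12 ℕ.+ L)) (sym (+-identityʳ z)) (weaken K≤ u)
        where
        K≤ : K ≤ (1 ℕ.+ (0 ℕ.+ (K ℕ.+ L))) ℕ.* 12 ℕ.+ L
        K≤ = ℕ.≤-trans (ℕ.≤-trans (ℕ.m≤m+n K L) (ℕ.n≤1+n (K ℕ.+ L))) (ℕ.≤-trans (ℕ.m≤m*n (1 ℕ.+ (0 ℕ.+ (K ℕ.+ L))) 12) (ℕ.m≤m+n _ L))
      ... | no y≢0 = subst (λ x → Weight k x ((1 ℕ.+ (0 ℕ.+ (K ℕ.+ L))) ℕ.* 12 ℕ.+ L)) (lemma y z (1/ y) (*-inverseʳ y))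
          (weight-* {0} {k} {1ℚ + z * 1/ y} {y}
            (weight⁰ {1ℚ + z * 1/ y} {1 ℕ.+ (0 ℕ.+ (K ℕ.+ L))} (H-+-bound {1ℚ} {z * 1/ y} {0} {K ℕ.+ L} ℕ.≤-refl (height⁰ {z * 1/ y} ratio))) v)
        where
        instance nzy : NonZero y
                 nzy = ≢-nonZero y≢0
        lemma : ∀ y z i → y * i ≡ 1ℚ → (1ℚ + z * i) * y ≡ z + y
        lemma y z i h = byLinComb (z · h) (lemma′ y z i)
          where
          lemma′ : ∀ y z i → (1ℚ + z * i) * y - (z + y) ≡ z * (y * i - 1ℚ)
          lemma′ = ℚ-identity 3 (λ y z i → (Κ 1ℚ ⊕ z ⊗ i) ⊗ y ⊖ (z ⊕ y) ⊜ z ⊗ (y ⊗ i ⊖ Κ 1ℚ)) refl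
        ratio : Weight 0 (z * 1/ y) (K ℕ.+ L)
        ratio = weight-quotient {k} {0} {y} {z * 1/ y} {z} y≢0 (lemma″ y z (1/ y) (*-inverseʳ y)) v
          (subst (λ l → Weight l z K) (sym (ℕ.+-identityʳ k)) u)
          where
          lemma″ : ∀ y z i → y * i ≡ 1ℚ → y * (z * i) ≡ z
          lemma″ y z i h = byLinComb (z · h) (lemma′ y z i)
            where
            lemma′ : ∀ y z i → y * (z * i) - z ≡ z * (y * i - 1ℚ)
            lemma′ = ℚ-identity 3 (λ y z i → y ⊗ (z ⊗ i) ⊖ z ⊜ z ⊗ (y ⊗ i ⊖ Κ 1ℚ)) refl

    weight-- : ∀ {k z y K L} → Weight k z K → Weight k y L → Weight k (z - y) (sumExp K L)
    weight-- u v = weight-+ u (weight-neg v)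

    normal-D : ∀ {z} → (κ : ℚ) → z ≡ κ * D → normal 12 z ≡ κ ^^ 12
    normal-D κ refl = trans (cong (_* D⁻¹ ^^ 12) (^^-* κ D 12)) (trans (*-assoc (κ ^^ 12) (D ^^ 12) (D⁻¹ ^^ 12))
      (trans (cong (κ ^^ 12 *_) (trans (sym (^^-* D D⁻¹ 12)) (trans (cong (_^^ 12) (*-inverseʳ D)) refl))) (*-identityʳ (κ ^^ 12))))

    opaque
      unfolding prodExp sumExp powExp

      weight-D : ∀ {z K} κ → z ≡ κ * D → H κ ≤ Q ℕ.^ K → Weight 12 z (powExp K)
      weight-D {z} {K} κ h hκ = weight (subst (λ x → H x ≤ Q ℕ.^ (K ℕ.* 12)) (sym (normal-D κ h)) (H-^^-bound {κ} {K} 12 hκ))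

    opaque
      unfolding prodExp

      weight-product-bound : ∀ {x y z J K} → H z ≤ H x ℕ.* H y → Weight 0 x J → Weight 0 y K → Weight 0 z (powExp (prodExp J K))
      weight-product-bound {x} {y} {z} {J} {K} h wx wy = weight⁰ {z} {J ℕ.+ K} (ℕ.≤-trans h (ℕ.≤-trans (ℕ.*-mono-≤ (height⁰ wx) (height⁰ wy))
        (ℕ.≤-reflexive (sym (ℕ.^-distribˡ-+-* Q J K)))))

    opaque
      unfolding maxExp

      weaken-maxˡ : ∀ {k z K L} → Weight k z K → Weight k z (maxExp K L)
      weaken-maxˡ {K = K} {L} = weaken (ℕ.m≤m⊔n K L)

      weaken-maxʳ : ∀ {k z K L} → Weight k z L → Weight k z (maxExp K L)
      weaken-maxʳ {K = K} {L} = weaken (ℕ.m≤n⊔m K L)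

    record NatBound (n K : ℕ) : Set where
      constructor natBound
      field
        n≤ : n ≤ Q ℕ.^ K
    open NatBound public

    opaque
      unfolding prodExp plusExp powExp

      bound-* : ∀ {m n K L} → NatBound m K → NatBound n L → NatBound (m ℕ.* n) (prodExp K L)
      bound-* {K = K} {L} (natBound hm) (natBound hn) = natBound (ℕ.≤-trans (ℕ.*-mono-≤ hm hn) (ℕ.≤-reflexive (sym (ℕ.^-distribˡ-+-* Q K L))))

      bound-+ : ∀ {m n K L} → NatBound m K → NatBound n L → NatBound (m ℕ.+ n) (plusExp K L)
      bound-+ {m} {n} {K} {L} (natBound hm) (natBound hn) = natBound (begin
        m ℕ.+ n                            ≤⟨ ℕ.+-mono-≤ (ℕ.≤-trans hm (Q^-mono (ℕ.m≤m+n K L))) (ℕ.≤-trans hn (Q^-mono (ℕ.m≤n+m L K))) ⟩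
        Q ℕ.^ (K ℕ.+ L) ℕ.+ Q ℕ.^ (K ℕ.+ L) ≡⟨ cong (Q ℕ.^ (K ℕ.+ L) ℕ.+_) (sym (ℕ.+-identityʳ _)) ⟩
        2 ℕ.* Q ℕ.^ (K ℕ.+ L)              ≤⟨ ℕ.*-monoˡ-≤ (Q ℕ.^ (K ℕ.+ L)) 2≤Q ⟩
        Q ℕ.^ (1 ℕ.+ (K ℕ.+ L))            ∎)
        where open ℕ.≤-Reasoning

      bound-weight : ∀ {z n K} → H z ≤ n → NatBound n K → Weight 0 z (powExp K)
      bound-weight {z} {n} {K} h (natBound hn) = weight⁰ {z} {K} (ℕ.≤-trans h hn)

    bound-≤ : ∀ {m n K} → m ≤ n → NatBound n K → NatBound m K
    bound-≤ h (natBound hn) = natBound (ℕ.≤-trans h hn)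

    bound-Q : ∀ {n} → n ≤ Q → NatBound n 1
    bound-Q h = natBound (ℕ.≤-trans h (ℕ.≤-reflexive (sym (ℕ.*-identityʳ Q))))

    bound-height : ∀ {z K} → Weight 0 z K → NatBound (H z) K
    bound-height {z} w = natBound (height⁰ {z} w)

-- Rational roots of cubics, and weights on 3Y² = X³ + AX + B

module ShortWeierstrass where

  open import Defs using (q)
  open RationalAlgebra
  open RationalHeight
  open WeightedHeight
  open import Data.Nat as ℕ using (ℕ; _≤_; z≤n; s≤s)
  import Data.Nat.Properties as ℕ
  import Data.Nat.Divisibility as ℕ
  open import Data.Nat.Coprimality as Coprimality using (Coprime; coprime-divisor)
  open import Data.Integer as ℤ using (+_; ∣_∣)
  import Data.Integer.Properties as ℤ
  open import Data.Rational using (ℚ; 0ℚ; 1ℚ; _+_; _*_; _-_; -_; 1/_; ↥_; ↧_; ↧ₙ_; ≢-nonZero; NonZero)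
  open import Data.Rational.Properties hiding (≤-trans; ≤-reflexive)
  open import Data.Sum using (_⊎_; inj₁; inj₂)
  open import Relation.Nullary using (Dec; yes; no; contradiction)
  open import Relation.Binary.PropositionalEquality

  private
    -- With `β = 0` the divisibility `m∣bd` below says nothing about the numerator; but then `x = 0`
    -- or `x² = - α`.
    cubic-root-zero : ∀ {x α β} → x * x * x + α * x + β ≡ 0ℚ → β ≡ 0ℚ → H x ≤ H α ℕ.* H β
    cubic-root-zero {x} {α} {β} h β≡0 = go (x*y≡0⇒x≡0∨y≡0 x factored)
      where
      factored : x * (x * x + α) ≡ 0ℚ
      factored = byLinComb (1ℚ · h ⊹ - 1ℚ · β≡0) (ℚ-identity 3 (λ x α β → x ⊗ (x ⊗ x ⊕ α) ⊖ Κ 0ℚ ⊜ Κ 1ℚ ⊗ (x ⊗ x ⊗ x ⊕ α ⊗ x ⊕ β ⊖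
          Κ 0ℚ) ⊕ ⊝ Κ 1ℚ ⊗ (β ⊖ Κ 0ℚ)) refl x α β)
      go : x ≡ 0ℚ ⊎ x * x + α ≡ 0ℚ → H x ≤ H α ℕ.* H β
      go (inj₁ refl) = ℕ.*-mono-≤ (1≤H α) (1≤H β)
      go (inj₂ e) = ℕ.≤-trans (H≤H^^ x 1) (ℕ.≤-trans (ℕ.≤-reflexive (trans (cong H x²≡) (H-neg α)))
          (ℕ.≤-trans (ℕ.≤-reflexive (sym (ℕ.*-identityʳ (H α)))) (ℕ.*-monoʳ-≤ (H α) (1≤H β))))
        where
        x²≡ : x ^^ 2 ≡ - α
        x²≡ = trans (cong (x *_) (*-identityʳ x)) (byLinComb (1ℚ · e) (ℚ-identity 2 (λ x α → x ⊗ x ⊖ ⊝ α ⊜ Κ 1ℚ ⊗ (x ⊗ x ⊕ α ⊖ Κ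
            0ℚ)) refl x α))

    abs-cube : ∀ m k → ∣ m ℤ.* (m ℤ.* (m ℤ.* k)) ∣ ≡ ∣ m ∣ ℕ.* (∣ m ∣ ℕ.* (∣ m ∣ ℕ.* ∣ k ∣))
    abs-cube m k = trans (ℤ.abs-* m (m ℤ.* (m ℤ.* k))) (cong (∣ m ∣ ℕ.*_)
      (trans (ℤ.abs-* m (m ℤ.* k)) (cong (∣ m ∣ ℕ.*_) (ℤ.abs-* m k))))

    cube : ∀ x → x ^^ 3 ≡ x * x * x
    cube x = lemma x
      where
      lemma : ∀ x → x * (x * (x * 1ℚ)) ≡ x * x * x
      lemma = ℚ-identity 1 (λ x → x ⊗ (x ⊗ (x ⊗ Κ 1ℚ)) ⊜ x ⊗ x ⊗ x) refl

    square : ∀ x → x ^^ 2 ≡ x * x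
    square x = cong (x *_) (*-identityʳ x)

  -- The rational root theorem for the integral polynomial `d e x³ + a e x + b d`: the numerator of
  -- a root divides `b d`, the denominator divides `d e`.
  module CubicRoot (x α β : ℚ) (h : x * x * x + α * x + β ≡ 0ℚ) (β≢0 : β ≢ 0ℚ) where
    m = ↥ x
    n = ↧ x
    a = ↥ α
    d = ↧ α
    b = ↥ β
    e = ↧ β
    d*e>0 : 1 ≤ ↧ₙ α ℕ.* ↧ₙ β
    d*e>0 = ℕ.*-mono-≤ (1≤↧ α) (1≤↧ β)
    b*d>0 : 1 ≤ ∣ b ∣ ℕ.* ↧ₙ α
    b*d>0 = ℕ.*-mono-≤ (1≤∣↥∣ β≢0) (1≤↧ α)
    clear : ∀ x α β N d e → x * x * x + α * x + β ≡ 0ℚ →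
      (x * N) * ((x * N) * ((x * N) * (d * e))) + N * ((α * d) * (e * ((x * N) * N)) + (β * e) * (d * (N * N))) ≡ 0ℚ
    clear x α β N d e h = byLinComb (N * N * N * d * e · h) (ℚ-identity 6 (λ x α β N d e → x ⊗ N ⊗ (x ⊗ N ⊗ (x ⊗ N ⊗ (d ⊗ e))) ⊕ N
        ⊗ (α ⊗ d ⊗ (e ⊗ (x ⊗ N ⊗ N)) ⊕ β ⊗ e ⊗ (d ⊗ (N ⊗ N))) ⊖ Κ 0ℚ ⊜ N ⊗ N ⊗ N ⊗ d ⊗ e ⊗ (x ⊗ x ⊗ x ⊕ α ⊗ x ⊕ β ⊖ Κ 0ℚ)) refl x
        α β N d e)
    cleared : m ℤ.* (m ℤ.* (m ℤ.* (d ℤ.* e))) ℤ.+ n ℤ.* (a ℤ.* (e ℤ.* (m ℤ.* n)) ℤ.+ b ℤ.* (d ℤ.* (n ℤ.* n))) ≡ + 0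
    cleared = int-equal (int-+ (int-* M (int-* M (int-* M (int-* (int-q d) (int-q e)))))
        (int-* (int-q n) (int-+ (int-* (int-clear α) (int-* (int-q e) (int-* M (int-q n))))
          (int-* (int-clear β) (int-* (int-q d) (int-* (int-q n) (int-q n)))))))
      (int-q (+ 0)) (clear x α β (q n) (q d) (q e) h)
      where
      M = int-clear x
    m∣bd : ∣ m ∣ ℕ.∣ ∣ b ∣ ℕ.* ↧ₙ α
    m∣bd = strip (subst (∣ m ∣ ℕ.∣_) abs≡ (∣-sum≡0 {n ℤ.* (n ℤ.* (n ℤ.* (b ℤ.* d)))} {m}
        {m ℤ.* (m ℤ.* (d ℤ.* e)) ℤ.+ n ℤ.* (n ℤ.* (a ℤ.* e))} (trans (rearrange m n a b d e) cleared)))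
      where
      rearrange : ∀ m n a b d e → n ℤ.* (n ℤ.* (n ℤ.* (b ℤ.* d))) ℤ.+ m ℤ.* (m ℤ.* (m ℤ.* (d ℤ.* e)) ℤ.+ n ℤ.* (n ℤ.* (a ℤ.* e))) ≡
        m ℤ.* (m ℤ.* (m ℤ.* (d ℤ.* e))) ℤ.+ n ℤ.* (a ℤ.* (e ℤ.* (m ℤ.* n)) ℤ.+ b ℤ.* (d ℤ.* (n ℤ.* n)))
      rearrange = ℤ-identity 6 (λ m n a b d e → n ⊗ (n ⊗ (n ⊗ (b ⊗ d))) ⊕ m ⊗ (m ⊗ (m ⊗ (d ⊗ e)) ⊕ n ⊗ (n ⊗ (a ⊗ e))) ⊜ m ⊗ (m ⊗
          (m ⊗ (d ⊗ e))) ⊕ n ⊗ (a ⊗ (e ⊗ (m ⊗ n)) ⊕ b ⊗ (d ⊗ (n ⊗ n)))) refl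
      abs≡ : ∣ n ℤ.* (n ℤ.* (n ℤ.* (b ℤ.* d))) ∣ ≡ ↧ₙ x ℕ.* (↧ₙ x ℕ.* (↧ₙ x ℕ.* (∣ b ∣ ℕ.* ↧ₙ α)))
      abs≡ = trans (abs-cube n (b ℤ.* d)) (cong (λ k → ↧ₙ x ℕ.* (↧ₙ x ℕ.* (↧ₙ x ℕ.* k))) (ℤ.abs-* b d))
      strip : ∀ {k} → ∣ m ∣ ℕ.∣ ↧ₙ x ℕ.* (↧ₙ x ℕ.* (↧ₙ x ℕ.* k)) → ∣ m ∣ ℕ.∣ k
      strip h = coprime-divisor (coprime-↥-↧ x) (coprime-divisor (coprime-↥-↧ x) (coprime-divisor (coprime-↥-↧ x) h))
    n∣de : ↧ₙ x ℕ.∣ ↧ₙ α ℕ.* ↧ₙ β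
    n∣de = strip (subst (↧ₙ x ℕ.∣_) abs≡ (∣-sum≡0 {m ℤ.* (m ℤ.* (m ℤ.* (d ℤ.* e)))} {n} cleared))
      where
      abs≡ : ∣ m ℤ.* (m ℤ.* (m ℤ.* (d ℤ.* e))) ∣ ≡ ∣ m ∣ ℕ.* (∣ m ∣ ℕ.* (∣ m ∣ ℕ.* (↧ₙ α ℕ.* ↧ₙ β)))
      abs≡ = trans (abs-cube m (d ℤ.* e)) (cong (λ k → ∣ m ∣ ℕ.* (∣ m ∣ ℕ.* (∣ m ∣ ℕ.* k))) (ℤ.abs-* d e))
      cop : Coprime (↧ₙ x) ∣ m ∣
      cop = Coprimality.sym (coprime-↥-↧ x)
      strip : ∀ {k} → ↧ₙ x ℕ.∣ ∣ m ∣ ℕ.* (∣ m ∣ ℕ.* (∣ m ∣ ℕ.* k)) → ↧ₙ x ℕ.∣ k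
      strip h = coprime-divisor cop (coprime-divisor cop (coprime-divisor cop h))
    bound : H x ≤ H α ℕ.* H β
    bound = ℕ.⊔-lub
      (ℕ.≤-trans (ℕ.∣⇒≤ {{ℕ.>-nonZero b*d>0}} m∣bd) (ℕ.≤-trans (ℕ.*-mono-≤ (∣↥∣≤H β) (↧≤H α)) (ℕ.≤-reflexive (ℕ.*-comm (H β) (H α)))))
      (ℕ.≤-trans (ℕ.∣⇒≤ {{ℕ.>-nonZero d*e>0}} n∣de) (ℕ.*-mono-≤ (↧≤H α) (↧≤H β)))

  cubic-root-height : ∀ {x α β} → x * x * x + α * x + β ≡ 0ℚ → H x ≤ H α ℕ.* H β
  cubic-root-height {x} {α} {β} h = go (β ≟ 0ℚ)
    where
    go : Dec (β ≡ 0ℚ) → H x ≤ H α ℕ.* H β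
    go (yes β≡0) = cubic-root-zero {x} {α} {β} h β≡0
    go (no β≢0)  = CubicRoot.bound x α β h β≢0

  module ShortModel (A B D κ₁ κ₂ : ℚ) (D≢0 : D ≢ 0ℚ) (A³≡ : A * A * A ≡ κ₁ * D) (B²≡ : B * B ≡ κ₂ * D)
    (Q : ℕ) (10≤Q : 10 ≤ Q) (hκ₁ : H κ₁ ≤ Q) (hκ₂ : H κ₂ ≤ Q) where

    open Weights D D≢0 Q (ℕ.≤-trans (s≤s (s≤s z≤n)) 10≤Q)

    height¹ : ∀ {n} → n ≤ Q → n ≤ Q ℕ.^ 1
    height¹ {n} = subst (n ≤_) (sym (ℕ.*-identityʳ Q))

    weight-const : ∀ m {_ : ∣ m ∣ ≤ 10} → Weight 0 (q m) (powExp 1)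
    weight-const m {h} = weight-q m (ℕ.≤-trans h 10≤Q)

    weight-A : Weight 4 A (powExp 1)
    weight-A = weight-root 2 (weight-D {A ^^ 3} {1} κ₁ (trans (cube A) A³≡) (height¹ hκ₁))

    weight-B : Weight 6 B (powExp 1)
    weight-B = weight-root 1 (weight-D {B ^^ 2} {1} κ₂ (trans (square B) B²≡) (height¹ hκ₂))

    OnCurve : ℚ → ℚ → Set
    OnCurve X Y = q (+ 3) * (Y * Y) ≡ X * X * X + A * X + B

    3≢0 : q (+ 3) ≢ 0ℚ
    3≢0 ()

    weight-cubic : ∀ {X K} → Weight 2 X K → Weight 6 (X * X * X + A * X + B) _
    weight-cubic {X} w = weight-+ (weight-+ (weight-* {4} {2} (weight-* {2} {2} w w) w) (weight-* {4} {2} weight-A w)) weight-B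

    weight-Y : ∀ X Y {K} → OnCurve X Y → Weight 2 X K → Weight 3 Y _
    weight-Y X Y h w = weight-root {3} {Y} 1 (weight-quotient {0} {6} {q (+ 3)} {Y ^^ 2} 3≢0
      (trans (cong (q (+ 3) *_) (square Y)) h) (weight-const (+ 3) {s≤s (s≤s (s≤s z≤n))}) (weight-cubic w))

    private
      weight-third : ∀ {X₁ X₂ X₃ l J K L} → X₁ + X₂ + X₃ ≡ q (+ 3) * (l * l) →
        Weight 2 X₁ J → Weight 2 X₂ K → Weight 1 l L → Weight 2 X₃ _
      weight-third {X₁} {X₂} {X₃} {l} h w₁ w₂ wl = subst (λ x → Weight 2 x _) (sym X₃≡)
        (weight-- (weight-- (weight-* {0} {2} (weight-const (+ 3) {s≤s (s≤s (s≤s z≤n))}) (weight-* {1} {1} wl wl)) w₁) w₂)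
        where
        X₃≡ : X₃ ≡ q (+ 3) * (l * l) - X₁ - X₂
        X₃≡ = byLinComb (1ℚ · h) (ℚ-identity 4 (λ X₁ X₂ X₃ l → X₃ ⊖ (# 3 ⊗ (l ⊗ l) ⊖ X₁ ⊖ X₂) ⊜ Κ 1ℚ ⊗ (X₁ ⊕ X₂ ⊕ X₃ ⊖ # 3 ⊗ (l ⊗
            l))) refl X₁ X₂ X₃ l)

    weight-chord : ∀ {X₁ Y₁ X₂ Y₂ X₃ l J K} → OnCurve X₁ Y₁ → OnCurve X₂ Y₂ →
      X₁ + X₂ + X₃ ≡ q (+ 3) * (l * l) → (X₂ - X₁) * l ≡ Y₂ - Y₁ → X₂ - X₁ ≢ 0ℚ →
      Weight 2 X₁ J → Weight 2 X₂ K → Weight 2 X₃ _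
    weight-chord {X₁} {Y₁} {X₂} {Y₂} {X₃} {l} C₁ C₂ h hl x≢ w₁ w₂ = weight-third {X₁} {X₂} {X₃} {l} h w₁ w₂
      (weight-quotient {2} {1} {X₂ - X₁} {l} {Y₂ - Y₁} x≢ hl (weight-- w₂ w₁) (weight-- (weight-Y X₂ Y₂ C₂ w₂) (weight-Y X₁ Y₁ C₁ w₁)))

    weight-tangent : ∀ {X Y X₃ l K} → OnCurve X Y → X + X + X₃ ≡ q (+ 3) * (l * l) →
      q (+ 6) * Y * l ≡ q (+ 3) * (X * X) + A → q (+ 6) * Y ≢ 0ℚ → Weight 2 X K → Weight 2 X₃ _
    weight-tangent {X} {Y} {X₃} {l} C h hl y≢ w = weight-third {X} {X} {X₃} {l} h w w
      (weight-quotient {3} {1} {q (+ 6) * Y} {l} {q (+ 3) * (X * X) + A} y≢ hl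
        (weight-* {0} {3} (weight-const (+ 6) {s≤s (s≤s (s≤s (s≤s (s≤s (s≤s z≤n)))))}) (weight-Y X Y C w))
        (weight-+ (weight-* {0} {4} (weight-const (+ 3) {s≤s (s≤s (s≤s z≤n))}) (weight-* {2} {2} w w)) weight-A))

    weight-interpolate : ∀ {k u v w m n o J K} → n ≢ + 0 → ∣ m ∣ ≤ Q → ∣ n ∣ ≤ Q → ∣ o ∣ ≤ Q →
      q n * w ≡ q m * u + q o * v → Weight k u J → Weight k v K → Weight k w _
    weight-interpolate {k} {u} {v} {w} {m} {n} {o} n≢0 hm hn ho h wu wv =
      weight-quotient {0} {k} {q n} {w} (λ e → n≢0 (q-injective e)) h (weight-q n hn)
        (weight-+ (weight-* {0} {k} (weight-q m hm) wu) (weight-* {0} {k} (weight-q o ho) wv))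

    -- The height of X is controlled by that of Y: some quotient u of quantities of weight 6 and 4 makes X / u
    -- a root of a cubic with coefficients of weight 0.
    private
      root-in-unit : ∀ {X w c J K} → A ≢ 0ℚ → w ≢ 0ℚ → Weight 6 w J → Weight 6 c K → X * X * X + A * X + c ≡ 0ℚ →
        Weight 2 X _
      root-in-unit {X} {w} {c} {J} {K} A≢0 w≢0 hw hc h = subst (λ x → Weight 2 x _) uξ≡X
        (weight-* {2} {0} wu (weight-product-bound {α} {β} (cubic-root-height {ξ} {α} {β} root) wα wβ))
        where
        instance nzA : NonZero A
                 nzA = ≢-nonZero A≢0
                 nzw : NonZero w
                 nzw = ≢-nonZero w≢0
        i j u v ξ α β : ℚ
        i = 1/ A
        j = 1/ w
        u = w * i
        v = A * j
        ξ = X * v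
        α = A * (v * v)
        β = c * (v * (v * v))
        uv≡1 : u * v ≡ 1ℚ
        uv≡1 = trans (lemma A w i j) (trans (cong₂ _*_ (*-inverseʳ A) (*-inverseʳ w)) refl)
          where
          lemma : ∀ A w i j → w * i * (A * j) ≡ A * i * (w * j)
          lemma = ℚ-identity 4 (λ A w i j → w ⊗ i ⊗ (A ⊗ j) ⊜ A ⊗ i ⊗ (w ⊗ j)) refl
        u≢0 : u ≢ 0ℚ
        u≢0 e = contradiction (trans (sym uv≡1) (trans (cong (_* v) e) (*-zeroˡ v))) λ ()
        uξ≡X : u * ξ ≡ X
        uξ≡X = trans (lemma u X v) (trans (cong (X *_) uv≡1) (*-identityʳ X))
          where
          lemma : ∀ u X v → u * (X * v) ≡ X * (u * v)
          lemma = ℚ-identity 3 (λ u X v → u ⊗ (X ⊗ v) ⊜ X ⊗ (u ⊗ v)) refl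
        root : ξ * ξ * ξ + α * ξ + β ≡ 0ℚ
        root = trans (lemma A X v c) (trans (cong (_* (v * (v * v))) h) (*-zeroˡ (v * (v * v))))
          where
          lemma : ∀ A X v c → X * v * (X * v) * (X * v) + A * (v * v) * (X * v) + c * (v * (v * v)) ≡
            (X * X * X + A * X + c) * (v * (v * v))
          lemma = ℚ-identity 4 (λ A X v c → X ⊗ v ⊗ (X ⊗ v) ⊗ (X ⊗ v) ⊕ A ⊗ (v ⊗ v) ⊗ (X ⊗ v) ⊕ c ⊗ (v ⊗ (v ⊗ v)) ⊜ (X ⊗ X ⊗ X ⊕ A
              ⊗ X ⊕ c) ⊗ (v ⊗ (v ⊗ v))) refl
        wu : Weight 2 u _
        wu = weight-quotient {4} {2} {A} {u} {w} A≢0 (trans (lemma A w i) (trans (cong (w *_) (*-inverseʳ A)) (*-identityʳ w))) weight-A hw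
          where
          lemma : ∀ A w i → A * (w * i) ≡ w * (A * i)
          lemma = ℚ-identity 3 (λ A w i → A ⊗ (w ⊗ i) ⊜ w ⊗ (A ⊗ i)) refl
        wα : Weight 0 α _
        wα = weight-quotient {4} {0} {u * u} {α} {A} (*-≢0 u≢0 u≢0)
          (byLinComb (A * (u * v + 1ℚ) · uv≡1) (lemma A u v)) (weight-* {2} {2} wu wu) weight-A
          where
          lemma : ∀ A u v → u * u * (A * (v * v)) - A ≡ A * (u * v + 1ℚ) * (u * v - 1ℚ)
          lemma = ℚ-identity 3 (λ A u v → u ⊗ u ⊗ (A ⊗ (v ⊗ v)) ⊖ A ⊜ A ⊗ (u ⊗ v ⊕ Κ 1ℚ) ⊗ (u ⊗ v ⊖ Κ 1ℚ)) refl
        wβ : Weight 0 β _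
        wβ = weight-quotient {6} {0} {u * (u * u)} {β} {c} (*-≢0 u≢0 (*-≢0 u≢0 u≢0))
          (byLinComb (c * (u * v * (u * v) + u * v + 1ℚ) · uv≡1) (lemma c u v)) (weight-* {2} {4} wu (weight-* {2} {2} wu wu)) hc
          where
          lemma : ∀ c u v → u * (u * u) * (c * (v * (v * v))) - c ≡ c * (u * v * (u * v) + u * v + 1ℚ) * (u * v - 1ℚ)
          lemma = ℚ-identity 3 (λ c u v → u ⊗ (u ⊗ u) ⊗ (c ⊗ (v ⊗ (v ⊗ v))) ⊖ c ⊜ c ⊗ (u ⊗ v ⊗ (u ⊗ v) ⊕ u ⊗ v ⊕ Κ 1ℚ) ⊗ (u ⊗ v ⊖
              Κ 1ℚ)) refl

      weight-0 : ∀ {X} → X ≡ 0ℚ → Weight 2 X 0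
      weight-0 refl = weight (ℕ.≤-reflexive (cong H (*-zeroˡ (D⁻¹ ^^ 2))))

    -- The unit of weight 2 is `w / A`, with `w` either `Y²` or `B`, whichever is nonzero. If
    -- `A = 0`, then `X³` is known directly; if `Y = B = 0`, then `X = 0` or `X² = - A`. The four
    -- cases give different exponents, whence the maximum.
    weight-X : ∀ {X Y K} → OnCurve X Y → Weight 3 Y K → Weight 2 X (maxExp (maxExp _ _) (maxExp _ _))
    weight-X {X} {Y} C wY = go (A ≟ 0ℚ) (Y ≟ 0ℚ) (B ≟ 0ℚ)
      where
      wY² : Weight 6 (Y * Y) _
      wY² = weight-* {3} {3} wY wY
      wc : Weight 6 (B - q (+ 3) * (Y * Y)) _
      wc = weight-- weight-B (weight-* {0} {6} (weight-const (+ 3) {s≤s (s≤s (s≤s z≤n))}) wY²)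
      cubic : X * X * X + A * X + (B - q (+ 3) * (Y * Y)) ≡ 0ℚ
      cubic = byLinComb (- 1ℚ · C) (ℚ-identity 4 (λ A B X Y → X ⊗ X ⊗ X ⊕ A ⊗ X ⊕ (B ⊖ # 3 ⊗ (Y ⊗ Y)) ⊖ Κ 0ℚ ⊜ ⊝ Κ 1ℚ ⊗ (# 3 ⊗ (Y
          ⊗ Y) ⊖ (X ⊗ X ⊗ X ⊕ A ⊗ X ⊕ B))) refl A B X Y)
      A≡0-case : A ≡ 0ℚ → Weight 2 X _
      A≡0-case A≡0 = weight-root {2} {X} 2 (subst (λ x → Weight 6 x _) (sym (trans (cube X) X³≡)) (weight-neg wc))
        where
        X³≡ : X * X * X ≡ - (B - q (+ 3) * (Y * Y))
        X³≡ = byLinComb (- 1ℚ · C ⊹ - X · A≡0) (ℚ-identity 4 (λ A B X Y → X ⊗ X ⊗ X ⊖ ⊝ (B ⊖ # 3 ⊗ (Y ⊗ Y)) ⊜ ⊝ Κ 1ℚ ⊗ (# 3 ⊗ (Y ⊗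
            Y) ⊖ (X ⊗ X ⊗ X ⊕ A ⊗ X ⊕ B)) ⊕ ⊝ X ⊗ (A ⊖ Κ 0ℚ)) refl A B X Y)
      all-zero-case : Y ≡ 0ℚ → B ≡ 0ℚ → Weight 2 X _
      all-zero-case Y≡0 B≡0 = pick (x*y≡0⇒x≡0∨y≡0 X factored)
        where
        factored : X * (X * X + A) ≡ 0ℚ
        factored = byLinComb (- 1ℚ · C ⊹ - 1ℚ · B≡0 ⊹ q (+ 3) * Y · Y≡0) (ℚ-identity 4 (λ A B X Y → X ⊗ (X ⊗ X ⊕ A) ⊖ Κ 0ℚ ⊜ ⊝ Κ
            1ℚ ⊗ (# 3 ⊗ (Y ⊗ Y) ⊖ (X ⊗ X ⊗ X ⊕ A ⊗ X ⊕ B)) ⊕ ⊝ Κ 1ℚ ⊗ (B ⊖ Κ 0ℚ) ⊕ # 3 ⊗ Y ⊗ (Y ⊖ Κ 0ℚ)) refl A B X Y)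
        X²≡ : X * X + A ≡ 0ℚ → X * X ≡ - A
        X²≡ e = byLinComb (1ℚ · e) (ℚ-identity 2 (λ A X → X ⊗ X ⊖ ⊝ A ⊜ Κ 1ℚ ⊗ (X ⊗ X ⊕ A ⊖ Κ 0ℚ)) refl A X)
        pick : X ≡ 0ℚ ⊎ X * X + A ≡ 0ℚ → Weight 2 X (powExp 1)
        pick (inj₁ e) = weaken z≤n (weight-0 e)
        pick (inj₂ e) = weight-root {2} {X} 1 (subst (λ x → Weight 4 x (powExp 1)) (sym (trans (square X) (X²≡ e))) (weight-neg weight-A))
      go : Dec (A ≡ 0ℚ) → Dec (Y ≡ 0ℚ) → Dec (B ≡ 0ℚ) → Weight 2 X (maxExp (maxExp _ _) (maxExp _ _))
      go (yes A≡0) _ _ = weaken-maxˡ (weaken-maxˡ (A≡0-case A≡0))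
      go (no A≢0) (no Y≢0) _ = weaken-maxˡ (weaken-maxʳ (root-in-unit {X} {Y * Y} {B - q (+ 3) * (Y * Y)} A≢0 (*-≢0 Y≢0 Y≢0) wY² wc cubic))
      go (no A≢0) (yes Y≡0) (no B≢0) = weaken-maxʳ (weaken-maxˡ (root-in-unit {X} {B} {B - q (+ 3) * (Y * Y)} A≢0 B≢0 weight-B wc cubic))
      go (no A≢0) (yes Y≡0) (yes B≡0) = weaken-maxʳ (weaken-maxʳ (all-zero-case Y≡0 B≡0))

-- Two abscissas collinear with a small third one

module CollinearPair where

  open import Defs using (q)
  open RationalAlgebra
  open RationalHeight
  open import Data.Nat as ℕ using (ℕ; _≤_; z≤n; s≤s)
  import Data.Nat.Properties as ℕ
  import Data.Nat.Divisibility as ℕ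
  open import Data.Nat.Coprimality as Coprimality using (Coprime; coprime-divisor)
  open import Data.Integer as ℤ using (ℤ; +_; ∣_∣)
  import Data.Integer.Properties as ℤ
  open import Data.Rational using (ℚ; _+_; _*_; _-_; -_; ↥_; ↧_; ↧ₙ_)
  open import Data.Rational.Properties hiding (≤-trans; ≤-reflexive)
  open import Data.Product using (_,_)
  open import Data.Sum using (_⊎_; inj₁; inj₂)
  open import Relation.Nullary using (contradiction)
  open import Relation.Binary.PropositionalEquality

  -- The abscissas x, x′, s of three collinear points of 3Y² = X³ + AX + B.
  Collinear : ℚ → ℚ → ℚ → ℚ → ℚ → Set
  Collinear A B x x′ s =
    (A - (x * x′ + s * (x + x′))) * (A - (x * x′ + s * (x + x′))) ≡ q (+ 4) * ((x + x′ + s) * (x * x′ * s + B))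

  ∣*∣≤ : ∀ i j {a b} → ∣ i ∣ ≤ a → ∣ j ∣ ≤ b → ∣ i ℤ.* j ∣ ≤ a ℕ.* b
  ∣*∣≤ i j hi hj = ℕ.≤-trans (ℕ.≤-reflexive (ℤ.abs-* i j)) (ℕ.*-mono-≤ hi hj)

  ∣+∣≤ : ∀ i j {a b} → ∣ i ∣ ≤ a → ∣ j ∣ ≤ b → ∣ i ℤ.+ j ∣ ≤ a ℕ.+ b
  ∣+∣≤ i j hi hj = ℕ.≤-trans (ℤ.∣i+j∣≤∣i∣+∣j∣ i j) (ℕ.+-mono-≤ hi hj)

  ∣-∣≤ : ∀ i j {a b} → ∣ i ∣ ≤ a → ∣ j ∣ ≤ b → ∣ i ℤ.- j ∣ ≤ a ℕ.+ b
  ∣-∣≤ i j hi hj = ∣+∣≤ i (ℤ.- j) hi (ℕ.≤-trans (ℕ.≤-reflexive (ℤ.∣-i∣≡∣i∣ j)) hj)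

  1≤m*n : ∀ {m n} → 1 ≤ m → 1 ≤ n → 1 ≤ m ℕ.* n
  1≤m*n = ℕ.*-mono-≤

  m≤m*n′ : ∀ {m n} → 1 ≤ n → m ≤ m ℕ.* n
  m≤m*n′ {m} {n} h = ℕ.≤-trans (ℕ.≤-reflexive (sym (ℕ.*-identityʳ m))) (ℕ.*-monoʳ-≤ m h)

  module Pair (A B S : ℤ) (x x′ : ℚ) (M : ℕ) (1≤M : 1 ≤ M) (hA : ∣ A ∣ ≤ M) (hB : ∣ B ∣ ≤ M) (hS : ∣ S ∣ ≤ M)
    (collinear : Collinear (q A) (q B) x x′ (q S)) where

    m = ↥ x
    n = ↧ x
    m′ = ↥ x′
    n′ = ↧ x′

    N P Σ′ T R V : ℤ
    N = n ℤ.* n′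
    P = m ℤ.* m′
    Σ′ = m ℤ.* n′ ℤ.+ m′ ℤ.* n
    T = A ℤ.* N ℤ.- S ℤ.* Σ′
    R = Σ′ ℤ.+ S ℤ.* N
    V = P ℤ.* S ℤ.+ B ℤ.* N

    private
      clear : ∀ A B x x′ s n n′ →
        (A - (x * x′ + s * (x + x′))) * (A - (x * x′ + s * (x + x′))) ≡ q (+ 4) * ((x + x′ + s) * (x * x′ * s + B)) →
        (A * (n * n′) - s * ((x * n) * n′ + (x′ * n′) * n) - (x * n) * (x′ * n′)) *
        (A * (n * n′) - s * ((x * n) * n′ + (x′ * n′) * n) - (x * n) * (x′ * n′)) ≡
        q (+ 4) * ((((x * n) * n′ + (x′ * n′) * n) + s * (n * n′)) * ((x * n) * (x′ * n′) * s + B * (n * n′)))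
      clear A B x x′ s n n′ h = byLinComb (n * n * n′ * n′ · h) (ℚ-identity 7 (λ A B x x′ s n n′ → (A ⊗ (n ⊗ n′) ⊖ s ⊗ (x ⊗ n ⊗ n′
          ⊕ x′ ⊗ n′ ⊗ n) ⊖ x ⊗ n ⊗ (x′ ⊗ n′)) ⊗ (A ⊗ (n ⊗ n′) ⊖ s ⊗ (x ⊗ n ⊗ n′ ⊕ x′ ⊗ n′ ⊗ n) ⊖ x ⊗ n ⊗ (x′ ⊗ n′)) ⊖ # 4 ⊗ ((x ⊗
          n ⊗ n′ ⊕ x′ ⊗ n′ ⊗ n ⊕ s ⊗ (n ⊗ n′)) ⊗ (x ⊗ n ⊗ (x′ ⊗ n′) ⊗ s ⊕ B ⊗ (n ⊗ n′))) ⊜ n ⊗ n ⊗ n′ ⊗ n′ ⊗ ((A ⊖ (x ⊗ x′ ⊕ s ⊗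
          (x ⊕ x′))) ⊗ (A ⊖ (x ⊗ x′ ⊕ s ⊗ (x ⊕ x′))) ⊖ # 4 ⊗ ((x ⊕ x′ ⊕ s) ⊗ (x ⊗ x′ ⊗ s ⊕ B)))) refl A B x x′ s n n′)

    cleared : (T ℤ.- P) ℤ.* (T ℤ.- P) ≡ + 4 ℤ.* (R ℤ.* V)
    cleared = int-equal (int-* iTP iTP) (int-* (int-q (+ 4)) (int-* (int-+ iΣ (int-* (int-q S) iN)) (int-+ (int-* iP (int-q S)) (int-* (int-q B) iN))))
      (clear (q A) (q B) x x′ (q S) (q n) (q n′) collinear)
      where
      iN = int-* (int-q n) (int-q n′)
      iP = int-* (int-clear x) (int-clear x′)
      iΣ = int-+ (int-* (int-clear x) (int-q n′)) (int-* (int-clear x′) (int-q n))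
      iTP = int-+ (int-+ (int-* (int-q A) iN) (int-neg (int-* (int-q S) iΣ))) (int-neg iP)

    -- Solved for `P²`, every term on the right contains `T` or `R`, combinations of `N` and `Σ′`.
    -- These are divisible by each common factor of the denominators, and they are small against `P`
    -- when both abscissas are large; the next two results exploit this.
    expanded : P ℤ.* P ≡ + 2 ℤ.* (P ℤ.* T) ℤ.- T ℤ.* T ℤ.+ + 4 ℤ.* (R ℤ.* V)
    expanded = trans (lemma P T) (cong (λ z → + 2 ℤ.* (P ℤ.* T) ℤ.- T ℤ.* T ℤ.+ z) cleared)
      where
      lemma : ∀ P T → P ℤ.* P ≡ + 2 ℤ.* (P ℤ.* T) ℤ.- T ℤ.* T ℤ.+ (T ℤ.- P) ℤ.* (T ℤ.- P)
      lemma = ℤ-identity 2 (λ P T → P ⊗ P ⊜ Κ (+ 2) ⊗ (P ⊗ T) ⊖ T ⊗ T ⊕ (T ⊖ P) ⊗ (T ⊖ P)) refl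

    -- A common divisor of the denominators divides `N` and `Σ′`, hence `T`, `R` and `P²`, although
    -- it is prime to both numerators.
    coprime-denominators : Coprime (↧ₙ x) (↧ₙ x′)
    coprime-denominators {i} (ℕ.divides a n≡ , ℕ.divides b n′≡) =
      ℕ.∣1⇒≡1 (strip m′ x′-cop (strip m x-cop (strip m′ x′-cop (strip m x-cop (subst (i ℕ.∣_) abs≡ i∣P²)))))
      where
      x-cop : Coprime i ∣ m ∣
      x-cop (d∣i , d∣m) = coprime-↥-↧ x (d∣m , ℕ.∣-trans d∣i (ℕ.divides a n≡))
      x′-cop : Coprime i ∣ m′ ∣
      x′-cop (d∣i , d∣m) = coprime-↥-↧ x′ (d∣m , ℕ.∣-trans d∣i (ℕ.divides b n′≡))
      strip : ∀ m {k} → Coprime i ∣ m ∣ → i ℕ.∣ ∣ m ∣ ℕ.* k → i ℕ.∣ k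
      strip _ c h = coprime-divisor c h
      abs≡ : ∣ P ℤ.* P ∣ ≡ ∣ m ∣ ℕ.* (∣ m′ ∣ ℕ.* (∣ m ∣ ℕ.* (∣ m′ ∣ ℕ.* 1)))
      abs≡ = trans (ℤ.abs-* P P) (trans (cong₂ ℕ._*_ (ℤ.abs-* m m′) (ℤ.abs-* m m′)) (lemma (∣ m ∣) (∣ m′ ∣)))
        where
        lemma : ∀ a b → a ℕ.* b ℕ.* (a ℕ.* b) ≡ a ℕ.* (b ℕ.* (a ℕ.* (b ℕ.* 1)))
        lemma = ℕ-identity 2 (λ a b → a ⊗ b ⊗ (a ⊗ b) ⊜ a ⊗ (b ⊗ (a ⊗ (b ⊗ Κ 1)))) refl
      n≡′ : n ≡ + a ℤ.* + i
      n≡′ = trans (cong +_ n≡) (ℤ.pos-* a i)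
      n′≡′ : n′ ≡ + b ℤ.* + i
      n′≡′ = trans (cong +_ n′≡) (ℤ.pos-* b i)
      i∣ : ∀ {z} k → z ≡ + i ℤ.* k → i ℕ.∣ ∣ z ∣
      i∣ k refl = ℕ.divides ∣ k ∣ (trans (ℤ.abs-* (+ i) k) (ℕ.*-comm i ∣ k ∣))
      N≡ : N ≡ + i ℤ.* (+ a ℤ.* n′)
      N≡ = trans (cong (ℤ._* n′) n≡′) (lemma (+ a) (+ i) n′)
        where
        lemma : ∀ a i n → a ℤ.* i ℤ.* n ≡ i ℤ.* (a ℤ.* n)
        lemma = ℤ-identity 3 (λ a i n → a ⊗ i ⊗ n ⊜ i ⊗ (a ⊗ n)) refl
      Σ≡ : Σ′ ≡ + i ℤ.* (m ℤ.* + b ℤ.+ m′ ℤ.* + a)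
      Σ≡ = trans (cong₂ (λ u v → m ℤ.* u ℤ.+ m′ ℤ.* v) n′≡′ n≡′) (lemma (+ a) (+ b) (+ i) m m′)
        where
        lemma : ∀ a b i m m′ → m ℤ.* (b ℤ.* i) ℤ.+ m′ ℤ.* (a ℤ.* i) ≡ i ℤ.* (m ℤ.* b ℤ.+ m′ ℤ.* a)
        lemma = ℤ-identity 5 (λ a b i m m′ → m ⊗ (b ⊗ i) ⊕ m′ ⊗ (a ⊗ i) ⊜ i ⊗ (m ⊗ b ⊕ m′ ⊗ a)) refl
      T≡ : T ≡ + i ℤ.* (A ℤ.* (+ a ℤ.* n′) ℤ.- S ℤ.* (m ℤ.* + b ℤ.+ m′ ℤ.* + a))
      T≡ = trans (cong₂ (λ u v → A ℤ.* u ℤ.- S ℤ.* v) N≡ Σ≡) (lemma A S (+ i) (+ a ℤ.* n′) (m ℤ.* + b ℤ.+ m′ ℤ.* + a))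
        where
        lemma : ∀ A S i u v → A ℤ.* (i ℤ.* u) ℤ.- S ℤ.* (i ℤ.* v) ≡ i ℤ.* (A ℤ.* u ℤ.- S ℤ.* v)
        lemma = ℤ-identity 5 (λ A S i u v → A ⊗ (i ⊗ u) ⊖ S ⊗ (i ⊗ v) ⊜ i ⊗ (A ⊗ u ⊖ S ⊗ v)) refl
      R≡ : R ≡ + i ℤ.* (m ℤ.* + b ℤ.+ m′ ℤ.* + a ℤ.+ S ℤ.* (+ a ℤ.* n′))
      R≡ = trans (cong₂ (λ u v → v ℤ.+ S ℤ.* u) N≡ Σ≡) (lemma S (+ i) (+ a ℤ.* n′) (m ℤ.* + b ℤ.+ m′ ℤ.* + a))
        where
        lemma : ∀ S i u v → i ℤ.* v ℤ.+ S ℤ.* (i ℤ.* u) ≡ i ℤ.* (v ℤ.+ S ℤ.* u)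
        lemma = ℤ-identity 4 (λ S i u v → i ⊗ v ⊕ S ⊗ (i ⊗ u) ⊜ i ⊗ (v ⊕ S ⊗ u)) refl
      i∣P² : i ℕ.∣ ∣ P ℤ.* P ∣
      i∣P² = i∣ _ (trans expanded (trans (cong₂ (λ t r → + 2 ℤ.* (P ℤ.* t) ℤ.- t ℤ.* T ℤ.+ + 4 ℤ.* (r ℤ.* V)) T≡ R≡)
          (lemma (+ i) P T V (A ℤ.* (+ a ℤ.* n′) ℤ.- S ℤ.* (m ℤ.* + b ℤ.+ m′ ℤ.* + a)) (m ℤ.* + b ℤ.+ m′ ℤ.* + a ℤ.+ S ℤ.* (+ a ℤ.* n′)))))
        where
        lemma : ∀ i P T V t r → + 2 ℤ.* (P ℤ.* (i ℤ.* t)) ℤ.- i ℤ.* t ℤ.* T ℤ.+ + 4 ℤ.* (i ℤ.* r ℤ.* V) ≡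
          i ℤ.* (+ 2 ℤ.* (P ℤ.* t) ℤ.- t ℤ.* T ℤ.+ + 4 ℤ.* (r ℤ.* V))
        lemma = ℤ-identity 6 (λ i P T V t r → Κ (+ 2) ⊗ (P ⊗ (i ⊗ t)) ⊖ i ⊗ t ⊗ T ⊕ Κ (+ 4) ⊗ (i ⊗ r ⊗ V) ⊜ i ⊗ (Κ (+ 2) ⊗ (P ⊗ t)
            ⊖ t ⊗ T ⊕ Κ (+ 4) ⊗ (r ⊗ V))) refl

    -- The factor 40 exceeds 6 + 9 + 24 = 39, the sum of the coefficients that appear in
    -- `conclusion`.
    large : ℕ
    large = 40 ℕ.* (M ℕ.* M)

    -- If both abscissas exceeded `K`, then `K T` and `K R` would be at most `3 M p`, and `expanded`
    -- would give `40 p² ≤ 39 p²` up to a common positive factor.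
    one-bounded : ∣ m ∣ ≤ large ℕ.* ↧ₙ x ⊎ ∣ m′ ∣ ≤ large ℕ.* ↧ₙ x′
    one-bounded with ℕ.≤-<-connex ∣ m ∣ (large ℕ.* ↧ₙ x)
    ... | inj₁ h = inj₁ h
    ... | inj₂ h with ℕ.≤-<-connex ∣ m′ ∣ (large ℕ.* ↧ₙ x′)
    ...   | inj₁ h′ = inj₂ h′
    ...   | inj₂ h′ = contradiction conclusion (ℕ.<⇒≱ (ℕ.*-monoˡ-< (p ℕ.* p) {{ℕ.>-nonZero (1≤m*n p≥1 p≥1)}}
              (ℕ.*-monoˡ-< K {{ℕ.>-nonZero 1≤K}} (ℕ.*-monoˡ-< (M ℕ.* M) {{ℕ.>-nonZero 1≤M²}} (ℕ.n<1+n 39)))))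
      where
      K = large
      p = ∣ m ∣ ℕ.* ∣ m′ ∣
      1≤M² : 1 ≤ M ℕ.* M
      1≤M² = 1≤m*n 1≤M 1≤M
      1≤K : 1 ≤ K
      1≤K = 1≤m*n {40} (s≤s z≤n) 1≤M²
      Kn≤ : K ℕ.* ↧ₙ x ≤ ∣ m ∣
      Kn≤ = ℕ.<⇒≤ h
      Kn′≤ : K ℕ.* ↧ₙ x′ ≤ ∣ m′ ∣
      Kn′≤ = ℕ.<⇒≤ h′
      n≤K : ∀ n → n ≤ K ℕ.* n
      n≤K n = ℕ.≤-trans (m≤m*n′ 1≤K) (ℕ.≤-reflexive (ℕ.*-comm n K))
      p≥1 : 1 ≤ p
      p≥1 = 1≤m*n (ℕ.≤-trans (s≤s z≤n) h) (ℕ.≤-trans (s≤s z≤n) h′)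
      N≤ : ∣ N ∣ ≤ p
      N≤ = ∣*∣≤ n n′ (ℕ.≤-trans (n≤K _) Kn≤) (ℕ.≤-trans (n≤K _) Kn′≤)
      KN≤ : K ℕ.* ∣ N ∣ ≤ p
      KN≤ = ℕ.≤-trans (ℕ.≤-reflexive (trans (cong (K ℕ.*_) (ℤ.abs-* n n′)) (sym (ℕ.*-assoc K (↧ₙ x) (↧ₙ x′)))))
        (ℕ.*-mono-≤ Kn≤ (ℕ.≤-trans (n≤K _) Kn′≤))
      KΣ≤ : K ℕ.* ∣ Σ′ ∣ ≤ p ℕ.+ p
      KΣ≤ = ℕ.≤-trans (ℕ.*-monoʳ-≤ K (∣+∣≤ (m ℤ.* n′) (m′ ℤ.* n) (ℕ.≤-reflexive (ℤ.abs-* m n′)) (ℕ.≤-reflexive (ℤ.abs-* m′ n))))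
        (ℕ.≤-trans (ℕ.≤-reflexive (lemma K (∣ m ∣) (∣ m′ ∣) (↧ₙ x) (↧ₙ x′))) (ℕ.+-mono-≤ (ℕ.*-monoʳ-≤ ∣ m ∣ Kn′≤) (ℕ.*-monoˡ-≤ ∣ m′ ∣ Kn≤)))
        where
        lemma : ∀ K m m′ n n′ → K ℕ.* (m ℕ.* n′ ℕ.+ m′ ℕ.* n) ≡ m ℕ.* (K ℕ.* n′) ℕ.+ K ℕ.* n ℕ.* m′
        lemma = ℕ-identity 5 (λ K m m′ n n′ → K ⊗ (m ⊗ n′ ⊕ m′ ⊗ n) ⊜ m ⊗ (K ⊗ n′) ⊕ K ⊗ n ⊗ m′) refl
      KT≤ : K ℕ.* ∣ T ∣ ≤ 3 ℕ.* (M ℕ.* p)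
      KT≤ = ℕ.≤-trans (ℕ.*-monoʳ-≤ K (∣-∣≤ (A ℤ.* N) (S ℤ.* Σ′) (∣*∣≤ A N hA ℕ.≤-refl) (∣*∣≤ S Σ′ hS ℕ.≤-refl)))
        (ℕ.≤-trans (ℕ.≤-reflexive (lemma K M (∣ N ∣) (∣ Σ′ ∣))) (ℕ.≤-trans (ℕ.+-mono-≤ (ℕ.*-monoʳ-≤ M KN≤) (ℕ.*-monoʳ-≤ M KΣ≤))
          (ℕ.≤-reflexive (lemma′ M p))))
        where
        lemma : ∀ K M N Z → K ℕ.* (M ℕ.* N ℕ.+ M ℕ.* Z) ≡ M ℕ.* (K ℕ.* N) ℕ.+ M ℕ.* (K ℕ.* Z)
        lemma = ℕ-identity 4 (λ K M N Z → K ⊗ (M ⊗ N ⊕ M ⊗ Z) ⊜ M ⊗ (K ⊗ N) ⊕ M ⊗ (K ⊗ Z)) refl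
        lemma′ : ∀ M p → M ℕ.* p ℕ.+ M ℕ.* (p ℕ.+ p) ≡ 3 ℕ.* (M ℕ.* p)
        lemma′ = ℕ-identity 2 (λ M p → M ⊗ p ⊕ M ⊗ (p ⊕ p) ⊜ Κ 3 ⊗ (M ⊗ p)) refl
      KR≤ : K ℕ.* ∣ R ∣ ≤ 3 ℕ.* (M ℕ.* p)
      KR≤ = ℕ.≤-trans (ℕ.*-monoʳ-≤ K (∣+∣≤ Σ′ (S ℤ.* N) ℕ.≤-refl (∣*∣≤ S N hS ℕ.≤-refl)))
        (ℕ.≤-trans (ℕ.≤-reflexive (lemma K M (∣ N ∣) (∣ Σ′ ∣))) (ℕ.≤-trans (ℕ.+-mono-≤ KΣ≤ (ℕ.*-monoʳ-≤ M KN≤))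
          (ℕ.≤-trans (ℕ.+-monoˡ-≤ (M ℕ.* p) (ℕ.+-mono-≤ p≤Mp p≤Mp)) (ℕ.≤-reflexive (lemma′ (M ℕ.* p))))))
        where
        p≤Mp : p ≤ M ℕ.* p
        p≤Mp = ℕ.≤-trans (m≤m*n′ 1≤M) (ℕ.≤-reflexive (ℕ.*-comm p M))
        lemma : ∀ K M N Z → K ℕ.* (Z ℕ.+ M ℕ.* N) ≡ K ℕ.* Z ℕ.+ M ℕ.* (K ℕ.* N)
        lemma = ℕ-identity 4 (λ K M N Z → K ⊗ (Z ⊕ M ⊗ N) ⊜ K ⊗ Z ⊕ M ⊗ (K ⊗ N)) refl
        lemma′ : ∀ a → a ℕ.+ a ℕ.+ a ≡ 3 ℕ.* a
        lemma′ = ℕ-identity 1 (λ a → a ⊕ a ⊕ a ⊜ Κ 3 ⊗ a) refl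
      V≤ : ∣ V ∣ ≤ 2 ℕ.* (M ℕ.* p)
      V≤ = ℕ.≤-trans (∣+∣≤ (P ℤ.* S) (B ℤ.* N) (∣*∣≤ P S (ℕ.≤-reflexive (ℤ.abs-* m m′)) hS) (∣*∣≤ B N hB N≤))
        (ℕ.≤-reflexive (lemma M p))
        where
        lemma : ∀ M p → p ℕ.* M ℕ.+ M ℕ.* p ≡ 2 ℕ.* (M ℕ.* p)
        lemma = ℕ-identity 2 (λ M p → p ⊗ M ⊕ M ⊗ p ⊜ Κ 2 ⊗ (M ⊗ p)) refl
      p²≤ : p ℕ.* p ≤ 2 ℕ.* (p ℕ.* ∣ T ∣) ℕ.+ ∣ T ∣ ℕ.* ∣ T ∣ ℕ.+ 4 ℕ.* (∣ R ∣ ℕ.* ∣ V ∣)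
      p²≤ = ℕ.≤-trans (ℕ.≤-reflexive (sym (trans (ℤ.abs-* P P) (cong₂ ℕ._*_ (ℤ.abs-* m m′) (ℤ.abs-* m m′)))))
        (ℕ.≤-trans (ℕ.≤-reflexive (cong ∣_∣ expanded))
        (∣+∣≤ (+ 2 ℤ.* (P ℤ.* T) ℤ.- T ℤ.* T) (+ 4 ℤ.* (R ℤ.* V))
          (∣-∣≤ (+ 2 ℤ.* (P ℤ.* T)) (T ℤ.* T) (∣*∣≤ (+ 2) (P ℤ.* T) ℕ.≤-refl (∣*∣≤ P T (ℕ.≤-reflexive (ℤ.abs-* m m′)) ℕ.≤-refl))
            (∣*∣≤ T T ℕ.≤-refl ℕ.≤-refl))
          (∣*∣≤ (+ 4) (R ℤ.* V) ℕ.≤-refl (∣*∣≤ R V ℕ.≤-refl ℕ.≤-refl))))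
      conclusion : (40 ℕ.* (M ℕ.* M)) ℕ.* K ℕ.* (p ℕ.* p) ≤ (39 ℕ.* (M ℕ.* M)) ℕ.* K ℕ.* (p ℕ.* p)
      conclusion = ℕ.≤-trans (ℕ.*-monoʳ-≤ (K ℕ.* K) p²≤) (ℕ.≤-trans (ℕ.≤-reflexive (lemma K p (∣ T ∣) (∣ R ∣) (∣ V ∣)))
        (ℕ.≤-trans (ℕ.+-mono-≤ (ℕ.+-mono-≤ (ℕ.*-monoʳ-≤ (2 ℕ.* (K ℕ.* p)) KT≤) (ℕ.*-mono-≤ KT≤ KT≤))
            (ℕ.*-monoʳ-≤ 4 (ℕ.*-mono-≤ KR≤ (ℕ.*-monoʳ-≤ K V≤))))
        (ℕ.≤-trans (ℕ.≤-reflexive (lemma′ K M p)) (ℕ.≤-trans (ℕ.*-monoˡ-≤ (p ℕ.* p)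
          (ℕ.+-monoˡ-≤ (24 ℕ.* (M ℕ.* M) ℕ.* K) (ℕ.+-mono-≤
            (ℕ.*-monoˡ-≤ K (ℕ.*-monoʳ-≤ 6 (m≤m*n′ {M} 1≤M))) (m≤m*n′ {9 ℕ.* (M ℕ.* M)} 1≤K))))
          (ℕ.≤-reflexive (lemma″ K (M ℕ.* M) (p ℕ.* p)))))))
        where
        lemma : ∀ K p t r v → K ℕ.* K ℕ.* (2 ℕ.* (p ℕ.* t) ℕ.+ t ℕ.* t ℕ.+ 4 ℕ.* (r ℕ.* v)) ≡
          2 ℕ.* (K ℕ.* p) ℕ.* (K ℕ.* t) ℕ.+ K ℕ.* t ℕ.* (K ℕ.* t) ℕ.+ 4 ℕ.* (K ℕ.* r ℕ.* (K ℕ.* v))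
        lemma = ℕ-identity 5 (λ K p t r v → K ⊗ K ⊗ (Κ 2 ⊗ (p ⊗ t) ⊕ t ⊗ t ⊕ Κ 4 ⊗ (r ⊗ v)) ⊜ Κ 2 ⊗ (K ⊗ p) ⊗ (K ⊗ t) ⊕ K ⊗ t ⊗ (K
            ⊗ t) ⊕ Κ 4 ⊗ (K ⊗ r ⊗ (K ⊗ v))) refl
        lemma′ : ∀ K M p → 2 ℕ.* (K ℕ.* p) ℕ.* (3 ℕ.* (M ℕ.* p)) ℕ.+ 3 ℕ.* (M ℕ.* p) ℕ.* (3 ℕ.* (M ℕ.* p)) ℕ.+
          4 ℕ.* (3 ℕ.* (M ℕ.* p) ℕ.* (K ℕ.* (2 ℕ.* (M ℕ.* p)))) ≡
          (6 ℕ.* M ℕ.* K ℕ.+ 9 ℕ.* (M ℕ.* M) ℕ.+ 24 ℕ.* (M ℕ.* M) ℕ.* K) ℕ.* (p ℕ.* p)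
        lemma′ = ℕ-identity 3 (λ K M p → Κ 2 ⊗ (K ⊗ p) ⊗ (Κ 3 ⊗ (M ⊗ p)) ⊕ Κ 3 ⊗ (M ⊗ p) ⊗ (Κ 3 ⊗ (M ⊗ p)) ⊕ Κ 4 ⊗ (Κ 3 ⊗ (M ⊗ p)
            ⊗ (K ⊗ (Κ 2 ⊗ (M ⊗ p)))) ⊜ (Κ 6 ⊗ M ⊗ K ⊕ Κ 9 ⊗ (M ⊗ M) ⊕ Κ 24 ⊗ (M ⊗ M) ⊗ K) ⊗ (p ⊗ p)) refl
        lemma″ : ∀ K m p → (6 ℕ.* m ℕ.* K ℕ.+ 9 ℕ.* m ℕ.* K ℕ.+ 24 ℕ.* m ℕ.* K) ℕ.* p ≡ 39 ℕ.* m ℕ.* K ℕ.* p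
        lemma″ = ℕ-identity 3 (λ K m p → (Κ 6 ⊗ m ⊗ K ⊕ Κ 9 ⊗ m ⊗ K ⊕ Κ 24 ⊗ m ⊗ K) ⊗ p ⊜ Κ 39 ⊗ m ⊗ K ⊗ p) refl

-- Three abscissas tied by a linear relation, or by one between the ordinates

module LinearTriple where

  open import Defs using (q)
  open RationalAlgebra
  open RationalHeight
  open CollinearPair
  open import Data.Nat as ℕ using (ℕ; _≤_)
  import Data.Nat.Properties as ℕ
  import Data.Nat.Divisibility as ℕ
  open import Data.Nat.Coprimality as Coprimality using (Coprime; coprime-divisor)
  open import Data.Integer as ℤ using (ℤ; +_; ∣_∣)
  import Data.Integer.Properties as ℤ
  import Data.Integer.Divisibility.Signed as Signed
  open import Data.Rational using (ℚ; 0ℚ; _+_; _*_; _-_; -_; ↥_; ↧_; ↧ₙ_)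
  open import Data.Rational.Properties hiding (≤-trans; ≤-reflexive)
  open import Data.Product using (_×_; _,_)
  open import Data.Sum using (_⊎_; inj₁; inj₂)
  open import Relation.Nullary using (contradiction)
  open import Relation.Binary.PropositionalEquality

  private
    abs-*² : ∀ i j k → ∣ i ℤ.* (j ℤ.* k) ∣ ≡ ∣ i ∣ ℕ.* (∣ j ∣ ℕ.* ∣ k ∣)
    abs-*² i j k = trans (ℤ.abs-* i (j ℤ.* k)) (cong (∣ i ∣ ℕ.*_) (ℤ.abs-* j k))

    1≤∣∣ : ∀ {α} → α ≢ + 0 → 1 ≤ ∣ α ∣
    1≤∣∣ α≢0 = ℕ.n≢0⇒n>0 (λ e → α≢0 (ℤ.∣i∣≡0⇒i≡0 e))

    square-cancel-≤ : ∀ {a b} → a ℕ.* a ≤ b ℕ.* b → a ≤ b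
    square-cancel-≤ {a} {b} h with ℕ.≤-<-connex a b
    ... | inj₁ a≤b = a≤b
    ... | inj₂ b<a = contradiction h (ℕ.<⇒≱ (ℕ.*-mono-< b<a b<a))

    opposite : ∀ t u → t ℤ.+ u ≡ + 0 → ∣ t ∣ ≡ ∣ u ∣
    opposite t u h = trans (cong ∣_∣ t≡) (ℤ.∣-i∣≡∣i∣ u)
      where
      lemma : ∀ t u → t ≡ t ℤ.+ u ℤ.+ ℤ.- u
      lemma = ℤ-identity 2 (λ t u → t ⊜ t ⊕ u ⊕ ⊝ u) refl
      t≡ : t ≡ ℤ.- u
      t≡ = trans (lemma t u) (trans (cong (ℤ._+ ℤ.- u) h) (ℤ.+-identityˡ (ℤ.- u)))

  Bounded : ℕ → ℚ → Set
  Bounded K x = ∣ ↥ x ∣ ≤ K ℕ.* ↧ₙ x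

  module Triple (x₀ x₁ x₂ : ℚ) (K L : ℕ) (1≤K : 1 ≤ K) (1≤L : 1 ≤ L)
    (coprime₁ : Coprime (↧ₙ x₀) (↧ₙ x₁)) (coprime₂ : Coprime (↧ₙ x₀) (↧ₙ x₂))
    (bounded₁ : Bounded K x₀ ⊎ Bounded K x₁) (bounded₂ : Bounded K x₀ ⊎ Bounded K x₂)
    (α β γ : ℤ) (α≢0 : α ≢ + 0) (hα : ∣ α ∣ ≤ L) (hβ : ∣ β ∣ ≤ L) (hγ : ∣ γ ∣ ≤ L) where

    private
      m₀ = ↥ x₀
      m₁ = ↥ x₁
      m₂ = ↥ x₂
      n₀ = ↧ x₀
      n₁ = ↧ x₁
      n₂ = ↧ x₂

      -- Each pair contains a bounded abscissa, so either `x₀` is bounded at once, or both others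
      -- are and the relation transfers their bound to `x₀`.
      cases : Bounded K x₀ ⊎ (Bounded K x₁ × Bounded K x₂)
      cases = either bounded₁ bounded₂
        where
        either : ∀ {A B C : Set} → A ⊎ B → A ⊎ C → A ⊎ (B × C)
        either (inj₁ h) _ = inj₁ h
        either (inj₂ _) (inj₁ h) = inj₁ h
        either (inj₂ h) (inj₂ h′) = inj₂ (h , h′)

      height-bound : ∀ {a b} → ∣ m₀ ∣ ≤ a ℕ.* ↧ₙ x₀ → ↧ₙ x₀ ≤ b → 1 ≤ a → H x₀ ≤ a ℕ.* b
      height-bound {a} {b} hm hn 1≤a = ℕ.⊔-lub (ℕ.≤-trans hm (ℕ.*-monoʳ-≤ a hn))
        (ℕ.≤-trans hn (ℕ.≤-trans (m≤m*n′ 1≤a) (ℕ.≤-reflexive (ℕ.*-comm b a))))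

    module Linear (relation : q α * x₀ + q β * x₁ + q γ * x₂ ≡ 0ℚ) where

      private
        clear : ∀ α β γ x y z a b c → α * x + β * y + γ * z ≡ 0ℚ →
          (x * a) * (b * (c * α)) + a * (β * ((y * b) * c) + γ * ((z * c) * b)) ≡ 0ℚ
        clear α β γ x y z a b c h = byLinComb (a * b * c · h) (ℚ-identity 9 (λ α β γ x y z a b c → x ⊗ a ⊗ (b ⊗ (c ⊗ α)) ⊕ a ⊗ (β
            ⊗ (y ⊗ b ⊗ c) ⊕ γ ⊗ (z ⊗ c ⊗ b)) ⊖ Κ 0ℚ ⊜ a ⊗ b ⊗ c ⊗ (α ⊗ x ⊕ β ⊗ y ⊕ γ ⊗ z ⊖ Κ 0ℚ)) refl α β γ x y z a b c)

        rest : ℤ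
        rest = β ℤ.* (m₁ ℤ.* n₂) ℤ.+ γ ℤ.* (m₂ ℤ.* n₁)

        cleared : m₀ ℤ.* (n₁ ℤ.* (n₂ ℤ.* α)) ℤ.+ n₀ ℤ.* rest ≡ + 0
        cleared = int-equal (int-+ (int-* (int-clear x₀) (int-* (int-q n₁) (int-* (int-q n₂) (int-q α))))
            (int-* (int-q n₀) (int-+ (int-* (int-q β) (int-* (int-clear x₁) (int-q n₂))) (int-* (int-q γ) (int-* (int-clear x₂) (int-q n₁))))))
          (int-q (+ 0)) (clear (q α) (q β) (q γ) x₀ x₁ x₂ (q n₀) (q n₁) (q n₂) relation)

        abs-left : ∣ m₀ ℤ.* (n₁ ℤ.* (n₂ ℤ.* α)) ∣ ≡ ∣ m₀ ∣ ℕ.* (↧ₙ x₁ ℕ.* (↧ₙ x₂ ℕ.* ∣ α ∣))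
        abs-left = trans (ℤ.abs-* m₀ (n₁ ℤ.* (n₂ ℤ.* α))) (cong (∣ m₀ ∣ ℕ.*_) (abs-*² n₁ n₂ α))

        -- After clearing, `n₀` divides `m₀ n₁ n₂ α` and is prime to the first three factors, so it
        -- divides `α`.
        denominator : ↧ₙ x₀ ≤ L
        denominator = ℕ.≤-trans (ℕ.∣⇒≤ {{ℕ.>-nonZero (1≤∣∣ α≢0)}} (coprime-divisor coprime₂ (coprime-divisor coprime₁
          (coprime-divisor (Coprimality.sym (coprime-↥-↧ x₀)) (subst (↧ₙ x₀ ℕ.∣_) abs-left (∣-sum≡0 {m₀ ℤ.* (n₁ ℤ.* (n₂ ℤ.* α))} {n₀} {rest} cleared)))))) hα

        numerator : Bounded (2 ℕ.* (L ℕ.* K)) x₀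
        numerator with cases
        ... | inj₁ h = ℕ.≤-trans h (ℕ.*-monoˡ-≤ (↧ₙ x₀) (ℕ.≤-trans (m≤m*n′ {K} 1≤L) (ℕ.≤-trans (ℕ.≤-reflexive (ℕ.*-comm K L)) (ℕ.m≤m+n (L ℕ.* K) _))))
        ... | inj₂ (h₁ , h₂) = ℕ.*-cancelʳ-≤ ∣ m₀ ∣ (2 ℕ.* (L ℕ.* K) ℕ.* ↧ₙ x₀) (↧ₙ x₁ ℕ.* ↧ₙ x₂) {{ℕ.>-nonZero (1≤m*n (1≤↧ x₁) (1≤↧ x₂))}} (begin
            ∣ m₀ ∣ ℕ.* (↧ₙ x₁ ℕ.* ↧ₙ x₂) ≤⟨ ℕ.*-monoʳ-≤ ∣ m₀ ∣ (ℕ.*-monoʳ-≤ (↧ₙ x₁) (m≤m*n′ (1≤∣∣ α≢0))) ⟩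
            ∣ m₀ ∣ ℕ.* (↧ₙ x₁ ℕ.* (↧ₙ x₂ ℕ.* ∣ α ∣)) ≡⟨ trans (sym abs-left) (opposite (m₀ ℤ.* (n₁ ℤ.* (n₂ ℤ.* α))) (n₀ ℤ.* rest) cleared) ⟩
            ∣ n₀ ℤ.* rest ∣ ≤⟨ ∣*∣≤ n₀ rest ℕ.≤-refl (∣+∣≤ (β ℤ.* (m₁ ℤ.* n₂)) (γ ℤ.* (m₂ ℤ.* n₁))
               (∣*∣≤ β (m₁ ℤ.* n₂) hβ (∣*∣≤ m₁ n₂ h₁ ℕ.≤-refl)) (∣*∣≤ γ (m₂ ℤ.* n₁) hγ (∣*∣≤ m₂ n₁ h₂ ℕ.≤-refl))) ⟩
            ↧ₙ x₀ ℕ.* (L ℕ.* (K ℕ.* ↧ₙ x₁ ℕ.* ↧ₙ x₂) ℕ.+ L ℕ.* (K ℕ.* ↧ₙ x₂ ℕ.* ↧ₙ x₁)) ≡⟨ lemma L K (↧ₙ x₀) (↧ₙ x₁) (↧ₙ x₂) ⟩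
            2 ℕ.* (L ℕ.* K) ℕ.* ↧ₙ x₀ ℕ.* (↧ₙ x₁ ℕ.* ↧ₙ x₂) ∎)
          where
          open ℕ.≤-Reasoning
          lemma : ∀ L K a b c → a ℕ.* (L ℕ.* (K ℕ.* b ℕ.* c) ℕ.+ L ℕ.* (K ℕ.* c ℕ.* b)) ≡ 2 ℕ.* (L ℕ.* K) ℕ.* a ℕ.* (b ℕ.* c)
          lemma = ℕ-identity 5 (λ L K a b c → a ⊗ (L ⊗ (K ⊗ b ⊗ c) ⊕ L ⊗ (K ⊗ c ⊗ b)) ⊜ Κ 2 ⊗ (L ⊗ K) ⊗ a ⊗ (b ⊗ c)) refl

      bound : H x₀ ≤ 2 ℕ.* (L ℕ.* K) ℕ.* L
      bound = height-bound numerator denominator (ℕ.≤-trans (1≤m*n 1≤L 1≤K) (ℕ.m≤m+n (L ℕ.* K) _))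

    -- The relation between the ordinates with the ordinates eliminated by squaring twice. They
    -- cannot be kept: abscissas are going to be scaled by a unit of weight 2, and a quantity of
    -- weight 3 would need its square root.
    SquaresRelation : ℤ → ℤ → Set
    SquaresRelation A B = (q α * q α * Z x₀ - (q β * q β * Z x₁ + q γ * q γ * Z x₂)) * (q α * q α * Z x₀ - (q β * q β * Z x₁ + q γ * q γ * Z x₂)) ≡
        q (+ 4) * ((q β * q γ) * (q β * q γ) * (Z x₁ * Z x₂))
      where
      Z : ℚ → ℚ
      Z x = x * x * x + q A * x + q B

    module Quadratic (A B : ℤ) (M : ℕ) (1≤M : 1 ≤ M) (hA : ∣ A ∣ ≤ M) (hB : ∣ B ∣ ≤ M)
      (relation : SquaresRelation A B) where

      private
        Z : ℚ → ℚ
        Z x = x * x * x + q A * x + q B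

        N f : ℚ → ℤ
        N x = ↧ x ℤ.* (↧ x ℤ.* ↧ x)
        f x = ↥ x ℤ.* (↥ x ℤ.* ↥ x) ℤ.+ ↧ x ℤ.* (A ℤ.* ↥ x ℤ.* ↧ x ℤ.+ B ℤ.* ↧ x ℤ.* ↧ x)

        Nₙ : ℚ → ℕ
        Nₙ x = ↧ₙ x ℕ.* (↧ₙ x ℕ.* ↧ₙ x)

        abs-N : ∀ x → ∣ N x ∣ ≡ Nₙ x
        abs-N x = abs-*² (↧ x) (↧ x) (↧ x)

        1≤N : ∀ x → 1 ≤ Nₙ x
        1≤N x = 1≤m*n (1≤↧ x) (1≤m*n (1≤↧ x) (1≤↧ x))

        int-N : ∀ x → Int (q (↧ x) * (q (↧ x) * q (↧ x))) (N x)
        int-N x = int-* (int-q (↧ x)) (int-* (int-q (↧ x)) (int-q (↧ x)))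

        int-f : ∀ x → Int (Z x * (q (↧ x) * (q (↧ x) * q (↧ x)))) (f x)
        int-f x = int (trans (lemma (q A) (q B) x (q (↧ x))) (int≡ (int-+ (int-* X (int-* X X))
            (int-* n (int-+ (int-* (int-* (int-q A) X) n) (int-* (int-* (int-q B) n) n))))))
          where
          X = int-clear x
          n = int-q (↧ x)
          lemma : ∀ A B x n → (x * x * x + A * x + B) * (n * (n * n)) ≡ (x * n) * ((x * n) * (x * n)) + n * (A * (x * n) * n + B * n * n)
          lemma = ℚ-identity 4 (λ A B x n → (x ⊗ x ⊗ x ⊕ A ⊗ x ⊕ B) ⊗ (n ⊗ (n ⊗ n)) ⊜ (x ⊗ n) ⊗ ((x ⊗ n) ⊗ (x ⊗ n)) ⊕ n ⊗ (A ⊗ (x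
              ⊗ n) ⊗ n ⊕ B ⊗ n ⊗ n)) refl

        t G : ℤ
        t = f x₀ ℤ.* (N x₁ ℤ.* (N x₂ ℤ.* (α ℤ.* α)))
        G = β ℤ.* β ℤ.* (f x₁ ℤ.* N x₂) ℤ.+ γ ℤ.* γ ℤ.* (f x₂ ℤ.* N x₁)

        clear : ∀ α β γ u v w a b c →
          (α * α * u - (β * β * v + γ * γ * w)) * (α * α * u - (β * β * v + γ * γ * w)) ≡ q (+ 4) * ((β * γ) * (β * γ) * (v * w)) →
          ((u * a) * (b * (c * (α * α))) - a * (β * β * ((v * b) * c) + γ * γ * ((w * c) * b))) *
          ((u * a) * (b * (c * (α * α))) - a * (β * β * ((v * b) * c) + γ * γ * ((w * c) * b))) ≡
          a * (a * (q (+ 4) * ((β * γ) * (β * γ) * (((v * b) * c) * ((w * c) * b)))))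
        clear α β γ u v w a b c h = byLinComb (a * a * b * b * c * c · h) (ℚ-identity 9 (λ α β γ u v w a b c → (u ⊗ a ⊗ (b ⊗ (c ⊗
            (α ⊗ α))) ⊖ a ⊗ (β ⊗ β ⊗ (v ⊗ b ⊗ c) ⊕ γ ⊗ γ ⊗ (w ⊗ c ⊗ b))) ⊗ (u ⊗ a ⊗ (b ⊗ (c ⊗ (α ⊗ α))) ⊖ a ⊗ (β ⊗ β ⊗ (v ⊗ b ⊗ c)
            ⊕ γ ⊗ γ ⊗ (w ⊗ c ⊗ b))) ⊖ a ⊗ (a ⊗ (# 4 ⊗ (β ⊗ γ ⊗ (β ⊗ γ) ⊗ (v ⊗ b ⊗ c ⊗ (w ⊗ c ⊗ b))))) ⊜ a ⊗ a ⊗ b ⊗ b ⊗ c ⊗ c ⊗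
            ((α ⊗ α ⊗ u ⊖ (β ⊗ β ⊗ v ⊕ γ ⊗ γ ⊗ w)) ⊗ (α ⊗ α ⊗ u ⊖ (β ⊗ β ⊗ v ⊕ γ ⊗ γ ⊗ w)) ⊖ # 4 ⊗ (β ⊗ γ ⊗ (β ⊗ γ) ⊗ (v ⊗ w))))
            refl α β γ u v w a b c)

        cleared : (t ℤ.- N x₀ ℤ.* G) ℤ.* (t ℤ.- N x₀ ℤ.* G) ≡
          N x₀ ℤ.* (N x₀ ℤ.* (+ 4 ℤ.* ((β ℤ.* γ) ℤ.* (β ℤ.* γ) ℤ.* ((f x₁ ℤ.* N x₂) ℤ.* (f x₂ ℤ.* N x₁)))))
        cleared = int-equal (int-* side side)
          (int-* (int-N x₀) (int-* (int-N x₀) (int-* (int-q (+ 4)) (int-* (int-* βγ βγ) (int-* (int-* (int-f x₁) (int-N x₂)) (int-* (int-f x₂) (int-N x₁)))))))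
          (clear (q α) (q β) (q γ) (Z x₀) (Z x₁) (Z x₂) _ _ _ relation)
          where
          βγ = int-* (int-q β) (int-q γ)
          side = int-+ (int-* (int-f x₀) (int-* (int-N x₁) (int-* (int-N x₂) (int-* (int-q α) (int-q α)))))
            (int-neg (int-* (int-N x₀) (int-+ (int-* (int-* (int-q β) (int-q β)) (int-* (int-f x₁) (int-N x₂)))
              (int-* (int-* (int-q γ) (int-q γ)) (int-* (int-f x₂) (int-N x₁))))))

        -- `f x₀`, the numerator of `Z x₀` over `n₀³`, is congruent to `m₀³` modulo `n₀`.
        coprime-f : Coprime (↧ₙ x₀) ∣ f x₀ ∣
        coprime-f {i} (ℕ.divides a n≡ , i∣f) = ℕ.∣1⇒≡1 (coprime-divisor cop (coprime-divisor cop (coprime-divisor cop i∣m³)))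
          where
          cop : Coprime i ∣ m₀ ∣
          cop (d∣i , d∣m) = coprime-↥-↧ x₀ (d∣m , ℕ.∣-trans d∣i (ℕ.divides a n≡))
          i∣m³ : i ℕ.∣ ∣ m₀ ∣ ℕ.* (∣ m₀ ∣ ℕ.* (∣ m₀ ∣ ℕ.* 1))
          i∣m³ = subst (i ℕ.∣_) (trans (abs-*² m₀ m₀ m₀) (cong (λ k → ∣ m₀ ∣ ℕ.* (∣ m₀ ∣ ℕ.* k)) (sym (ℕ.*-identityʳ ∣ m₀ ∣)))) (split i∣f)
            where
            split : i ℕ.∣ ∣ f x₀ ∣ → i ℕ.∣ ∣ m₀ ℤ.* (m₀ ℤ.* m₀) ∣
            split h with Signed.∣ᵤ⇒∣ {+ i} {f x₀} h
            ... | Signed.divides c f≡ = ∣-sum≡0 {m₀ ℤ.* (m₀ ℤ.* m₀)} {+ i} {+ a ℤ.* k ℤ.- c}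
                  (trans (lemma (m₀ ℤ.* (m₀ ℤ.* m₀)) (+ i) (+ a) k c) (trans (cong (λ n → m₀ ℤ.* (m₀ ℤ.* m₀) ℤ.+ n ℤ.* k ℤ.- c ℤ.* + i)
                    (sym (trans (cong +_ n≡) (ℤ.pos-* a i)))) (trans (cong (λ z → f x₀ ℤ.- z) (sym f≡)) (ℤ.+-inverseʳ (f x₀)))))
              where
              k = A ℤ.* m₀ ℤ.* n₀ ℤ.+ B ℤ.* n₀ ℤ.* n₀
              lemma : ∀ m i a k c → m ℤ.+ i ℤ.* (a ℤ.* k ℤ.- c) ≡ m ℤ.+ a ℤ.* i ℤ.* k ℤ.- c ℤ.* i
              lemma = ℤ-identity 5 (λ m i a k c → m ⊕ i ⊗ (a ⊗ k ⊖ c) ⊜ m ⊕ a ⊗ i ⊗ k ⊖ c ⊗ i) refl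

        coprime-N : ∀ {x} → Coprime (↧ₙ x₀) (↧ₙ x) → Coprime (↧ₙ x₀) (Nₙ x)
        coprime-N {x} c = coprime-* {↧ₙ x₀} {↧ₙ x} {↧ₙ x ℕ.* ↧ₙ x} c (coprime-* {↧ₙ x₀} {↧ₙ x} {↧ₙ x} c c)

        D : ℕ
        D = ∣ f x₀ ∣ ℕ.* (Nₙ x₁ ℕ.* Nₙ x₂)

        abs-t : ∣ t ∣ ≡ D ℕ.* ∣ α ℤ.* α ∣
        abs-t = trans (ℤ.abs-* (f x₀) (N x₁ ℤ.* (N x₂ ℤ.* (α ℤ.* α)))) (trans (cong (∣ f x₀ ∣ ℕ.*_) (trans (abs-*² (N x₁) (N x₂) (α ℤ.* α))
          (cong₂ (λ u v → u ℕ.* (v ℕ.* ∣ α ℤ.* α ∣)) (abs-N x₁) (abs-N x₂)))) (lemma (∣ f x₀ ∣) (Nₙ x₁) (Nₙ x₂) (∣ α ℤ.* α ∣)))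
          where
          lemma : ∀ a b c d → a ℕ.* (b ℕ.* (c ℕ.* d)) ≡ a ℕ.* (b ℕ.* c) ℕ.* d
          lemma = ℕ-identity 4 (λ a b c d → a ⊗ (b ⊗ (c ⊗ d)) ⊜ a ⊗ (b ⊗ c) ⊗ d) refl

        -- Modulo `n₀` the cleared relation reads `t² = 0`, and `t` is `α²` times factors prime to
        -- `n₀`; so `n₀` divides `α⁴`.
        denominator : ↧ₙ x₀ ≤ (L ℕ.* L) ℕ.* (L ℕ.* L)
        denominator = ℕ.≤-trans (ℕ.∣⇒≤ {{ℕ.>-nonZero (1≤m*n 1≤αα 1≤αα)}}
            (coprime-divisor cop (coprime-divisor cop (subst (↧ₙ x₀ ℕ.∣_) abs-t² n₀∣t²)))) (ℕ.*-mono-≤ αα≤ αα≤)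
          where
          W = + 4 ℤ.* ((β ℤ.* γ) ℤ.* (β ℤ.* γ) ℤ.* ((f x₁ ℤ.* N x₂) ℤ.* (f x₂ ℤ.* N x₁)))
          αα≤ : ∣ α ℤ.* α ∣ ≤ L ℕ.* L
          αα≤ = ∣*∣≤ α α hα hα
          1≤αα : 1 ≤ ∣ α ℤ.* α ∣
          1≤αα = subst (1 ≤_) (sym (ℤ.abs-* α α)) (1≤m*n (1≤∣∣ α≢0) (1≤∣∣ α≢0))
          cop : Coprime (↧ₙ x₀) D
          cop = coprime-* {↧ₙ x₀} {∣ f x₀ ∣} {Nₙ x₁ ℕ.* Nₙ x₂} coprime-f
            (coprime-* {↧ₙ x₀} {Nₙ x₁} {Nₙ x₂} (coprime-N {x₁} coprime₁) (coprime-N {x₂} coprime₂))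
          abs-t² : ∣ t ℤ.* t ∣ ≡ D ℕ.* (D ℕ.* (∣ α ℤ.* α ∣ ℕ.* ∣ α ℤ.* α ∣))
          abs-t² = trans (ℤ.abs-* t t) (trans (cong₂ ℕ._*_ abs-t abs-t) (lemma D (∣ α ℤ.* α ∣)))
            where
            lemma : ∀ d a → d ℕ.* a ℕ.* (d ℕ.* a) ≡ d ℕ.* (d ℕ.* (a ℕ.* a))
            lemma = ℕ-identity 2 (λ d a → d ⊗ a ⊗ (d ⊗ a) ⊜ d ⊗ (d ⊗ (a ⊗ a))) refl
          lemma : ∀ t n G W → t ℤ.* t ℤ.+ n ℤ.* ((n ℤ.* n) ℤ.* (n ℤ.* (n ℤ.* n) ℤ.* G ℤ.* G ℤ.- + 2 ℤ.* t ℤ.* G ℤ.- n ℤ.* (n ℤ.* n) ℤ.* W)) ≡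
            (t ℤ.- n ℤ.* (n ℤ.* n) ℤ.* G) ℤ.* (t ℤ.- n ℤ.* (n ℤ.* n) ℤ.* G) ℤ.- n ℤ.* (n ℤ.* n) ℤ.* (n ℤ.* (n ℤ.* n) ℤ.* W)
          lemma = ℤ-identity 4 (λ t n G W → t ⊗ t ⊕ n ⊗ ((n ⊗ n) ⊗ (n ⊗ (n ⊗ n) ⊗ G ⊗ G ⊖ Κ (+ 2) ⊗ t ⊗ G ⊖ n ⊗ (n ⊗ n) ⊗ W)) ⊜ (t
              ⊖ n ⊗ (n ⊗ n) ⊗ G) ⊗ (t ⊖ n ⊗ (n ⊗ n) ⊗ G) ⊖ n ⊗ (n ⊗ n) ⊗ (n ⊗ (n ⊗ n) ⊗ W)) refl
          n₀∣t² : ↧ₙ x₀ ℕ.∣ ∣ t ℤ.* t ∣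
          n₀∣t² = ∣-sum≡0 {t ℤ.* t} {n₀} {(n₀ ℤ.* n₀) ℤ.* (N x₀ ℤ.* G ℤ.* G ℤ.- + 2 ℤ.* t ℤ.* G ℤ.- N x₀ ℤ.* W)} (trans (lemma t n₀ G W)
            (trans (cong (ℤ._- N x₀ ℤ.* (N x₀ ℤ.* W)) cleared) (ℤ.+-inverseʳ (N x₀ ℤ.* (N x₀ ℤ.* W)))))

        -- `F` absorbs `K³ + M K + M`. In `c` the factor 4 is 2 + 2: one 2 is the square root of the
        -- 4 in `cleared`, the other counts the two terms of `G`.
        F c : ℕ
        F = 3 ℕ.* (M ℕ.* (K ℕ.* (K ℕ.* K)))
        c = 4 ℕ.* (L ℕ.* L ℕ.* F)

        f-bound : ∀ x → Bounded K x → ∣ f x ∣ ≤ F ℕ.* Nₙ x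
        f-bound x h = begin
          ∣ f x ∣ ≤⟨ ∣+∣≤ (↥ x ℤ.* (↥ x ℤ.* ↥ x)) (↧ x ℤ.* rest) (∣*∣≤ (↥ x) (↥ x ℤ.* ↥ x) h (∣*∣≤ (↥ x) (↥ x) h h))
              (∣*∣≤ (↧ x) rest ℕ.≤-refl (∣+∣≤ (A ℤ.* ↥ x ℤ.* ↧ x) (B ℤ.* ↧ x ℤ.* ↧ x)
                (∣*∣≤ (A ℤ.* ↥ x) (↧ x) (∣*∣≤ A (↥ x) hA h) ℕ.≤-refl) (∣*∣≤ (B ℤ.* ↧ x) (↧ x) (∣*∣≤ B (↧ x) hB ℕ.≤-refl) ℕ.≤-refl))) ⟩
          K ℕ.* n ℕ.* (K ℕ.* n ℕ.* (K ℕ.* n)) ℕ.+ n ℕ.* (M ℕ.* (K ℕ.* n) ℕ.* n ℕ.+ M ℕ.* n ℕ.* n) ≡⟨ lemma K M n ⟩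
          (K³ ℕ.+ M ℕ.* K ℕ.+ M) ℕ.* Nₙ x ≤⟨ ℕ.*-monoˡ-≤ (Nₙ x) (ℕ.+-mono-≤ (ℕ.+-mono-≤
              (ℕ.≤-trans (m≤m*n′ {K³} {M} 1≤M) (ℕ.≤-reflexive (ℕ.*-comm K³ M))) (ℕ.*-monoʳ-≤ M (m≤m*n′ {K} {K ℕ.* K} (1≤m*n 1≤K 1≤K)))) (m≤m*n′ {M} {K³} (1≤m*n 1≤K (1≤m*n 1≤K 1≤K)))) ⟩
          (M ℕ.* K³ ℕ.+ M ℕ.* K³ ℕ.+ M ℕ.* K³) ℕ.* Nₙ x ≡⟨ cong (ℕ._* Nₙ x) (lemma′ (M ℕ.* K³)) ⟩
          F ℕ.* Nₙ x ∎
          where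
          open ℕ.≤-Reasoning
          rest = A ℤ.* ↥ x ℤ.* ↧ x ℤ.+ B ℤ.* ↧ x ℤ.* ↧ x
          n = ↧ₙ x
          K³ = K ℕ.* (K ℕ.* K)
          lemma : ∀ K M n → K ℕ.* n ℕ.* (K ℕ.* n ℕ.* (K ℕ.* n)) ℕ.+ n ℕ.* (M ℕ.* (K ℕ.* n) ℕ.* n ℕ.+ M ℕ.* n ℕ.* n) ≡
            (K ℕ.* (K ℕ.* K) ℕ.+ M ℕ.* K ℕ.+ M) ℕ.* (n ℕ.* (n ℕ.* n))
          lemma = ℕ-identity 3 (λ K M n → K ⊗ n ⊗ (K ⊗ n ⊗ (K ⊗ n)) ⊕ n ⊗ (M ⊗ (K ⊗ n) ⊗ n ⊕ M ⊗ n ⊗ n) ⊜ (K ⊗ (K ⊗ K) ⊕ M ⊗ K ⊕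
              M) ⊗ (n ⊗ (n ⊗ n))) refl
          lemma′ : ∀ a → a ℕ.+ a ℕ.+ a ≡ 3 ℕ.* a
          lemma′ = ℕ-identity 1 (λ a → a ⊕ a ⊕ a ⊜ Κ 3 ⊗ a) refl

        -- `cleared` bounds the square of `t - N₀ G`, and `G` is bounded termwise; together they
        -- bound `t`, from which the nonzero factor `α²` is dropped.
        f₀-bound : Bounded K x₁ → Bounded K x₂ → ∣ f x₀ ∣ ≤ c ℕ.* Nₙ x₀
        f₀-bound h₁ h₂ = ℕ.*-cancelʳ-≤ ∣ f x₀ ∣ (c ℕ.* Nₙ x₀) (N₁ ℕ.* N₂) {{ℕ.>-nonZero (1≤m*n (1≤N x₁) (1≤N x₂))}} (begin
          ∣ f x₀ ∣ ℕ.* (N₁ ℕ.* N₂) ≤⟨ m≤m*n′ (subst (1 ≤_) (sym (ℤ.abs-* α α)) (1≤m*n (1≤∣∣ α≢0) (1≤∣∣ α≢0))) ⟩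
          D ℕ.* ∣ α ℤ.* α ∣ ≡⟨ abs-t ⟨
          ∣ t ∣ ≡⟨ cong ∣_∣ (split t (N x₀ ℤ.* G)) ⟩
          ∣ (t ℤ.- N x₀ ℤ.* G) ℤ.+ N x₀ ℤ.* G ∣ ≤⟨ ∣+∣≤ (t ℤ.- N x₀ ℤ.* G) (N x₀ ℤ.* G) side≤ (∣*∣≤ (N x₀) G (ℕ.≤-reflexive (abs-N x₀)) G≤) ⟩
          2 ℕ.* (LL ℕ.* (F ℕ.* (N₀ ℕ.* (N₁ ℕ.* N₂)))) ℕ.+ N₀ ℕ.* (LL ℕ.* (F ℕ.* N₁ ℕ.* N₂) ℕ.+ LL ℕ.* (F ℕ.* N₂ ℕ.* N₁)) ≡⟨ lemma LL F N₀ N₁ N₂ ⟩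
          c ℕ.* Nₙ x₀ ℕ.* (N₁ ℕ.* N₂) ∎)
          where
          open ℕ.≤-Reasoning
          LL = L ℕ.* L
          N₀ = Nₙ x₀
          N₁ = Nₙ x₁
          N₂ = Nₙ x₂
          split : ∀ t u → t ≡ (t ℤ.- u) ℤ.+ u
          split = ℤ-identity 2 (λ t u → t ⊜ (t ⊖ u) ⊕ u) refl
          fN≤ : ∀ x y → Bounded K x → ∣ f x ℤ.* N y ∣ ≤ F ℕ.* Nₙ x ℕ.* Nₙ y
          fN≤ x y h = ∣*∣≤ (f x) (N y) (f-bound x h) (ℕ.≤-reflexive (abs-N y))
          G≤ : ∣ G ∣ ≤ LL ℕ.* (F ℕ.* N₁ ℕ.* N₂) ℕ.+ LL ℕ.* (F ℕ.* N₂ ℕ.* N₁)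
          G≤ = ∣+∣≤ (β ℤ.* β ℤ.* (f x₁ ℤ.* N x₂)) (γ ℤ.* γ ℤ.* (f x₂ ℤ.* N x₁))
            (∣*∣≤ (β ℤ.* β) (f x₁ ℤ.* N x₂) (∣*∣≤ β β hβ hβ) (fN≤ x₁ x₂ h₁)) (∣*∣≤ (γ ℤ.* γ) (f x₂ ℤ.* N x₁) (∣*∣≤ γ γ hγ hγ) (fN≤ x₂ x₁ h₂))
          side≤ : ∣ t ℤ.- N x₀ ℤ.* G ∣ ≤ 2 ℕ.* (LL ℕ.* (F ℕ.* (N₀ ℕ.* (N₁ ℕ.* N₂))))
          side≤ = square-cancel-≤ (begin
            ∣ t ℤ.- N x₀ ℤ.* G ∣ ℕ.* ∣ t ℤ.- N x₀ ℤ.* G ∣ ≡⟨ ℤ.abs-* (t ℤ.- N x₀ ℤ.* G) (t ℤ.- N x₀ ℤ.* G) ⟨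
            ∣ (t ℤ.- N x₀ ℤ.* G) ℤ.* (t ℤ.- N x₀ ℤ.* G) ∣ ≡⟨ cong ∣_∣ cleared ⟩
            ∣ N x₀ ℤ.* (N x₀ ℤ.* (+ 4 ℤ.* ((β ℤ.* γ) ℤ.* (β ℤ.* γ) ℤ.* ((f x₁ ℤ.* N x₂) ℤ.* (f x₂ ℤ.* N x₁))))) ∣
              ≤⟨ ∣*∣≤ (N x₀) (N x₀ ℤ.* (+ 4 ℤ.* W)) (ℕ.≤-reflexive (abs-N x₀)) (∣*∣≤ (N x₀) (+ 4 ℤ.* W) (ℕ.≤-reflexive (abs-N x₀)) (∣*∣≤ (+ 4) W ℕ.≤-refl
                (∣*∣≤ ((β ℤ.* γ) ℤ.* (β ℤ.* γ)) ((f x₁ ℤ.* N x₂) ℤ.* (f x₂ ℤ.* N x₁)) (∣*∣≤ (β ℤ.* γ) (β ℤ.* γ) (∣*∣≤ β γ hβ hγ) (∣*∣≤ β γ hβ hγ))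
                  (∣*∣≤ (f x₁ ℤ.* N x₂) (f x₂ ℤ.* N x₁) (fN≤ x₁ x₂ h₁) (fN≤ x₂ x₁ h₂))))) ⟩
            N₀ ℕ.* (N₀ ℕ.* (4 ℕ.* (LL ℕ.* LL ℕ.* (F ℕ.* N₁ ℕ.* N₂ ℕ.* (F ℕ.* N₂ ℕ.* N₁))))) ≡⟨ lemma″ LL F N₀ N₁ N₂ ⟩
            2 ℕ.* (LL ℕ.* (F ℕ.* (N₀ ℕ.* (N₁ ℕ.* N₂)))) ℕ.* (2 ℕ.* (LL ℕ.* (F ℕ.* (N₀ ℕ.* (N₁ ℕ.* N₂))))) ∎)
            where
            W = (β ℤ.* γ) ℤ.* (β ℤ.* γ) ℤ.* ((f x₁ ℤ.* N x₂) ℤ.* (f x₂ ℤ.* N x₁))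
            lemma″ : ∀ l F a b c → a ℕ.* (a ℕ.* (4 ℕ.* (l ℕ.* l ℕ.* (F ℕ.* b ℕ.* c ℕ.* (F ℕ.* c ℕ.* b))))) ≡
              2 ℕ.* (l ℕ.* (F ℕ.* (a ℕ.* (b ℕ.* c)))) ℕ.* (2 ℕ.* (l ℕ.* (F ℕ.* (a ℕ.* (b ℕ.* c)))))
            lemma″ = ℕ-identity 5 (λ l F a b c → a ⊗ (a ⊗ (Κ 4 ⊗ (l ⊗ l ⊗ (F ⊗ b ⊗ c ⊗ (F ⊗ c ⊗ b))))) ⊜ Κ 2 ⊗ (l ⊗ (F ⊗ (a ⊗ (b ⊗
                c)))) ⊗ (Κ 2 ⊗ (l ⊗ (F ⊗ (a ⊗ (b ⊗ c)))))) refl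
          lemma : ∀ l F a b c → 2 ℕ.* (l ℕ.* (F ℕ.* (a ℕ.* (b ℕ.* c)))) ℕ.+ a ℕ.* (l ℕ.* (F ℕ.* b ℕ.* c) ℕ.+ l ℕ.* (F ℕ.* c ℕ.* b)) ≡
            4 ℕ.* (l ℕ.* F) ℕ.* a ℕ.* (b ℕ.* c)
          lemma = ℕ-identity 5 (λ l F a b c → Κ 2 ⊗ (l ⊗ (F ⊗ (a ⊗ (b ⊗ c)))) ⊕ a ⊗ (l ⊗ (F ⊗ b ⊗ c) ⊕ l ⊗ (F ⊗ c ⊗ b)) ⊜ Κ 4 ⊗ (l
              ⊗ F) ⊗ a ⊗ (b ⊗ c)) refl

        large : ℕ
        large = c ℕ.+ 2 ℕ.* M ℕ.+ K

        numerator : Bounded large x₀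
        numerator = go cases
          where
          open ℕ.≤-Reasoning
          m = ∣ m₀ ∣
          n = ↧ₙ x₀
          e = c ℕ.+ 2 ℕ.* M
          big : ∣ f x₀ ∣ ≤ c ℕ.* Nₙ x₀ → n ≤ m → m ≤ e ℕ.* n
          -- For `n ≤ m` the cubic term dominates: `m³ ≤ c n³ + M m n² + M n³ ≤ e m n²`, so
          -- `m² ≤ e n² ≤ (e n)²`.
          big hf n≤m = square-cancel-≤ (ℕ.*-cancelˡ-≤ m {{ℕ.>-nonZero (ℕ.≤-trans (1≤↧ x₀) n≤m)}} (begin
            m ℕ.* (m ℕ.* m) ≡⟨ abs-*² m₀ m₀ m₀ ⟨
            ∣ m₀ ℤ.* (m₀ ℤ.* m₀) ∣ ≡⟨ cong ∣_∣ (split (m₀ ℤ.* (m₀ ℤ.* m₀)) (n₀ ℤ.* (A ℤ.* m₀ ℤ.* n₀ ℤ.+ B ℤ.* n₀ ℤ.* n₀))) ⟩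
            ∣ f x₀ ℤ.- n₀ ℤ.* (A ℤ.* m₀ ℤ.* n₀ ℤ.+ B ℤ.* n₀ ℤ.* n₀) ∣ ≤⟨ ∣-∣≤ (f x₀) (n₀ ℤ.* tail) hf (∣*∣≤ n₀ tail ℕ.≤-refl
               (∣+∣≤ (A ℤ.* m₀ ℤ.* n₀) (B ℤ.* n₀ ℤ.* n₀) (∣*∣≤ (A ℤ.* m₀) n₀ (∣*∣≤ A m₀ hA ℕ.≤-refl) ℕ.≤-refl)
                 (∣*∣≤ (B ℤ.* n₀) n₀ (∣*∣≤ B n₀ hB ℕ.≤-refl) ℕ.≤-refl))) ⟩
            c ℕ.* (n ℕ.* (n ℕ.* n)) ℕ.+ n ℕ.* (M ℕ.* m ℕ.* n ℕ.+ M ℕ.* n ℕ.* n) ≤⟨ ℕ.+-mono-≤ (ℕ.*-monoʳ-≤ c (ℕ.*-monoˡ-≤ (n ℕ.* n) n≤m))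
               (ℕ.*-monoʳ-≤ n (ℕ.+-monoʳ-≤ (M ℕ.* m ℕ.* n) (ℕ.*-monoˡ-≤ n (ℕ.*-monoʳ-≤ M n≤m)))) ⟩
            c ℕ.* (m ℕ.* (n ℕ.* n)) ℕ.+ n ℕ.* (M ℕ.* m ℕ.* n ℕ.+ M ℕ.* m ℕ.* n) ≡⟨ lemma c m n M ⟩
            m ℕ.* (e ℕ.* (n ℕ.* n)) ≤⟨ ℕ.*-monoʳ-≤ m (ℕ.*-monoˡ-≤ (n ℕ.* n) (m≤m*n′ {e} 1≤e)) ⟩
            m ℕ.* (e ℕ.* e ℕ.* (n ℕ.* n)) ≡⟨ cong (m ℕ.*_) (lemma′ e n) ⟩
            m ℕ.* (e ℕ.* n ℕ.* (e ℕ.* n)) ∎))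
            where
            tail = A ℤ.* m₀ ℤ.* n₀ ℤ.+ B ℤ.* n₀ ℤ.* n₀
            1≤e : 1 ≤ e
            1≤e = ℕ.≤-trans 1≤M (ℕ.≤-trans (ℕ.m≤m+n M (M ℕ.+ 0)) (ℕ.m≤n+m (2 ℕ.* M) c))
            split : ∀ a b → a ≡ a ℤ.+ b ℤ.- b
            split = ℤ-identity 2 (λ a b → a ⊜ a ⊕ b ⊖ b) refl
            lemma : ∀ c m n M → c ℕ.* (m ℕ.* (n ℕ.* n)) ℕ.+ n ℕ.* (M ℕ.* m ℕ.* n ℕ.+ M ℕ.* m ℕ.* n) ≡ m ℕ.* ((c ℕ.+ 2 ℕ.* M) ℕ.* (n ℕ.* n))
            lemma = ℕ-identity 4 (λ c m n M → c ⊗ (m ⊗ (n ⊗ n)) ⊕ n ⊗ (M ⊗ m ⊗ n ⊕ M ⊗ m ⊗ n) ⊜ m ⊗ ((c ⊕ Κ 2 ⊗ M) ⊗ (n ⊗ n))) refl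
            lemma′ : ∀ e n → e ℕ.* e ℕ.* (n ℕ.* n) ≡ e ℕ.* n ℕ.* (e ℕ.* n)
            lemma′ = ℕ-identity 2 (λ e n → e ⊗ e ⊗ (n ⊗ n) ⊜ e ⊗ n ⊗ (e ⊗ n)) refl
          go : Bounded K x₀ ⊎ (Bounded K x₁ × Bounded K x₂) → m ≤ large ℕ.* n
          go (inj₁ h) = ℕ.≤-trans h (ℕ.*-monoˡ-≤ n (ℕ.m≤n+m K e))
          go (inj₂ (h₁ , h₂)) = small-or-big (ℕ.≤-total m n)
            where
            small-or-big : m ≤ n ⊎ n ≤ m → m ≤ large ℕ.* n
            small-or-big (inj₁ m≤n) = ℕ.≤-trans m≤n (ℕ.≤-trans (m≤m*n′ (ℕ.≤-trans 1≤K (ℕ.m≤n+m K e))) (ℕ.≤-reflexive (ℕ.*-comm n large)))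
            small-or-big (inj₂ n≤m) = ℕ.≤-trans (big (f₀-bound h₁ h₂) n≤m) (ℕ.*-monoˡ-≤ n (ℕ.m≤m+n e K))

      bound : H x₀ ≤ (4 ℕ.* (L ℕ.* L ℕ.* (3 ℕ.* (M ℕ.* (K ℕ.* (K ℕ.* K))))) ℕ.+ 2 ℕ.* M ℕ.+ K) ℕ.* ((L ℕ.* L) ℕ.* (L ℕ.* L))
      bound = height-bound numerator denominator (ℕ.≤-trans 1≤K (ℕ.m≤n+m K (c ℕ.+ 2 ℕ.* M)))

-- Integral coordinates from a small difference, and bounds for close triples

module CloseTriple where

  open import Defs using (q)
  open RationalAlgebra
  open RationalHeight
  open WeightedHeight
  open ShortWeierstrass
  open CollinearPair
  open LinearTriple
  open import Data.Nat as ℕ using (ℕ; _≤_; z≤n; s≤s)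
  import Data.Nat.Properties as ℕ
  open import Data.Integer as ℤ using (ℤ; +_; ∣_∣)
  import Data.Integer.Properties as ℤ
  open import Data.Rational using (ℚ; 0ℚ; _+_; _*_; _-_; -_; 1/_; ↥_; ↧_; ↧ₙ_; ≢-nonZero; NonZero)
  open import Data.Rational.Properties hiding (≤-trans; ≤-reflexive)
  open import Data.Product using (∃; _×_; _,_; proj₁; proj₂)
  open import Relation.Nullary using (contradiction)
  open import Relation.Binary.PropositionalEquality

  -- Dividing by the unit u = S₁ / d, with d a common denominator, makes A, B, S₁, S₂ integral of bounded size.
  module Scaled (A B S₁ S₂ : ℚ) (S₁≢0 : S₁ ≢ 0ℚ) where

    private
      instance nz : NonZero S₁
               nz = ≢-nonZero S₁≢0

    i a b r : ℚ
    i = 1/ S₁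
    a = A * (i * i)
    b = B * (i * (i * i))
    r = S₂ * i

    d : ℤ
    d = ↧ a ℤ.* (↧ b ℤ.* ↧ r)

    h : ℕ
    h = H a ℕ.* (H b ℕ.* H r)

    1≤h : 1 ≤ h
    1≤h = 1≤m*n (1≤H a) (1≤m*n (1≤H b) (1≤H r))

    abs-d : ∣ d ∣ ≤ h
    abs-d = ∣*∣≤ (↧ a) (↧ b ℤ.* ↧ r) (↧≤H a) (∣*∣≤ (↧ b) (↧ r) (↧≤H b) (↧≤H r))

    d≢0 : d ≢ + 0
    d≢0 e = contradiction (trans (sym (trans (ℤ.abs-* (↧ a) (↧ b ℤ.* ↧ r)) (cong (↧ₙ a ℕ.*_) (ℤ.abs-* (↧ b) (↧ r))))) (cong ∣_∣ e))
      (ℕ.>⇒≢ (1≤m*n (1≤↧ a) (1≤m*n (1≤↧ b) (1≤↧ r))))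

    v : ℚ
    v = i * q d

    A′ B′ S₂′ : ℤ
    A′ = ↥ a ℤ.* (↧ b ℤ.* ↧ r) ℤ.* d
    B′ = ↥ b ℤ.* (↧ a ℤ.* ↧ r) ℤ.* (d ℤ.* d)
    S₂′ = ↥ r ℤ.* (↧ a ℤ.* ↧ b)

    A′≡ : q A′ ≡ A * (v * v)
    A′≡ = trans (sym (int≡ (int-* (int-* (int-clear a) (int-* (int-q (↧ b)) (int-q (↧ r)))) (int-q d))))
      (trans (lemma A i (q (↧ a)) (q (↧ b)) (q (↧ r)) (q d)) (cong (λ z → A * (i * z * (i * q d))) (int≡ d-int)))
      where
      d-int = int-* (int-q (↧ a)) (int-* (int-q (↧ b)) (int-q (↧ r)))
      lemma : ∀ A i x y z d → A * (i * i) * x * (y * z) * d ≡ A * (i * (x * (y * z)) * (i * d))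
      lemma = ℚ-identity 6 (λ A i x y z d → A ⊗ (i ⊗ i) ⊗ x ⊗ (y ⊗ z) ⊗ d ⊜ A ⊗ (i ⊗ (x ⊗ (y ⊗ z)) ⊗ (i ⊗ d))) refl

    B′≡ : q B′ ≡ B * (v * (v * v))
    B′≡ = trans (sym (int≡ (int-* (int-* (int-clear b) (int-* (int-q (↧ a)) (int-q (↧ r)))) (int-* (int-q d) (int-q d)))))
      (trans (lemma B i (q (↧ a)) (q (↧ b)) (q (↧ r)) (q d)) (cong (λ z → B * (i * z * (i * q d * (i * q d)))) (int≡ d-int)))
      where
      d-int = int-* (int-q (↧ a)) (int-* (int-q (↧ b)) (int-q (↧ r)))
      lemma : ∀ B i x y z d → B * (i * (i * i)) * y * (x * z) * (d * d) ≡ B * (i * (x * (y * z)) * (i * d * (i * d)))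
      lemma = ℚ-identity 6 (λ B i x y z d → B ⊗ (i ⊗ (i ⊗ i)) ⊗ y ⊗ (x ⊗ z) ⊗ (d ⊗ d) ⊜ B ⊗ (i ⊗ (x ⊗ (y ⊗ z)) ⊗ (i ⊗ d ⊗ (i ⊗ d)))) refl

    S₂′≡ : q S₂′ ≡ S₂ * v
    S₂′≡ = trans (sym (int≡ (int-* (int-clear r) (int-* (int-q (↧ a)) (int-q (↧ b))))))
      (trans (lemma S₂ i (q (↧ a)) (q (↧ b)) (q (↧ r))) (cong (λ z → S₂ * (i * z)) (int≡ d-int)))
      where
      d-int = int-* (int-q (↧ a)) (int-* (int-q (↧ b)) (int-q (↧ r)))
      lemma : ∀ S i x y z → S * i * z * (x * y) ≡ S * (i * (x * (y * z)))
      lemma = ℚ-identity 5 (λ S i x y z → S ⊗ i ⊗ z ⊗ (x ⊗ y) ⊜ S ⊗ (i ⊗ (x ⊗ (y ⊗ z)))) refl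

    S₁′≡ : q d ≡ S₁ * v
    S₁′≡ = sym (trans (sym (*-assoc S₁ i (q d))) (trans (cong (_* q d) (*-inverseʳ S₁)) (*-identityˡ (q d))))

    -- The cube is forced by `B′`, which carries two further factors `d`.
    M : ℕ
    M = h ℕ.* (h ℕ.* h)

    1≤M : 1 ≤ M
    1≤M = 1≤m*n 1≤h (1≤m*n 1≤h 1≤h)

    private
      h²≤M : h ℕ.* h ≤ M
      h²≤M = ℕ.≤-trans (m≤m*n′ 1≤h) (ℕ.≤-reflexive (ℕ.*-comm (h ℕ.* h) h))

      h≤M : h ≤ M
      h≤M = m≤m*n′ {h} (1≤m*n 1≤h 1≤h)

    abs-A′ : ∣ A′ ∣ ≤ M
    abs-A′ = ℕ.≤-trans (∣*∣≤ (↥ a ℤ.* (↧ b ℤ.* ↧ r)) d (∣*∣≤ (↥ a) (↧ b ℤ.* ↧ r) (∣↥∣≤H a) (∣*∣≤ (↧ b) (↧ r) (↧≤H b) (↧≤H r))) abs-d) h²≤M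

    abs-B′ : ∣ B′ ∣ ≤ M
    abs-B′ = ∣*∣≤ (↥ b ℤ.* (↧ a ℤ.* ↧ r)) (d ℤ.* d) (ℕ.≤-trans (∣*∣≤ (↥ b) (↧ a ℤ.* ↧ r) (∣↥∣≤H b) (∣*∣≤ (↧ a) (↧ r) (↧≤H a) (↧≤H r)))
        (ℕ.≤-reflexive (lemma (H a) (H b) (H r)))) (∣*∣≤ d d abs-d abs-d)
      where
      lemma : ∀ a b r → b ℕ.* (a ℕ.* r) ≡ a ℕ.* (b ℕ.* r)
      lemma a b r = trans (sym (ℕ.*-assoc b a r)) (trans (cong (ℕ._* r) (ℕ.*-comm b a)) (ℕ.*-assoc a b r))

    abs-S₂′ : ∣ S₂′ ∣ ≤ M
    abs-S₂′ = ℕ.≤-trans (∣*∣≤ (↥ r) (↧ a ℤ.* ↧ b) (∣↥∣≤H r) (∣*∣≤ (↧ a) (↧ b) (↧≤H a) (↧≤H b)))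
      (ℕ.≤-trans (ℕ.≤-reflexive (trans (ℕ.*-comm (H r) (H a ℕ.* H b)) (ℕ.*-assoc (H a) (H b) (H r)))) h≤M)

    abs-S₁′ : ∣ d ∣ ≤ M
    abs-S₁′ = ℕ.≤-trans abs-d h≤M

    collinear-scale : ∀ {x x′ S} S′ → q S′ ≡ S * v → Collinear A B x x′ S → Collinear (q A′) (q B′) (x * v) (x′ * v) (q S′)
    collinear-scale {x} {x′} {S} S′ e c = subst (λ A → Collinear A (q B′) (x * v) (x′ * v) (q S′)) (sym A′≡)
      (subst (λ B → Collinear (A * (v * v)) B (x * v) (x′ * v) (q S′)) (sym B′≡)
      (subst (Collinear (A * (v * v)) (B * (v * (v * v))) (x * v) (x′ * v)) (sym e) (scale A B x x′ S v c)))
      where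
      scale : ∀ A B x x′ S v → Collinear A B x x′ S → Collinear (A * (v * v)) (B * (v * (v * v))) (x * v) (x′ * v) (S * v)
      scale A B x x′ S v c = byLinComb (v * v * v * v · c) (ℚ-identity 6 (λ A B x x′ S v → (A ⊗ (v ⊗ v) ⊖ (x ⊗ v ⊗ (x′ ⊗ v) ⊕ S ⊗
          v ⊗ (x ⊗ v ⊕ x′ ⊗ v))) ⊗ (A ⊗ (v ⊗ v) ⊖ (x ⊗ v ⊗ (x′ ⊗ v) ⊕ S ⊗ v ⊗ (x ⊗ v ⊕ x′ ⊗ v))) ⊖ # 4 ⊗ ((x ⊗ v ⊕ x′ ⊗ v ⊕ S ⊗ v)
          ⊗ (x ⊗ v ⊗ (x′ ⊗ v) ⊗ (S ⊗ v) ⊕ B ⊗ (v ⊗ (v ⊗ v)))) ⊜ v ⊗ v ⊗ v ⊗ v ⊗ ((A ⊖ (x ⊗ x′ ⊕ S ⊗ (x ⊕ x′))) ⊗ (A ⊖ (x ⊗ x′ ⊕ S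
          ⊗ (x ⊕ x′))) ⊖ # 4 ⊗ ((x ⊕ x′ ⊕ S) ⊗ (x ⊗ x′ ⊗ S ⊕ B)))) refl A B x x′ S v)

    unscale : ∀ x → ∃ λ t → S₁ * t ≡ x × H t ≤ H (x * v) ℕ.* h
    unscale x = x * i , trans (lemma S₁ x i) (trans (cong (x *_) (*-inverseʳ S₁)) (*-identityʳ x)) ,
      ℕ.≤-trans (H-quotient {q d} {x * i} {x * v} (λ e → d≢0 (q-injective e)) (lemma′ x i (q d)))
        (ℕ.*-monoʳ-≤ (H (x * v)) (ℕ.≤-trans (H-q d) (ℕ.⊔-lub abs-d 1≤h)))
      where
      lemma : ∀ s x i → s * (x * i) ≡ x * (s * i)
      lemma = ℚ-identity 3 (λ s x i → s ⊗ (x ⊗ i) ⊜ x ⊗ (s ⊗ i)) refl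
      lemma′ : ∀ x i d → d * (x * i) ≡ x * (i * d)
      lemma′ = ℚ-identity 3 (λ x i d → d ⊗ (x ⊗ i) ⊜ x ⊗ (i ⊗ d)) refl

    module Points (X₀ X₁ X₂ : ℚ) (c₁ : Collinear A B X₀ X₁ S₁) (c₂ : Collinear A B X₀ X₂ S₂)
      (L : ℕ) (1≤L : 1 ≤ L) (α β γ : ℤ) (α≢0 : α ≢ + 0) (hα : ∣ α ∣ ≤ L) (hβ : ∣ β ∣ ≤ L) (hγ : ∣ γ ∣ ≤ L) where

      private
        module P₁ = Pair A′ B′ d (X₀ * v) (X₁ * v) M 1≤M abs-A′ abs-B′ abs-S₁′ (collinear-scale {X₀} {X₁} {S₁} d S₁′≡ c₁)
        module P₂ = Pair A′ B′ S₂′ (X₀ * v) (X₂ * v) M 1≤M abs-A′ abs-B′ abs-S₂′ (collinear-scale {X₀} {X₂} {S₂} S₂′ S₂′≡ c₂)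

      K : ℕ
      K = 40 ℕ.* (M ℕ.* M)

      1≤K : 1 ≤ K
      1≤K = 1≤m*n {40} (s≤s z≤n) (1≤m*n 1≤M 1≤M)

      private
        module T = LinearTriple.Triple (X₀ * v) (X₁ * v) (X₂ * v) K L 1≤K 1≤L P₁.coprime-denominators P₂.coprime-denominators
          P₁.one-bounded P₂.one-bounded α β γ α≢0 hα hβ hγ

      linear-bound : q α * X₀ + q β * X₁ + q γ * X₂ ≡ 0ℚ → H (X₀ * v) ≤ 2 ℕ.* (L ℕ.* K) ℕ.* L
      linear-bound e = T.Linear.bound (trans (lemma (q α) (q β) (q γ) X₀ X₁ X₂ v) (trans (cong (_* v) e) (*-zeroˡ v)))
        where
        lemma : ∀ α β γ x y z v → α * (x * v) + β * (y * v) + γ * (z * v) ≡ (α * x + β * y + γ * z) * v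
        lemma = ℚ-identity 7 (λ α β γ x y z v → α ⊗ (x ⊗ v) ⊕ β ⊗ (y ⊗ v) ⊕ γ ⊗ (z ⊗ v) ⊜ (α ⊗ x ⊕ β ⊗ y ⊕ γ ⊗ z) ⊗ v) refl

      -- From `α Y₀ = - (β Y₁ + γ Y₂)` one gets `α² Y₀² - β² Y₁² - γ² Y₂² = 2 β γ Y₁ Y₂`, whose
      -- square involves only squares of ordinates. These become rational in the scaled model, as
      -- `3 Y² v³`.
      quadratic-bound : ∀ {Y₀ Y₁ Y₂} → q (+ 3) * (Y₀ * Y₀) ≡ X₀ * X₀ * X₀ + A * X₀ + B →
        q (+ 3) * (Y₁ * Y₁) ≡ X₁ * X₁ * X₁ + A * X₁ + B → q (+ 3) * (Y₂ * Y₂) ≡ X₂ * X₂ * X₂ + A * X₂ + B →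
        q α * Y₀ + q β * Y₁ + q γ * Y₂ ≡ 0ℚ →
        H (X₀ * v) ≤ (4 ℕ.* (L ℕ.* L ℕ.* (3 ℕ.* (M ℕ.* (K ℕ.* (K ℕ.* K))))) ℕ.+ 2 ℕ.* M ℕ.+ K) ℕ.* ((L ℕ.* L) ℕ.* (L ℕ.* L))
      quadratic-bound {Y₀} {Y₁} {Y₂} C₀ C₁ C₂ e = T.Quadratic.bound A′ B′ M 1≤M abs-A′ abs-B′
        (trans (cong (λ s → s * s) side)
        (trans (step (q α) (q β) (q γ) Y₀ Y₁ Y₂ (v * (v * v)) e)
          (cong (λ z → q (+ 4) * ((q β * q γ) * (q β * q γ) * z)) (sym (cong₂ _*_ (Z≡ X₁ Y₁ C₁) (Z≡ X₂ Y₂ C₂))))))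
        where
        Z≡ : ∀ X Y → q (+ 3) * (Y * Y) ≡ X * X * X + A * X + B →
          X * v * (X * v) * (X * v) + q A′ * (X * v) + q B′ ≡ q (+ 3) * (Y * Y) * (v * (v * v))
        Z≡ X Y C = trans (cong₂ (λ s t → X * v * (X * v) * (X * v) + s * (X * v) + t) A′≡ B′≡)
          (trans (lemma A B X v) (cong (_* (v * (v * v))) (sym C)))
          where
          lemma : ∀ A B X v → X * v * (X * v) * (X * v) + A * (v * v) * (X * v) + B * (v * (v * v)) ≡ (X * X * X + A * X + B) * (v * (v * v))
          lemma = ℚ-identity 4 (λ A B X v → X ⊗ v ⊗ (X ⊗ v) ⊗ (X ⊗ v) ⊕ A ⊗ (v ⊗ v) ⊗ (X ⊗ v) ⊕ B ⊗ (v ⊗ (v ⊗ v)) ⊜ (X ⊗ X ⊗ X ⊕ A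
              ⊗ X ⊕ B) ⊗ (v ⊗ (v ⊗ v))) refl
        side : q α * q α * (X₀ * v * (X₀ * v) * (X₀ * v) + q A′ * (X₀ * v) + q B′) -
            (q β * q β * (X₁ * v * (X₁ * v) * (X₁ * v) + q A′ * (X₁ * v) + q B′) + q γ * q γ * (X₂ * v * (X₂ * v) * (X₂ * v) + q A′ * (X₂ * v) + q B′)) ≡
          q α * q α * (q (+ 3) * (Y₀ * Y₀) * (v * (v * v))) -
            (q β * q β * (q (+ 3) * (Y₁ * Y₁) * (v * (v * v))) + q γ * q γ * (q (+ 3) * (Y₂ * Y₂) * (v * (v * v))))
        side = cong₂ (λ s t → q α * q α * s - t) (Z≡ X₀ Y₀ C₀)
          (cong₂ (λ s t → q β * q β * s + q γ * q γ * t) (Z≡ X₁ Y₁ C₁) (Z≡ X₂ Y₂ C₂))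
        half : ∀ α β γ x y z w → α * x + β * y + γ * z ≡ 0ℚ →
          α * α * (q (+ 3) * (x * x) * w) - (β * β * (q (+ 3) * (y * y) * w) + γ * γ * (q (+ 3) * (z * z) * w)) ≡
          q (+ 3) * w * (q (+ 2) * (β * y) * (γ * z))
        half α β γ x y z w e = byLinComb (q (+ 3) * w * (α * x - β * y - γ * z) · e)
          (ℚ-identity 7 (λ α β γ x y z w → α ⊗ α ⊗ (# 3 ⊗ (x ⊗ x) ⊗ w) ⊖ (β ⊗ β ⊗ (# 3 ⊗ (y ⊗ y) ⊗ w) ⊕ γ ⊗ γ ⊗ (# 3 ⊗ (z ⊗ z) ⊗
              w)) ⊖ # 3 ⊗ w ⊗ (# 2 ⊗ (β ⊗ y) ⊗ (γ ⊗ z)) ⊜ # 3 ⊗ w ⊗ (α ⊗ x ⊖ β ⊗ y ⊖ γ ⊗ z) ⊗ (α ⊗ x ⊕ β ⊗ y ⊕ γ ⊗ z ⊖ Κ 0ℚ)) refl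
              α β γ x y z w)
        step : ∀ α β γ x y z w → α * x + β * y + γ * z ≡ 0ℚ →
          (α * α * (q (+ 3) * (x * x) * w) - (β * β * (q (+ 3) * (y * y) * w) + γ * γ * (q (+ 3) * (z * z) * w))) *
          (α * α * (q (+ 3) * (x * x) * w) - (β * β * (q (+ 3) * (y * y) * w) + γ * γ * (q (+ 3) * (z * z) * w))) ≡
          q (+ 4) * ((β * γ) * (β * γ) * ((q (+ 3) * (y * y) * w) * (q (+ 3) * (z * z) * w)))
        step α β γ x y z w e = trans (cong (λ t → t * t) (half α β γ x y z w e)) (lemma β γ y z w)
          where
          lemma : ∀ β γ y z w → q (+ 3) * w * (q (+ 2) * (β * y) * (γ * z)) * (q (+ 3) * w * (q (+ 2) * (β * y) * (γ * z))) ≡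
            q (+ 4) * ((β * γ) * (β * γ) * ((q (+ 3) * (y * y) * w) * (q (+ 3) * (z * z) * w)))
          lemma = ℚ-identity 5 (λ β γ y z w → # 3 ⊗ w ⊗ (# 2 ⊗ (β ⊗ y) ⊗ (γ ⊗ z)) ⊗ (# 3 ⊗ w ⊗ (# 2 ⊗ (β ⊗ y) ⊗ (γ ⊗ z))) ⊜ # 4 ⊗
              ((β ⊗ γ) ⊗ (β ⊗ γ) ⊗ ((# 3 ⊗ (y ⊗ y) ⊗ w) ⊗ (# 3 ⊗ (z ⊗ z) ⊗ w)))) refl

  module _ (A B D κ₁ κ₂ : ℚ) (D≢0 : D ≢ 0ℚ) (A³≡ : A * A * A ≡ κ₁ * D) (B²≡ : B * B ≡ κ₂ * D)
    (Q : ℕ) (10≤Q : 10 ≤ Q) (hκ₁ : H κ₁ ≤ Q) (hκ₂ : H κ₂ ≤ Q) where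

    open ShortModel A B D κ₁ κ₂ D≢0 A³≡ B²≡ Q 10≤Q hκ₁ hκ₂
    open Weights D D≢0 Q (ℕ.≤-trans (s≤s (s≤s z≤n)) 10≤Q)

    module _ {S₁ S₂ J K} (S₁≢0 : S₁ ≢ 0ℚ) (w₁ : Weight 2 S₁ J) (w₂ : Weight 2 S₂ K) where

      private
        open module S = Scaled A B S₁ S₂ S₁≢0 using (a; b; r; h; M; v)

        instance nzS : NonZero S₁
                 nzS = ≢-nonZero S₁≢0

        inverse : ∀ x → S₁ * (x * 1/ S₁) ≡ x
        inverse x = trans (lemma S₁ x (1/ S₁)) (trans (cong (x *_) (*-inverseʳ S₁)) (*-identityʳ x))
          where
          lemma : ∀ s x i → s * (x * i) ≡ x * (s * i)
          lemma = ℚ-identity 3 (λ s x i → s ⊗ (x ⊗ i) ⊜ x ⊗ (s ⊗ i)) refl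

        bound-a : NatBound (H a) _
        bound-a = bound-height (weight-quotient {4} {0} {S₁ * S₁} {a} {A} (*-≢0 S₁≢0 S₁≢0)
            (trans (lemma S₁ A (1/ S₁)) (trans (cong (S₁ *_) (inverse (A * 1/ S₁))) (inverse A))) (weight-* {2} {2} w₁ w₁) weight-A)
          where
          lemma : ∀ s x i → s * s * (x * (i * i)) ≡ s * (s * (x * i * i))
          lemma = ℚ-identity 3 (λ s x i → s ⊗ s ⊗ (x ⊗ (i ⊗ i)) ⊜ s ⊗ (s ⊗ (x ⊗ i ⊗ i))) refl

        bound-b : NatBound (H b) _
        bound-b = bound-height (weight-quotient {6} {0} {S₁ * (S₁ * S₁)} {b} {B} (*-≢0 S₁≢0 (*-≢0 S₁≢0 S₁≢0))
            (trans (lemma S₁ B (1/ S₁)) (trans (cong (λ z → S₁ * (S₁ * z)) (inverse (B * 1/ S₁ * 1/ S₁)))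
              (trans (cong (S₁ *_) (inverse (B * 1/ S₁))) (inverse B)))) (weight-* {2} {4} w₁ (weight-* {2} {2} w₁ w₁)) weight-B)
          where
          lemma : ∀ s x i → s * (s * s) * (x * (i * (i * i))) ≡ s * (s * (s * (x * i * i * i)))
          lemma = ℚ-identity 3 (λ s x i → s ⊗ (s ⊗ s) ⊗ (x ⊗ (i ⊗ (i ⊗ i))) ⊜ s ⊗ (s ⊗ (s ⊗ (x ⊗ i ⊗ i ⊗ i)))) refl

        bound-r : NatBound (H r) _
        bound-r = bound-height (weight-quotient {2} {0} {S₁} {r} {S₂} S₁≢0 (inverse S₂) w₁ w₂)

        bound-h : NatBound h _
        bound-h = bound-* bound-a (bound-* bound-b bound-r)

        bound-M : NatBound M _
        bound-M = bound-* bound-h (bound-* bound-h bound-h)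

        small : ∀ n → n ≤ 10 → NatBound n 1
        small n n≤ = bound-Q (ℕ.≤-trans n≤ 10≤Q)

        bound-40M² : NatBound (40 ℕ.* (M ℕ.* M)) _
        bound-40M² = bound-* (bound-* (small 4 (s≤s (s≤s (s≤s (s≤s z≤n))))) (small 10 ℕ.≤-refl)) (bound-* bound-M bound-M)

        restore : ∀ {X n N} → H (X * v) ≤ n → NatBound n N → Weight 2 X _
        restore {X} h≤ bn = subst (λ x → Weight 2 x _) (proj₁ (proj₂ (S.unscale X)))
          (weight-* {2} {0} w₁ (bound-weight (proj₂ (proj₂ (S.unscale X))) (bound-* (bound-≤ h≤ bn) bound-h)))

      module _ (X₀ X₁ X₂ : ℚ) (c₁ : Collinear A B X₀ X₁ S₁) (c₂ : Collinear A B X₀ X₂ S₂)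
        (L : ℕ) (1≤L : 1 ≤ L) (L≤Q : L ≤ Q) (α β γ : ℤ) (α≢0 : α ≢ + 0) (hα : ∣ α ∣ ≤ L) (hβ : ∣ β ∣ ≤ L) (hγ : ∣ γ ∣ ≤ L) where

        private
          module P = S.Points X₀ X₁ X₂ c₁ c₂ L 1≤L α β γ α≢0 hα hβ hγ
          bL = bound-Q L≤Q

        -- The size `M` of the scaled model is built from heights of weight 0, so the integral bound
        -- is a power of `Q`; multiplying by the unit `S₁` restores the weight of `X₀`.
        weight-linear-triple : q α * X₀ + q β * X₁ + q γ * X₂ ≡ 0ℚ → Weight 2 X₀ _
        weight-linear-triple e = restore (P.linear-bound e)
          (bound-* (bound-* (small 2 (s≤s (s≤s z≤n))) (bound-* bL bound-40M²)) bL)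

        weight-quadratic-triple : ∀ {Y₀ Y₁ Y₂} → OnCurve X₀ Y₀ → OnCurve X₁ Y₁ → OnCurve X₂ Y₂ →
          q α * Y₀ + q β * Y₁ + q γ * Y₂ ≡ 0ℚ → Weight 2 X₀ _
        weight-quadratic-triple {Y₀} {Y₁} {Y₂} C₀ C₁ C₂ e = restore (P.quadratic-bound {Y₀} {Y₁} {Y₂} C₀ C₁ C₂ e)
          (bound-* (bound-+ (bound-+ (bound-* (small 4 (s≤s (s≤s (s≤s (s≤s z≤n)))))
              (bound-* (bound-* bL bL) (bound-* (small 3 (s≤s (s≤s (s≤s z≤n)))) (bound-* bound-M (bound-* bound-40M² (bound-* bound-40M² bound-40M²))))))
            (bound-* (small 2 (s≤s (s≤s z≤n))) bound-M)) bound-40M²) (bound-* (bound-* bL bL) (bound-* bL bL)))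

-- Growth of heights under a quotient of two quartic forms

module QuarticForms where

  open import Defs using (q)
  open RationalAlgebra
  open RationalHeight
  open CollinearPair using (∣*∣≤; ∣+∣≤; 1≤m*n)
  open import Data.Nat as ℕ using (ℕ; _≤_; _⊔_)
  import Data.Nat.Properties as ℕ
  import Data.Nat.Divisibility as ℕ
  import Data.Nat.GCD as ℕ
  open import Data.Nat.Coprimality as Coprimality using (Coprime; coprime-divisor; coprime⇒gcd≡1)
  open import Data.Integer as ℤ using (ℤ; +_; ∣_∣)
  import Data.Integer.Properties as ℤ
  open import Data.Integer.Divisibility.Signed as Signed using () renaming (_∣_ to _∣ₛ_)
  open import Data.Rational using (ℚ; _+_; _*_; ↥_; ↧_; ↧ₙ_)
  open import Data.Rational.Properties hiding (≤-trans; ≤-reflexive)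
  open import Data.Sum using (_⊎_; inj₁; inj₂)
  open import Relation.Binary.PropositionalEquality

  -- Seven is 4 + 3: cubic cofactors combine two quartic forms without common zero into multiples of
  -- `n⁷` and of `m⁷`.
  pow7 : ℤ → ℤ
  pow7 m = m ℤ.* (m ℤ.* (m ℤ.* (m ℤ.* (m ℤ.* (m ℤ.* m)))))

  record Form : Set where
    constructor form
    field
      a b c d : ℤ

  cubicForm : Form → ℤ → ℤ → ℤ
  cubicForm (form a b c d) m n =
    a ℤ.* (m ℤ.* (m ℤ.* m)) ℤ.+ b ℤ.* (m ℤ.* (m ℤ.* n)) ℤ.+ c ℤ.* (m ℤ.* (n ℤ.* n)) ℤ.+ d ℤ.* (n ℤ.* (n ℤ.* n))

  size : Form → ℕ
  size (form a b c d) = ∣ a ∣ ℕ.+ ∣ b ∣ ℕ.+ ∣ c ∣ ℕ.+ ∣ d ∣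

  cubicForm-bound : ∀ F m n h → ∣ m ∣ ≤ h → ∣ n ∣ ≤ h → ∣ cubicForm F m n ∣ ≤ size F ℕ.* (h ℕ.* (h ℕ.* h))
  cubicForm-bound (form a b c d) m n h hm hn = ℕ.≤-trans
    (∣+∣≤ (A ℤ.+ B ℤ.+ C) D (∣+∣≤ (A ℤ.+ B) C (∣+∣≤ A B (term a m m m hm hm hm) (term b m m n hm hm hn)) (term c m n n hm hn hn)) (term d n n n hn hn hn))
    (ℕ.≤-reflexive (lemma (∣ a ∣) (∣ b ∣) (∣ c ∣) (∣ d ∣) (h ℕ.* (h ℕ.* h))))
    where
    A = a ℤ.* (m ℤ.* (m ℤ.* m))
    B = b ℤ.* (m ℤ.* (m ℤ.* n))
    C = c ℤ.* (m ℤ.* (n ℤ.* n))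
    D = d ℤ.* (n ℤ.* (n ℤ.* n))
    term : ∀ a x y z → ∣ x ∣ ≤ h → ∣ y ∣ ≤ h → ∣ z ∣ ≤ h → ∣ a ℤ.* (x ℤ.* (y ℤ.* z)) ∣ ≤ ∣ a ∣ ℕ.* (h ℕ.* (h ℕ.* h))
    term a x y z hx hy hz = ∣*∣≤ a (x ℤ.* (y ℤ.* z)) ℕ.≤-refl (∣*∣≤ x (y ℤ.* z) hx (∣*∣≤ y z hy hz))
    lemma : ∀ a b c d k → a ℕ.* k ℕ.+ b ℕ.* k ℕ.+ c ℕ.* k ℕ.+ d ℕ.* k ≡ (a ℕ.+ b ℕ.+ c ℕ.+ d) ℕ.* k
    lemma = ℕ-identity 5 (λ a b c d k → a ⊗ k ⊕ b ⊗ k ⊕ c ⊗ k ⊕ d ⊗ k ⊜ (a ⊕ b ⊕ c ⊕ d) ⊗ k) refl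

  divides-coprime-multiples : ∀ {g R a b} → Coprime a b → g ℕ.∣ R ℕ.* a → g ℕ.∣ R ℕ.* b → g ℕ.∣ R
  divides-coprime-multiples {g} {R} {a} {b} c ha hb = subst (g ℕ.∣_)
    (trans (sym (ℕ.c*gcd[m,n]≡gcd[cm,cn] R a b)) (trans (cong (R ℕ.*_) (coprime⇒gcd≡1 c)) (ℕ.*-identityʳ R)))
    (ℕ.gcd-greatest ha hb)

  pow7ₙ : ℕ → ℕ
  pow7ₙ h = h ℕ.* (h ℕ.* (h ℕ.* (h ℕ.* (h ℕ.* (h ℕ.* h)))))

  abs-pow7 : ∀ m → ∣ pow7 m ∣ ≡ pow7ₙ ∣ m ∣
  abs-pow7 m = step _ (step _ (step _ (step _ (step _ (ℤ.abs-* m m)))))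
    where
    step : ∀ k {l} → ∣ k ∣ ≡ l → ∣ m ℤ.* k ∣ ≡ ∣ m ∣ ℕ.* l
    step k e = trans (ℤ.abs-* m k) (cong (∣ m ∣ ℕ.*_) e)

  -- The resultant R bounds the common factor of the values N and M of two quartic forms at (m , n).
  module Resultant (N M R : ℤ) (R≢0 : R ≢ + 0) (m n : ℤ) (coprime : Coprime ∣ m ∣ ∣ n ∣) (1≤n : 1 ≤ ∣ n ∣)
    (U V U′ V′ : Form)
    (n⁷ : cubicForm U m n ℤ.* N ℤ.+ cubicForm V m n ℤ.* M ≡ R ℤ.* pow7 n)
    (m⁷ : cubicForm U′ m n ℤ.* N ℤ.+ cubicForm V′ m n ℤ.* M ≡ R ℤ.* pow7 m) where

    constant : ℕ
    constant = (size U ℕ.+ size V) ℕ.+ (size U′ ℕ.+ size V′)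

    private
      h = ∣ m ∣ ⊔ ∣ n ∣
      h³ = h ℕ.* (h ℕ.* h)

      1≤h : 1 ≤ h
      1≤h = ℕ.≤-trans 1≤n (ℕ.m≤n⊔m ∣ m ∣ ∣ n ∣)

      factor : ∀ U V g k l → N ≡ g ℤ.* k → M ≡ g ℤ.* l →
        cubicForm U m n ℤ.* N ℤ.+ cubicForm V m n ℤ.* M ≡ g ℤ.* (cubicForm U m n ℤ.* k ℤ.+ cubicForm V m n ℤ.* l)
      factor U V g k l refl refl = lemma (cubicForm U m n) (cubicForm V m n) g k l
        where
        lemma : ∀ U V g k l → U ℤ.* (g ℤ.* k) ℤ.+ V ℤ.* (g ℤ.* l) ≡ g ℤ.* (U ℤ.* k ℤ.+ V ℤ.* l)
        lemma = ℤ-identity 5 (λ U V g k l → U ⊗ (g ⊗ k) ⊕ V ⊗ (g ⊗ l) ⊜ g ⊗ (U ⊗ k ⊕ V ⊗ l)) refl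

      combination : ∀ U V k l → ∣ cubicForm U m n ℤ.* k ℤ.+ cubicForm V m n ℤ.* l ∣ ≤ (size U ℕ.+ size V) ℕ.* (h³ ℕ.* (∣ k ∣ ⊔ ∣ l ∣))
      combination U V k l = ℕ.≤-trans (∣+∣≤ (cubicForm U m n ℤ.* k) (cubicForm V m n ℤ.* l)
          (∣*∣≤ (cubicForm U m n) k (cubicForm-bound U m n h hm hn) (ℕ.m≤m⊔n ∣ k ∣ ∣ l ∣))
          (∣*∣≤ (cubicForm V m n) l (cubicForm-bound V m n h hm hn) (ℕ.m≤n⊔m ∣ k ∣ ∣ l ∣)))
        (ℕ.≤-reflexive (lemma (size U) (size V) h³ (∣ k ∣ ⊔ ∣ l ∣)))
        where
        hm = ℕ.m≤m⊔n ∣ m ∣ ∣ n ∣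
        hn = ℕ.m≤n⊔m ∣ m ∣ ∣ n ∣
        lemma : ∀ u v a b → u ℕ.* a ℕ.* b ℕ.+ v ℕ.* a ℕ.* b ≡ (u ℕ.+ v) ℕ.* (a ℕ.* b)
        lemma = ℕ-identity 4 (λ u v a b → u ⊗ a ⊗ b ⊕ v ⊗ a ⊗ b ⊜ (u ⊕ v) ⊗ (a ⊗ b)) refl

    -- The common factor `g` divides `R m⁷` and `R n⁷`, hence `R`. The larger of the two identities
    -- gives `R h⁷ ≤ g · constant · h³ · max(k , l)`, and `R h³` cancels.
    growth : ∀ g k l → N ≡ g ℤ.* k → M ≡ g ℤ.* l → h ℕ.^ 4 ≤ constant ℕ.* (∣ k ∣ ⊔ ∣ l ∣)
    growth g k l N≡ M≡ = ℕ.*-cancelˡ-≤ (∣ R ∣ ℕ.* h³) {{ℕ.>-nonZero (1≤m*n 1≤R (1≤m*n 1≤h (1≤m*n 1≤h 1≤h)))}} (begin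
        ∣ R ∣ ℕ.* h³ ℕ.* h ℕ.^ 4 ≡⟨ lemma ∣ R ∣ h ⟩
        ∣ R ∣ ℕ.* pow7ₙ h ≤⟨ max-case (ℕ.≤-total ∣ m ∣ ∣ n ∣) ⟩
        ∣ g ∣ ℕ.* (constant ℕ.* (h³ ℕ.* t)) ≤⟨ ℕ.*-monoˡ-≤ (constant ℕ.* (h³ ℕ.* t)) (ℕ.∣⇒≤ {{ℕ.>-nonZero 1≤R}} g∣R) ⟩
        ∣ R ∣ ℕ.* (constant ℕ.* (h³ ℕ.* t)) ≡⟨ lemma′ ∣ R ∣ constant h³ t ⟩
        ∣ R ∣ ℕ.* h³ ℕ.* (constant ℕ.* t) ∎)
      where
      open ℕ.≤-Reasoning
      t = ∣ k ∣ ⊔ ∣ l ∣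
      1≤R : 1 ≤ ∣ R ∣
      1≤R = ℕ.n≢0⇒n>0 (λ e → R≢0 (ℤ.∣i∣≡0⇒i≡0 e))
      n-side : ∣ R ∣ ℕ.* pow7ₙ ∣ n ∣ ≡ ∣ g ∣ ℕ.* ∣ cubicForm U m n ℤ.* k ℤ.+ cubicForm V m n ℤ.* l ∣
      n-side = trans (cong (∣ R ∣ ℕ.*_) (sym (abs-pow7 n))) (trans (sym (ℤ.abs-* R (pow7 n)))
        (trans (cong ∣_∣ (trans (sym n⁷) (factor U V g k l N≡ M≡))) (ℤ.abs-* g (cubicForm U m n ℤ.* k ℤ.+ cubicForm V m n ℤ.* l))))
      m-side : ∣ R ∣ ℕ.* pow7ₙ ∣ m ∣ ≡ ∣ g ∣ ℕ.* ∣ cubicForm U′ m n ℤ.* k ℤ.+ cubicForm V′ m n ℤ.* l ∣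
      m-side = trans (cong (∣ R ∣ ℕ.*_) (sym (abs-pow7 m))) (trans (sym (ℤ.abs-* R (pow7 m)))
        (trans (cong ∣_∣ (trans (sym m⁷) (factor U′ V′ g k l N≡ M≡))) (ℤ.abs-* g (cubicForm U′ m n ℤ.* k ℤ.+ cubicForm V′ m n ℤ.* l))))
      coprime⁷ : Coprime (pow7ₙ ∣ m ∣) (pow7ₙ ∣ n ∣)
      coprime⁷ = subst₂ Coprime (power ∣ m ∣) (power ∣ n ∣) (coprime-^ 7 coprime)
        where
        power : ∀ x → x ℕ.^ 7 ≡ pow7ₙ x
        power x = cong (λ y → x ℕ.* (x ℕ.* (x ℕ.* (x ℕ.* (x ℕ.* (x ℕ.* y)))))) (ℕ.*-identityʳ x)
      g∣R : ∣ g ∣ ℕ.∣ ∣ R ∣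
      g∣R = divides-coprime-multiples coprime⁷ (ℕ.divides s (trans m-side (ℕ.*-comm ∣ g ∣ s))) (ℕ.divides s′ (trans n-side (ℕ.*-comm ∣ g ∣ s′)))
        where
        s = ∣ cubicForm U′ m n ℤ.* k ℤ.+ cubicForm V′ m n ℤ.* l ∣
        s′ = ∣ cubicForm U m n ℤ.* k ℤ.+ cubicForm V m n ℤ.* l ∣
      max-case : (∣ m ∣ ≤ ∣ n ∣) ⊎ (∣ n ∣ ≤ ∣ m ∣) → ∣ R ∣ ℕ.* pow7ₙ h ≤ ∣ g ∣ ℕ.* (constant ℕ.* (h³ ℕ.* t))
      max-case (inj₁ m≤n) = ℕ.≤-trans (ℕ.≤-reflexive (trans (cong (λ x → ∣ R ∣ ℕ.* pow7ₙ x) (ℕ.m≤n⇒m⊔n≡n m≤n)) n-side))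
        (ℕ.*-monoʳ-≤ ∣ g ∣ (ℕ.≤-trans (combination U V k l) (ℕ.*-monoˡ-≤ (h³ ℕ.* t) (ℕ.m≤m+n (size U ℕ.+ size V) _))))
      max-case (inj₂ n≤m) = ℕ.≤-trans (ℕ.≤-reflexive (trans (cong (λ x → ∣ R ∣ ℕ.* pow7ₙ x) (ℕ.m≥n⇒m⊔n≡m n≤m)) m-side))
        (ℕ.*-monoʳ-≤ ∣ g ∣ (ℕ.≤-trans (combination U′ V′ k l) (ℕ.*-monoˡ-≤ (h³ ℕ.* t) (ℕ.m≤n+m (size U′ ℕ.+ size V′) (size U ℕ.+ size V)))))
      lemma : ∀ R h → R ℕ.* (h ℕ.* (h ℕ.* h)) ℕ.* (h ℕ.* (h ℕ.* (h ℕ.* (h ℕ.* 1)))) ≡ R ℕ.* (h ℕ.* (h ℕ.* (h ℕ.* (h ℕ.* (h ℕ.* (h ℕ.* h))))))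
      lemma = ℕ-identity 2 (λ R h → R ⊗ (h ⊗ (h ⊗ h)) ⊗ (h ⊗ (h ⊗ (h ⊗ (h ⊗ Κ 1)))) ⊜ R ⊗ (h ⊗ (h ⊗ (h ⊗ (h ⊗ (h ⊗ (h ⊗ h))))))) refl
      lemma′ : ∀ R c h t → R ℕ.* (c ℕ.* (h ℕ.* t)) ≡ R ℕ.* h ℕ.* (c ℕ.* t)
      lemma′ = ℕ-identity 4 (λ R c h t → R ⊗ (c ⊗ (h ⊗ t)) ⊜ R ⊗ h ⊗ (c ⊗ t)) refl

  module Coordinate (w : ℚ) (N M R : ℤ) (R≢0 : R ≢ + 0) (U V U′ V′ : Form)
    (n⁷ : cubicForm U (↥ w) (↧ w) ℤ.* N ℤ.+ cubicForm V (↥ w) (↧ w) ℤ.* M ≡ R ℤ.* pow7 (↧ w))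
    (m⁷ : cubicForm U′ (↥ w) (↧ w) ℤ.* N ℤ.+ cubicForm V′ (↥ w) (↧ w) ℤ.* M ≡ R ℤ.* pow7 (↥ w)) where

    open Resultant N M R R≢0 (↥ w) (↧ w) (coprime-↥-↧ w) (1≤↧ w) U V U′ V′ n⁷ m⁷ public using (constant)
    open Resultant N M R R≢0 (↥ w) (↧ w) (coprime-↥-↧ w) (1≤↧ w) U V U′ V′ n⁷ m⁷ using (growth)

    -- The image is the point at infinity with coordinates (1 : 0), so the common factor is `N`
    -- itself.
    growth-infinite : M ≡ + 0 → H w ℕ.^ 4 ≤ constant
    growth-infinite M≡0 = ℕ.≤-trans (growth N (+ 1) (+ 0) (sym (ℤ.*-identityʳ N)) (trans M≡0 (sym (ℤ.*-zeroʳ N)))) (ℕ.≤-reflexive (ℕ.*-identityʳ constant))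

    growth-finite : ∀ w′ → w′ * q M ≡ q N → H w ℕ.^ 4 ≤ constant ℕ.* H w′
    growth-finite w′ e = conclude (Signed.∣ᵤ⇒∣ {↧ w′} {M} l∣M)
      where
      k = ↥ w′
      l = ↧ w′
      cross : k ℤ.* M ≡ N ℤ.* l
      cross = int-equal (int-* (int-clear w′) (int-q M)) (int-* (int-q N) (int-q l))
        (trans (lemma w′ (q l) (q M)) (cong (_* q l) e))
        where
        lemma : ∀ w l M → w * l * M ≡ w * M * l
        lemma = ℚ-identity 3 (λ w l M → w ⊗ l ⊗ M ⊜ w ⊗ M ⊗ l) refl
      l∣M : ↧ₙ w′ ℕ.∣ ∣ M ∣
      l∣M = coprime-divisor (Coprimality.sym (coprime-↥-↧ w′)) (ℕ.divides ∣ N ∣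
        (trans (sym (ℤ.abs-* k M)) (trans (cong ∣_∣ cross) (ℤ.abs-* N l))))
      conclude : l ∣ₛ M → H w ℕ.^ 4 ≤ constant ℕ.* H w′
      conclude (Signed.divides g M≡) = growth g k l N≡ M≡
        where
        lemma : ∀ k g l → k ℤ.* (g ℤ.* l) ≡ g ℤ.* k ℤ.* l
        lemma = ℤ-identity 3 (λ k g l → k ⊗ (g ⊗ l) ⊜ g ⊗ k ⊗ l) refl
        N≡ : N ≡ g ℤ.* k
        N≡ = ℤ.*-cancelʳ-≡ N (g ℤ.* k) l {{ℤ.≢-nonZero {l} (λ z → ℕ.>⇒≢ (1≤↧ w′) (cong ∣_∣ z))}}
          (trans (sym cross) (trans (cong (k ℤ.*_) M≡) (lemma k g l)))

-- The duplication map in homogeneous coordinates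

module DuplicationForms where

  open import Defs using (q)
  open RationalAlgebra
  open RationalHeight
  open QuarticForms
  open import Data.Nat as ℕ using (ℕ; _≤_)
  import Data.Nat.Properties as ℕ
  open import Data.Integer as ℤ using (ℤ; +_; -[1+_])
  import Data.Integer.Properties as ℤ
  open import Data.Rational using (ℚ; 0ℚ; 1ℚ; _+_; _*_; _-_; -_; ↥_; ↧_)
  open import Data.Rational.Properties hiding (≤-trans; ≤-reflexive)
  open import Relation.Binary.PropositionalEquality

  private
    int-form : ∀ a b c d {x y m n} → Int x m → Int y n →
      Int (q a * (x * (x * x)) + q b * (x * (x * y)) + q c * (x * (y * y)) + q d * (y * (y * y))) (cubicForm (form a b c d) m n)
    int-form a b c d X Y = int-+ (int-+ (int-+ (int-* (int-q a) (int-* X (int-* X X))) (int-* (int-q b) (int-* X (int-* X Y))))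
      (int-* (int-q c) (int-* X (int-* Y Y)))) (int-* (int-q d) (int-* Y (int-* Y Y)))

    int-pow7 : ∀ {x m} → Int x m → Int (x * (x * (x * (x * (x * (x * x)))))) (pow7 m)
    int-pow7 X = int-* X (int-* X (int-* X (int-* X (int-* X (int-* X X)))))

  -- `N / M` is the homogenised duplication formula, numerator `X⁴ - 2AX² - 8BX + A²` and
  -- denominator `4 (X³ + AX + B)`. The cubic forms in `n⁷` and `m⁷` are Bézout cofactors producing
  -- `R = 4 (4A³ + 27B²)`.
  module GeneralForms (A B : ℤ) (R≢0 : + 4 ℤ.* (+ 4 ℤ.* (A ℤ.* (A ℤ.* A)) ℤ.+ + 27 ℤ.* (B ℤ.* B)) ≢ + 0) where

    private
      n⁷ : ∀ A B m n → ((+ 0) ℤ.* (m ℤ.* (m ℤ.* m)) ℤ.+ (+ 12) ℤ.* (m ℤ.* (m ℤ.* n)) ℤ.+ (+ 0) ℤ.* (m ℤ.* (n ℤ.* n)) ℤ.+ (+ 16 ℤ.* A) ℤ.* (n ℤ.* (n ℤ.* n))) ℤ.* (m ℤ.* (m ℤ.* (m ℤ.* m)) ℤ.- + 2 ℤ.* (A ℤ.* (m ℤ.* (m ℤ.* (n ℤ.* n)))) ℤ.- + 8 ℤ.* (B ℤ.* (m ℤ.* (n ℤ.* (n ℤ.* n)))) ℤ.+ A ℤ.* (A ℤ.* (n ℤ.* (n ℤ.* (n ℤ.* n))))) ℤ.+ ((-[1+ 2 ]) ℤ.* (m ℤ.* (m ℤ.* m)) ℤ.+ (+ 0) ℤ.*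 (m ℤ.* (m ℤ.* n)) ℤ.+ (+ 5 ℤ.* A) ℤ.* (m ℤ.* (n ℤ.* n)) ℤ.+ (+ 27 ℤ.* B) ℤ.* (n ℤ.* (n ℤ.* n))) ℤ.* (+ 4 ℤ.* (n ℤ.* (m ℤ.* (m ℤ.* m) ℤ.+ A ℤ.* (m ℤ.* (n ℤ.* n)) ℤ.+ B ℤ.* (n ℤ.* (n ℤ.* n))))) ≡
        (+ 4 ℤ.* (+ 4 ℤ.* (A ℤ.* (A ℤ.* A)) ℤ.+ + 27 ℤ.* (B ℤ.* B))) ℤ.* (n ℤ.* (n ℤ.* (n ℤ.* (n ℤ.* (n ℤ.* (n ℤ.* n))))))
      n⁷ = ℤ-identity 4 (λ A B m n → (Κ (+ 0) ⊗ (m ⊗ (m ⊗ m)) ⊕ Κ (+ 12) ⊗ (m ⊗ (m ⊗ n)) ⊕ Κ (+ 0) ⊗ (m ⊗ (n ⊗ n)) ⊕ (Κ (+ 16) ⊗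
          A) ⊗ (n ⊗ (n ⊗ n))) ⊗ (m ⊗ (m ⊗ (m ⊗ m)) ⊖ Κ (+ 2) ⊗ (A ⊗ (m ⊗ (m ⊗ (n ⊗ n)))) ⊖ Κ (+ 8) ⊗ (B ⊗ (m ⊗ (n ⊗ (n ⊗ n)))) ⊕ A
          ⊗ (A ⊗ (n ⊗ (n ⊗ (n ⊗ n))))) ⊕ ((Κ -[1+ 2 ]) ⊗ (m ⊗ (m ⊗ m)) ⊕ Κ (+ 0) ⊗ (m ⊗ (m ⊗ n)) ⊕ (Κ (+ 5) ⊗ A) ⊗ (m ⊗ (n ⊗ n)) ⊕
          (Κ (+ 27) ⊗ B) ⊗ (n ⊗ (n ⊗ n))) ⊗ (Κ (+ 4) ⊗ (n ⊗ (m ⊗ (m ⊗ m) ⊕ A ⊗ (m ⊗ (n ⊗ n)) ⊕ B ⊗ (n ⊗ (n ⊗ n))))) ⊜ (Κ (+ 4) ⊗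
          (Κ (+ 4) ⊗ (A ⊗ (A ⊗ A)) ⊕ Κ (+ 27) ⊗ (B ⊗ B))) ⊗ (n ⊗ (n ⊗ (n ⊗ (n ⊗ (n ⊗ (n ⊗ n))))))) refl

      m⁷ : ∀ A B m n → ((+ 4 ℤ.* (+ 4 ℤ.* (A ℤ.* (A ℤ.* A)) ℤ.+ + 27 ℤ.* (B ℤ.* B))) ℤ.* (m ℤ.* (m ℤ.* m)) ℤ.+ (-[1+ 3 ] ℤ.* (A ℤ.* (A ℤ.* B))) ℤ.* (m ℤ.* (m ℤ.* n)) ℤ.+ (+ 4 ℤ.* (A ℤ.* (+ 3 ℤ.* (A ℤ.* (A ℤ.* A)) ℤ.+ + 22 ℤ.* (B ℤ.* B)))) ℤ.* (m ℤ.* (n ℤ.* n)) ℤ.+ (+ 12 ℤ.* (B ℤ.* ((A ℤ.* (A ℤ.* A)) ℤ.+ + 8 ℤ.* (B ℤ.* B)))) ℤ.* (n ℤ.* (n ℤ.* n))) ℤ.* (m ℤ.* (m ℤ.* (m ℤ.* m)) ℤ.- + 2 ℤ.* (A ℤ.* (m ℤ.* (m ℤ.* (n ℤ.* n)))) ℤ.- + 8 ℤ.* (B ℤ.* (m ℤ.* (n ℤ.* (n ℤ.* n)))) ℤ.+ A ℤ.* (A ℤ.* (n ℤ.* (n ℤ.* (n ℤ.* n))))) ℤ.+ ((A ℤ.* (A ℤ.* B)) ℤ.* (m ℤ.* (m ℤ.* m)) ℤ.+ (A ℤ.* (+ 5 ℤ.* (A ℤ.* (A ℤ.* A)) ℤ.+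 + 32 ℤ.* (B ℤ.* B))) ℤ.* (m ℤ.* (m ℤ.* n)) ℤ.+ (+ 2 ℤ.* (B ℤ.* (+ 13 ℤ.* (A ℤ.* (A ℤ.* A)) ℤ.+ + 96 ℤ.* (B ℤ.* B)))) ℤ.* (m ℤ.* (n ℤ.* n)) ℤ.+ (-[1+ 2 ] ℤ.* (A ℤ.* (A ℤ.* ((A ℤ.* (A ℤ.* A)) ℤ.+ + 8 ℤ.* (B ℤ.* B))))) ℤ.* (n ℤ.* (n ℤ.* n))) ℤ.* (+ 4 ℤ.* (n ℤ.* (m ℤ.* (m ℤ.* m) ℤ.+ A ℤ.* (m ℤ.* (n ℤ.* n)) ℤ.+ B ℤ.* (n ℤ.* (n ℤ.* n))))) ≡
        (+ 4 ℤ.* (+ 4 ℤ.* (A ℤ.* (A ℤ.* A)) ℤ.+ + 27 ℤ.* (B ℤ.* B))) ℤ.* (m ℤ.* (m ℤ.* (m ℤ.* (m ℤ.* (m ℤ.* (m ℤ.* m))))))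
      m⁷ = ℤ-identity 4 (λ A B m n → ((Κ (+ 4) ⊗ (Κ (+ 4) ⊗ (A ⊗ (A ⊗ A)) ⊕ Κ (+ 27) ⊗ (B ⊗ B))) ⊗ (m ⊗ (m ⊗ m)) ⊕ (Κ -[1+ 3 ] ⊗
          (A ⊗ (A ⊗ B))) ⊗ (m ⊗ (m ⊗ n)) ⊕ (Κ (+ 4) ⊗ (A ⊗ (Κ (+ 3) ⊗ (A ⊗ (A ⊗ A)) ⊕ Κ (+ 22) ⊗ (B ⊗ B)))) ⊗ (m ⊗ (n ⊗ n)) ⊕ (Κ
          (+ 12) ⊗ (B ⊗ ((A ⊗ (A ⊗ A)) ⊕ Κ (+ 8) ⊗ (B ⊗ B)))) ⊗ (n ⊗ (n ⊗ n))) ⊗ (m ⊗ (m ⊗ (m ⊗ m)) ⊖ Κ (+ 2) ⊗ (A ⊗ (m ⊗ (m ⊗ (n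
          ⊗ n)))) ⊖ Κ (+ 8) ⊗ (B ⊗ (m ⊗ (n ⊗ (n ⊗ n)))) ⊕ A ⊗ (A ⊗ (n ⊗ (n ⊗ (n ⊗ n))))) ⊕ ((A ⊗ (A ⊗ B)) ⊗ (m ⊗ (m ⊗ m)) ⊕ (A ⊗
          (Κ (+ 5) ⊗ (A ⊗ (A ⊗ A)) ⊕ Κ (+ 32) ⊗ (B ⊗ B))) ⊗ (m ⊗ (m ⊗ n)) ⊕ (Κ (+ 2) ⊗ (B ⊗ (Κ (+ 13) ⊗ (A ⊗ (A ⊗ A)) ⊕ Κ (+ 96) ⊗
          (B ⊗ B)))) ⊗ (m ⊗ (n ⊗ n)) ⊕ (Κ -[1+ 2 ] ⊗ (A ⊗ (A ⊗ ((A ⊗ (A ⊗ A)) ⊕ Κ (+ 8) ⊗ (B ⊗ B))))) ⊗ (n ⊗ (n ⊗ n))) ⊗ (Κ (+ 4)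
          ⊗ (n ⊗ (m ⊗ (m ⊗ m) ⊕ A ⊗ (m ⊗ (n ⊗ n)) ⊕ B ⊗ (n ⊗ (n ⊗ n))))) ⊜ (Κ (+ 4) ⊗ (Κ (+ 4) ⊗ (A ⊗ (A ⊗ A)) ⊕ Κ (+ 27) ⊗ (B ⊗
          B))) ⊗ (m ⊗ (m ⊗ (m ⊗ (m ⊗ (m ⊗ (m ⊗ m))))))) refl

      N M : ℤ → ℤ → ℤ
      N m n = m ℤ.* (m ℤ.* (m ℤ.* m)) ℤ.- + 2 ℤ.* (A ℤ.* (m ℤ.* (m ℤ.* (n ℤ.* n)))) ℤ.- + 8 ℤ.* (B ℤ.* (m ℤ.* (n ℤ.* (n ℤ.* n)))) ℤ.+ A ℤ.* (A ℤ.* (n ℤ.* (n ℤ.* (n ℤ.* n))))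
      M m n = + 4 ℤ.* (n ℤ.* (m ℤ.* (m ℤ.* m) ℤ.+ A ℤ.* (m ℤ.* (n ℤ.* n)) ℤ.+ B ℤ.* (n ℤ.* (n ℤ.* n))))

      scale-N : ∀ (A B w n : ℚ) → (w * n) * ((w * n) * ((w * n) * (w * n))) - q (+ 2) * (A * ((w * n) * ((w * n) * (n * n)))) - q (+ 8) * (B * ((w * n) * (n * (n * n)))) + A * (A * (n * (n * (n * n)))) ≡ n * n * n * n * (w * (w * (w * w)) - q (+ 2) * (A * (w * w)) - q (+ 8) * (B * w) + A * A)
      scale-N = ℚ-identity 4 (λ A B w n → (w ⊗ n) ⊗ ((w ⊗ n) ⊗ ((w ⊗ n) ⊗ (w ⊗ n))) ⊖ # 2 ⊗ (A ⊗ ((w ⊗ n) ⊗ ((w ⊗ n) ⊗ (n ⊗ n))))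
          ⊖ # 8 ⊗ (B ⊗ ((w ⊗ n) ⊗ (n ⊗ (n ⊗ n)))) ⊕ A ⊗ (A ⊗ (n ⊗ (n ⊗ (n ⊗ n)))) ⊜ n ⊗ n ⊗ n ⊗ n ⊗ (w ⊗ (w ⊗ (w ⊗ w)) ⊖ # 2 ⊗ (A
          ⊗ (w ⊗ w)) ⊖ # 8 ⊗ (B ⊗ w) ⊕ A ⊗ A)) refl

      scale-M : ∀ (A B w n : ℚ) → q (+ 4) * (n * ((w * n) * ((w * n) * (w * n)) + A * ((w * n) * (n * n)) + B * (n * (n * n)))) ≡ n * n * n * n * (q (+ 4) * (w * (w * w) + A * w + B))
      scale-M = ℚ-identity 4 (λ A B w n → # 4 ⊗ (n ⊗ ((w ⊗ n) ⊗ ((w ⊗ n) ⊗ (w ⊗ n)) ⊕ A ⊗ ((w ⊗ n) ⊗ (n ⊗ n)) ⊕ B ⊗ (n ⊗ (n ⊗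
          n)))) ⊜ n ⊗ n ⊗ n ⊗ n ⊗ (# 4 ⊗ (w ⊗ (w ⊗ w) ⊕ A ⊗ w ⊕ B))) refl

    module _ (w : ℚ) where

      private
        X = int-clear w
        Y = int-q (↧ w)
        α = int-q A
        β = int-q B
        int-N : Int _ (N (↥ w) (↧ w))
        int-N = int-+ (int-+ (int-+ (int-* X (int-* X (int-* X X))) (int-neg (int-* (int-q (+ 2)) (int-* α (int-* X (int-* X (int-* Y Y)))))))
          (int-neg (int-* (int-q (+ 8)) (int-* β (int-* X (int-* Y (int-* Y Y))))))) (int-* α (int-* α (int-* Y (int-* Y (int-* Y Y)))))
        int-M : Int _ (M (↥ w) (↧ w))
        int-M = int-* (int-q (+ 4)) (int-* Y (int-+ (int-+ (int-* X (int-* X X)) (int-* α (int-* X (int-* Y Y)))) (int-* β (int-* Y (int-* Y Y)))))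
        module At = Coordinate w (N (↥ w) (↧ w)) (M (↥ w) (↧ w)) (+ 4 ℤ.* (+ 4 ℤ.* (A ℤ.* (A ℤ.* A)) ℤ.+ + 27 ℤ.* (B ℤ.* B))) R≢0
          (form (+ 0) (+ 12) (+ 0) (+ 16 ℤ.* A)) (form (-[1+ 2 ]) (+ 0) (+ 5 ℤ.* A) (+ 27 ℤ.* B))
          (form (+ 4 ℤ.* (+ 4 ℤ.* (A ℤ.* (A ℤ.* A)) ℤ.+ + 27 ℤ.* (B ℤ.* B))) (-[1+ 3 ] ℤ.* (A ℤ.* (A ℤ.* B))) (+ 4 ℤ.* (A ℤ.* (+ 3 ℤ.* (A ℤ.* (A ℤ.* A)) ℤ.+ + 22 ℤ.* (B ℤ.* B)))) (+ 12 ℤ.* (B ℤ.* ((A ℤ.* (A ℤ.* A)) ℤ.+ + 8 ℤ.* (B ℤ.* B)))))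
          (form (A ℤ.* (A ℤ.* B)) (A ℤ.* (+ 5 ℤ.* (A ℤ.* (A ℤ.* A)) ℤ.+ + 32 ℤ.* (B ℤ.* B))) (+ 2 ℤ.* (B ℤ.* (+ 13 ℤ.* (A ℤ.* (A ℤ.* A)) ℤ.+ + 96 ℤ.* (B ℤ.* B)))) (-[1+ 2 ] ℤ.* (A ℤ.* (A ℤ.* ((A ℤ.* (A ℤ.* A)) ℤ.+ + 8 ℤ.* (B ℤ.* B))))))
          (n⁷ A B (↥ w) (↧ w)) (m⁷ A B (↥ w) (↧ w))

      constant : ℕ
      constant = At.constant

      infinite : q (+ 4) * (w * (w * w) + q A * w + q B) ≡ 0ℚ → H w ℕ.^ 4 ≤ constant
      infinite e = At.growth-infinite (int-equal int-M (int-q (+ 0))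
        (trans (scale-M (q A) (q B) w (q (↧ w))) (trans (cong (q (↧ w) * q (↧ w) * q (↧ w) * q (↧ w) *_) e) (*-zeroʳ (q (↧ w) * q (↧ w) * q (↧ w) * q (↧ w))))))

      finite : ∀ w′ → w′ * (q (+ 4) * (w * (w * w) + q A * w + q B)) ≡ w * (w * (w * w)) - q (+ 2) * (q A * (w * w)) - q (+ 8) * (q B * w) + q A * q A → H w ℕ.^ 4 ≤ constant ℕ.* H w′
      finite w′ e = At.growth-finite w′ (trans (cong (w′ *_) (trans (sym (int≡ int-M)) (scale-M (q A) (q B) w (q (↧ w)))))
        (trans (lemma w′ (q (↧ w) * q (↧ w) * q (↧ w) * q (↧ w)) (q (+ 4) * (w * (w * w) + q A * w + q B))) (trans (cong (q (↧ w) * q (↧ w) * q (↧ w) * q (↧ w) *_) e)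
          (trans (sym (scale-N (q A) (q B) w (q (↧ w)))) (int≡ int-N)))))
        where
        lemma : ∀ a b c → a * (b * c) ≡ b * (a * c)
        lemma = ℚ-identity 3 (λ a b c → a ⊗ (b ⊗ c) ⊜ b ⊗ (a ⊗ c)) refl

  -- For `A = 0` the twist-invariant coordinate is `w = X³ / B`, and doubling sends it to
  -- `w (w - 8)³ / (64 (w + 1)³)`. The Bézout identities produce 1259712 = 2⁶ · 3⁹.
  module Forms₀ where

    private
      n⁷ : ∀ (m n : ℚ) → (q (+ 0) * (m * (m * m)) + q (+ 2432) * (m * (m * n)) + q (+ 7168) * (m * (n * n)) + q (+ 6464) * (n * (n * n))) * (m * ((m - q (+ 8) * n) * ((m - q (+ 8) * n) * (m - q (+ 8) * n)))) + (q -[1+ 37 ] * (m * (m * m)) + q (+ 914) * (m * (m * n)) + q -[1+ 7336 ] * (m * (n * n)) + q (+ 19683) * (n * (n * n))) * (q (+ 64) * (n * ((m + n) * ((m + n) * (m + n))))) ≡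
        q (+ 1259712) * (n * (n * (n * (n * (n * (n * n))))))
      n⁷ = ℚ-identity 2 (λ m n → (# 0 ⊗ (m ⊗ (m ⊗ m)) ⊕ # 2432 ⊗ (m ⊗ (m ⊗ n)) ⊕ # 7168 ⊗ (m ⊗ (n ⊗ n)) ⊕ # 6464 ⊗ (n ⊗ (n ⊗ n)))
          ⊗ (m ⊗ ((m ⊖ # 8 ⊗ n) ⊗ ((m ⊖ # 8 ⊗ n) ⊗ (m ⊖ # 8 ⊗ n)))) ⊕ (Κ (q -[1+ 37 ]) ⊗ (m ⊗ (m ⊗ m)) ⊕ # 914 ⊗ (m ⊗ (m ⊗ n)) ⊕ Κ
          (q -[1+ 7336 ]) ⊗ (m ⊗ (n ⊗ n)) ⊕ # 19683 ⊗ (n ⊗ (n ⊗ n))) ⊗ (# 64 ⊗ (n ⊗ ((m ⊕ n) ⊗ ((m ⊕ n) ⊗ (m ⊕ n))))) ⊜ # 1259712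
          ⊗ (n ⊗ (n ⊗ (n ⊗ (n ⊗ (n ⊗ (n ⊗ n))))))) refl

      m⁷ : ∀ (m n : ℚ) → (q (+ 1259712) * (m * (m * m)) + q (+ 3756544) * (m * (m * n)) + q (+ 3743744) * (m * (n * n)) + q (+ 1245184) * (n * (n * n))) * (m * ((m - q (+ 8) * n) * ((m - q (+ 8) * n) * (m - q (+ 8) * n)))) + (q (+ 413696) * (m * (m * m)) + q -[1+ 3670015 ] * (m * (m * n)) + q (+ 9961472) * (m * (n * n)) + q (+ 0) * (n * (n * n))) * (q (+ 64) * (n * ((m + n) * ((m + n) * (m + n))))) ≡
        q (+ 1259712) * (m * (m * (m * (m * (m * (m * m))))))
      m⁷ = ℚ-identity 2 (λ m n → (# 1259712 ⊗ (m ⊗ (m ⊗ m)) ⊕ # 3756544 ⊗ (m ⊗ (m ⊗ n)) ⊕ # 3743744 ⊗ (m ⊗ (n ⊗ n)) ⊕ # 1245184 ⊗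
          (n ⊗ (n ⊗ n))) ⊗ (m ⊗ ((m ⊖ # 8 ⊗ n) ⊗ ((m ⊖ # 8 ⊗ n) ⊗ (m ⊖ # 8 ⊗ n)))) ⊕ (# 413696 ⊗ (m ⊗ (m ⊗ m)) ⊕ Κ (q -[1+ 3670015
          ]) ⊗ (m ⊗ (m ⊗ n)) ⊕ # 9961472 ⊗ (m ⊗ (n ⊗ n)) ⊕ # 0 ⊗ (n ⊗ (n ⊗ n))) ⊗ (# 64 ⊗ (n ⊗ ((m ⊕ n) ⊗ ((m ⊕ n) ⊗ (m ⊕ n))))) ⊜
          # 1259712 ⊗ (m ⊗ (m ⊗ (m ⊗ (m ⊗ (m ⊗ (m ⊗ m))))))) refl

      N M : ℤ → ℤ → ℤ
      N m n = m ℤ.* ((m ℤ.- + 8 ℤ.* n) ℤ.* ((m ℤ.- + 8 ℤ.* n) ℤ.* (m ℤ.- + 8 ℤ.* n)))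
      M m n = + 64 ℤ.* (n ℤ.* ((m ℤ.+ n) ℤ.* ((m ℤ.+ n) ℤ.* (m ℤ.+ n))))

      scale-N : ∀ w n → (w * n) * (((w * n) - q (+ 8) * n) * (((w * n) - q (+ 8) * n) * ((w * n) - q (+ 8) * n))) ≡ n * n * n * n * (w * ((w - q (+ 8)) * ((w - q (+ 8)) * (w - q (+ 8)))))
      scale-N = ℚ-identity 2 (λ w n → (w ⊗ n) ⊗ (((w ⊗ n) ⊖ # 8 ⊗ n) ⊗ (((w ⊗ n) ⊖ # 8 ⊗ n) ⊗ ((w ⊗ n) ⊖ # 8 ⊗ n))) ⊜ n ⊗ n ⊗ n ⊗
          n ⊗ (w ⊗ ((w ⊖ # 8) ⊗ ((w ⊖ # 8) ⊗ (w ⊖ # 8))))) refl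

      scale-M : ∀ w n → q (+ 64) * (n * (((w * n) + n) * (((w * n) + n) * ((w * n) + n)))) ≡ n * n * n * n * (q (+ 64) * ((w + 1ℚ) * ((w + 1ℚ) * (w + 1ℚ))))
      scale-M = ℚ-identity 2 (λ w n → # 64 ⊗ (n ⊗ (((w ⊗ n) ⊕ n) ⊗ (((w ⊗ n) ⊕ n) ⊗ ((w ⊗ n) ⊕ n)))) ⊜ n ⊗ n ⊗ n ⊗ n ⊗ (# 64 ⊗ ((w
          ⊕ Κ 1ℚ) ⊗ ((w ⊕ Κ 1ℚ) ⊗ (w ⊕ Κ 1ℚ))))) refl

    module _ (w : ℚ) where

      private
        X = int-clear w
        Y = int-q (↧ w)
        X+Y = int-+ X Y
        X-8Y = int-+ X (int-neg (int-* (int-q (+ 8)) Y))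
        int-N : Int _ (N (↥ w) (↧ w))
        int-N = int-* X (int-* X-8Y (int-* X-8Y X-8Y))
        int-M : Int _ (M (↥ w) (↧ w))
        int-M = int-* (int-q (+ 64)) (int-* Y (int-* X+Y (int-* X+Y X+Y)))
        module At = Coordinate w (N (↥ w) (↧ w)) (M (↥ w) (↧ w)) (+ 1259712) (λ ())
          (form (+ 0) (+ 2432) (+ 7168) (+ 6464)) (form (-[1+ 37 ]) (+ 914) (-[1+ 7336 ]) (+ 19683))
          (form (+ 1259712) (+ 3756544) (+ 3743744) (+ 1245184))
          (form (+ 413696) (-[1+ 3670015 ]) (+ 9961472) (+ 0))
          (int-equal (int-+ (int-* (int-form (+ 0) (+ 2432) (+ 7168) (+ 6464) X Y) int-N) (int-* (int-form (-[1+ 37 ]) (+ 914) (-[1+ 7336 ]) (+ 19683) X Y) int-M)) (int-* (int-q (+ 1259712)) (int-pow7 Y)) (n⁷ (w * q (↧ w)) (q (↧ w))))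
          (int-equal (int-+ (int-* (int-form (+ 1259712) (+ 3756544) (+ 3743744) (+ 1245184) X Y) int-N) (int-* (int-form (+ 413696) (-[1+ 3670015 ]) (+ 9961472) (+ 0) X Y) int-M)) (int-* (int-q (+ 1259712)) (int-pow7 X)) (m⁷ (w * q (↧ w)) (q (↧ w))))

      constant : ℕ
      constant = At.constant

      infinite : q (+ 64) * ((w + 1ℚ) * ((w + 1ℚ) * (w + 1ℚ))) ≡ 0ℚ → H w ℕ.^ 4 ≤ constant
      infinite e = At.growth-infinite (int-equal int-M (int-q (+ 0))
        (trans (scale-M w (q (↧ w))) (trans (cong (q (↧ w) * q (↧ w) * q (↧ w) * q (↧ w) *_) e) (*-zeroʳ (q (↧ w) * q (↧ w) * q (↧ w) * q (↧ w))))))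

      finite : ∀ w′ → w′ * (q (+ 64) * ((w + 1ℚ) * ((w + 1ℚ) * (w + 1ℚ)))) ≡ w * ((w - q (+ 8)) * ((w - q (+ 8)) * (w - q (+ 8)))) → H w ℕ.^ 4 ≤ constant ℕ.* H w′
      finite w′ e = At.growth-finite w′ (trans (cong (w′ *_) (trans (sym (int≡ int-M)) (scale-M w (q (↧ w)))))
        (trans (lemma w′ (q (↧ w) * q (↧ w) * q (↧ w) * q (↧ w)) (q (+ 64) * ((w + 1ℚ) * ((w + 1ℚ) * (w + 1ℚ))))) (trans (cong (q (↧ w) * q (↧ w) * q (↧ w) * q (↧ w) *_) e)
          (trans (sym (scale-N w (q (↧ w)))) (int≡ int-N)))))
        where
        lemma : ∀ a b c → a * (b * c) ≡ b * (a * c)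
        lemma = ℚ-identity 3 (λ a b c → a ⊗ (b ⊗ c) ⊜ b ⊗ (a ⊗ c)) refl

  -- For `B = 0` the twist-invariant coordinate is `w = X² / A`, and doubling sends it to
  -- `(w - 1)⁴ / (16 w (w + 1)²)`.
  module Forms₁₇₂₈ where

    private
      n⁷ : ∀ (m n : ℚ) → (q (+ 0) * (m * (m * m)) + q (+ 208) * (m * (m * n)) + q (+ 448) * (m * (n * n)) + q (+ 256) * (n * (n * n))) * ((m - n) * ((m - n) * ((m - n) * (m - n)))) + (q -[1+ 12 ] * (m * (m * m)) + q (+ 50) * (m * (m * n)) + q -[1+ 68 ] * (m * (n * n)) + q (+ 36) * (n * (n * n))) * (q (+ 16) * (m * (n * ((m + n) * (m + n))))) ≡
        q (+ 256) * (n * (n * (n * (n * (n * (n * n))))))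
      n⁷ = ℚ-identity 2 (λ m n → (# 0 ⊗ (m ⊗ (m ⊗ m)) ⊕ # 208 ⊗ (m ⊗ (m ⊗ n)) ⊕ # 448 ⊗ (m ⊗ (n ⊗ n)) ⊕ # 256 ⊗ (n ⊗ (n ⊗ n))) ⊗
          ((m ⊖ n) ⊗ ((m ⊖ n) ⊗ ((m ⊖ n) ⊗ (m ⊖ n)))) ⊕ (Κ (q -[1+ 12 ]) ⊗ (m ⊗ (m ⊗ m)) ⊕ # 50 ⊗ (m ⊗ (m ⊗ n)) ⊕ Κ (q -[1+ 68 ])
          ⊗ (m ⊗ (n ⊗ n)) ⊕ # 36 ⊗ (n ⊗ (n ⊗ n))) ⊗ (# 16 ⊗ (m ⊗ (n ⊗ ((m ⊕ n) ⊗ (m ⊕ n))))) ⊜ # 256 ⊗ (n ⊗ (n ⊗ (n ⊗ (n ⊗ (n ⊗ (n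
          ⊗ n))))))) refl

      m⁷ : ∀ (m n : ℚ) → (q (+ 256) * (m * (m * m)) + q (+ 448) * (m * (m * n)) + q (+ 208) * (m * (n * n)) + q (+ 0) * (n * (n * n))) * ((m - n) * ((m - n) * ((m - n) * (m - n)))) + (q (+ 36) * (m * (m * m)) + q -[1+ 68 ] * (m * (m * n)) + q (+ 50) * (m * (n * n)) + q -[1+ 12 ] * (n * (n * n))) * (q (+ 16) * (m * (n * ((m + n) * (m + n))))) ≡
        q (+ 256) * (m * (m * (m * (m * (m * (m * m))))))
      m⁷ = ℚ-identity 2 (λ m n → (# 256 ⊗ (m ⊗ (m ⊗ m)) ⊕ # 448 ⊗ (m ⊗ (m ⊗ n)) ⊕ # 208 ⊗ (m ⊗ (n ⊗ n)) ⊕ # 0 ⊗ (n ⊗ (n ⊗ n))) ⊗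
          ((m ⊖ n) ⊗ ((m ⊖ n) ⊗ ((m ⊖ n) ⊗ (m ⊖ n)))) ⊕ (# 36 ⊗ (m ⊗ (m ⊗ m)) ⊕ Κ (q -[1+ 68 ]) ⊗ (m ⊗ (m ⊗ n)) ⊕ # 50 ⊗ (m ⊗ (n ⊗
          n)) ⊕ Κ (q -[1+ 12 ]) ⊗ (n ⊗ (n ⊗ n))) ⊗ (# 16 ⊗ (m ⊗ (n ⊗ ((m ⊕ n) ⊗ (m ⊕ n))))) ⊜ # 256 ⊗ (m ⊗ (m ⊗ (m ⊗ (m ⊗ (m ⊗ (m
          ⊗ m))))))) refl

      N M : ℤ → ℤ → ℤ
      N m n = (m ℤ.- n) ℤ.* ((m ℤ.- n) ℤ.* ((m ℤ.- n) ℤ.* (m ℤ.- n)))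
      M m n = + 16 ℤ.* (m ℤ.* (n ℤ.* ((m ℤ.+ n) ℤ.* (m ℤ.+ n))))

      scale-N : ∀ w n → ((w * n) - n) * (((w * n) - n) * (((w * n) - n) * ((w * n) - n))) ≡ n * n * n * n * ((w - 1ℚ) * ((w - 1ℚ) * ((w - 1ℚ) * (w - 1ℚ))))
      scale-N = ℚ-identity 2 (λ w n → ((w ⊗ n) ⊖ n) ⊗ (((w ⊗ n) ⊖ n) ⊗ (((w ⊗ n) ⊖ n) ⊗ ((w ⊗ n) ⊖ n))) ⊜ n ⊗ n ⊗ n ⊗ n ⊗ ((w ⊖ Κ
          1ℚ) ⊗ ((w ⊖ Κ 1ℚ) ⊗ ((w ⊖ Κ 1ℚ) ⊗ (w ⊖ Κ 1ℚ))))) refl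

      scale-M : ∀ w n → q (+ 16) * ((w * n) * (n * (((w * n) + n) * ((w * n) + n)))) ≡ n * n * n * n * (q (+ 16) * (w * ((w + 1ℚ) * (w + 1ℚ))))
      scale-M = ℚ-identity 2 (λ w n → # 16 ⊗ ((w ⊗ n) ⊗ (n ⊗ (((w ⊗ n) ⊕ n) ⊗ ((w ⊗ n) ⊕ n)))) ⊜ n ⊗ n ⊗ n ⊗ n ⊗ (# 16 ⊗ (w ⊗ ((w
          ⊕ Κ 1ℚ) ⊗ (w ⊕ Κ 1ℚ))))) refl

    module _ (w : ℚ) where

      private
        X = int-clear w
        Y = int-q (↧ w)
        X+Y = int-+ X Y
        X-Y = int-+ X (int-neg Y)
        int-N : Int _ (N (↥ w) (↧ w))
        int-N = int-* X-Y (int-* X-Y (int-* X-Y X-Y))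
        int-M : Int _ (M (↥ w) (↧ w))
        int-M = int-* (int-q (+ 16)) (int-* X (int-* Y (int-* X+Y X+Y)))
        module At = Coordinate w (N (↥ w) (↧ w)) (M (↥ w) (↧ w)) (+ 256) (λ ())
          (form (+ 0) (+ 208) (+ 448) (+ 256)) (form (-[1+ 12 ]) (+ 50) (-[1+ 68 ]) (+ 36))
          (form (+ 256) (+ 448) (+ 208) (+ 0))
          (form (+ 36) (-[1+ 68 ]) (+ 50) (-[1+ 12 ]))
          (int-equal (int-+ (int-* (int-form (+ 0) (+ 208) (+ 448) (+ 256) X Y) int-N) (int-* (int-form (-[1+ 12 ]) (+ 50) (-[1+ 68 ]) (+ 36) X Y) int-M)) (int-* (int-q (+ 256)) (int-pow7 Y)) (n⁷ (w * q (↧ w)) (q (↧ w))))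
          (int-equal (int-+ (int-* (int-form (+ 256) (+ 448) (+ 208) (+ 0) X Y) int-N) (int-* (int-form (+ 36) (-[1+ 68 ]) (+ 50) (-[1+ 12 ]) X Y) int-M)) (int-* (int-q (+ 256)) (int-pow7 X)) (m⁷ (w * q (↧ w)) (q (↧ w))))

      constant : ℕ
      constant = At.constant

      infinite : q (+ 16) * (w * ((w + 1ℚ) * (w + 1ℚ))) ≡ 0ℚ → H w ℕ.^ 4 ≤ constant
      infinite e = At.growth-infinite (int-equal int-M (int-q (+ 0))
        (trans (scale-M w (q (↧ w))) (trans (cong (q (↧ w) * q (↧ w) * q (↧ w) * q (↧ w) *_) e) (*-zeroʳ (q (↧ w) * q (↧ w) * q (↧ w) * q (↧ w))))))

      finite : ∀ w′ → w′ * (q (+ 16) * (w * ((w + 1ℚ) * (w + 1ℚ)))) ≡ (w - 1ℚ) * ((w - 1ℚ) * ((w - 1ℚ) * (w - 1ℚ))) → H w ℕ.^ 4 ≤ constant ℕ.* H w′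
      finite w′ e = At.growth-finite w′ (trans (cong (w′ *_) (trans (sym (int≡ int-M)) (scale-M w (q (↧ w)))))
        (trans (lemma w′ (q (↧ w) * q (↧ w) * q (↧ w) * q (↧ w)) (q (+ 16) * (w * ((w + 1ℚ) * (w + 1ℚ))))) (trans (cong (q (↧ w) * q (↧ w) * q (↧ w) * q (↧ w) *_) e)
          (trans (sym (scale-N w (q (↧ w)))) (int≡ int-N)))))
        where
        lemma : ∀ a b c → a * (b * c) ≡ b * (a * c)
        lemma = ℚ-identity 3 (λ a b c → a ⊗ (b ⊗ c) ⊜ b ⊗ (a ⊗ c)) refl

-- Doubling and the twist-invariant height, uniformly in `j`

module DoublingHeight where

  open import Defs using (q)
  open RationalAlgebra
  open SpherePacking using (^-distrib-*; ^-swap)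
  open RationalHeight
  open DuplicationForms
  open import Data.Nat as ℕ using (ℕ; _≤_)
  import Data.Nat.Properties as ℕ
  open import Data.Integer as ℤ using (ℤ; +_; ∣_∣)
  open import Data.Rational using (ℚ; 0ℚ; 1ℚ; _+_; _*_; _-_; -_; 1/_; ↥_; ↧_; ≢-nonZero; NonZero)
  open import Data.Rational.Properties hiding (≤-trans; ≤-reflexive)
  open import Data.Product using (∃; _×_; _,_; proj₁; proj₂)
  open import Data.Sum using (_⊎_; inj₁; inj₂)
  open import Relation.Nullary using (Dec; yes; no; contradiction)
  open import Relation.Binary.PropositionalEquality hiding (J)

  private
    -- The height on the curve is that of `w^k ν`, with `w` an invariant coordinate and `ν` a factor
    -- whose height depends on `j` only. Growth is proved for `w` and transferred here.
    lift-bound : ∀ w ν k {n} → H w ℕ.^ 4 ≤ n → H (w ^^ k * ν) ℕ.^ 4 ≤ n ℕ.^ k ℕ.* H ν ℕ.^ 4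
    lift-bound w ν k {n} h = begin
      H (w ^^ k * ν) ℕ.^ 4               ≤⟨ ℕ.^-monoˡ-≤ 4 (H-* (w ^^ k) ν) ⟩
      (H (w ^^ k) ℕ.* H ν) ℕ.^ 4         ≡⟨ ^-distrib-* (H (w ^^ k)) (H ν) 4 ⟩
      H (w ^^ k) ℕ.^ 4 ℕ.* H ν ℕ.^ 4     ≡⟨ cong (λ x → x ℕ.^ 4 ℕ.* H ν ℕ.^ 4) (sym (H-^^ w k)) ⟩
      (H w ℕ.^ k) ℕ.^ 4 ℕ.* H ν ℕ.^ 4    ≡⟨ cong (ℕ._* H ν ℕ.^ 4) (^-swap (H w) k 4) ⟩
      (H w ℕ.^ 4) ℕ.^ k ℕ.* H ν ℕ.^ 4    ≤⟨ ℕ.*-monoˡ-≤ (H ν ℕ.^ 4) (ℕ.^-monoˡ-≤ k h) ⟩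
      n ℕ.^ k ℕ.* H ν ℕ.^ 4              ∎
      where open ℕ.≤-Reasoning

    lift-finite : ∀ w w′ ν k c → ν ≢ 0ℚ → H w ℕ.^ 4 ≤ c ℕ.* H w′ →
      H (w ^^ k * ν) ℕ.^ 4 ≤ c ℕ.^ k ℕ.* (H ν ℕ.* H ν ℕ.^ 4) ℕ.* H (w′ ^^ k * ν)
    lift-finite w w′ ν k c ν≢0 h = begin
      H (w ^^ k * ν) ℕ.^ 4                                             ≤⟨ lift-bound w ν k h ⟩
      (c ℕ.* H w′) ℕ.^ k ℕ.* H ν ℕ.^ 4                                 ≡⟨ cong (ℕ._* H ν ℕ.^ 4) (trans (^-distrib-* c (H w′) k) (cong (c ℕ.^ k ℕ.*_) (H-^^ w′ k))) ⟩
      c ℕ.^ k ℕ.* H (w′ ^^ k) ℕ.* H ν ℕ.^ 4                            ≤⟨ ℕ.*-monoˡ-≤ (H ν ℕ.^ 4) (ℕ.*-monoʳ-≤ (c ℕ.^ k) (H-quotient ν≢0 (*-comm ν (w′ ^^ k)))) ⟩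
      c ℕ.^ k ℕ.* (H (w′ ^^ k * ν) ℕ.* H ν) ℕ.* H ν ℕ.^ 4              ≡⟨ lemma (c ℕ.^ k) (H (w′ ^^ k * ν)) (H ν) (H ν ℕ.^ 4) ⟩
      c ℕ.^ k ℕ.* (H ν ℕ.* H ν ℕ.^ 4) ℕ.* H (w′ ^^ k * ν)              ∎
      where
      open ℕ.≤-Reasoning
      lemma : ∀ a x y z → a ℕ.* (x ℕ.* y) ℕ.* z ≡ a ℕ.* (y ℕ.* z) ℕ.* x
      lemma = ℕ-identity 4 (λ a x y z → a ⊗ (x ⊗ y) ⊗ z ⊜ a ⊗ (y ⊗ z) ⊗ x) refl

  -- X and X′ are the abscissas of a point of 3Y² = X³ + AX + B and of its double.
  Doubling : ℚ → ℚ → ℚ → ℚ → Set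
  Doubling A B X X′ = X′ * (q (+ 4) * (X * (X * X) + A * X + B)) ≡ X * (X * (X * X)) - q (+ 2) * (A * (X * X)) - q (+ 8) * (B * X) + A * A

  -- The constant precedes `A`, `B` and `D`, which expresses uniformity over all twists with the
  -- same `κ₁` and `κ₂`.
  record DoublingGrowth (κ₁ κ₂ : ℚ) : Set where
    field
      constant : ℕ
      bounds : ∀ A B D D⁻¹ → D * D⁻¹ ≡ 1ℚ → A * A * A ≡ κ₁ * D → B * B ≡ κ₂ * D → ∀ X →
        (X * (X * X) + A * X + B ≡ 0ℚ → H (X ^^ 12 * D⁻¹ ^^ 2) ℕ.^ 4 ≤ constant) ×
        (∀ X′ → Doubling A B X X′ → H (X ^^ 12 * D⁻¹ ^^ 2) ℕ.^ 4 ≤ constant ℕ.* H (X′ ^^ 12 * D⁻¹ ^^ 2))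

  private
    1≢0′ : 1ℚ ≢ 0ℚ
    1≢0′ ()

    D≢0 : ∀ {D D⁻¹} → D * D⁻¹ ≡ 1ℚ → D ≢ 0ℚ
    D≢0 {D} {D⁻¹} h e = 1≢0′ (trans (sym h) (trans (cong (_* D⁻¹) e) (*-zeroˡ D⁻¹)))

    inverse : ∀ {x} → x ≢ 0ℚ → ∃ λ i → x * i ≡ 1ℚ
    inverse {x} x≢0 = 1/ x , *-inverseʳ x
      where
      instance nz : NonZero x
               nz = ≢-nonZero x≢0

    cube-zero : ∀ x → x * x * x ≡ 0ℚ → x ≡ 0ℚ
    cube-zero x h = either (x*y≡0⇒x≡0∨y≡0 (x * x) h)
      where
      either : x * x ≡ 0ℚ ⊎ x ≡ 0ℚ → x ≡ 0ℚ
      either (inj₁ e) = x*x≡0⇒x≡0 x e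
      either (inj₂ e) = e

    -- Since `D = B² / κ`, the quotient `X¹² / D²` is the fourth power of `X³ / B` times `κ²`.
    coordinate⁴ : ∀ X B I D J κ → B * I ≡ 1ℚ → D * J ≡ 1ℚ → B * B ≡ κ * D →
      X ^^ 12 * J ^^ 2 ≡ (X * (X * X) * I) ^^ 4 * κ ^^ 2
    coordinate⁴ X B I D J κ BI DJ B² = trans (cong (λ t → X ^^ 12 * t) J²) (trans (lemma X I κ)
        refl)
      where
      J≡ : J ≡ κ * (I * I)
      J≡ = byLinComb (κ * (I * I) · DJ ⊹ - (J * (B * I + 1ℚ)) · BI ⊹ I * I * J · B²)
        (ℚ-identity 5 (λ B I D J κ → J ⊖ κ ⊗ (I ⊗ I) ⊜ κ ⊗ (I ⊗ I) ⊗ (D ⊗ J ⊖ Κ 1ℚ) ⊕ ⊝ (J ⊗ (B ⊗ I ⊕ Κ 1ℚ)) ⊗ (B ⊗ I ⊖ Κ 1ℚ) ⊕ I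
            ⊗ I ⊗ J ⊗ (B ⊗ B ⊖ κ ⊗ D)) refl B I D J κ)
      J² : J ^^ 2 ≡ (κ * (I * I)) ^^ 2
      J² = cong (_^^ 2) J≡
      lemma : ∀ X I κ → X * (X * (X * (X * (X * (X * (X * (X * (X * (X * (X * (X * 1ℚ))))))))))) * (κ * (I * I) * (κ * (I * I) * 1ℚ)) ≡
        X * (X * X) * I * (X * (X * X) * I * (X * (X * X) * I * (X * (X * X) * I * 1ℚ))) * (κ * (κ * 1ℚ))
      lemma = ℚ-identity 3 (λ X I κ → X ⊗ (X ⊗ (X ⊗ (X ⊗ (X ⊗ (X ⊗ (X ⊗ (X ⊗ (X ⊗ (X ⊗ (X ⊗ (X ⊗ Κ 1ℚ))))))))))) ⊗ (κ ⊗ (I ⊗ I) ⊗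
          (κ ⊗ (I ⊗ I) ⊗ Κ 1ℚ)) ⊜ X ⊗ (X ⊗ X) ⊗ I ⊗ (X ⊗ (X ⊗ X) ⊗ I ⊗ (X ⊗ (X ⊗ X) ⊗ I ⊗ (X ⊗ (X ⊗ X) ⊗ I ⊗ Κ 1ℚ))) ⊗ (κ ⊗ (κ ⊗ Κ
          1ℚ))) refl

  growth₀ : ∀ κ₁ κ₂ → κ₁ ≡ 0ℚ → κ₂ ≢ 0ℚ → DoublingGrowth κ₁ κ₂
  growth₀ κ₁ κ₂ κ₁≡0 κ₂≢0 = record
    { constant = C
    ; bounds = λ A B D D⁻¹ DD⁻¹ A³≡ B²≡ X → At.infinite A B D D⁻¹ DD⁻¹ A³≡ B²≡ X , At.finite A B D D⁻¹ DD⁻¹ A³≡ B²≡ X }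
    where
    ν = κ₂ ^^ 2
    -- The growth constant is the same for every abscissa, so it is read off at `0ℚ`.
    c = Forms₀.constant 0ℚ
    C = c ℕ.^ 4 ℕ.* (H ν ℕ.* H ν ℕ.^ 4)
    module At (A B D D⁻¹ : ℚ) (DD⁻¹ : D * D⁻¹ ≡ 1ℚ) (A³≡ : A * A * A ≡ κ₁ * D) (B²≡ : B * B ≡ κ₂ * D) (X : ℚ) where
      A≡0 : A ≡ 0ℚ
      A≡0 = cube-zero A (trans A³≡ (trans (cong (_* D) κ₁≡0) (*-zeroˡ D)))
      B≢0 : B ≢ 0ℚ
      B≢0 e = *-≢0 κ₂≢0 (D≢0 DD⁻¹) (trans (sym B²≡) (trans (cong (_* B) e) (*-zeroˡ B)))
      I = proj₁ (inverse B≢0)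
      BI = proj₂ (inverse B≢0)
      w : ℚ → ℚ
      w X = X * (X * X) * I
      height≡ : ∀ X → X ^^ 12 * D⁻¹ ^^ 2 ≡ w X ^^ 4 * ν
      height≡ X = coordinate⁴ X B I D D⁻¹ κ₂ BI DD⁻¹ B²≡
      shift₁ : ∀ X A B I → A ≡ 0ℚ → B * I ≡ 1ℚ → X * (X * X) * I + 1ℚ ≡ I * (X * (X * X) + A * X + B)
      shift₁ X A B I A≡0 BI = byLinComb (- 1ℚ · BI ⊹ - (I * X) · A≡0) (ℚ-identity 4 (λ X A B I → X ⊗ (X ⊗ X) ⊗ I ⊕ Κ 1ℚ ⊖ I ⊗ (X ⊗
          (X ⊗ X) ⊕ A ⊗ X ⊕ B) ⊜ ⊝ Κ 1ℚ ⊗ (B ⊗ I ⊖ Κ 1ℚ) ⊕ ⊝ (I ⊗ X) ⊗ (A ⊖ Κ 0ℚ)) refl X A B I)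
      shift₈ : ∀ X A B I → A ≡ 0ℚ → B * I ≡ 1ℚ →
        X * (X * (X * X) * I - q (+ 8)) ≡ I * (X * (X * (X * X)) - q (+ 2) * (A * (X * X)) - q (+ 8) * (B * X) + A * A)
      shift₈ X A B I A≡0 BI = byLinComb (q (+ 8) * X · BI ⊹ q (+ 2) * I * X * X - I * A · A≡0) (ℚ-identity 4 (λ X A B I → X ⊗ (X ⊗
          (X ⊗ X) ⊗ I ⊖ # 8) ⊖ I ⊗ (X ⊗ (X ⊗ (X ⊗ X)) ⊖ # 2 ⊗ (A ⊗ (X ⊗ X)) ⊖ # 8 ⊗ (B ⊗ X) ⊕ A ⊗ A) ⊜ # 8 ⊗ X ⊗ (B ⊗ I ⊖ Κ 1ℚ) ⊕
          (# 2 ⊗ I ⊗ X ⊗ X ⊖ I ⊗ A) ⊗ (A ⊖ Κ 0ℚ)) refl X A B I)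
      w-double : ∀ X′ → Doubling A B X X′ → w X′ * (q (+ 64) * ((w X + 1ℚ) * ((w X + 1ℚ) * (w X + 1ℚ)))) ≡
        w X * ((w X - q (+ 8)) * ((w X - q (+ 8)) * (w X - q (+ 8))))
      w-double X′ h = trans (lemma X′ I (w X + 1ℚ)) (trans (cong (λ t → I * (t * t * t)) base) (lemma′ X I (w X - q (+ 8))))
        where
        base : X′ * (q (+ 4) * (w X + 1ℚ)) ≡ X * (w X - q (+ 8))
        base = trans (cong (λ t → X′ * (q (+ 4) * t)) (shift₁ X A B I A≡0 BI)) (trans (lemma″ X′ I (X * (X * X) + A * X + B))
          (trans (cong (I *_) h) (sym (shift₈ X A B I A≡0 BI))))
          where
          lemma″ : ∀ x i f → x * (q (+ 4) * (i * f)) ≡ i * (x * (q (+ 4) * f))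
          lemma″ = ℚ-identity 3 (λ x i f → x ⊗ (# 4 ⊗ (i ⊗ f)) ⊜ i ⊗ (x ⊗ (# 4 ⊗ f))) refl
        lemma : ∀ x i t → x * (x * x) * i * (q (+ 64) * (t * (t * t))) ≡ i * (x * (q (+ 4) * t) * (x * (q (+ 4) * t)) * (x * (q (+ 4) * t)))
        lemma = ℚ-identity 3 (λ x i t → x ⊗ (x ⊗ x) ⊗ i ⊗ (# 64 ⊗ (t ⊗ (t ⊗ t))) ⊜ i ⊗ (x ⊗ (# 4 ⊗ t) ⊗ (x ⊗ (# 4 ⊗ t)) ⊗ (x ⊗ (#
            4 ⊗ t)))) refl
        lemma′ : ∀ x i t → i * (x * t * (x * t) * (x * t)) ≡ x * (x * x) * i * (t * (t * t))
        lemma′ = ℚ-identity 3 (λ x i t → i ⊗ (x ⊗ t ⊗ (x ⊗ t) ⊗ (x ⊗ t)) ⊜ x ⊗ (x ⊗ x) ⊗ i ⊗ (t ⊗ (t ⊗ t))) refl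
      infinite : X * (X * X) + A * X + B ≡ 0ℚ → H (X ^^ 12 * D⁻¹ ^^ 2) ℕ.^ 4 ≤ C
      infinite e = ℕ.≤-trans (subst (λ z → H z ℕ.^ 4 ≤ c ℕ.^ 4 ℕ.* H ν ℕ.^ 4) (sym (height≡ X))
        (lift-bound (w X) ν 4 (Forms₀.infinite (w X) (trans (cong (λ t → q (+ 64) * (t * (t * t))) w+1≡0) refl))))
        (ℕ.*-monoʳ-≤ (c ℕ.^ 4) (ℕ.m≤n*m (H ν ℕ.^ 4) (H ν) {{ℕ.>-nonZero (1≤H ν)}}))
        where
        w+1≡0 : w X + 1ℚ ≡ 0ℚ
        w+1≡0 = trans (shift₁ X A B I A≡0 BI) (trans (cong (I *_) e) (*-zeroʳ I))
      finite : ∀ X′ → Doubling A B X X′ → H (X ^^ 12 * D⁻¹ ^^ 2) ℕ.^ 4 ≤ C ℕ.* H (X′ ^^ 12 * D⁻¹ ^^ 2)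
      finite X′ h = subst₂ (λ y z → H y ℕ.^ 4 ≤ C ℕ.* H z) (sym (height≡ X)) (sym (height≡ X′))
        (lift-finite (w X) (w X′) ν 4 c (^^-≢0 2 κ₂≢0) (Forms₀.finite (w X) (w X′) (w-double X′ h)))

  growth₁₇₂₈ : ∀ κ₁ κ₂ → κ₁ ≢ 0ℚ → κ₂ ≡ 0ℚ → DoublingGrowth κ₁ κ₂
  growth₁₇₂₈ κ₁ κ₂ κ₁≢0 κ₂≡0 = record
    { constant = C
    ; bounds = λ A B D D⁻¹ DD⁻¹ A³≡ B²≡ X → At.infinite A B D D⁻¹ DD⁻¹ A³≡ B²≡ X , At.finite A B D D⁻¹ DD⁻¹ A³≡ B²≡ X }
    where
    ν = κ₁ ^^ 2
    c = Forms₁₇₂₈.constant 0ℚ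
    C = c ℕ.^ 6 ℕ.* (H ν ℕ.* H ν ℕ.^ 4)
    module At (A B D D⁻¹ : ℚ) (DD⁻¹ : D * D⁻¹ ≡ 1ℚ) (A³≡ : A * A * A ≡ κ₁ * D) (B²≡ : B * B ≡ κ₂ * D) (X : ℚ) where
      B≡0 : B ≡ 0ℚ
      B≡0 = x*x≡0⇒x≡0 B (trans B²≡ (trans (cong (_* D) κ₂≡0) (*-zeroˡ D)))
      A≢0 : A ≢ 0ℚ
      A≢0 e = *-≢0 κ₁≢0 (D≢0 DD⁻¹) (trans (sym A³≡) (trans (cong (A * A *_) e) (*-zeroʳ (A * A))))
      I = proj₁ (inverse A≢0)
      AI = proj₂ (inverse A≢0)
      w : ℚ → ℚ
      w X = X * X * I
      height≡ : ∀ X → X ^^ 12 * D⁻¹ ^^ 2 ≡ w X ^^ 6 * ν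
      height≡ X = trans (cong (λ t → X ^^ 12 * t ^^ 2) (J≡ A I D D⁻¹ κ₁ AI DD⁻¹ A³≡)) (lemma X I κ₁)
        where
        J≡ : ∀ A I D J κ → A * I ≡ 1ℚ → D * J ≡ 1ℚ → A * A * A ≡ κ * D → J ≡ κ * (I * I * I)
        J≡ A I D J κ AI DJ A³ = byLinComb (κ * (I * I * I) · DJ ⊹ - (J * (A * I * (A * I) + A * I + 1ℚ)) · AI ⊹ I * I * I * J · A³)
          (ℚ-identity 5 (λ A I D J κ → J ⊖ κ ⊗ (I ⊗ I ⊗ I) ⊜ κ ⊗ (I ⊗ I ⊗ I) ⊗ (D ⊗ J ⊖ Κ 1ℚ) ⊕ ⊝ (J ⊗ (A ⊗ I ⊗ (A ⊗ I) ⊕ A ⊗ I ⊕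
              Κ 1ℚ)) ⊗ (A ⊗ I ⊖ Κ 1ℚ) ⊕ I ⊗ I ⊗ I ⊗ J ⊗ (A ⊗ A ⊗ A ⊖ κ ⊗ D)) refl A I D J κ)
        lemma : ∀ X I κ → X * (X * (X * (X * (X * (X * (X * (X * (X * (X * (X * (X * 1ℚ))))))))))) * (κ * (I * I * I) * (κ * (I * I * I) * 1ℚ)) ≡
          X * X * I * (X * X * I * (X * X * I * (X * X * I * (X * X * I * (X * X * I * 1ℚ))))) * (κ * (κ * 1ℚ))
        lemma = ℚ-identity 3 (λ X I κ → X ⊗ (X ⊗ (X ⊗ (X ⊗ (X ⊗ (X ⊗ (X ⊗ (X ⊗ (X ⊗ (X ⊗ (X ⊗ (X ⊗ Κ 1ℚ))))))))))) ⊗ (κ ⊗ (I ⊗ I ⊗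
            I) ⊗ (κ ⊗ (I ⊗ I ⊗ I) ⊗ Κ 1ℚ)) ⊜ X ⊗ X ⊗ I ⊗ (X ⊗ X ⊗ I ⊗ (X ⊗ X ⊗ I ⊗ (X ⊗ X ⊗ I ⊗ (X ⊗ X ⊗ I ⊗ (X ⊗ X ⊗ I ⊗ Κ
            1ℚ))))) ⊗ (κ ⊗ (κ ⊗ Κ 1ℚ))) refl
      shift₊ : ∀ X A B I → B ≡ 0ℚ → A * I ≡ 1ℚ → X * (X * X * I + 1ℚ) ≡ I * (X * (X * X) + A * X + B)
      shift₊ X A B I B≡0 AI = byLinComb (- X · AI ⊹ - I · B≡0) (ℚ-identity 4 (λ X A B I → X ⊗ (X ⊗ X ⊗ I ⊕ Κ 1ℚ) ⊖ I ⊗ (X ⊗ (X ⊗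
          X) ⊕ A ⊗ X ⊕ B) ⊜ ⊝ X ⊗ (A ⊗ I ⊖ Κ 1ℚ) ⊕ ⊝ I ⊗ (B ⊖ Κ 0ℚ)) refl X A B I)
      shift₋ : ∀ X A B I → B ≡ 0ℚ → A * I ≡ 1ℚ →
        A * (X * X * I - 1ℚ) * (X * X * I - 1ℚ) ≡ I * (X * (X * (X * X)) - q (+ 2) * (A * (X * X)) - q (+ 8) * (B * X) + A * A)
      shift₋ X A B I B≡0 AI = byLinComb (X * X * X * X * I - A · AI ⊹ q (+ 8) * I * X · B≡0)
        (ℚ-identity 4 (λ X A B I → A ⊗ (X ⊗ X ⊗ I ⊖ Κ 1ℚ) ⊗ (X ⊗ X ⊗ I ⊖ Κ 1ℚ) ⊖ I ⊗ (X ⊗ (X ⊗ (X ⊗ X)) ⊖ # 2 ⊗ (A ⊗ (X ⊗ X)) ⊖ #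
            8 ⊗ (B ⊗ X) ⊕ A ⊗ A) ⊜ (X ⊗ X ⊗ X ⊗ X ⊗ I ⊖ A) ⊗ (A ⊗ I ⊖ Κ 1ℚ) ⊕ # 8 ⊗ I ⊗ X ⊗ (B ⊖ Κ 0ℚ)) refl X A B I)
      w-double : ∀ X′ → Doubling A B X X′ → w X′ * (q (+ 16) * (w X * ((w X + 1ℚ) * (w X + 1ℚ)))) ≡
        (w X - 1ℚ) * ((w X - 1ℚ) * ((w X - 1ℚ) * (w X - 1ℚ)))
      w-double X′ h = trans (lemma X X′ I (w X + 1ℚ)) (trans (cong (λ t → I * I * (t * t)) base) (lemma′ A I (w X - 1ℚ) AI))
        where
        base : X′ * (q (+ 4) * (X * (w X + 1ℚ))) ≡ A * (w X - 1ℚ) * (w X - 1ℚ)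
        base = trans (cong (λ t → X′ * (q (+ 4) * t)) (shift₊ X A B I B≡0 AI)) (trans (lemma″ X′ I (X * (X * X) + A * X + B))
          (trans (cong (I *_) h) (sym (shift₋ X A B I B≡0 AI))))
          where
          lemma″ : ∀ x i f → x * (q (+ 4) * (i * f)) ≡ i * (x * (q (+ 4) * f))
          lemma″ = ℚ-identity 3 (λ x i f → x ⊗ (# 4 ⊗ (i ⊗ f)) ⊜ i ⊗ (x ⊗ (# 4 ⊗ f))) refl
        lemma : ∀ x x′ i t → x′ * x′ * i * (q (+ 16) * (x * x * i * (t * t))) ≡ i * i * (x′ * (q (+ 4) * (x * t)) * (x′ * (q (+ 4) * (x * t))))
        lemma = ℚ-identity 4 (λ x x′ i t → x′ ⊗ x′ ⊗ i ⊗ (# 16 ⊗ (x ⊗ x ⊗ i ⊗ (t ⊗ t))) ⊜ i ⊗ i ⊗ (x′ ⊗ (# 4 ⊗ (x ⊗ t)) ⊗ (x′ ⊗ (#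
            4 ⊗ (x ⊗ t))))) refl
        lemma′ : ∀ a i t → a * i ≡ 1ℚ → i * i * (a * t * t * (a * t * t)) ≡ t * (t * (t * t))
        lemma′ a i t h = byLinComb ((a * i + 1ℚ) * (t * t * t * t) · h) (ℚ-identity 3 (λ a i t → i ⊗ i ⊗ (a ⊗ t ⊗ t ⊗ (a ⊗ t ⊗ t))
            ⊖ t ⊗ (t ⊗ (t ⊗ t)) ⊜ (a ⊗ i ⊕ Κ 1ℚ) ⊗ (t ⊗ t ⊗ t ⊗ t) ⊗ (a ⊗ i ⊖ Κ 1ℚ)) refl a i t)
      infinite : X * (X * X) + A * X + B ≡ 0ℚ → H (X ^^ 12 * D⁻¹ ^^ 2) ℕ.^ 4 ≤ C
      infinite e = ℕ.≤-trans (subst (λ z → H z ℕ.^ 4 ≤ c ℕ.^ 6 ℕ.* H ν ℕ.^ 4) (sym (height≡ X))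
        (lift-bound (w X) ν 6 (Forms₁₇₂₈.infinite (w X) (trans (lemma X I (w X + 1ℚ)) (trans (cong (λ t → q (+ 16) * I * (t * t)) zero-product) refl′)))))
        (ℕ.*-monoʳ-≤ (c ℕ.^ 6) (ℕ.m≤n*m (H ν ℕ.^ 4) (H ν) {{ℕ.>-nonZero (1≤H ν)}}))
        where
        zero-product : X * (w X + 1ℚ) ≡ 0ℚ
        zero-product = trans (shift₊ X A B I B≡0 AI) (trans (cong (I *_) e) (*-zeroʳ I))
        lemma : ∀ x i t → q (+ 16) * (x * x * i * (t * t)) ≡ q (+ 16) * i * (x * t * (x * t))
        lemma = ℚ-identity 3 (λ x i t → # 16 ⊗ (x ⊗ x ⊗ i ⊗ (t ⊗ t)) ⊜ # 16 ⊗ i ⊗ (x ⊗ t ⊗ (x ⊗ t))) refl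
        refl′ : q (+ 16) * I * (0ℚ * 0ℚ) ≡ 0ℚ
        refl′ = *-zeroʳ (q (+ 16) * I)
      finite : ∀ X′ → Doubling A B X X′ → H (X ^^ 12 * D⁻¹ ^^ 2) ℕ.^ 4 ≤ C ℕ.* H (X′ ^^ 12 * D⁻¹ ^^ 2)
      finite X′ h = subst₂ (λ y z → H y ℕ.^ 4 ≤ C ℕ.* H z) (sym (height≡ X)) (sym (height≡ X′))
        (lift-finite (w X) (w X′) ν 6 c (^^-≢0 2 κ₁≢0) (Forms₁₇₂₈.finite (w X) (w X′) (w-double X′ h)))

  private
    -- ν is the normalised height quotient of the unit u = B / (A e).
    unit-height : ∀ A B D J κ₁ κ₂ e u → D * J ≡ 1ℚ → A * A * A ≡ κ₁ * D → B * B ≡ κ₂ * D → A * e * u ≡ B →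
      D ^^ 4 * (κ₁ ^^ 4 * e ^^ 12 * (u ^^ 12 * J ^^ 2)) ≡ D ^^ 4 * κ₂ ^^ 6
    unit-height A B D J κ₁ κ₂ e u DJ A³≡ B²≡ Aeu≡B = begin
      D ^^ 4 * (κ₁ ^^ 4 * e ^^ 12 * (u ^^ 12 * J ^^ 2))  ≡⟨ lemma (D ^^ 4) (κ₁ ^^ 4) (e ^^ 12) (u ^^ 12) (J ^^ 2) ⟩
      κ₁ ^^ 4 * D ^^ 4 * e ^^ 12 * u ^^ 12 * J ^^ 2      ≡⟨ cong (λ z → z * e ^^ 12 * u ^^ 12 * J ^^ 2) (trans (sym (^^-* κ₁ D 4)) (trans (cong (_^^ 4) (sym A³≡′)) (^^-^^ A 3 4))) ⟩
      A ^^ 12 * e ^^ 12 * u ^^ 12 * J ^^ 2               ≡⟨ cong (_* J ^^ 2) (sym (trans (^^-* (A * e) u 12) (cong (_* u ^^ 12) (^^-* A e 12)))) ⟩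
      (A * e * u) ^^ 12 * J ^^ 2                         ≡⟨ cong (λ z → z ^^ 12 * J ^^ 2) Aeu≡B ⟩
      B ^^ 12 * J ^^ 2                                   ≡⟨ cong (_* J ^^ 2) (trans (sym (^^-^^ B 2 6)) (trans (cong (_^^ 6) B²≡′) (^^-* κ₂ D 6))) ⟩
      κ₂ ^^ 6 * D ^^ 6 * J ^^ 2                          ≡⟨ cong (λ z → κ₂ ^^ 6 * z * J ^^ 2) (^^-+ D 4 2) ⟩
      κ₂ ^^ 6 * (D ^^ 4 * D ^^ 2) * J ^^ 2               ≡⟨ lemma′ (κ₂ ^^ 6) (D ^^ 4) (D ^^ 2) (J ^^ 2) ⟩
      D ^^ 4 * κ₂ ^^ 6 * (D ^^ 2 * J ^^ 2)               ≡⟨ cong (D ^^ 4 * κ₂ ^^ 6 *_) (trans (sym (^^-* D J 2)) (cong (_^^ 2) DJ)) ⟩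
      D ^^ 4 * κ₂ ^^ 6 * 1ℚ                              ≡⟨ *-identityʳ (D ^^ 4 * κ₂ ^^ 6) ⟩
      D ^^ 4 * κ₂ ^^ 6                                   ∎
      where
      open ≡-Reasoning
      A³≡′ : A ^^ 3 ≡ κ₁ * D
      A³≡′ = trans (lemma″ A) A³≡
        where
        lemma″ : ∀ A → A * (A * (A * 1ℚ)) ≡ A * A * A
        lemma″ = ℚ-identity 1 (λ A → A ⊗ (A ⊗ (A ⊗ Κ 1ℚ)) ⊜ A ⊗ A ⊗ A) refl
      B²≡′ : B ^^ 2 ≡ κ₂ * D
      B²≡′ = trans (cong (B *_) (*-identityʳ B)) B²≡
      lemma : ∀ d k e u j → d * (k * e * (u * j)) ≡ k * d * e * u * j
      lemma = ℚ-identity 5 (λ d k e u j → d ⊗ (k ⊗ e ⊗ (u ⊗ j)) ⊜ k ⊗ d ⊗ e ⊗ u ⊗ j) refl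
      lemma′ : ∀ k d d′ j → k * (d * d′) * j ≡ d * k * (d′ * j)
      lemma′ = ℚ-identity 4 (λ k d d′ j → k ⊗ (d ⊗ d′) ⊗ j ⊜ d ⊗ k ⊗ (d′ ⊗ j)) refl

  -- In the coordinate ξ = X v the curve has the fixed coefficients A₀ = A v², B₀ = B v³.
  module Rescaled (A B D J κ₁ κ₂ e A₀ B₀ u v : ℚ) (DJ : D * J ≡ 1ℚ) (vu≡1 : v * u ≡ 1ℚ) (u≢0 : u ≢ 0ℚ)
    (A³≡ : A * A * A ≡ κ₁ * D) (B²≡ : B * B ≡ κ₂ * D) (κ₁≢0 : κ₁ ≢ 0ℚ) (e≢0 : e ≢ 0ℚ)
    (Aeu≡B : A * e * u ≡ B) (Av² : A₀ ≡ A * (v * v)) (Bv³ : B₀ ≡ B * (v * (v * v)))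
    (c : ℕ)
    (infinite₀ : ∀ w → q (+ 4) * (w * (w * w) + A₀ * w + B₀) ≡ 0ℚ → H w ℕ.^ 4 ≤ c)
    (finite₀ : ∀ w w′ → w′ * (q (+ 4) * (w * (w * w) + A₀ * w + B₀)) ≡
      w * (w * (w * w)) - q (+ 2) * (A₀ * (w * w)) - q (+ 8) * (B₀ * w) + A₀ * A₀ → H w ℕ.^ 4 ≤ c ℕ.* H w′)
    (hν : ℕ) (hν≡ : hν ≡ H (κ₂ ^^ 6) ℕ.* H (κ₁ ^^ 4 * e ^^ 12)) (C : ℕ) (C≡ : C ≡ c ℕ.^ 12 ℕ.* (hν ℕ.* hν ℕ.^ 4)) where

    private
      ν : ℚ
      ν = u ^^ 12 * J ^^ 2

      height≡ : ∀ X → X ^^ 12 * J ^^ 2 ≡ (X * v) ^^ 12 * ν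
      height≡ X = trans (cong (λ x → x ^^ 12 * J ^^ 2) (sym (trans (*-assoc X v u) (trans (cong (X *_) vu≡1) (*-identityʳ X)))))
        (trans (cong (_* J ^^ 2) (^^-* (X * v) u 12)) (*-assoc ((X * v) ^^ 12) (u ^^ 12) (J ^^ 2)))

      ν≢0 : ν ≢ 0ℚ
      ν≢0 = *-≢0 (^^-≢0 12 u≢0) (^^-≢0 {J} 2 (D≢0 {J} {D} (trans (*-comm J D) DJ)))

      Hν≤ : H ν ≤ hν
      Hν≤ = subst (H ν ≤_) (sym hν≡) (H-quotient {κ₁ ^^ 4 * e ^^ 12} {ν} {κ₂ ^^ 6} (*-≢0 (^^-≢0 4 κ₁≢0) (^^-≢0 12 e≢0))
        (*-cancelˡ-≢0 {D ^^ 4} (^^-≢0 {D} 4 (D≢0 {D} {J} DJ)) (unit-height A B D J κ₁ κ₂ e u DJ A³≡ B²≡ Aeu≡B)))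

      cubic : ∀ X → q (+ 4) * (X * v * (X * v * (X * v)) + A₀ * (X * v) + B₀) ≡ v * (v * v) * (q (+ 4) * (X * (X * X) + A * X + B))
      cubic X = trans (cong₂ (λ a b → q (+ 4) * (X * v * (X * v * (X * v)) + a * (X * v) + b)) Av² Bv³) (lemma A B X v)
        where
        lemma : ∀ A B X v → q (+ 4) * (X * v * (X * v * (X * v)) + A * (v * v) * (X * v) + B * (v * (v * v))) ≡ v * (v * v) * (q (+ 4) * (X * (X * X) + A * X + B))
        lemma = ℚ-identity 4 (λ A B X v → # 4 ⊗ (X ⊗ v ⊗ (X ⊗ v ⊗ (X ⊗ v)) ⊕ A ⊗ (v ⊗ v) ⊗ (X ⊗ v) ⊕ B ⊗ (v ⊗ (v ⊗ v))) ⊜ v ⊗ (v ⊗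
            v) ⊗ (# 4 ⊗ (X ⊗ (X ⊗ X) ⊕ A ⊗ X ⊕ B))) refl

      double : ∀ X X′ → Doubling A B X X′ → X′ * v * (q (+ 4) * (X * v * (X * v * (X * v)) + A₀ * (X * v) + B₀)) ≡
        X * v * (X * v * (X * v * (X * v))) - q (+ 2) * (A₀ * (X * v * (X * v))) - q (+ 8) * (B₀ * (X * v)) + A₀ * A₀
      double X X′ h = trans (cong (X′ * v *_) (cubic X)) (trans (lemma X′ v (q (+ 4) * (X * (X * X) + A * X + B))) (trans (cong (v * (v * (v * v)) *_) h)
        (trans (lemma′ A B X v) (cong₂ (λ a b → X * v * (X * v * (X * v * (X * v))) - q (+ 2) * (a * (X * v * (X * v))) - q (+ 8) * (b * (X * v)) + a * a) (sym Av²) (sym Bv³)))))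
        where
        lemma : ∀ x v f → x * v * (v * (v * v) * f) ≡ v * (v * (v * v)) * (x * f)
        lemma = ℚ-identity 3 (λ x v f → x ⊗ v ⊗ (v ⊗ (v ⊗ v) ⊗ f) ⊜ v ⊗ (v ⊗ (v ⊗ v)) ⊗ (x ⊗ f)) refl
        lemma′ : ∀ A B X v → v * (v * (v * v)) * (X * (X * (X * X)) - q (+ 2) * (A * (X * X)) - q (+ 8) * (B * X) + A * A) ≡
          X * v * (X * v * (X * v * (X * v))) - q (+ 2) * (A * (v * v) * (X * v * (X * v))) - q (+ 8) * (B * (v * (v * v)) * (X * v)) + A * (v * v) * (A * (v * v))
        lemma′ = ℚ-identity 4 (λ A B X v → v ⊗ (v ⊗ (v ⊗ v)) ⊗ (X ⊗ (X ⊗ (X ⊗ X)) ⊖ # 2 ⊗ (A ⊗ (X ⊗ X)) ⊖ # 8 ⊗ (B ⊗ X) ⊕ A ⊗ A) ⊜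
            X ⊗ v ⊗ (X ⊗ v ⊗ (X ⊗ v ⊗ (X ⊗ v))) ⊖ # 2 ⊗ (A ⊗ (v ⊗ v) ⊗ (X ⊗ v ⊗ (X ⊗ v))) ⊖ # 8 ⊗ (B ⊗ (v ⊗ (v ⊗ v)) ⊗ (X ⊗ v)) ⊕
            A ⊗ (v ⊗ v) ⊗ (A ⊗ (v ⊗ v))) refl

      -- The exponent is a variable so that powers are not unfolded.
      infinite-bound : ∀ k w n → H w ℕ.^ 4 ≤ n → H (w ^^ k * ν) ℕ.^ 4 ≤ n ℕ.^ k ℕ.* (hν ℕ.* hν ℕ.^ 4)
      infinite-bound k w n h = ℕ.≤-trans (lift-bound w ν k h) (ℕ.*-monoʳ-≤ (n ℕ.^ k) (ℕ.≤-trans (ℕ.^-monoˡ-≤ 4 Hν≤)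
        (ℕ.m≤n*m (hν ℕ.^ 4) hν {{ℕ.>-nonZero (ℕ.≤-trans (1≤H ν) Hν≤)}})))

      finite-bound : ∀ k w w′ n → H w ℕ.^ 4 ≤ n ℕ.* H w′ → H (w ^^ k * ν) ℕ.^ 4 ≤ n ℕ.^ k ℕ.* (hν ℕ.* hν ℕ.^ 4) ℕ.* H (w′ ^^ k * ν)
      finite-bound k w w′ n h = ℕ.≤-trans (lift-finite w w′ ν k n ν≢0 h)
        (ℕ.*-monoˡ-≤ (H (w′ ^^ k * ν)) (ℕ.*-monoʳ-≤ (n ℕ.^ k) (ℕ.*-mono-≤ Hν≤ (ℕ.^-monoˡ-≤ 4 Hν≤))))

    infinite : ∀ X → X * (X * X) + A * X + B ≡ 0ℚ → H (X ^^ 12 * J ^^ 2) ℕ.^ 4 ≤ C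
    infinite X h = subst₂ (λ z n → H z ℕ.^ 4 ≤ n) (sym (height≡ X)) (sym C≡) (infinite-bound 12 (X * v) c
      (infinite₀ (X * v) (trans (cubic X) (trans (cong (λ t → v * (v * v) * (q (+ 4) * t)) h) (*-zeroʳ (v * (v * v)))))))

    finite : ∀ X X′ → Doubling A B X X′ → H (X ^^ 12 * J ^^ 2) ℕ.^ 4 ≤ C ℕ.* H (X′ ^^ 12 * J ^^ 2)
    finite X X′ h = subst₂ (λ z n → H z ℕ.^ 4 ≤ n ℕ.* H (X′ ^^ 12 * J ^^ 2)) (sym (height≡ X)) (sym C≡)
      (subst (λ z → H ((X * v) ^^ 12 * ν) ℕ.^ 4 ≤ c ℕ.^ 12 ℕ.* (hν ℕ.* hν ℕ.^ 4) ℕ.* H z) (sym (height≡ X′))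
        (finite-bound 12 (X * v) (X′ * v) c (finite₀ (X * v) (X′ * v) (double X X′ h))))

  -- With `k = κ₁ / κ₂ = A³ / B²` and `e` its denominator, the unit `u = B / (A e)` turns the
  -- coefficients into `k e²` and `k e³`, which are integers depending on `j` only. One application
  -- of `GeneralForms` then serves all twists.
  growth-general : ∀ κ₁ κ₂ → κ₁ ≢ 0ℚ → κ₂ ≢ 0ℚ → q (+ 4) * κ₁ + q (+ 27) * κ₂ ≡ 1ℚ → DoublingGrowth κ₁ κ₂
  growth-general κ₁ κ₂ κ₁≢0 κ₂≢0 sum≡1 = assemble (F.constant 0ℚ) F.infinite F.finite _ refl _ refl
    where
    κ₂⁻¹ = proj₁ (inverse κ₂≢0)
    k = κ₁ * κ₂⁻¹
    kκ₂ : k * κ₂ ≡ κ₁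
    kκ₂ = trans (*-assoc κ₁ κ₂⁻¹ κ₂) (trans (cong (κ₁ *_) (trans (*-comm κ₂⁻¹ κ₂) (proj₂ (inverse κ₂≢0)))) (*-identityʳ κ₁))
    e : ℚ
    e = q (↧ k)
    e≢0 : e ≢ 0ℚ
    e≢0 h = ℕ.>⇒≢ (1≤↧ k) (cong ∣_∣ (q-injective {↧ k} {+ 0} h))
    A₀ B₀ : ℤ
    A₀ = ↥ k ℤ.* ↧ k
    B₀ = ↥ k ℤ.* (↧ k ℤ.* ↧ k)
    A₀≡ : q A₀ ≡ k * e * e
    A₀≡ = sym (int≡ (int-* (int-clear k) (int-q (↧ k))))
    B₀≡ : q B₀ ≡ k * e * (e * e)
    B₀≡ = sym (int≡ (int-* (int-clear k) (int-* (int-q (↧ k)) (int-q (↧ k)))))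
    -- `R` factors as `4 k² e⁶ (4k + 27)`, and `(4k + 27) κ₂ = 4 κ₁ + 27 κ₂ = 1`.
    R≢0 : + 4 ℤ.* (+ 4 ℤ.* (A₀ ℤ.* (A₀ ℤ.* A₀)) ℤ.+ + 27 ℤ.* (B₀ ℤ.* B₀)) ≢ + 0
    R≢0 h = *-≢0 (*-≢0 (*-≢0 {q (+ 4)} (λ ()) (*-≢0 k≢0 k≢0)) (*-≢0 e≢0 (*-≢0 e≢0 (*-≢0 e≢0 (*-≢0 e≢0 (*-≢0 e≢0 e≢0)))))) resultant≢0
        (trans (sym (lemma k e)) (trans (sym (cong₂ (λ a b → q (+ 4) * (q (+ 4) * (a * (a * a)) + q (+ 27) * (b * b))) A₀≡ B₀≡))
          (trans (int≡ integral) (cong q h))))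
      where
      integral = int-* (int-q (+ 4)) (int-+ (int-* (int-q (+ 4)) (int-* (int-q A₀) (int-* (int-q A₀) (int-q A₀)))) (int-* (int-q (+ 27)) (int-* (int-q B₀) (int-q B₀))))
      k≢0 : k ≢ 0ℚ
      k≢0 h = κ₁≢0 (trans (sym kκ₂) (trans (cong (_* κ₂) h) (*-zeroˡ κ₂)))
      resultant≢0 : q (+ 4) * k + q (+ 27) ≢ 0ℚ
      resultant≢0 h = 1≢0′ (trans (sym sum≡1) (trans (cong (λ x → q (+ 4) * x + q (+ 27) * κ₂) (sym kκ₂))
        (trans (lemma′ k κ₂) (trans (cong (_* κ₂) h) (*-zeroˡ κ₂)))))
        where
        lemma′ : ∀ k κ → q (+ 4) * (k * κ) + q (+ 27) * κ ≡ (q (+ 4) * k + q (+ 27)) * κ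
        lemma′ = ℚ-identity 2 (λ k κ → # 4 ⊗ (k ⊗ κ) ⊕ # 27 ⊗ κ ⊜ (# 4 ⊗ k ⊕ # 27) ⊗ κ) refl
      lemma : ∀ k e → q (+ 4) * (q (+ 4) * (k * e * e * (k * e * e * (k * e * e))) + q (+ 27) * (k * e * (e * e) * (k * e * (e * e)))) ≡
        q (+ 4) * (k * k) * (e * (e * (e * (e * (e * e))))) * (q (+ 4) * k + q (+ 27))
      lemma = ℚ-identity 2 (λ k e → # 4 ⊗ (# 4 ⊗ (k ⊗ e ⊗ e ⊗ (k ⊗ e ⊗ e ⊗ (k ⊗ e ⊗ e))) ⊕ # 27 ⊗ (k ⊗ e ⊗ (e ⊗ e) ⊗ (k ⊗ e ⊗ (e ⊗
          e)))) ⊜ # 4 ⊗ (k ⊗ k) ⊗ (e ⊗ (e ⊗ (e ⊗ (e ⊗ (e ⊗ e))))) ⊗ (# 4 ⊗ k ⊕ # 27)) refl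
    module F = GeneralForms A₀ B₀ R≢0
    assemble : (c : ℕ)
      (infinite₀ : ∀ w → q (+ 4) * (w * (w * w) + q A₀ * w + q B₀) ≡ 0ℚ → H w ℕ.^ 4 ≤ c)
      (finite₀ : ∀ w w′ → w′ * (q (+ 4) * (w * (w * w) + q A₀ * w + q B₀)) ≡
        w * (w * (w * w)) - q (+ 2) * (q A₀ * (w * w)) - q (+ 8) * (q B₀ * w) + q A₀ * q A₀ → H w ℕ.^ 4 ≤ c ℕ.* H w′)
      (hν : ℕ) (hν≡ : hν ≡ H (κ₂ ^^ 6) ℕ.* H (κ₁ ^^ 4 * e ^^ 12)) (C : ℕ) (C≡ : C ≡ c ℕ.^ 12 ℕ.* (hν ℕ.* hν ℕ.^ 4)) → DoublingGrowth κ₁ κ₂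
    assemble c infinite₀ finite₀ hν hν≡ C C≡ = record { constant = C ; bounds = bounds }
      where
      bounds : ∀ A B D D⁻¹ → D * D⁻¹ ≡ 1ℚ → A * A * A ≡ κ₁ * D → B * B ≡ κ₂ * D → ∀ X →
        (X * (X * X) + A * X + B ≡ 0ℚ → H (X ^^ 12 * D⁻¹ ^^ 2) ℕ.^ 4 ≤ C) ×
        (∀ X′ → Doubling A B X X′ → H (X ^^ 12 * D⁻¹ ^^ 2) ℕ.^ 4 ≤ C ℕ.* H (X′ ^^ 12 * D⁻¹ ^^ 2))
      bounds A B D J DJ A³≡ B²≡ X = with-inverses (inverse A≢0) (inverse B≢0) (inverse e≢0)
        where
        A≢0 : A ≢ 0ℚ
        A≢0 h = *-≢0 κ₁≢0 (D≢0 DJ) (trans (sym A³≡) (trans (cong (A * A *_) h) (*-zeroʳ (A * A))))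
        B≢0 : B ≢ 0ℚ
        B≢0 h = *-≢0 κ₂≢0 (D≢0 DJ) (trans (sym B²≡) (trans (cong (_* B) h) (*-zeroˡ B)))
        A³≡kB² : A * A * A ≡ k * (B * B)
        A³≡kB² = trans A³≡ (trans (cong (_* D) (sym kκ₂)) (trans (*-assoc k κ₂ D) (cong (k *_) (sym B²≡))))
        with-inverses : (∃ λ a → A * a ≡ 1ℚ) → (∃ λ b → B * b ≡ 1ℚ) → (∃ λ f → e * f ≡ 1ℚ) →
          (X * (X * X) + A * X + B ≡ 0ℚ → H (X ^^ 12 * J ^^ 2) ℕ.^ 4 ≤ C) ×
          (∀ X′ → Doubling A B X X′ → H (X ^^ 12 * J ^^ 2) ℕ.^ 4 ≤ C ℕ.* H (X′ ^^ 12 * J ^^ 2))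
        with-inverses (a , Aa) (b , Bb) (f , ef) = R.infinite X , R.finite X
          where
          vu≡1 : A * e * b * (B * a * f) ≡ 1ℚ
          vu≡1 = trans (lemma A e b B a f) (trans (cong₂ _*_ (cong₂ _*_ Aa ef) Bb) refl)
            where
            lemma : ∀ A e I B J E → A * e * I * (B * J * E) ≡ A * J * (e * E) * (B * I)
            lemma = ℚ-identity 6 (λ A e I B J E → A ⊗ e ⊗ I ⊗ (B ⊗ J ⊗ E) ⊜ A ⊗ J ⊗ (e ⊗ E) ⊗ (B ⊗ I)) refl
          u≢0 : B * a * f ≢ 0ℚ
          u≢0 h = 1≢0′ (trans (sym vu≡1) (trans (cong (A * e * b *_) h) (*-zeroʳ (A * e * b))))
          Aeu≡B : A * e * (B * a * f) ≡ B
          Aeu≡B = trans (lemma A e B a f) (trans (cong₂ (λ s t → B * s * t) Aa ef) (trans (*-identityʳ (B * 1ℚ)) (*-identityʳ B)))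
            where
            lemma : ∀ A e B J E → A * e * (B * J * E) ≡ B * (A * J) * (e * E)
            lemma = ℚ-identity 5 (λ A e B J E → A ⊗ e ⊗ (B ⊗ J ⊗ E) ⊜ B ⊗ (A ⊗ J) ⊗ (e ⊗ E)) refl
          Av² : q A₀ ≡ A * (A * e * b * (A * e * b))
          Av² = trans A₀≡ (lemma A B b e k Bb A³≡kB²)
            where
            lemma : ∀ A B I e k → B * I ≡ 1ℚ → A * A * A ≡ k * (B * B) → k * e * e ≡ A * (A * e * I * (A * e * I))
            lemma A B I e k BI A³ = byLinComb (- (k * e * e * (B * I + 1ℚ)) · BI ⊹ - (e * e * I * I) · A³) (ℚ-identity 5 (λ A B I
                e k → k ⊗ e ⊗ e ⊖ A ⊗ (A ⊗ e ⊗ I ⊗ (A ⊗ e ⊗ I)) ⊜ ⊝ (k ⊗ e ⊗ e ⊗ (B ⊗ I ⊕ Κ 1ℚ)) ⊗ (B ⊗ I ⊖ Κ 1ℚ) ⊕ ⊝ (e ⊗ e ⊗ I ⊗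
                I) ⊗ (A ⊗ A ⊗ A ⊖ k ⊗ (B ⊗ B))) refl A B I e k)
          Bv³ : q B₀ ≡ B * (A * e * b * (A * e * b * (A * e * b)))
          Bv³ = trans B₀≡ (lemma A B b e k Bb A³≡kB²)
            where
            lemma : ∀ A B I e k → B * I ≡ 1ℚ → A * A * A ≡ k * (B * B) → k * e * (e * e) ≡ B * (A * e * I * (A * e * I * (A * e * I)))
            lemma A B I e k BI A³ = byLinComb (- (k * e * e * e * (B * I * (B * I) + B * I + 1ℚ)) · BI ⊹ - (e * e * e * B * I * I * I) · A³)
              (ℚ-identity 5 (λ A B I e k → k ⊗ e ⊗ (e ⊗ e) ⊖ B ⊗ (A ⊗ e ⊗ I ⊗ (A ⊗ e ⊗ I ⊗ (A ⊗ e ⊗ I))) ⊜ ⊝ (k ⊗ e ⊗ e ⊗ e ⊗ (B ⊗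
                  I ⊗ (B ⊗ I) ⊕ B ⊗ I ⊕ Κ 1ℚ)) ⊗ (B ⊗ I ⊖ Κ 1ℚ) ⊕ ⊝ (e ⊗ e ⊗ e ⊗ B ⊗ I ⊗ I ⊗ I) ⊗ (A ⊗ A ⊗ A ⊖ k ⊗ (B ⊗ B))) refl
                  A B I e k)
          module R = Rescaled A B D J κ₁ κ₂ e (q A₀) (q B₀) (B * a * f) (A * e * b) DJ vu≡1 u≢0 A³≡ B²≡ κ₁≢0 e≢0 Aeu≡B Av² Bv³
            c infinite₀ finite₀ hν hν≡ C C≡

  doubling-growth : ∀ κ₁ κ₂ → q (+ 4) * κ₁ + q (+ 27) * κ₂ ≡ 1ℚ → DoublingGrowth κ₁ κ₂
  doubling-growth κ₁ κ₂ h = cases (κ₁ ≟ 0ℚ) (κ₂ ≟ 0ℚ)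
    where
    cases : Dec (κ₁ ≡ 0ℚ) → Dec (κ₂ ≡ 0ℚ) → DoublingGrowth κ₁ κ₂
    cases (no κ₁≢0) (no κ₂≢0) = growth-general κ₁ κ₂ κ₁≢0 κ₂≢0 h
    cases (no κ₁≢0) (yes κ₂≡0) = growth₁₇₂₈ κ₁ κ₂ κ₁≢0 κ₂≡0
    cases (yes κ₁≡0) (no κ₂≢0) = growth₀ κ₁ κ₂ κ₁≡0 κ₂≢0
    cases (yes κ₁≡0) (yes κ₂≡0) = contradiction (trans (sym h) (cong₂ (λ x y → q (+ 4) * x + q (+ 27) * y) κ₁≡0 κ₂≡0)) λ ()

-- The short model of a curve, and the height of its points

module CurveHeight where

  open import Defs
  open RationalAlgebra
  open ChordTangent
  open RationalHeight
  open WeightedHeight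
  open ShortWeierstrass
  open CollinearPair using (Collinear)
  open DoublingHeight
  open import Data.Nat as ℕ using (ℕ; _≤_; z≤n; s≤s)
  import Data.Nat.Properties as ℕ
  open import Data.Integer as ℤ using (+_)
  open import Data.Rational using (ℚ; 0ℚ; 1ℚ; _+_; _*_; _-_; -_; 1/_; ≢-nonZero)
  open import Data.Rational.Properties hiding (≤-trans; ≤-reflexive)
  open import Data.Product using (proj₁; proj₂)
  open import Relation.Nullary using (Dec; yes; no)
  open import Relation.Binary.PropositionalEquality hiding (J)

  -- With X = 3x + a and Y = 3y the equation becomes 3Y² = X³ + AX + B.
  A B : Weierstrass → ℚ
  A E = q (+ 9) * b E - q (+ 3) * (a E * a E)
  B E = q (+ 2) * (a E * a E * a E) - q (+ 9) * (a E * b E) + q (+ 27) * c E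

  D : Weierstrass → ℚ
  D E = q (+ 4) * (A E * A E * A E) + q (+ 27) * (B E * B E)

  private
    -- `disc` is 16 times the discriminant of the cubic in `x`, and `- D` is that of X³ + AX + B.
    -- The roots are scaled by 3, which multiplies a cubic discriminant by 3⁶ = 729.
    disc-D : ∀ a b c → q (+ 729) * disc a b c ≡ - (q (+ 16)) *
      (q (+ 4) * ((q (+ 9) * b - q (+ 3) * (a * a)) * (q (+ 9) * b - q (+ 3) * (a * a)) * (q (+ 9) * b - q (+ 3) * (a * a))) +
       q (+ 27) * ((q (+ 2) * (a * a * a) - q (+ 9) * (a * b) + q (+ 27) * c) * (q (+ 2) * (a * a * a) - q (+ 9) * (a * b) + q (+ 27) * c)))
    disc-D a b c = lemma a b c
      where
      lemma : ∀ a b c → q (+ 729) * ((- (q (+ 16) * a * a * (q (+ 4) * a * c - b * b))) - q (+ 64) * b * b * b - q (+ 432) * c * c + q (+ 288) * a * b * c) ≡ - (q (+ 16)) *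
        (q (+ 4) * ((q (+ 9) * b - q (+ 3) * (a * a)) * (q (+ 9) * b - q (+ 3) * (a * a)) * (q (+ 9) * b - q (+ 3) * (a * a))) +
         q (+ 27) * ((q (+ 2) * (a * a * a) - q (+ 9) * (a * b) + q (+ 27) * c) * (q (+ 2) * (a * a * a) - q (+ 9) * (a * b) + q (+ 27) * c)))
      lemma = ℚ-identity 3 (λ a b c → # 729 ⊗ ((⊝ (# 16 ⊗ a ⊗ a ⊗ (# 4 ⊗ a ⊗ c ⊖ b ⊗ b))) ⊖ # 64 ⊗ b ⊗ b ⊗ b ⊖ # 432 ⊗ c ⊗ c ⊕ #
          288 ⊗ a ⊗ b ⊗ c) ⊜ ⊝ (# 16) ⊗ (# 4 ⊗ ((# 9 ⊗ b ⊖ # 3 ⊗ (a ⊗ a)) ⊗ (# 9 ⊗ b ⊖ # 3 ⊗ (a ⊗ a)) ⊗ (# 9 ⊗ b ⊖ # 3 ⊗ (a ⊗ a)))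
          ⊕ # 27 ⊗ ((# 2 ⊗ (a ⊗ a ⊗ a) ⊖ # 9 ⊗ (a ⊗ b) ⊕ # 27 ⊗ c) ⊗ (# 2 ⊗ (a ⊗ a ⊗ a) ⊖ # 9 ⊗ (a ⊗ b) ⊕ # 27 ⊗ c)))) refl

  D≢0 : ∀ E → D E ≢ 0ℚ
  D≢0 E e = nonsing E (*-zero-cancelˡ {q (+ 729)} (λ ()) (trans (disc-D (a E) (b E) (c E)) (trans (cong (- (q (+ 16)) *_) e) refl)))

  -- A³ = κ₁ D and B² = κ₂ D, because j = 1728 · 4A³ / D.
  κ₁ κ₂ : ℚ → ℚ
  κ₁ j = j * (+ 1 Data.Rational./ 6912)
  κ₂ j = (1ℚ - q (+ 4) * κ₁ j) * (+ 1 Data.Rational./ 27)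

  κ-sum : ∀ j → q (+ 4) * κ₁ j + q (+ 27) * κ₂ j ≡ 1ℚ
  κ-sum j = trans (lemma (κ₁ j) (+ 1 Data.Rational./ 27)) (lemma′ (κ₁ j))
    where
    lemma : ∀ k i → q (+ 4) * k + q (+ 27) * ((1ℚ - q (+ 4) * k) * i) ≡ q (+ 4) * k + (q (+ 27) * i) * (1ℚ - q (+ 4) * k)
    lemma = ℚ-identity 2 (λ k i → # 4 ⊗ k ⊕ # 27 ⊗ ((Κ 1ℚ ⊖ # 4 ⊗ k) ⊗ i) ⊜ # 4 ⊗ k ⊕ (# 27 ⊗ i) ⊗ (Κ 1ℚ ⊖ # 4 ⊗ k)) refl
    lemma′ : ∀ k → q (+ 4) * k + 1ℚ * (1ℚ - q (+ 4) * k) ≡ 1ℚ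
    lemma′ = ℚ-identity 1 (λ k → # 4 ⊗ k ⊕ Κ 1ℚ ⊗ (Κ 1ℚ ⊖ # 4 ⊗ k) ⊜ Κ 1ℚ) refl

  j-relation : ∀ E {j} → jInv E ≡ j → c4 E * c4 E * c4 E ≡ disc (a E) (b E) (c E) * j
  j-relation E {j} h = trans (sym (*-÷-cancel (c4 E * c4 E * c4 E) (disc (a E) (b E) (c E)) (nonsing E))) (cong (disc (a E) (b E) (c E) *_) h)

  A³≡ : ∀ E {j} → jInv E ≡ j → A E * A E * A E ≡ κ₁ j * D E
  A³≡ E {j} h = finish (a E) (b E) (c E) (disc (a E) (b E) (c E)) j (D E) (disc-D (a E) (b E) (c E)) (j-relation E h)
    where
    finish : ∀ a b c Δ j D → q (+ 729) * Δ ≡ - (q (+ 16)) * D →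
      (q (+ 16) * a * a - q (+ 48) * b) * (q (+ 16) * a * a - q (+ 48) * b) * (q (+ 16) * a * a - q (+ 48) * b) ≡ Δ * j →
      (q (+ 9) * b - q (+ 3) * (a * a)) * (q (+ 9) * b - q (+ 3) * (a * a)) * (q (+ 9) * b - q (+ 3) * (a * a)) ≡ j * (+ 1 Data.Rational./ 6912) * D
    -- `c4 = - (16/3) A`, and 729 · (16/3)³ = 110592 = 16 · 6912.
    finish a b c Δ j D h₁ h₂ = *-cancelˡ-≢0 {q (+ 110592)} (λ ()) (trans middle (lemma j D))
      where
      lemma : ∀ j D → q (+ 16) * j * D ≡ q (+ 110592) * (j * (+ 1 Data.Rational./ 6912) * D)
      lemma = ℚ-identity 2 (λ j D → # 16 ⊗ j ⊗ D ⊜ # 110592 ⊗ (j ⊗ Κ (+ 1 Data.Rational./ 6912) ⊗ D)) refl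
      middle : q (+ 110592) * ((q (+ 9) * b - q (+ 3) * (a * a)) * (q (+ 9) * b - q (+ 3) * (a * a)) * (q (+ 9) * b - q (+ 3) * (a * a))) ≡ q (+ 16) * j * D
      middle = byLinComb (- (q (+ 729)) · h₂ ⊹ - j · h₁) (ℚ-identity 5 (λ a b Δ j D → # 110592 ⊗ ((# 9 ⊗ b ⊖ # 3 ⊗ (a ⊗ a)) ⊗ (# 9
          ⊗ b ⊖ # 3 ⊗ (a ⊗ a)) ⊗ (# 9 ⊗ b ⊖ # 3 ⊗ (a ⊗ a))) ⊖ # 16 ⊗ j ⊗ D ⊜ ⊝ # 729 ⊗ ((# 16 ⊗ a ⊗ a ⊖ # 48 ⊗ b) ⊗ (# 16 ⊗ a ⊗ a
          ⊖ # 48 ⊗ b) ⊗ (# 16 ⊗ a ⊗ a ⊖ # 48 ⊗ b) ⊖ Δ ⊗ j) ⊕ ⊝ j ⊗ (# 729 ⊗ Δ ⊖ ⊝ # 16 ⊗ D)) refl a b Δ j D)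

  B²≡ : ∀ E {j} → jInv E ≡ j → B E * B E ≡ κ₂ j * D E
  B²≡ E {j} h = *-cancelˡ-≢0 {q (+ 27)} (λ ()) (finish (A E) (B E) (D E) (κ₁ j) (κ₂ j) refl (A³≡ E h) (κ-sum j))
    where
    finish : ∀ A B D k k′ → D ≡ q (+ 4) * (A * A * A) + q (+ 27) * (B * B) → A * A * A ≡ k * D → q (+ 4) * k + q (+ 27) * k′ ≡ 1ℚ →
      q (+ 27) * (B * B) ≡ q (+ 27) * (k′ * D)
    finish A B D k k′ hD hA hk = byLinComb (- 1ℚ · hD ⊹ - (q (+ 4)) · hA ⊹ - D · hk) (ℚ-identity 5 (λ A B D k k′ → # 27 ⊗ (B ⊗ B)
        ⊖ # 27 ⊗ (k′ ⊗ D) ⊜ ⊝ Κ 1ℚ ⊗ (D ⊖ (# 4 ⊗ (A ⊗ A ⊗ A) ⊕ # 27 ⊗ (B ⊗ B))) ⊕ ⊝ # 4 ⊗ (A ⊗ A ⊗ A ⊖ k ⊗ D) ⊕ ⊝ D ⊗ (# 4 ⊗ k ⊕ #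
        27 ⊗ k′ ⊖ Κ 1ℚ)) refl A B D k k′)

  Xc : Weierstrass → ℚ → ℚ
  Xc E x = q (+ 3) * x + a E

  Yc : ℚ → ℚ
  Yc y = q (+ 3) * y

  short-curve : ∀ E x y → OnCurve E (pt x y) → q (+ 3) * (Yc y * Yc y) ≡ Xc E x * Xc E x * Xc E x + A E * Xc E x + B E
  short-curve E x y h = lemma (a E) (b E) (c E) x y h
    where
    lemma : ∀ a b c x y → y * y ≡ x * x * x + a * x * x + b * x + c →
      q (+ 3) * ((q (+ 3) * y) * (q (+ 3) * y)) ≡ (q (+ 3) * x + a) * (q (+ 3) * x + a) * (q (+ 3) * x + a) +
        (q (+ 9) * b - q (+ 3) * (a * a)) * (q (+ 3) * x + a) + (q (+ 2) * (a * a * a) - q (+ 9) * (a * b) + q (+ 27) * c)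
    lemma a b c x y h = byLinComb (q (+ 27) · h) (ℚ-identity 5 (λ a b c x y → # 3 ⊗ (# 3 ⊗ y ⊗ (# 3 ⊗ y)) ⊖ ((# 3 ⊗ x ⊕ a) ⊗ (# 3
        ⊗ x ⊕ a) ⊗ (# 3 ⊗ x ⊕ a) ⊕ (# 9 ⊗ b ⊖ # 3 ⊗ (a ⊗ a)) ⊗ (# 3 ⊗ x ⊕ a) ⊕ (# 2 ⊗ (a ⊗ a ⊗ a) ⊖ # 9 ⊗ (a ⊗ b) ⊕ # 27 ⊗ c)) ⊜ #
        27 ⊗ (y ⊗ y ⊖ (x ⊗ x ⊗ x ⊕ a ⊗ x ⊗ x ⊕ b ⊗ x ⊕ c))) refl a b c x y)

  module _ (E : Weierstrass) {l n x₁ y₁ x₂ y₂ x₃ y₃ : ℚ} (L : Line (a E) (b E) l n x₁ y₁ x₂ y₂ x₃ y₃) where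

    short-sum : Xc E x₁ + Xc E x₂ + Xc E x₃ ≡ q (+ 3) * (l * l)
    short-sum = lemma (a E) l x₁ x₂ x₃ (s₁ L)
      where
      lemma : ∀ a l x₁ x₂ x₃ → x₁ + x₂ + x₃ ≡ l * l - a → (q (+ 3) * x₁ + a) + (q (+ 3) * x₂ + a) + (q (+ 3) * x₃ + a) ≡ q (+ 3) * (l * l)
      lemma a l x₁ x₂ x₃ h = byLinComb (q (+ 3) · h) (ℚ-identity 5 (λ a l x₁ x₂ x₃ → # 3 ⊗ x₁ ⊕ a ⊕ (# 3 ⊗ x₂ ⊕ a) ⊕ (# 3 ⊗ x₃ ⊕
          a) ⊖ # 3 ⊗ (l ⊗ l) ⊜ # 3 ⊗ (x₁ ⊕ x₂ ⊕ x₃ ⊖ (l ⊗ l ⊖ a))) refl a l x₁ x₂ x₃)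

    short-chord : (Xc E x₂ - Xc E x₁) * l ≡ Yc y₂ - Yc y₁
    short-chord = lemma (a E) l x₁ y₁ x₂ y₂ (slope-chord L)
      where
      lemma : ∀ a l x₁ y₁ x₂ y₂ → (x₂ - x₁) * l ≡ y₂ - y₁ → ((q (+ 3) * x₂ + a) - (q (+ 3) * x₁ + a)) * l ≡ q (+ 3) * y₂ - q (+ 3) * y₁
      lemma a l x₁ y₁ x₂ y₂ h = byLinComb (q (+ 3) · h) (ℚ-identity 6 (λ a l x₁ y₁ x₂ y₂ → (# 3 ⊗ x₂ ⊕ a ⊖ (# 3 ⊗ x₁ ⊕ a)) ⊗ l ⊖
          (# 3 ⊗ y₂ ⊖ # 3 ⊗ y₁) ⊜ # 3 ⊗ ((x₂ ⊖ x₁) ⊗ l ⊖ (y₂ ⊖ y₁))) refl a l x₁ y₁ x₂ y₂)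

    short-tangent : x₂ ≡ x₁ → q (+ 6) * Yc y₁ * l ≡ q (+ 3) * (Xc E x₁ * Xc E x₁) + A E
    short-tangent e = lemma (a E) (b E) l x₁ y₁ (slope-tangent L e)
      where
      lemma : ∀ a b l x y → q (+ 2) * y * l ≡ q (+ 3) * x * x + q (+ 2) * a * x + b →
        q (+ 6) * (q (+ 3) * y) * l ≡ q (+ 3) * ((q (+ 3) * x + a) * (q (+ 3) * x + a)) + (q (+ 9) * b - q (+ 3) * (a * a))
      lemma a b l x y h = byLinComb (q (+ 9) · h) (ℚ-identity 5 (λ a b l x y → # 6 ⊗ (# 3 ⊗ y) ⊗ l ⊖ (# 3 ⊗ ((# 3 ⊗ x ⊕ a) ⊗ (# 3
          ⊗ x ⊕ a)) ⊕ (# 9 ⊗ b ⊖ # 3 ⊗ (a ⊗ a))) ⊜ # 9 ⊗ (# 2 ⊗ y ⊗ l ⊖ (# 3 ⊗ x ⊗ x ⊕ # 2 ⊗ a ⊗ x ⊕ b))) refl a b l x y)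

    -- On the line `Y = l X + m` with `m = 3n - a l`, Vieta gives `e₁ = 3 l²`, `A - e₂ = 6 l m` and
    -- `e₃ + B = 3 m²` for the elementary symmetric functions of the abscissas. Eliminating `l` and
    -- `m` leaves `(A - e₂)² = 4 e₁ (e₃ + B)`.
    short-collinear : OnCurve E (pt x₁ y₁) → Collinear (A E) (B E) (Xc E x₁) (Xc E x₂) (Xc E x₃)
    short-collinear h = trans (cong (λ t → t * t) (pairs (a E) (b E) l n x₁ x₂ x₃ (s₁ L) (s₂ L)))
      (trans (lemma l (q (+ 3) * n - a E * l)) (sym (cong₂ (λ s t → q (+ 4) * (s * t)) short-sum
        (product (a E) (b E) (c E) l n x₁ x₂ x₃ (s₁ L) (s₂ L) (trans (sym (cong (λ y → y * y) (on₁ L))) h)))))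
      where
      lemma : ∀ l m → q (+ 6) * l * m * (q (+ 6) * l * m) ≡ q (+ 4) * (q (+ 3) * (l * l) * (q (+ 3) * (m * m)))
      lemma = ℚ-identity 2 (λ l m → # 6 ⊗ l ⊗ m ⊗ (# 6 ⊗ l ⊗ m) ⊜ # 4 ⊗ (# 3 ⊗ (l ⊗ l) ⊗ (# 3 ⊗ (m ⊗ m)))) refl
      pairs : ∀ a b l n x₁ x₂ x₃ → x₁ + x₂ + x₃ ≡ l * l - a → x₁ * x₂ + x₁ * x₃ + x₂ * x₃ ≡ b - q (+ 2) * l * n →
        (q (+ 9) * b - q (+ 3) * (a * a)) - ((q (+ 3) * x₁ + a) * (q (+ 3) * x₂ + a) + (q (+ 3) * x₃ + a) * ((q (+ 3) * x₁ + a) + (q (+ 3) * x₂ + a))) ≡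
        q (+ 6) * l * (q (+ 3) * n - a * l)
      pairs a b l n x₁ x₂ x₃ h₁ h₂ = byLinComb (- (q (+ 9)) · h₂ ⊹ - (q (+ 6) * a) · h₁) (ℚ-identity 7 (λ a b l n x₁ x₂ x₃ → # 9 ⊗
          b ⊖ # 3 ⊗ (a ⊗ a) ⊖ ((# 3 ⊗ x₁ ⊕ a) ⊗ (# 3 ⊗ x₂ ⊕ a) ⊕ (# 3 ⊗ x₃ ⊕ a) ⊗ (# 3 ⊗ x₁ ⊕ a ⊕ (# 3 ⊗ x₂ ⊕ a))) ⊖ # 6 ⊗ l ⊗ (#
          3 ⊗ n ⊖ a ⊗ l) ⊜ ⊝ # 9 ⊗ (x₁ ⊗ x₂ ⊕ x₁ ⊗ x₃ ⊕ x₂ ⊗ x₃ ⊖ (b ⊖ # 2 ⊗ l ⊗ n)) ⊕ ⊝ (# 6 ⊗ a) ⊗ (x₁ ⊕ x₂ ⊕ x₃ ⊖ (l ⊗ l ⊖ a)))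
          refl a b l n x₁ x₂ x₃)
      product : ∀ a b c l n x₁ x₂ x₃ → x₁ + x₂ + x₃ ≡ l * l - a → x₁ * x₂ + x₁ * x₃ + x₂ * x₃ ≡ b - q (+ 2) * l * n →
        (l * x₁ + n) * (l * x₁ + n) ≡ x₁ * x₁ * x₁ + a * x₁ * x₁ + b * x₁ + c →
        (q (+ 3) * x₁ + a) * (q (+ 3) * x₂ + a) * (q (+ 3) * x₃ + a) + (q (+ 2) * (a * a * a) - q (+ 9) * (a * b) + q (+ 27) * c) ≡
        q (+ 3) * ((q (+ 3) * n - a * l) * (q (+ 3) * n - a * l))
      product a b c l n x₁ x₂ x₃ h₁ h₂ h = byLinComb
        (- (q (+ 27)) · h ⊹ (q (+ 3) * (a * a) - q (+ 27) * (x₁ * x₁)) · h₁ ⊹ (q (+ 27) * x₁ + q (+ 9) * a) · h₂)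
        (ℚ-identity 8 (λ a b c l n x₁ x₂ x₃ → (# 3 ⊗ x₁ ⊕ a) ⊗ (# 3 ⊗ x₂ ⊕ a) ⊗ (# 3 ⊗ x₃ ⊕ a) ⊕ (# 2 ⊗ (a ⊗ a ⊗ a) ⊖ # 9 ⊗ (a ⊗
            b) ⊕ # 27 ⊗ c) ⊖ # 3 ⊗ ((# 3 ⊗ n ⊖ a ⊗ l) ⊗ (# 3 ⊗ n ⊖ a ⊗ l)) ⊜ ⊝ # 27 ⊗ ((l ⊗ x₁ ⊕ n) ⊗ (l ⊗ x₁ ⊕ n) ⊖ (x₁ ⊗ x₁ ⊗ x₁
            ⊕ a ⊗ x₁ ⊗ x₁ ⊕ b ⊗ x₁ ⊕ c)) ⊕ (# 3 ⊗ (a ⊗ a) ⊖ # 27 ⊗ (x₁ ⊗ x₁)) ⊗ (x₁ ⊕ x₂ ⊕ x₃ ⊖ (l ⊗ l ⊖ a)) ⊕ (# 27 ⊗ x₁ ⊕ # 9 ⊗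
            a) ⊗ (x₁ ⊗ x₂ ⊕ x₁ ⊗ x₃ ⊕ x₂ ⊗ x₃ ⊖ (b ⊖ # 2 ⊗ l ⊗ n))) refl a b c l n x₁ x₂ x₃)

  private
    doubling-relation : ∀ A B X Y X′ l → X + X + X′ ≡ q (+ 3) * (l * l) → q (+ 6) * Y * l ≡ q (+ 3) * (X * X) + A →
      q (+ 3) * (Y * Y) ≡ X * X * X + A * X + B → Doubling A B X X′
    doubling-relation A B X Y X′ l h₁ h₂ h₃ = byLinComb
      (q (+ 4) * (X * (X * X) + A * X + B) · h₁ ⊹ - (q (+ 12) * (l * l)) · h₃ ⊹ (q (+ 6) * Y * l + q (+ 3) * (X * X) + A) · h₂)
      (ℚ-identity 6 (λ A B X Y X′ l → X′ ⊗ (# 4 ⊗ (X ⊗ (X ⊗ X) ⊕ A ⊗ X ⊕ B)) ⊖ (X ⊗ (X ⊗ (X ⊗ X)) ⊖ # 2 ⊗ (A ⊗ (X ⊗ X)) ⊖ # 8 ⊗ (B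
          ⊗ X) ⊕ A ⊗ A) ⊜ # 4 ⊗ (X ⊗ (X ⊗ X) ⊕ A ⊗ X ⊕ B) ⊗ (X ⊕ X ⊕ X′ ⊖ # 3 ⊗ (l ⊗ l)) ⊕ ⊝ (# 12 ⊗ (l ⊗ l)) ⊗ (# 3 ⊗ (Y ⊗ Y) ⊖
          (X ⊗ X ⊗ X ⊕ A ⊗ X ⊕ B)) ⊕ (# 6 ⊗ Y ⊗ l ⊕ # 3 ⊗ (X ⊗ X) ⊕ A) ⊗ (# 6 ⊗ Y ⊗ l ⊖ (# 3 ⊗ (X ⊗ X) ⊕ A))) refl A B X Y X′ l)

  D⁻¹ : Weierstrass → ℚ
  D⁻¹ E = (1/ D E) {{≢-nonZero (D≢0 E)}}

  height : Weierstrass → Pt → ℕ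
  height E O = 1
  height E (pt x y) = H (Xc E x ^^ 12 * D⁻¹ E ^^ 2)

  1≤height : ∀ E P → 1 ≤ height E P
  1≤height E O = s≤s z≤n
  1≤height E (pt x y) = 1≤H (Xc E x ^^ 12 * D⁻¹ E ^^ 2)

  height-neg : ∀ E P → height E (neg P) ≡ height E P
  height-neg E O = refl
  height-neg E (pt x y) = refl

  opaque
    doublingGrowth : ∀ j → DoublingGrowth (κ₁ j) (κ₂ j)
    doublingGrowth j = doubling-growth (κ₁ j) (κ₂ j) (κ-sum j)

  module _ (j : ℚ) where

    open DoublingGrowth (doublingGrowth j) using (constant; bounds)

    opaque
      baseConstant : ℕ
      baseConstant = constant ℕ.+ (10 ℕ.+ (H (κ₁ j) ℕ.+ H (κ₂ j)))

      10≤baseConstant : 10 ≤ baseConstant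
      10≤baseConstant = ℕ.≤-trans (ℕ.m≤m+n 10 _) (ℕ.m≤n+m _ constant)

      constant≤ : constant ≤ baseConstant
      constant≤ = ℕ.m≤m+n constant _

      Hκ₁≤ : H (κ₁ j) ≤ baseConstant
      Hκ₁≤ = ℕ.≤-trans (ℕ.m≤m+n (H (κ₁ j)) (H (κ₂ j))) (ℕ.≤-trans (ℕ.m≤n+m _ 10) (ℕ.m≤n+m _ constant))

      Hκ₂≤ : H (κ₂ j) ≤ baseConstant
      Hκ₂≤ = ℕ.≤-trans (ℕ.m≤n+m (H (κ₂ j)) (H (κ₁ j))) (ℕ.≤-trans (ℕ.m≤n+m _ 10) (ℕ.m≤n+m _ constant))

    height-double : ∀ E → jInv E ≡ j → ∀ P → OnCurve E P → height E P ℕ.^ 4 ≤ baseConstant ℕ.* height E (add E P P)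
    height-double E hj O h = ℕ.≤-trans (ℕ.≤-trans (s≤s z≤n) 10≤baseConstant) (ℕ.≤-reflexive (sym (ℕ.*-identityʳ baseConstant)))
    height-double E hj (pt x y) h = go (add-sum E {x} {y} {x} {y} h h)
      where
      X = Xc E x
      both = bounds (A E) (B E) (D E) (D⁻¹ E) (*-inverseʳ (D E) {{≢-nonZero (D≢0 E)}}) (A³≡ E hj) (B²≡ E hj) X
      regroup : ∀ X A B → X * (X * X) + A * X + B ≡ X * X * X + A * X + B
      regroup = ℚ-identity 3 (λ X A B → X ⊗ (X ⊗ X) ⊕ A ⊗ X ⊕ B ⊜ X ⊗ X ⊗ X ⊕ A ⊗ X ⊕ B) refl
      go : ∀ {P} → Sum E x y x y P → height E (pt x y) ℕ.^ 4 ≤ baseConstant ℕ.* height E P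
      go (inverse _ 2y≡0) = ℕ.≤-trans (proj₁ both (trans (regroup X (A E) (B E)) (trans (sym (short-curve E x y h))
          (trans (cong (λ t → q (+ 3) * (Yc t * Yc t)) (2x≡0⇒x≡0 y (trans (sym (x+x≡2x y)) 2y≡0))) refl))))
        (ℕ.≤-trans constant≤ (ℕ.≤-reflexive (sym (ℕ.*-identityʳ baseConstant))))
      go (secant {l} {n} {x₃} {y₃} L) = ℕ.≤-trans (proj₂ both (Xc E x₃)
          (doubling-relation (A E) (B E) X (Yc y) (Xc E x₃) l (short-sum E L) (short-tangent E L refl) (short-curve E x y h)))
        (ℕ.*-monoˡ-≤ (height E (pt x₃ y₃)) constant≤)

    module Model (E : Weierstrass) (hj : jInv E ≡ j) (Q : ℕ) (C≤Q : baseConstant ≤ Q) where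

      10≤Q : 10 ≤ Q
      10≤Q = ℕ.≤-trans 10≤baseConstant C≤Q

      open ShortModel (A E) (B E) (D E) (κ₁ j) (κ₂ j) (D≢0 E) (A³≡ E hj) (B²≡ E hj) Q 10≤Q (ℕ.≤-trans Hκ₁≤ C≤Q) (ℕ.≤-trans Hκ₂≤ C≤Q) public
      open Weights (D E) (D≢0 E) Q (ℕ.≤-trans (s≤s (s≤s z≤n)) 10≤Q) public hiding (D⁻¹)

      OnCurve′ : ℚ → ℚ → Set
      OnCurve′ x y = Defs.OnCurve E (pt x y)

      height⇒weight : ∀ x y → height E (pt x y) ≤ Q → Weight 2 (Xc E x) 1
      height⇒weight x y h = weight (ℕ.≤-trans h (ℕ.≤-reflexive (sym (ℕ.*-identityʳ Q))))

      weight⇒height : ∀ x y {K} → Weight 2 (Xc E x) K → height E (pt x y) ≤ Q ℕ.^ K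
      weight⇒height x y w = bound w

      private
        6Y≢0 : ∀ {l n x₁ y₁ x₂ y₂ x₃ y₃} → OnCurve′ x₁ y₁ → OnCurve′ x₂ y₂ → Line (a E) (b E) l n x₁ y₁ x₂ y₂ x₃ y₃ → x₂ ≡ x₁ → q (+ 6) * Yc y₁ ≢ 0ℚ
        6Y≢0 {x₁ = x₁} {y₁} {x₂} {y₂} h₁ h₂ L x≡ e = same-point-2y E {x₁} {y₁} {x₂} {y₂} h₁ h₂ x≡
            (not-inverse {a E} {b E} {c E} (nonsing E) h₁ L (sym x≡)) (*-zero-cancelˡ {q (+ 9)} (λ ()) (trans (lemma y₁) e))
          where
          lemma : ∀ y → q (+ 9) * (q (+ 2) * y) ≡ q (+ 6) * (q (+ 3) * y)
          lemma = ℚ-identity 1 (λ y → # 9 ⊗ (# 2 ⊗ y) ⊜ # 6 ⊗ (# 3 ⊗ y)) refl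

        Xc-injective : ∀ {x₁ x₂} → Xc E x₂ - Xc E x₁ ≡ 0ℚ → x₂ ≡ x₁
        Xc-injective {x₁} {x₂} X≡ = *-cancelˡ-≢0 {q (+ 3)} (λ ()) (byLinComb (1ℚ · X≡) (lemma (a E) x₁ x₂))
          where
          lemma : ∀ a x₁ x₂ → q (+ 3) * x₂ - q (+ 3) * x₁ ≡ 1ℚ * ((q (+ 3) * x₂ + a) - (q (+ 3) * x₁ + a) - 0ℚ)
          lemma = ℚ-identity 3 (λ a x₁ x₂ → # 3 ⊗ x₂ ⊖ # 3 ⊗ x₁ ⊜ Κ 1ℚ ⊗ ((# 3 ⊗ x₂ ⊕ a) ⊖ (# 3 ⊗ x₁ ⊕ a) ⊖ Κ 0ℚ)) refl

        weight-distinct : ∀ {l n x₁ y₁ x₂ y₂ x₃ y₃} → OnCurve′ x₁ y₁ → OnCurve′ x₂ y₂ → Line (a E) (b E) l n x₁ y₁ x₂ y₂ x₃ y₃ →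
          Xc E x₂ - Xc E x₁ ≢ 0ℚ → Weight 2 (Xc E x₁) 1 → Weight 2 (Xc E x₂) 1 → Weight 2 (Xc E x₃) _
        weight-distinct {l} {n} {x₁} {y₁} {x₂} {y₂} {x₃} h₁ h₂ L X≢ w₁ w₂ =
          weight-chord {Xc E x₁} {Yc y₁} {Xc E x₂} {Yc y₂} {Xc E x₃} {l} (short-curve E x₁ y₁ h₁) (short-curve E x₂ y₂ h₂)
            (short-sum E L) (short-chord E L) X≢ w₁ w₂

        weight-equal : ∀ {l n x₁ y₁ x₂ y₂ x₃ y₃} → OnCurve′ x₁ y₁ → OnCurve′ x₂ y₂ → Line (a E) (b E) l n x₁ y₁ x₂ y₂ x₃ y₃ →
          x₂ ≡ x₁ → Weight 2 (Xc E x₁) 1 → Weight 2 (Xc E x₃) _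
        weight-equal {l} {n} {x₁} {y₁} {x₂} {y₂} {x₃} h₁ h₂ L x≡ w₁ =
          weight-tangent {Xc E x₁} {Yc y₁} {Xc E x₃} {l} (short-curve E x₁ y₁ h₁)
            (trans (cong (λ t → Xc E x₁ + Xc E t + Xc E x₃) (sym x≡)) (short-sum E L)) (short-tangent E L x≡) (6Y≢0 h₁ h₂ L x≡) w₁

      weight-add : ∀ {l n x₁ y₁ x₂ y₂ x₃ y₃} → OnCurve′ x₁ y₁ → OnCurve′ x₂ y₂ → Line (a E) (b E) l n x₁ y₁ x₂ y₂ x₃ y₃ →
        Weight 2 (Xc E x₁) 1 → Weight 2 (Xc E x₂) 1 → Weight 2 (Xc E x₃) (maxExp _ _)
      weight-add {l} {n} {x₁} {y₁} {x₂} {y₂} {x₃} {y₃} h₁ h₂ L w₁ w₂ = cases (Xc E x₂ - Xc E x₁ ≟ 0ℚ)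
        where
        cases : Dec (Xc E x₂ - Xc E x₁ ≡ 0ℚ) → Weight 2 (Xc E x₃) (maxExp _ _)
        cases (no X≢)  = weaken-maxˡ (weight-distinct {l} {n} {x₁} {y₁} {x₂} {y₂} {x₃} {y₃} h₁ h₂ L X≢ w₁ w₂)
        cases (yes X≡) = weaken-maxʳ (weight-equal {l} {n} {x₁} {y₁} {x₂} {y₂} {x₃} {y₃} h₁ h₂ L (Xc-injective {x₁} {x₂} X≡) w₁)

-- The rational points as a group with a height; counting points

module PointGroup where

  open import Defs
  open RationalAlgebra
  open ChordTangent
  open AddLaws
  open AddAssociative
  open RationalHeight
  open CurveHeight
  open TwoPowerTorsion
  open SpherePacking
  open import Algebra.Structures using (IsAbelianGroup)
  open import Data.Nat as ℕ using (ℕ; zero; suc; _≤_; z≤n; s≤s)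
  import Data.Nat.Properties as ℕ
  open import Data.Integer as ℤ using (+_; -[1+_]; ∣_∣)
  open import Data.Fin as Fin using (Fin; zero; suc; fromℕ<; combine)
  open import Data.Fin.Properties using (combine-injective; fromℕ<-injective; injective⇒≤) renaming (suc-injective to Fin-suc-injective)
  open import Data.Rational using (ℚ; mkℚ; 0ℚ; 1ℚ; _+_; _*_; _-_; -_; 1/_; ↥_; ↧ₙ_; ≢-nonZero; NonZero)
  open import Data.Rational.Properties hiding (≤-trans; ≤-reflexive)
  open import Data.Product using (∃; _×_; _,_; proj₁; proj₂)
  open import Data.Sum using (_⊎_; inj₁; inj₂)
  open import Data.Unit using (tt)
  open import Relation.Nullary using (Dec; yes; no; contradiction)
  open import Relation.Binary.PropositionalEquality

  module _ (j : ℚ) where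

    private
      -- `K` is inferred from the chain of weight estimates. Standing before `E`, `Q` and the
      -- points, it is the same for all curves of invariant `j`.
      secant-weight : ∃ λ K → ∀ E (hj : jInv E ≡ j) Q (C≤Q : baseConstant j ≤ Q) l n x₁ y₁ x₂ y₂ x₃ y₃ → OnCurve E (pt x₁ y₁) → OnCurve E (pt x₂ y₂) →
        Line (a E) (b E) l n x₁ y₁ x₂ y₂ x₃ (- y₃) → height E (pt x₁ y₁) ≤ Q → height E (pt x₂ y₂) ≤ Q → Model.Weight j E hj Q C≤Q 2 (Xc E x₃) K
      secant-weight = _ , λ E hj Q C≤Q l n x₁ y₁ x₂ y₂ x₃ y₃ h₁ h₂ L b₁ b₂ →
        Model.weight-add j E hj Q C≤Q {l} {n} {x₁} {y₁} {x₂} {y₂} {x₃} { - y₃} h₁ h₂ L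
          (Model.height⇒weight j E hj Q C≤Q x₁ y₁ b₁) (Model.height⇒weight j E hj Q C≤Q x₂ y₂ b₂)

      secant-bound : ∀ E → jInv E ≡ j → ∀ Q → baseConstant j ≤ Q → ∀ l n x₁ y₁ x₂ y₂ x₃ y₃ → OnCurve E (pt x₁ y₁) → OnCurve E (pt x₂ y₂) →
        Line (a E) (b E) l n x₁ y₁ x₂ y₂ x₃ (- y₃) → height E (pt x₁ y₁) ≤ Q → height E (pt x₂ y₂) ≤ Q → height E (pt x₃ y₃) ≤ Q ℕ.^ proj₁ secant-weight
      secant-bound E hj Q C≤Q l n x₁ y₁ x₂ y₂ x₃ y₃ h₁ h₂ L b₁ b₂ = Model.weight⇒height j E hj Q C≤Q x₃ y₃ {proj₁ secant-weight}
        (proj₂ secant-weight E hj Q C≤Q l n x₁ y₁ x₂ y₂ x₃ y₃ h₁ h₂ L b₁ b₂)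

      -- The exponent of secant-bound is a variable here, so that it is not unfolded.
      add-bound : ∀ K → (∀ E → jInv E ≡ j → ∀ Q → baseConstant j ≤ Q → ∀ l n x₁ y₁ x₂ y₂ x₃ y₃ → OnCurve E (pt x₁ y₁) → OnCurve E (pt x₂ y₂) →
          Line (a E) (b E) l n x₁ y₁ x₂ y₂ x₃ (- y₃) → height E (pt x₁ y₁) ≤ Q → height E (pt x₂ y₂) ≤ Q → height E (pt x₃ y₃) ≤ Q ℕ.^ K) →
        ∀ E → jInv E ≡ j → ∀ P R → OnCurve E P → OnCurve E R →
        height E (add E P R) ≤ (baseConstant j ℕ.* (height E P ℕ.* height E R)) ℕ.^ suc K
      add-bound K secant-height E hj = go
        where
        C = baseConstant j
        1≤C : 1 ≤ C
        1≤C = ℕ.≤-trans (s≤s z≤n) (10≤baseConstant j)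
        product≥ : ∀ {c m n} → 1 ≤ c → 1 ≤ m → 1 ≤ n → (c ≤ c ℕ.* (m ℕ.* n)) × (m ≤ c ℕ.* (m ℕ.* n)) × (n ≤ c ℕ.* (m ℕ.* n))
        product≥ {c} {m} {n} hc hm hn =
          ℕ.≤-trans (ℕ.≤-reflexive (sym (ℕ.*-identityʳ c))) (ℕ.*-monoʳ-≤ c (ℕ.*-mono-≤ hm hn)) ,
          ℕ.≤-trans (ℕ.≤-trans (ℕ.≤-reflexive (sym (ℕ.*-identityʳ m))) (ℕ.*-monoʳ-≤ m hn)) grow ,
          ℕ.≤-trans (ℕ.≤-trans (ℕ.≤-reflexive (sym (ℕ.*-identityˡ n))) (ℕ.*-monoˡ-≤ n hm)) grow
          where
          grow : m ℕ.* n ≤ c ℕ.* (m ℕ.* n)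
          grow = ℕ.≤-trans (ℕ.≤-reflexive (sym (ℕ.*-identityˡ (m ℕ.* n)))) (ℕ.*-monoˡ-≤ (m ℕ.* n) hc)
        -- The exponent is `suc K` rather than `K` so that the bound also covers sums with `O`,
        -- where the height is merely at most `Q`.
        power : ∀ {n Q} → 1 ≤ Q → n ≤ Q → n ≤ Q ℕ.^ suc K
        power {n} {Q} hQ h = ℕ.≤-trans h (ℕ.≤-trans (ℕ.≤-reflexive (sym (ℕ.*-identityʳ Q))) (ℕ.*-monoʳ-≤ Q (1≤^ K hQ)))
        next : ∀ {n Q} → 1 ≤ Q → n ≤ Q ℕ.^ K → n ≤ Q ℕ.^ suc K
        next {n} {Q} hQ h = ℕ.≤-trans h (ℕ.≤-trans (ℕ.≤-reflexive (sym (ℕ.*-identityˡ (Q ℕ.^ K)))) (ℕ.*-monoˡ-≤ (Q ℕ.^ K) hQ))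
        go : ∀ P R → OnCurve E P → OnCurve E R → height E (add E P R) ≤ (C ℕ.* (height E P ℕ.* height E R)) ℕ.^ suc K
        go O R hP hR = power (ℕ.≤-trans 1≤C (proj₁ p)) (proj₂ (proj₂ p))
          where p = product≥ 1≤C (1≤height E O) (1≤height E R)
        go (pt x y) O hP hR = power (ℕ.≤-trans 1≤C (proj₁ p)) (proj₁ (proj₂ p))
          where p = product≥ 1≤C (1≤height E (pt x y)) (1≤height E O)
        go (pt x₁ y₁) (pt x₂ y₂) hP hR = sum (add-sum E {x₁} {y₁} {x₂} {y₂} hP hR)
          where
          p = product≥ 1≤C (1≤height E (pt x₁ y₁)) (1≤height E (pt x₂ y₂))
          sum : ∀ {S} → Sum E x₁ y₁ x₂ y₂ S → height E S ≤ (C ℕ.* (height E (pt x₁ y₁) ℕ.* height E (pt x₂ y₂))) ℕ.^ suc K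
          sum (inverse _ _) = power (ℕ.≤-trans 1≤C (proj₁ p)) (ℕ.≤-trans 1≤C (proj₁ p))
          sum (secant {l} {n} {x₃} {y₃} L) = next (ℕ.≤-trans 1≤C (proj₁ p))
            (secant-height E hj _ (proj₁ p) l n x₁ y₁ x₂ y₂ x₃ y₃ hP hR L (proj₁ (proj₂ p)) (proj₂ (proj₂ p)))

    height-add : ∃ λ K → ∀ E → jInv E ≡ j → ∀ P R → OnCurve E P → OnCurve E R →
      height E (add E P R) ≤ (baseConstant j ℕ.* (height E P ℕ.* height E R)) ℕ.^ suc K
    height-add = proj₁ secant-weight , add-bound (proj₁ secant-weight) secant-bound

  OnCurve-irrelevant : ∀ E P (h k : OnCurve E P) → h ≡ k
  OnCurve-irrelevant E O h k = refl
  OnCurve-irrelevant E (pt x y) h k = ≡-irrelevant h k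
    where open import Axiom.UniquenessOfIdentityProofs.WithK using () renaming (uip to ≡-irrelevant)

  RatPt-≡ : ∀ {E} {P R : RatPt E} → proj₁ P ≡ proj₁ R → P ≡ R
  RatPt-≡ {E} {P , h} {_ , k} refl = cong (P ,_) (OnCurve-irrelevant E P h k)

  module Points (E : Weierstrass) where

    infixl 6 _⊞_
    _⊞_ : RatPt E → RatPt E → RatPt E
    (P , h) ⊞ (R , k) = add E P R , add-onCurve E P R h k

    zeroPt : RatPt E
    zeroPt = O , tt

    negPt : RatPt E → RatPt E
    negPt (P , h) = neg P , neg-onCurve E P h

    isAbelianGroup : IsAbelianGroup _≡_ _⊞_ zeroPt negPt
    isAbelianGroup = record
      { isGroup = record
        { isMonoid = record
          { isSemigroup = record
            { isMagma = record { isEquivalence = isEquivalence ; ∙-cong = cong₂ _⊞_ }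
            ; assoc = λ { (P , h) (R , k) (S , l) → RatPt-≡ (add-assoc E P R S h k l) } }
          ; identity = (λ P → RatPt-≡ refl) , λ { (P , h) → RatPt-≡ (add-O E P) } }
        ; inverse = (λ { (P , h) → RatPt-≡ (trans (add-comm E (neg P) P (neg-onCurve E P h) h) (add-neg E P h)) }) ,
                    λ { (P , h) → RatPt-≡ (add-neg E P h) }
        ; ⁻¹-cong = cong negPt }
      ; comm = λ { (P , h) (R , k) → RatPt-≡ (add-comm E P R h k) } }

    open AbelianGroupFacts isAbelianGroup

    nmult-point : ∀ n P → proj₁ (nmult n P) ≡ nmul E n (proj₁ P)
    nmult-point zero P = refl
    nmult-point (suc n) P = cong (add E (proj₁ P)) (nmult-point n P)

    zmult-point : ∀ z P → proj₁ (zmult z P) ≡ zmul E z (proj₁ P)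
    zmult-point (+ n) P = nmult-point n P
    zmult-point -[1+ n ] P = cong neg (nmult-point (suc n) P)

    lincombination-point : ∀ n z g → proj₁ (lincombination n z g) ≡ lincomb E n z g
    lincombination-point zero z g = refl
    lincombination-point (suc n) z g = cong₂ (add E) (zmult-point (z zero) (g zero))
      (lincombination-point n (λ i → z (suc i)) (λ i → g (suc i)))

  private
    signBit : ℚ → Fin 2
    signBit (mkℚ (+ _) _ _) = zero
    signBit (mkℚ -[1+ _ ] _ _) = suc zero

    signBit-neg : ∀ x → signBit (- x) ≡ signBit x → - x ≡ x
    signBit-neg (mkℚ (+ zero) _ _) e = refl
    signBit-neg (mkℚ (+ suc _) _ _) ()
    signBit-neg (mkℚ -[1+ _ ] _ _) ()

    mkℚ-≡ : ∀ z w → signBit z ≡ signBit w → ∣ ↥ z ∣ ≡ ∣ ↥ w ∣ → ↧ₙ z ≡ ↧ₙ w → z ≡ w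
    mkℚ-≡ (mkℚ (+ m) d _) (mkℚ (+ n) e _) s h k = mkℚ-cong (cong +_ h) (ℕ.suc-injective k)
    mkℚ-≡ (mkℚ -[1+ m ] d _) (mkℚ -[1+ n ] e _) s h k = mkℚ-cong (cong -[1+_] (ℕ.suc-injective h)) (ℕ.suc-injective k)
    mkℚ-≡ (mkℚ (+ m) d _) (mkℚ -[1+ n ] e _) () h k
    mkℚ-≡ (mkℚ -[1+ m ] d _) (mkℚ (+ n) e _) () h k

    height-one : ∀ t → H t ≤ 1 → t ≡ 0ℚ ⊎ t ≡ 1ℚ ⊎ t ≡ - 1ℚ
    height-one t@(mkℚ n d _) h = go n d t refl refl (ℕ.≤-trans (∣↥∣≤H t) h) (ℕ.≤-pred (ℕ.≤-trans (↧≤H t) h))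
      where
      go : ∀ n d t → ↥ t ≡ n → ℚ.denominator-1 t ≡ d → ∣ n ∣ ≤ 1 → d ≤ 0 → t ≡ 0ℚ ⊎ t ≡ 1ℚ ⊎ t ≡ - 1ℚ
      go (+ 0) zero (mkℚ _ _ _) refl refl _ _ = inj₁ refl
      go (+ 1) zero (mkℚ _ _ _) refl refl _ _ = inj₂ (inj₁ refl)
      go -[1+ 0 ] zero (mkℚ _ _ _) refl refl _ _ = inj₂ (inj₂ refl)
      go (+ suc (suc n)) d t _ _ (s≤s ()) _
      go -[1+ suc n ] d t _ _ (s≤s ()) _

    -- For `y ≢ 0` the quotient `x / y` has twelfth power 1, hence height 1, hence is ±1; the sign
    -- bit decides.
    twelfth-power-injective : ∀ x y → x ^^ 12 ≡ y ^^ 12 → signBit x ≡ signBit y → x ≡ y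
    twelfth-power-injective x y h s = go (y ≟ 0ℚ)
      where
      power-zero : ∀ k z → z ^^ k ≡ 0ℚ → z ≡ 0ℚ
      power-zero zero z ()
      power-zero (suc k) z e = either (x*y≡0⇒x≡0∨y≡0 z e)
        where
        either : z ≡ 0ℚ ⊎ z ^^ k ≡ 0ℚ → z ≡ 0ℚ
        either (inj₁ e) = e
        either (inj₂ e) = power-zero k z e
      go : Dec (y ≡ 0ℚ) → x ≡ y
      go (yes refl) = power-zero 12 x h
      go (no y≢0) = conclude (height-one t (ℕ.≤-trans (H≤H^^ t 11) (ℕ.≤-reflexive (cong H t¹²≡1))))
        where
        instance nz : NonZero y
                 nz = ≢-nonZero y≢0
        t = x * 1/ y
        ty≡x : t * y ≡ x
        ty≡x = trans (*-assoc x (1/ y) y) (trans (cong (x *_) (*-inverseˡ y)) (*-identityʳ x))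
        t¹²≡1 : t ^^ 12 ≡ 1ℚ
        t¹²≡1 = *-cancelˡ-≢0 (^^-≢0 12 y≢0) (trans (*-comm (y ^^ 12) (t ^^ 12)) (trans (sym (^^-* t y 12))
          (trans (cong (_^^ 12) ty≡x) (trans h (sym (*-identityʳ (y ^^ 12)))))))
        conclude : t ≡ 0ℚ ⊎ t ≡ 1ℚ ⊎ t ≡ - 1ℚ → x ≡ y
        conclude (inj₁ e) = contradiction (trans (sym t¹²≡1) (cong (_^^ 12) e)) λ ()
        conclude (inj₂ (inj₁ e)) = trans (sym ty≡x) (trans (cong (_* y) e) (*-identityˡ y))
        conclude (inj₂ (inj₂ e)) = trans x≡-y (signBit-neg y (trans (cong signBit (sym x≡-y)) s))
          where
          lemma : ∀ y → - 1ℚ * y ≡ - y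
          lemma = ℚ-identity 1 (λ y → ⊝ Κ 1ℚ ⊗ y ⊜ ⊝ y) refl
          x≡-y : x ≡ - y
          x≡-y = trans (sym ty≡x) (trans (cong (_* y) e) (lemma y))

    square-injective : ∀ x y → x * x ≡ y * y → signBit x ≡ signBit y → x ≡ y
    square-injective x y h s = either (x*y≡0⇒x≡0∨y≡0 (x - y) (byLinComb (1ℚ · h) (ℚ-identity 2 (λ x y → (x ⊖ y) ⊗ (x ⊕ y) ⊖ Κ 0ℚ ⊜
        Κ 1ℚ ⊗ (x ⊗ x ⊖ y ⊗ y)) refl x y)))
      where
      either : x - y ≡ 0ℚ ⊎ x + y ≡ 0ℚ → x ≡ y
      either (inj₁ e) = x-y≡0⇒x≡y e
      either (inj₂ e) = trans x≡-y (signBit-neg y (trans (cong signBit (sym x≡-y)) s))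
        where
        x≡-y : x ≡ - y
        x≡-y = byLinComb (1ℚ · e) (ℚ-identity 2 (λ x y → x ⊖ ⊝ y ⊜ Κ 1ℚ ⊗ (x ⊕ y ⊖ Κ 0ℚ)) refl x y)

  -- One factor 2 makes room for `O`; the others are the signs of `X`, of `y` and of the normalised
  -- value, whose numerator and denominator are at most `N`.
  pointCount : ℕ → ℕ
  pointCount N = 2 ℕ.* (2 ℕ.* (2 ℕ.* (2 ℕ.* (suc N ℕ.* suc N))))

  module _ (E : Weierstrass) (N : ℕ) where

    private
      codeℚ : ∀ z → H z ≤ N → Fin (2 ℕ.* (suc N ℕ.* suc N))
      codeℚ z h = combine (signBit z) (combine (fromℕ< (s≤s (ℕ.≤-trans (∣↥∣≤H z) h))) (fromℕ< (s≤s (ℕ.≤-trans (↧≤H z) h))))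

      codeℚ-injective : ∀ z w h k → codeℚ z h ≡ codeℚ w k → z ≡ w
      codeℚ-injective z w h k e = mkℚ-≡ z w (proj₁ e₁) (fromℕ<-injective _ _ _ _ (proj₁ e₂)) (fromℕ<-injective (↧ₙ z) (↧ₙ w) (s≤s (ℕ.≤-trans (↧≤H z) h)) (s≤s (ℕ.≤-trans (↧≤H w) k)) (proj₂ e₂))
        where
        e₁ = combine-injective {2} (signBit z) _ (signBit w) _ e
        e₂ = combine-injective {suc N} {suc N} _ _ _ _ (proj₂ e₁)

      code : ∀ P → height E P ≤ N → Fin (suc (2 ℕ.* (2 ℕ.* (2 ℕ.* (suc N ℕ.* suc N)))))
      code O h = zero
      code (pt x y) h = suc (combine (signBit (Xc E x)) (combine (signBit y) (codeℚ (Xc E x ^^ 12 * D⁻¹ E ^^ 2) h)))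

      code-injective : ∀ P R hP hR → OnCurve E P → OnCurve E R → code P hP ≡ code R hR → P ≡ R
      code-injective O O hP hR C C′ e = refl
      code-injective O (pt _ _) hP hR C C′ ()
      code-injective (pt _ _) O hP hR C C′ ()
      code-injective (pt x y) (pt x′ y′) hP hR C C′ e = same x≡ (proj₁ e₂)
        where
        e₁ = combine-injective {2} (signBit (Xc E x)) _ (signBit (Xc E x′)) _ (Fin-suc-injective e)
        e₂ = combine-injective {2} (signBit y) _ (signBit y′) _ (proj₂ e₁)
        D⁻²≢0 : D⁻¹ E ^^ 2 ≢ 0ℚ
        D⁻²≢0 = ^^-≢0 {D⁻¹ E} 2 λ z → contradiction (trans (sym (*-inverseʳ (D E) {{≢-nonZero (D≢0 E)}})) (trans (cong (D E *_) z) (*-zeroʳ (D E)))) λ ()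
        X≡ : Xc E x ≡ Xc E x′
        X≡ = twelfth-power-injective (Xc E x) (Xc E x′)
          (*-cancelˡ-≢0 D⁻²≢0 (trans (*-comm (D⁻¹ E ^^ 2) (Xc E x ^^ 12)) (trans (codeℚ-injective _ _ hP hR (proj₂ e₂)) (*-comm (Xc E x′ ^^ 12) (D⁻¹ E ^^ 2))))) (proj₁ e₁)
        x≡ : x ≡ x′
        x≡ = *-cancelˡ-≢0 {q (+ 3)} (λ ()) (byLinComb (1ℚ · X≡) (lemma (a E) x x′))
          where
          lemma : ∀ a x x′ → q (+ 3) * x - q (+ 3) * x′ ≡ 1ℚ * ((q (+ 3) * x + a) - (q (+ 3) * x′ + a))
          lemma = ℚ-identity 3 (λ a x x′ → # 3 ⊗ x ⊖ # 3 ⊗ x′ ⊜ Κ 1ℚ ⊗ ((# 3 ⊗ x ⊕ a) ⊖ (# 3 ⊗ x′ ⊕ a))) refl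
        same : x ≡ x′ → signBit y ≡ signBit y′ → pt x y ≡ pt x′ y′
        same refl s = cong (pt x) (square-injective y y′ (trans C (sym C′)) s)

    points-finite : ∀ f (T : Fin f → RatPt E) → (∀ {i k} → T i ≡ T k → i ≡ k) → (∀ i → height E (proj₁ (T i)) ≤ N) → f ≤ pointCount N
    points-finite f T inj h = ℕ.≤-trans (injective⇒≤ {f = λ i → code (proj₁ (T i)) (h i)}
        (λ {i} {k} e → inj (RatPt-≡ (code-injective _ _ (h i) (h k) (proj₂ (T i)) (proj₂ (T k)) e))))
      (suc-≤-double (2 ℕ.* (2 ℕ.* (2 ℕ.* (suc N ℕ.* suc N)))) (s≤s z≤n))
      where
      suc-≤-double : ∀ n → 1 ≤ n → suc n ≤ 2 ℕ.* n
      suc-≤-double n h = ℕ.≤-trans (ℕ.+-monoˡ-≤ n h) (ℕ.+-monoʳ-≤ n (ℕ.m≤m+n n 0))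

  heightedGroup : ∀ j E → jInv E ≡ j → HeightedGroup
  heightedGroup j E hj = record
    { G = RatPt E ; _∙_ = _⊞_ ; ε = zeroPt ; inv = negPt
    ; isAbelianGroup = isAbelianGroup
    ; H = λ P → height E (proj₁ P)
    ; C = baseConstant j
    ; K = suc (proj₁ (height-add j))
    ; 1≤C = 1≤C
    ; 1≤H = λ P → 1≤height E (proj₁ P)
    ; H-ε = 1≤C
    ; H-inv = λ P → height-neg E (proj₁ P)
    ; H-∙ = λ { (P , h) (R , k) → proj₂ (height-add j) E hj P R h k }
    ; H-dbl = λ { (P , h) → height-double j E hj P h }
    ; count = pointCount
    ; finite = λ X → points-finite E X }
    where
    open Points E
    1≤C : 1 ≤ baseConstant j
    1≤C = ℕ.≤-trans (s≤s z≤n) (10≤baseConstant j)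

-- Progressions with four mutually close terms

module Progressions where

  open import Defs
  open RationalAlgebra
  open ChordTangent
  open AddLaws
  open RationalHeight
  open WeightedHeight
  open CollinearPair using (Collinear)
  open CloseTriple
  open CurveHeight
  open PointGroup
  open import Algebra.Bundles using (Group)
  open import Algebra.Structures using (IsAbelianGroup)
  open import Data.Nat as ℕ using (ℕ; zero; suc; _≤_; z≤n; s≤s)
  import Data.Nat.Properties as ℕ
  open import Data.Integer as ℤ using (ℤ; +_; ∣_∣)
  import Data.Integer.Properties as ℤ
  open import Data.Fin as Fin using (Fin; zero; suc; toℕ)
  open import Data.Fin.Properties using (toℕ<n; toℕ-injective)
  open import Data.Rational using (ℚ; 0ℚ; 1ℚ; _+_; _*_; _-_; -_)
  open import Data.Rational.Properties hiding (≤-trans; ≤-reflexive)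
  open import Data.Product using (∃; _,_; proj₁; proj₂)
  open import Data.Sum using (_⊎_; inj₁; inj₂)
  open import Relation.Nullary using (Dec; yes; no; contradiction)
  open import Relation.Binary.PropositionalEquality hiding (J)

  Arithmetic : ∀ {n} → (Fin n → ℚ) → Set
  Arithmetic f = ∃ λ u → ∃ λ d → ∀ i → f i ≡ u + q (+ toℕ i) * d

  index-difference : ∀ {n} → Fin n → Fin n → ℤ
  index-difference i k = + toℕ i ℤ.- + toℕ k

  private
    q-difference : ∀ {n} (i k : Fin n) → q (index-difference i k) ≡ q (+ toℕ i) - q (+ toℕ k)
    q-difference i k = trans (q-+ (+ toℕ i) (ℤ.- (+ toℕ k))) (cong (λ t → q (+ toℕ i) + t) (q-neg (+ toℕ k)))

    index-difference≢0 : ∀ {n} {i k : Fin n} → i ≢ k → index-difference i k ≢ + 0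
    index-difference≢0 {i = i} {k} i≢k e = i≢k (toℕ-injective (ℤ.+-injective (ℤ.i-j≡0⇒i≡j (+ toℕ i) (+ toℕ k) e)))

    ∣index-difference∣ : ∀ {n} (i k : Fin n) → ∣ index-difference i k ∣ ≤ n
    ∣index-difference∣ i k = ℕ.≤-trans (ℕ.≤-reflexive (cong ∣_∣ (ℤ.m-n≡m⊖n (toℕ i) (toℕ k))))
      (ℕ.≤-trans (ℤ.∣m⊝n∣≤m⊔n (toℕ i) (toℕ k)) (ℕ.⊔-lub (ℕ.<⇒≤ (toℕ<n i)) (ℕ.<⇒≤ (toℕ<n k))))

    -- The determinant saying that three pairs of index and value lie on a line. Its integer
    -- coefficients are bounded by the length, not by the size of the terms.
    arithmetic-relation : ∀ {n} {f : Fin n → ℚ} → Arithmetic f → ∀ i j k →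
      q (index-difference k j) * f i + q (index-difference i k) * f j + q (index-difference j i) * f k ≡ 0ℚ
    arithmetic-relation {f = f} (u , d , f≡) i j k = trans
        (cong₂ _+_ (cong₂ _+_ (cong₂ _*_ (q-difference k j) (f≡ i)) (cong₂ _*_ (q-difference i k) (f≡ j))) (cong₂ _*_ (q-difference j i) (f≡ k)))
        (lemma (q (+ toℕ i)) (q (+ toℕ j)) (q (+ toℕ k)) u d)
      where
      lemma : ∀ i j k u d → (k - j) * (u + i * d) + (i - k) * (u + j * d) + (j - i) * (u + k * d) ≡ 0ℚ
      lemma = ℚ-identity 5 (λ i j k u d → (k ⊖ j) ⊗ (u ⊕ i ⊗ d) ⊕ (i ⊖ k) ⊗ (u ⊕ j ⊗ d) ⊕ (j ⊖ i) ⊗ (u ⊕ k ⊗ d) ⊜ Κ 0ℚ) refl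

    arithmetic-interpolation : ∀ {n} {f : Fin n → ℚ} → Arithmetic f → ∀ i j l →
      q (index-difference j i) * f l ≡ q (index-difference j l) * f i + q (index-difference l i) * f j
    arithmetic-interpolation {f = f} (u , d , f≡) i j l = trans (cong₂ _*_ (q-difference j i) (f≡ l))
        (trans (lemma (q (+ toℕ i)) (q (+ toℕ j)) (q (+ toℕ l)) u d)
          (sym (cong₂ _+_ (cong₂ _*_ (q-difference j l) (f≡ i)) (cong₂ _*_ (q-difference l i) (f≡ j)))))
      where
      lemma : ∀ i j l u d → (j - i) * (u + l * d) ≡ (j - l) * (u + i * d) + (l - i) * (u + j * d)
      lemma = ℚ-identity 5 (λ i j l u d → (j ⊖ i) ⊗ (u ⊕ l ⊗ d) ⊜ (j ⊖ l) ⊗ (u ⊕ i ⊗ d) ⊕ (l ⊖ i) ⊗ (u ⊕ j ⊗ d)) refl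

  arithmetic-affine : ∀ {n} {f : Fin n → ℚ} s t → Arithmetic f → Arithmetic (λ i → s * f i + t)
  arithmetic-affine {f = f} s t (u , d , f≡) = s * u + t , s * d , λ i →
    trans (cong (λ z → s * z + t) (f≡ i)) (lemma s t u d (q (+ toℕ i)))
    where
    lemma : ∀ s t u d i → s * (u + i * d) + t ≡ (s * u + t) + i * (s * d)
    lemma = ℚ-identity 5 (λ s t u d i → s ⊗ (u ⊕ i ⊗ d) ⊕ t ⊜ (s ⊗ u ⊕ t) ⊕ i ⊗ (s ⊗ d)) refl

  -- Non-triviality of the progression is recorded as distinctness of the points, a property
  -- inherited by windows.
  record PointSequence (E : Weierstrass) (n : ℕ) : Set where
    field
      x y      : Fin n → ℚ
      onCurve  : ∀ i → OnCurve E (pt (x i) (y i))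
      distinct : ∀ {i k} → pt (x i) (y i) ≡ pt (x k) (y k) → i ≡ k

    point : Fin n → RatPt E
    point i = pt (x i) (y i) , onCurve i

  record Difference (E : Weierstrass) (x₁ y₁ x₂ y₂ : ℚ) : Set where
    constructor difference
    field
      s t       : ℚ
      affine    : add E (pt x₁ y₁) (neg (pt x₂ y₂)) ≡ pt s t
      onCurve   : OnCurve E (pt s t)
      collinear : Collinear (A E) (B E) (Xc E x₁) (Xc E x₂) (Xc E s)

  subtract : ∀ E {x₁ y₁ x₂ y₂} → OnCurve E (pt x₁ y₁) → OnCurve E (pt x₂ y₂) → pt x₁ y₁ ≢ pt x₂ y₂ → Difference E x₁ y₁ x₂ y₂
  subtract E {x₁} {y₁} {x₂} {y₂} h₁ h₂ P≢ = go (add-sum E {x₁} {y₁} {x₂} { - y₂} h₁ (neg-onCurve E (pt x₂ y₂) h₂)) refl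
    (add-onCurve E (pt x₁ y₁) (pt x₂ (- y₂)) h₁ (neg-onCurve E (pt x₂ y₂) h₂))
    where
    go : ∀ {S} → Sum E x₁ y₁ x₂ (- y₂) S → add E (pt x₁ y₁) (neg (pt x₂ y₂)) ≡ S → OnCurve E (add E (pt x₁ y₁) (neg (pt x₂ y₂))) →
      Difference E x₁ y₁ x₂ y₂
    go (inverse x≡ y≡) e h = contradiction (cong₂ pt x≡ (x-y≡0⇒x≡y {y₁} {y₂} y≡)) P≢
    go (secant {l} {n} {s} {t} L) e h = difference s t e (subst (OnCurve E) e h) (short-collinear E L h₁)

  collinear-swap : ∀ A B x x′ s → Collinear A B x x′ s → Collinear A B x′ x s
  collinear-swap A B x x′ s h = byLinComb (1ℚ · h) (ℚ-identity 5 (λ A B x x′ s → (A ⊖ (x′ ⊗ x ⊕ s ⊗ (x′ ⊕ x))) ⊗ (A ⊖ (x′ ⊗ x ⊕ s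
      ⊗ (x′ ⊕ x))) ⊖ # 4 ⊗ ((x′ ⊕ x ⊕ s) ⊗ (x′ ⊗ x ⊗ s ⊕ B)) ⊜ Κ 1ℚ ⊗ ((A ⊖ (x ⊗ x′ ⊕ s ⊗ (x ⊕ x′))) ⊗ (A ⊖ (x ⊗ x′ ⊕ s ⊗ (x ⊕
      x′))) ⊖ # 4 ⊗ ((x ⊕ x′ ⊕ s) ⊗ (x ⊗ x′ ⊗ s ⊕ B)))) refl A B x x′ s)

  module _ (j : ℚ) where

    private
      module AtScale (E : Weierstrass) (hj : jInv E ≡ j) (Q : ℕ) (C≤Q : baseConstant j ≤ Q) where

        open Model j E hj Q C≤Q public

        -- The difference with abscissa `S₁` belongs to both triples, `i₀` against `i₁`, `i₂` and
        -- `i₁` against `i₀`, `i₂`, so it is the unit for both. Two terms are thereby bounded, and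
        -- interpolation bounds all others.
        module Close {n} (𝓟 : PointSequence E n) (1≤n : 1 ≤ n) (n≤Q : n ≤ Q) (i₀ i₁ i₂ : Fin n) (i₀≢i₁ : i₀ ≢ i₁) (i₀≢i₂ : i₀ ≢ i₂) (i₁≢i₂ : i₁ ≢ i₂)
          (S₁ S₂ S₃ : ℚ) (S₁≢0 : S₁ ≢ 0ℚ) (w₁ : Weight 2 S₁ 1) (w₂ : Weight 2 S₂ 1) (w₃ : Weight 2 S₃ 1)
          (c₁ : Collinear (A E) (B E) (Xc E (PointSequence.x 𝓟 i₀)) (Xc E (PointSequence.x 𝓟 i₁)) S₁)
          (c₂ : Collinear (A E) (B E) (Xc E (PointSequence.x 𝓟 i₀)) (Xc E (PointSequence.x 𝓟 i₂)) S₂)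
          (c₃ : Collinear (A E) (B E) (Xc E (PointSequence.x 𝓟 i₁)) (Xc E (PointSequence.x 𝓟 i₂)) S₃) where

          open PointSequence 𝓟

          X Y : Fin n → ℚ
          X i = Xc E (x i)
          Y i = Yc (y i)

          curve : ∀ i → q (+ 3) * (Y i * Y i) ≡ X i * X i * X i + A E * X i + B E
          curve i = short-curve E (x i) (y i) (onCurve i)

          interpolate : ∀ {k} {f : Fin n → ℚ} {J K} → Arithmetic f → Weight k (f i₀) J → Weight k (f i₁) K → ∀ l → Weight k (f l) _
          interpolate {k} {f} {J} {K} ap v₀ v₁ l = weight-interpolate {k} {f i₀} {f i₁} {f l} {index-difference i₁ l} {index-difference i₁ i₀} {index-difference l i₀} {J} {K}
            (index-difference≢0 (λ e → i₀≢i₁ (sym e))) (ℕ.≤-trans (∣index-difference∣ i₁ l) n≤Q) (ℕ.≤-trans (∣index-difference∣ i₁ i₀) n≤Q) (ℕ.≤-trans (∣index-difference∣ l i₀) n≤Q)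
            (arithmetic-interpolation ap i₀ i₁ l) v₀ v₁

          linear : Arithmetic X → ∀ i j k → i ≢ j → j ≢ k → ∀ {S S′} → S ≢ 0ℚ → Weight 2 S 1 → Weight 2 S′ 1 →
            Collinear (A E) (B E) (X i) (X j) S → Collinear (A E) (B E) (X i) (X k) S′ → Weight 2 (X i) _
          linear ap i j′ k i≢j j≢k S≢0 w w′ c c′ = weight-linear-triple (A E) (B E) (D E) (κ₁ j) (κ₂ j) (D≢0 E) (A³≡ E hj) (B²≡ E hj) Q 10≤Q
            (ℕ.≤-trans (Hκ₁≤ j) C≤Q) (ℕ.≤-trans (Hκ₂≤ j) C≤Q) S≢0 w w′ (X i) (X j′) (X k) c c′ n 1≤n n≤Q
            (index-difference k j′) (index-difference i k) (index-difference j′ i) (index-difference≢0 (λ e → j≢k (sym e)))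
            (∣index-difference∣ k j′) (∣index-difference∣ i k) (∣index-difference∣ j′ i) (arithmetic-relation ap i j′ k)

          quadratic : Arithmetic Y → ∀ i j k → i ≢ j → j ≢ k → ∀ {S S′} → S ≢ 0ℚ → Weight 2 S 1 → Weight 2 S′ 1 →
            Collinear (A E) (B E) (X i) (X j) S → Collinear (A E) (B E) (X i) (X k) S′ → Weight 2 (X i) _
          quadratic ap i j′ k i≢j j≢k S≢0 w w′ c c′ = weight-quadratic-triple (A E) (B E) (D E) (κ₁ j) (κ₂ j) (D≢0 E) (A³≡ E hj) (B²≡ E hj) Q 10≤Q
            (ℕ.≤-trans (Hκ₁≤ j) C≤Q) (ℕ.≤-trans (Hκ₂≤ j) C≤Q) S≢0 w w′ (X i) (X j′) (X k) c c′ n 1≤n n≤Q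
            (index-difference k j′) (index-difference i k) (index-difference j′ i) (index-difference≢0 (λ e → j≢k (sym e)))
            (∣index-difference∣ k j′) (∣index-difference∣ i k) (∣index-difference∣ j′ i) {Y i} {Y j′} {Y k} (curve i) (curve j′) (curve k)
            (arithmetic-relation ap i j′ k)

          weight-x-progression : Arithmetic X → ∀ l → Weight 2 (X l) _
          weight-x-progression ap = interpolate ap (linear ap i₀ i₁ i₂ i₀≢i₁ i₁≢i₂ S₁≢0 w₁ w₂ c₁ c₂)
            (linear ap i₁ i₀ i₂ (λ e → i₀≢i₁ (sym e)) i₀≢i₂ S₁≢0 w₁ w₃ (collinear-swap (A E) (B E) (X i₀) (X i₁) S₁ c₁) c₃)

          weight-y-progression : Arithmetic Y → ∀ l → Weight 2 (X l) _
          weight-y-progression ap l = weight-X {X l} {Y l} (curve l) (interpolate ap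
            (weight-Y (X i₀) (Y i₀) (curve i₀) (quadratic ap i₀ i₁ i₂ i₀≢i₁ i₁≢i₂ S₁≢0 w₁ w₂ c₁ c₂))
            (weight-Y (X i₁) (Y i₁) (curve i₁) (quadratic ap i₁ i₀ i₂ (λ e → i₀≢i₁ (sym e)) i₀≢i₂ S₁≢0 w₁ w₃ (collinear-swap (A E) (B E) (X i₀) (X i₁) S₁ c₁) c₃)) l)

          weight-progression : Arithmetic X ⊎ Arithmetic Y → ∀ l → Weight 2 (X l) (maxExp _ _)
          weight-progression (inj₁ ap) l = weaken-maxˡ (weight-x-progression ap l)
          weight-progression (inj₂ ap) l = weaken-maxʳ (weight-y-progression ap l)

      -- As in `secant-weight`, the inferred exponent precedes the curve, the scale and the
      -- progression.
      close : ∃ λ K → ∀ E (hj : jInv E ≡ j) Q (C≤Q : baseConstant j ≤ Q) {n} (𝓟 : PointSequence E n) → 1 ≤ n → n ≤ Q →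
        (i₀ i₁ i₂ : Fin n) → i₀ ≢ i₁ → i₀ ≢ i₂ → i₁ ≢ i₂ → ∀ S₁ S₂ S₃ → S₁ ≢ 0ℚ →
        Model.Weight j E hj Q C≤Q 2 S₁ 1 → Model.Weight j E hj Q C≤Q 2 S₂ 1 → Model.Weight j E hj Q C≤Q 2 S₃ 1 →
        Collinear (A E) (B E) (Xc E (PointSequence.x 𝓟 i₀)) (Xc E (PointSequence.x 𝓟 i₁)) S₁ →
        Collinear (A E) (B E) (Xc E (PointSequence.x 𝓟 i₀)) (Xc E (PointSequence.x 𝓟 i₂)) S₂ →
        Collinear (A E) (B E) (Xc E (PointSequence.x 𝓟 i₁)) (Xc E (PointSequence.x 𝓟 i₂)) S₃ →
        Arithmetic (λ i → Xc E (PointSequence.x 𝓟 i)) ⊎ Arithmetic (λ i → Yc (PointSequence.y 𝓟 i)) →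
        ∀ l → Model.Weight j E hj Q C≤Q 2 (Xc E (PointSequence.x 𝓟 l)) K
      close = _ , λ E hj Q C≤Q 𝓟 1≤n n≤Q i₀ i₁ i₂ d₁ d₂ d₃ S₁ S₂ S₃ S₁≢0 w₁ w₂ w₃ c₁ c₂ c₃ →
        AtScale.Close.weight-progression E hj Q C≤Q 𝓟 1≤n n≤Q i₀ i₁ i₂ d₁ d₂ d₃ S₁ S₂ S₃ S₁≢0 w₁ w₂ w₃ c₁ c₂ c₃

    closeExponent : ℕ
    closeExponent = proj₁ close

    module _ (E : Weierstrass) (hj : jInv E ≡ j) {n : ℕ} (𝓟 : PointSequence E n) (ι : Fin 4 → Fin n) (ι-injective : ∀ {i k} → ι i ≡ ι k → i ≡ k)
      (Z : ℕ) (1≤Z : 1 ≤ Z) (near : ∀ i k → height E (add E (proj₁ (PointSequence.point 𝓟 (ι i))) (neg (proj₁ (PointSequence.point 𝓟 (ι k))))) ≤ Z) where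

      open PointSequence 𝓟

      private
        T : ∀ i k → i ≢ k → Difference E (x (ι i)) (y (ι i)) (x (ι k)) (y (ι k))
        T i k i≢k = subtract E {x (ι i)} {y (ι i)} {x (ι k)} {y (ι k)} (onCurve (ι i)) (onCurve (ι k)) (λ e → i≢k (ι-injective (distinct e)))

        module T i k (i≢k : i ≢ k) = Difference (T i k i≢k)

        X≡0⇒s≡ : ∀ {s s′} → Xc E s ≡ 0ℚ → Xc E s′ ≡ 0ℚ → s ≡ s′
        X≡0⇒s≡ {s} {s′} h h′ = *-cancelˡ-≢0 {q (+ 3)} (λ ()) (byLinComb (1ℚ · h ⊹ - 1ℚ · h′) (lemma (a E) s s′))
          where
          lemma : ∀ a s s′ → q (+ 3) * s - q (+ 3) * s′ ≡ 1ℚ * ((q (+ 3) * s + a) - 0ℚ) + - 1ℚ * ((q (+ 3) * s′ + a) - 0ℚ)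
          lemma = ℚ-identity 3 (λ a s s′ → # 3 ⊗ s ⊖ # 3 ⊗ s′ ⊜ Κ 1ℚ ⊗ ((# 3 ⊗ s ⊕ a) ⊖ Κ 0ℚ) ⊕ ⊝ Κ 1ℚ ⊗ ((# 3 ⊗ s′ ⊕ a) ⊖ Κ 0ℚ)) refl

        opposite : ∀ {s t t′} → OnCurve E (pt s t) → OnCurve E (pt s t′) → t ≢ t′ → t + t′ ≡ 0ℚ
        opposite {s} {t} {t′} h h′ t≢ = *-zero-cancelˡ {t - t′} (λ e → t≢ (x-y≡0⇒x≡y {t} {t′} e)) (squares t t′ (trans h (sym h′)))
          where
          squares : ∀ t t′ → t * t ≡ t′ * t′ → (t - t′) * (t + t′) ≡ 0ℚ
          squares t t′ h = byLinComb (1ℚ · h) (ℚ-identity 2 (λ t t′ → (t ⊖ t′) ⊗ (t ⊕ t′) ⊖ Κ 0ℚ ⊜ Κ 1ℚ ⊗ (t ⊗ t ⊖ t′ ⊗ t′)) refl t t′)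

        cancel : ∀ {t u v} → t + u ≡ 0ℚ → t + v ≡ 0ℚ → u ≡ v
        cancel {t} {u} {v} h k = byLinComb (1ℚ · h ⊹ - 1ℚ · k) (ℚ-identity 3 (λ t u v → u ⊖ v ⊜ Κ 1ℚ ⊗ (t ⊕ u ⊖ Κ 0ℚ) ⊕ ⊝ Κ 1ℚ ⊗
            (t ⊕ v ⊖ Κ 0ℚ)) refl t u v)

        T-injective : ∀ i k k′ (h : i ≢ k) (h′ : i ≢ k′) → T.s i k h ≡ T.s i k′ h′ → T.t i k h ≡ T.t i k′ h′ → k ≡ k′
        T-injective i k k′ h h′ s≡ t≡ = ι-injective (distinct (cong proj₁ (⁻¹-injective (∙-cancelˡ (point (ι i)) (negPt (point (ι k))) (negPt (point (ι k′)))
            (RatPt-≡ (trans (T.affine i k h) (trans (cong₂ pt s≡ t≡) (sym (T.affine i k′ h′)))))))))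
          where
          open Points E
          group : Group _ _
          group = record { isGroup = IsAbelianGroup.isGroup isAbelianGroup }
          open import Algebra.Properties.Group group using (⁻¹-injective; ∙-cancelˡ)

        -- At most two points of the curve have abscissa X = 0.
        some-X≢0 : ∀ i k₁ k₂ k₃ (h₁ : i ≢ k₁) (h₂ : i ≢ k₂) (h₃ : i ≢ k₃) → k₁ ≢ k₂ → k₁ ≢ k₃ → k₂ ≢ k₃ →
          Xc E (T.s i k₁ h₁) ≡ 0ℚ → Xc E (T.s i k₂ h₂) ≡ 0ℚ → Xc E (T.s i k₃ h₃) ≢ 0ℚ
        some-X≢0 i k₁ k₂ k₃ h₁ h₂ h₃ d₁₂ d₁₃ d₂₃ z₁ z₂ z₃ = d₂₃ (T-injective i k₂ k₃ h₂ h₃ (trans (sym s₁₂) s₁₃)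
            (cancel {T.t i k₁ h₁} (opposite {T.s i k₁ h₁} (T.onCurve i k₁ h₁) (subst (λ s → OnCurve E (pt s (T.t i k₂ h₂))) (sym s₁₂) (T.onCurve i k₂ h₂))
                (λ e → d₁₂ (T-injective i k₁ k₂ h₁ h₂ s₁₂ e)))
              (opposite {T.s i k₁ h₁} (T.onCurve i k₁ h₁) (subst (λ s → OnCurve E (pt s (T.t i k₃ h₃))) (sym s₁₃) (T.onCurve i k₃ h₃))
                (λ e → d₁₃ (T-injective i k₁ k₃ h₁ h₃ s₁₃ e)))))
          where
          s₁₂ = X≡0⇒s≡ {T.s i k₁ h₁} {T.s i k₂ h₂} z₁ z₂
          s₁₃ = X≡0⇒s≡ {T.s i k₁ h₁} {T.s i k₃ h₃} z₁ z₃

        1≤n : 1 ≤ n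
        1≤n = ℕ.≤-trans (s≤s z≤n) (toℕ<n (ι zero))

        Q : ℕ
        Q = baseConstant j ℕ.* (n ℕ.* Z)

        1≤C : 1 ≤ baseConstant j
        1≤C = ℕ.≤-trans (s≤s z≤n) (10≤baseConstant j)

        C≤Q : baseConstant j ≤ Q
        C≤Q = ℕ.≤-trans (ℕ.≤-reflexive (sym (ℕ.*-identityʳ (baseConstant j)))) (ℕ.*-monoʳ-≤ (baseConstant j) (ℕ.*-mono-≤ 1≤n 1≤Z))

        nZ≤Q : n ℕ.* Z ≤ Q
        nZ≤Q = ℕ.≤-trans (ℕ.≤-reflexive (sym (ℕ.*-identityˡ (n ℕ.* Z)))) (ℕ.*-monoˡ-≤ (n ℕ.* Z) 1≤C)

        n≤Q : n ≤ Q
        n≤Q = ℕ.≤-trans (ℕ.≤-trans (ℕ.≤-reflexive (sym (ℕ.*-identityʳ n))) (ℕ.*-monoʳ-≤ n 1≤Z)) nZ≤Q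

        Z≤Q : Z ≤ Q
        Z≤Q = ℕ.≤-trans (ℕ.≤-trans (ℕ.≤-reflexive (sym (ℕ.*-identityˡ Z))) (ℕ.*-monoˡ-≤ Z 1≤n)) nZ≤Q

        weight-T : ∀ i k (i≢k : i ≢ k) → Model.Weight j E hj Q C≤Q 2 (Xc E (T.s i k i≢k)) 1
        weight-T i k i≢k = Model.height⇒weight j E hj Q C≤Q (T.s i k i≢k) (T.t i k i≢k)
          (ℕ.≤-trans (subst (λ R → height E R ≤ Z) (T.affine i k i≢k) (near i k)) Z≤Q)

      module _ (ap : Arithmetic x ⊎ Arithmetic y) where

        private
          scaled : Arithmetic x ⊎ Arithmetic y → Arithmetic (λ i → Xc E (x i)) ⊎ Arithmetic (λ i → Yc (y i))
          scaled (inj₁ ap) = inj₁ (arithmetic-affine (q (+ 3)) (a E) ap)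
          scaled (inj₂ ap) = inj₂ (unshift (arithmetic-affine (q (+ 3)) 0ℚ ap))
            where
            unshift : Arithmetic (λ i → q (+ 3) * y i + 0ℚ) → Arithmetic (λ i → Yc (y i))
            unshift (u , d , f≡) = u , d , λ i → trans (sym (+-identityʳ (q (+ 3) * y i))) (f≡ i)

          bounded : ∀ i k m (h : i ≢ k) → i ≢ m → k ≢ m → Xc E (T.s i k h) ≢ 0ℚ → ∀ l → height E (pt (x l) (y l)) ≤ Q ℕ.^ closeExponent
          bounded i k m i≢k i≢m k≢m S≢0 l = Model.weight⇒height j E hj Q C≤Q (x l) (y l) {closeExponent}
            (proj₂ close E hj Q C≤Q 𝓟 1≤n n≤Q (ι i) (ι k) (ι m) (λ e → i≢k (ι-injective e)) (λ e → i≢m (ι-injective e)) (λ e → k≢m (ι-injective e))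
              (Xc E (T.s i k i≢k)) (Xc E (T.s i m i≢m)) (Xc E (T.s k m k≢m)) S≢0 (weight-T i k i≢k) (weight-T i m i≢m) (weight-T k m k≢m)
              (T.collinear i k i≢k) (T.collinear i m i≢m) (T.collinear k m k≢m) (scaled ap) l)

          #0 #1 #2 #3 : Fin 4
          #0 = zero
          #1 = suc zero
          #2 = suc (suc zero)
          #3 = suc (suc (suc zero))

        -- A unit requires a difference with `X ≢ 0`. Since two points may have `X = 0`, three
        -- differences from a common term are inspected, which is why four close terms are demanded.
        progression-height : ∀ l → height E (pt (x l) (y l)) ≤ (baseConstant j ℕ.* (n ℕ.* Z)) ℕ.^ closeExponent
        progression-height l = choose (Xc E (T.s #0 #1 (λ ())) ≟ 0ℚ) (Xc E (T.s #0 #2 (λ ())) ≟ 0ℚ)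
          where
          choose : Dec (Xc E (T.s #0 #1 (λ ())) ≡ 0ℚ) → Dec (Xc E (T.s #0 #2 (λ ())) ≡ 0ℚ) → height E (pt (x l) (y l)) ≤ Q ℕ.^ closeExponent
          choose (no X≢0) _          = bounded #0 #1 #2 (λ ()) (λ ()) (λ ()) X≢0 l
          choose (yes _)  (no X≢0)   = bounded #0 #2 #1 (λ ()) (λ ()) (λ ()) X≢0 l
          choose (yes z₁) (yes z₂)   = bounded #0 #3 #1 (λ ()) (λ ()) (λ ())
            (some-X≢0 #0 #1 #2 #3 (λ ()) (λ ()) (λ ()) (λ ()) (λ ()) (λ ()) z₁ z₂) l

-- The choice of constants

module ExplicitConstants where

  open SpherePacking using (^-distrib-*; ^-swap; 1≤^; module PackingExponents)
  open PointGroup using (pointCount)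
  open import Data.Nat
  open import Data.Nat.Properties
  open import Data.Fin as Fin using (Fin; zero; suc)
  open import Data.Product using (∃; _,_)
  open import Data.Sum using (inj₁; inj₂)
  open import Relation.Binary.PropositionalEquality

  maximum : ∀ n (f : Fin (suc n) → ℕ) → ∃ λ i → ∀ k → f k ≤ f i
  maximum zero f = zero , λ { zero → ≤-refl }
  maximum (suc n) f = larger (maximum n (λ i → f (suc i)))
    where
    larger : (∃ λ i → ∀ k → f (suc k) ≤ f (suc i)) → ∃ λ i → ∀ k → f k ≤ f i
    larger (i , h) with ≤-total (f zero) (f (suc i))
    ... | inj₁ le = suc i , λ { zero → le ; (suc k) → h k }
    ... | inj₂ ge = zero , λ { zero → ≤-refl ; (suc k) → ≤-trans (h k) ge }

  module Constants (C K₁ K₂ : ℕ) (1≤C : 1 ≤ C) where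

    open PackingExponents K₂

    -- By `n ≤ 4^n` this `k` makes `4^k` exceed both `ballExponent`, as the packing requires, and
    -- `differenceExponent * K₁`, as `self-bound` requires.
    k scale : ℕ
    k = suc (ballExponent + differenceExponent * K₁)
    scale = 4 ^ k

    private
      n≤4^n : ∀ n → n ≤ 4 ^ n
      n≤4^n zero = z≤n
      n≤4^n (suc n) = ≤-trans (+-mono-≤ (1≤^ n (s≤s z≤n)) (n≤4^n n)) (+-monoʳ-≤ (4 ^ n) (m≤m+n (4 ^ n) (2 * 4 ^ n)))

    ballExponent≤ : ballExponent ≤ scale
    ballExponent≤ = ≤-trans (≤-trans (m≤m+n ballExponent (differenceExponent * K₁)) (n≤1+n (ballExponent + differenceExponent * K₁))) (n≤4^n k)

    differenceExponent< : suc (differenceExponent * K₁) ≤ scale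
    differenceExponent< = ≤-trans (s≤s (m≤n+m (differenceExponent * K₁) ballExponent)) (n≤4^n k)

    -- Among any window r points of height at most X, packing finds four with close differences.
    window heightBound : ℕ → ℕ
    window r = suc (3 * (2 ^ r) ^ k)
    heightBound r = (C * window r) ^ (suc K₁ * scale)

    private
      1≤scale : 1 ≤ scale
      1≤scale = 1≤^ k (s≤s z≤n)

      1≤Cw : ∀ r → 1 ≤ C * window r
      1≤Cw r = *-mono-≤ 1≤C (s≤s z≤n)

      C≤Cw : ∀ r → C ≤ C * window r
      C≤Cw r = ≤-trans (≤-reflexive (sym (*-identityʳ C))) (*-monoʳ-≤ C (s≤s z≤n))

    -- The extra summand `scale` in the exponent `suc K₁ * scale` is there for this estimate, used
    -- when the heights are too small for the packing.
    C^scale≤heightBound : ∀ r → C ^ scale ≤ heightBound r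
    C^scale≤heightBound r = ≤-trans (^-monoˡ-≤ scale (C≤Cw r)) (^-monoʳ-≤ (C * window r) {{>-nonZero (1≤Cw r)}} (m≤m+n scale (K₁ * scale)))

    window≤heightBound : ∀ r → window r ≤ heightBound r
    window≤heightBound r = ≤-trans (≤-trans (≤-reflexive (sym (*-identityˡ (window r)))) (*-monoˡ-≤ (window r) 1≤C))
      (≤-trans (≤-reflexive (sym (*-identityʳ (C * window r)))) (^-monoʳ-≤ (C * window r) {{>-nonZero (1≤Cw r)}} (≤-trans 1≤scale (m≤m+n scale (K₁ * scale)))))

    -- Raised to the power `scale`, the bound for `X` contains `X` again, but only to the power
    -- `differenceExponent * K₁ < scale`; cancelling it leaves at least one factor `X` on the left.
    self-bound : ∀ r X Z → 1 ≤ X → X ≤ (C * (window r * Z)) ^ K₁ → Z ^ scale ≤ X ^ differenceExponent → X ≤ heightBound r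
    self-bound r X Z 1≤X X≤ Z≤ = ≤-trans (*-cancelʳ-≤ X ((C * window r) ^ (K₁ * scale)) (X ^ (differenceExponent * K₁)) {{>-nonZero (1≤^ (differenceExponent * K₁) 1≤X)}} (begin
        X * X ^ (differenceExponent * K₁)                          ≤⟨ ^-monoʳ-≤ X {{>-nonZero 1≤X}} differenceExponent< ⟩
        X ^ scale                                                  ≤⟨ ^-monoˡ-≤ scale X≤ ⟩
        ((C * (window r * Z)) ^ K₁) ^ scale                        ≡⟨ cong (λ t → (t ^ K₁) ^ scale) (*-assoc C (window r) Z) ⟨
        ((C * window r * Z) ^ K₁) ^ scale                          ≡⟨ cong (_^ scale) (^-distrib-* (C * window r) Z K₁) ⟩
        ((C * window r) ^ K₁ * Z ^ K₁) ^ scale                     ≡⟨ ^-distrib-* ((C * window r) ^ K₁) (Z ^ K₁) scale ⟩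
        ((C * window r) ^ K₁) ^ scale * (Z ^ K₁) ^ scale           ≡⟨ cong₂ _*_ (^-*-assoc (C * window r) K₁ scale) (^-swap Z K₁ scale) ⟩
        (C * window r) ^ (K₁ * scale) * (Z ^ scale) ^ K₁           ≤⟨ *-monoʳ-≤ ((C * window r) ^ (K₁ * scale)) (^-monoˡ-≤ K₁ Z≤) ⟩
        (C * window r) ^ (K₁ * scale) * (X ^ differenceExponent) ^ K₁ ≡⟨ cong ((C * window r) ^ (K₁ * scale) *_) (^-*-assoc X differenceExponent K₁) ⟩
        (C * window r) ^ (K₁ * scale) * X ^ (differenceExponent * K₁) ∎))
      (^-monoʳ-≤ (C * window r) {{>-nonZero (1≤Cw r)}} (m≤n+m (K₁ * scale) scale))
      where open ≤-Reasoning

    -- The window is at most `(4 · 2^k)^(r+1)`, so `heightBase ^ suc r` bounds the heights. The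
    -- constant copies the shape of `pointCount`, with `2 * heightBase` absorbing the successor.
    heightBase constant : ℕ
    heightBase = (C * (4 * 2 ^ k)) ^ (suc K₁ * scale)
    constant = 2 * (2 * (2 * (2 * ((2 * heightBase) * (2 * heightBase)))))

    private
      power-* : ∀ {a b} A B s → a ≤ A ^ s → b ≤ B ^ s → a * b ≤ (A * B) ^ s
      power-* A B s ha hb = ≤-trans (*-mono-≤ ha hb) (≤-reflexive (sym (^-distrib-* A B s)))

      power-base : ∀ a s → 1 ≤ a → a ≤ a ^ suc s
      power-base a s 1≤a = ≤-trans (≤-reflexive (sym (*-identityʳ a))) (*-monoʳ-≤ a (1≤^ s 1≤a))

      window≤ : ∀ r → window r ≤ (4 * 2 ^ k) ^ suc r
      window≤ r = ≤-trans (+-monoˡ-≤ (3 * (2 ^ r) ^ k) (1≤^ k (1≤^ {2} r (s≤s z≤n))))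
        (power-* 4 (2 ^ k) (suc r) (power-base 4 r (s≤s z≤n))
          (≤-trans (≤-reflexive (^-swap 2 r k)) (^-monoʳ-≤ (2 ^ k) {{>-nonZero (1≤^ {2} k (s≤s z≤n))}} (n≤1+n r))))

      heightBound≤ : ∀ r → heightBound r ≤ heightBase ^ suc r
      heightBound≤ r = ≤-trans (^-monoˡ-≤ (suc K₁ * scale) (power-* C (4 * 2 ^ k) (suc r) (power-base C r 1≤C) (window≤ r)))
        (≤-reflexive (^-swap (C * (4 * 2 ^ k)) (suc r) (suc K₁ * scale)))

      1≤heightBound : ∀ r → 1 ≤ heightBound r
      1≤heightBound r = 1≤^ (suc K₁ * scale) (1≤Cw r)

      power-2* : ∀ {b} B r → b ≤ B ^ suc r → 2 * b ≤ (2 * B) ^ suc r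
      power-2* B r h = power-* 2 B (suc r) (power-base 2 r (s≤s z≤n)) h

    pointCount≤ : ∀ r → pointCount (heightBound r) ≤ constant ^ suc r
    pointCount≤ r = power-2* (2 * (2 * (2 * V²))) r (power-2* (2 * (2 * V²)) r (power-2* (2 * V²) r (power-2* V² r (power-* (2 * heightBase) (2 * heightBase) (suc r) one one))))
      where
      V² = (2 * heightBase) * (2 * heightBase)
      one : suc (heightBound r) ≤ (2 * heightBase) ^ suc r
      one = ≤-trans (≤-trans (+-monoˡ-≤ (heightBound r) (1≤heightBound r)) (+-monoʳ-≤ (heightBound r) (m≤m+n (heightBound r) 0)))
        (power-2* heightBase r (heightBound≤ r))

    heightBound≤constant : ∀ r → heightBound r ≤ constant ^ suc r
    heightBound≤constant r = ≤-trans (≤-trans (n≤1+n (heightBound r))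
        (≤-trans (≤-trans (≤-reflexive (sym (*-identityʳ (suc (heightBound r))))) (*-monoʳ-≤ (suc (heightBound r)) (s≤s z≤n)))
          (double (double (double (double ≤-refl)))))) (pointCount≤ r)
      where
      double : ∀ {a b} → a ≤ b → a ≤ 2 * b
      double {b = b} h = ≤-trans h (m≤m+n b (b + 0))

-- From windows to the length of the whole progression

module ProgressionLength where

  open import Defs
  open RationalAlgebra
  open RationalHeight using (q-+; q-injective)
  open CurveHeight
  open PointGroup
  open TwoPowerTorsion
  open SpherePacking
  open ExplicitConstants
  open Progressions
  open import Data.Nat as ℕ using (ℕ; suc; _≤_; _<_; _∸_; z≤n; s≤s)
  import Data.Nat.Properties as ℕ
  open import Data.Integer as ℤ using (+_)
  import Data.Integer.Properties as ℤ
  open import Data.Fin as Fin using (Fin; suc; toℕ; fromℕ<)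
  open import Data.Fin.Properties using (toℕ<n; toℕ-injective; toℕ-fromℕ<)
  open import Data.Rational using (ℚ; 0ℚ; 1ℚ; _+_; _*_; _-_; -_)
  open import Data.Product using (Σ; ∃; _×_; _,_; proj₁; proj₂)
  open import Data.Sum using (_⊎_; inj₁; inj₂; map)
  open import Relation.Nullary using (¬_; Dec; yes; no)
  open import Relation.Nullary.Decidable using (decidable-stable)
  open import Relation.Binary.PropositionalEquality

  module Window {n w s : ℕ} (s+w≤n : s ℕ.+ w ≤ n) where

    shift : Fin w → Fin n
    shift i = fromℕ< (ℕ.<-≤-trans (ℕ.+-monoʳ-< s (toℕ<n i)) s+w≤n)

    toℕ-shift : ∀ i → toℕ (shift i) ≡ s ℕ.+ toℕ i
    toℕ-shift i = toℕ-fromℕ< (ℕ.<-≤-trans (ℕ.+-monoʳ-< s (toℕ<n i)) s+w≤n)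

    shift-injective : ∀ {i k} → shift i ≡ shift k → i ≡ k
    shift-injective {i} {k} e = toℕ-injective (ℕ.+-cancelˡ-≡ s (toℕ i) (toℕ k) (trans (sym (toℕ-shift i)) (trans (cong toℕ e) (toℕ-shift k))))

    arithmetic-shift : ∀ {f : Fin n → ℚ} → Arithmetic f → Arithmetic (λ i → f (shift i))
    arithmetic-shift {f} (u , d , f≡) = u + q (+ s) * d , d , λ i → trans (f≡ (shift i))
      (trans (cong (λ t → u + t * d) (trans (cong (λ t → q (+ t)) (toℕ-shift i)) (q-+ (+ s) (+ toℕ i)))) (lemma u d (q (+ s)) (q (+ toℕ i))))
      where
      lemma : ∀ u d s i → u + (s + i) * d ≡ u + s * d + i * d
      lemma = ℚ-identity 4 (λ u d s i → u ⊕ (s ⊕ i) ⊗ d ⊜ u ⊕ s ⊗ d ⊕ i ⊗ d) refl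

    restrict : ∀ {E} → PointSequence E n → PointSequence E w
    restrict 𝓟 = record
      { x = λ i → x (shift i) ; y = λ i → y (shift i) ; onCurve = λ i → onCurve (shift i)
      ; distinct = λ {i} {k} e → shift-injective (distinct {shift i} {shift k} e) }
      where open PointSequence 𝓟

  -- The window starts at `l` if there is room, and otherwise is the last one.
  in-window : ∀ {n w} → 1 ≤ w → w ≤ n → (l : Fin n) → ∃ λ s → Σ (s ℕ.+ w ≤ n) λ h → ∃ λ i → Window.shift h i ≡ l
  in-window {n} {w} 1≤w w≤n l = go (toℕ l ℕ.≤? n ∸ w)
    where
    located : ∀ s (h : s ℕ.+ w ≤ n) t (t<w : t < w) → s ℕ.+ t ≡ toℕ l → ∃ λ s → Σ (s ℕ.+ w ≤ n) λ h → ∃ λ i → Window.shift h i ≡ l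
    located s h t t<w e = s , h , fromℕ< t<w , toℕ-injective (trans (Window.toℕ-shift h (fromℕ< t<w)) (trans (cong (s ℕ.+_) (toℕ-fromℕ< t<w)) e))
    go : Dec (toℕ l ≤ n ∸ w) → ∃ λ s → Σ (s ℕ.+ w ≤ n) λ h → ∃ λ i → Window.shift h i ≡ l
    go (yes l≤) = located (toℕ l) (ℕ.≤-trans (ℕ.+-monoˡ-≤ w l≤) (ℕ.≤-reflexive (ℕ.m∸n+n≡m w≤n))) 0 1≤w (ℕ.+-identityʳ (toℕ l))
    go (no l≰) = located (n ∸ w) (ℕ.≤-reflexive (ℕ.m∸n+n≡m w≤n)) (toℕ l ∸ (n ∸ w))
      (ℕ.<-≤-trans (ℕ.∸-monoˡ-< (toℕ<n l) (ℕ.<⇒≤ (ℕ.≰⇒> l≰))) (ℕ.≤-reflexive (ℕ.m∸[m∸n]≡n w≤n)))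
      (ℕ.m+[n∸m]≡n (ℕ.<⇒≤ (ℕ.≰⇒> l≰)))

  module _ (E : Weierstrass) {N : ℕ} where

    private
      progression-injective : ∀ {u d} → d ≢ 0ℚ → ∀ (i k : Fin N) → u + q (+ toℕ i) * d ≡ u + q (+ toℕ k) * d → i ≡ k
      progression-injective {u} {d} d≢0 i k e = toℕ-injective (ℤ.+-injective (q-injective (*-cancelˡ-≢0 d≢0
        (byLinComb (1ℚ · e) (lemma u d (q (+ toℕ i)) (q (+ toℕ k)))))))
        where
        lemma : ∀ u d i k → d * i - d * k ≡ 1ℚ * ((u + i * d) - (u + k * d))
        lemma = ℚ-identity 4 (λ u d i k → d ⊗ i ⊖ d ⊗ k ⊜ Κ 1ℚ ⊗ ((u ⊕ i ⊗ d) ⊖ (u ⊕ k ⊗ d))) refl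

      abscissa ordinate : Pt → ℚ
      abscissa O = 0ℚ
      abscissa (pt x y) = x
      ordinate O = 0ℚ
      ordinate (pt x y) = y

      sequence : (P : Fin N → AffPt E) → (∀ {i k} → pt (xc {E} (P i)) (yc {E} (P i)) ≡ pt (xc {E} (P k)) (yc {E} (P k)) → i ≡ k) → PointSequence E N
      sequence P distinct = record
        { x = λ i → xc {E} (P i) ; y = λ i → yc {E} (P i) ; onCurve = λ i → proj₂ (P i) ; distinct = distinct }

    points-of-progression : XAP E N ⊎ YAP E N → Σ (PointSequence E N) λ 𝓟 → Arithmetic (PointSequence.x 𝓟) ⊎ Arithmetic (PointSequence.y 𝓟)
    points-of-progression (inj₁ (P , u , d , d≢0 , f≡)) =
      sequence P (λ {i} {k} e → progression-injective {u} {d} d≢0 i k (trans (sym (f≡ i)) (trans (cong abscissa e) (f≡ k)))) , inj₁ (u , d , f≡)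
    points-of-progression (inj₂ (P , u , d , d≢0 , f≡)) =
      sequence P (λ {i} {k} e → progression-injective {u} {d} d≢0 i k (trans (sym (f≡ i)) (trans (cong ordinate e) (f≡ k)))) , inj₂ (u , d , f≡)

  module _ (j : ℚ) where

    groupExponent : ℕ
    groupExponent = suc (proj₁ (height-add j))

    private
      1≤C : 1 ≤ baseConstant j
      1≤C = ℕ.≤-trans (s≤s z≤n) (10≤baseConstant j)

    open ExplicitConstants.Constants (baseConstant j) (closeExponent j) groupExponent 1≤C

    progressionConstant : ℕ
    progressionConstant = constant

    module _ (E : Weierstrass) (hj : jInv E ≡ j) (r : ℕ) (rank≤r : (P : Fin (suc r) → RatPt E) → ¬ Independent E (suc r) P) where

      open Points E
      open AbelianGroupFacts isAbelianGroup using (_⊝_; lincombination)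

      private
        H′ : RatPt E → ℕ
        H′ P = height E (proj₁ P)

        no-independent : (g : Fin (suc r) → RatPt E) → ¬ (∀ z → lincombination (suc r) z g ≡ zeroPt → ∀ i → z i ≡ + 0)
        no-independent g ind = rank≤r g λ z h → ind z (RatPt-≡ (trans (lincombination-point (suc r) z g) h))

      window-height : (𝓟 : PointSequence E (window r)) → Arithmetic (PointSequence.x 𝓟) ⊎ Arithmetic (PointSequence.y 𝓟) →
        ∀ l → H′ (PointSequence.point 𝓟 l) ≤ heightBound r
      window-height 𝓟 ap l = ℕ.≤-trans (proj₂ highest l) (decidable-stable (X ℕ.≤? heightBound r) (cases (baseConstant j ℕ.^ scale ℕ.≤? X)))
        where
        open PointSequence 𝓟
        highest = maximum _ (λ i → H′ (point i))
        X = H′ (point (proj₁ highest))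
        conclude : Σ (Fin 4 → Fin (window r)) (λ ι → (∀ {i k} → ι i ≡ ι k → i ≡ k) ×
          (∀ i k → H′ (point (ι i) ⊝ point (ι k)) ℕ.^ scale ≤ X ℕ.^ PackingExponents.differenceExponent groupExponent)) → X ≤ heightBound r
        conclude (ι , ι-injective , small) = self-bound r X Z (1≤height E (proj₁ (point (proj₁ highest))))
            (progression-height j E hj 𝓟 ι ι-injective Z (1≤height E (proj₁ (point (ι (proj₁ farthest)) ⊝ point (ι (proj₁ (row (proj₁ farthest))))))) near ap (proj₁ highest)) (small (proj₁ farthest) (proj₁ (row (proj₁ farthest))))
          where
          distance : Fin 4 → Fin 4 → ℕ
          distance i k = H′ (point (ι i) ⊝ point (ι k))
          row : ∀ i → ∃ λ k → ∀ m → distance i m ≤ distance i k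
          row i = maximum 3 (distance i)
          farthest : ∃ λ i → ∀ m → distance m (proj₁ (row m)) ≤ distance i (proj₁ (row i))
          farthest = maximum 3 (λ i → distance i (proj₁ (row i)))
          Z = distance (proj₁ farthest) (proj₁ (row (proj₁ farthest)))
          near : ∀ i k → distance i k ≤ Z
          near i k = ℕ.≤-trans (proj₂ (row i) k) (proj₂ farthest i)
        cases : Dec (baseConstant j ℕ.^ scale ≤ X) → ¬ ¬ (X ≤ heightBound r)
        cases (no  small) = return¬¬ (ℕ.≤-trans (ℕ.<⇒≤ (ℕ.≰⇒> small)) (C^scale≤heightBound r))
        cases (yes large) = Rank.packing (heightedGroup j E hj) r no-independent k X large ballExponent≤ (window r) point
          (λ {i} {k} e → distinct {i} {k} (cong proj₁ e)) (proj₂ highest) ℕ.≤-refl >>=¬¬ λ four → return¬¬ (conclude four)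

      -- Treating the sequence as a whole would bound heights by a power of `N`, which gives nothing
      -- on counting. Windows of a length depending on `r` alone bound every term independently of
      -- `N`, and then the number of points of that height bounds `N`.
      sequence-length : ∀ {N} (𝓟 : PointSequence E N) → Arithmetic (PointSequence.x 𝓟) ⊎ Arithmetic (PointSequence.y 𝓟) → N ≤ progressionConstant ℕ.^ suc r
      sequence-length {N} 𝓟 ap = cases (window r ℕ.≤? N)
        where
        open PointSequence 𝓟
        cases : Dec (window r ≤ N) → N ≤ progressionConstant ℕ.^ suc r
        cases (no short) = ℕ.≤-trans (ℕ.<⇒≤ (ℕ.≰⇒> short)) (ℕ.≤-trans (window≤heightBound r) (heightBound≤constant r))
        cases (yes long) = ℕ.≤-trans (points-finite E (heightBound r) N point (λ {i} {k} e → distinct {i} {k} (cong proj₁ e)) bounded) (pointCount≤ r)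
          where
          bounded : ∀ l → H′ (point l) ≤ heightBound r
          bounded l = at (in-window {N} {window r} (s≤s z≤n) long l)
            where
            at : (∃ λ s → Σ (s ℕ.+ window r ≤ N) λ h → ∃ λ i → Window.shift h i ≡ l) → H′ (point l) ≤ heightBound r
            at (s , h , i , refl) = window-height (Window.restrict h 𝓟) (map (Window.arithmetic-shift h) (Window.arithmetic-shift h) ap) i

open import Defs
open import Data.Nat using (ℕ; suc; _≤_; _^_)
open import Data.Rational using (ℚ)
open import Data.Product using (Σ; _,_; proj₁; proj₂)
open import Data.Sum using (_⊎_)
open import Relation.Binary.PropositionalEquality using (_≡_)
open ProgressionLength

theorem1p1 : (j0 : ℚ) → Σ ℕ λ C → (E : Weierstrass) → jInv E ≡ j0 →
    (r : ℕ) → IsRank E r → (N : ℕ) → XAP E N ⊎ YAP E N → N ≤ C ^ suc r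
-- Taking logarithms of `N ≤ C ^ suc r` gives `1 + r ≥ log N / log C`, so that `c(j₀) = 1 / log C`.
theorem1p1 j0 = progressionConstant j0 , λ E hj r rank N ap →
  sequence-length j0 E hj r (proj₂ rank) (proj₁ (points-of-progression E ap)) (proj₂ (points-of-progression E ap))
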